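{- Let $p$ be an odd prime with $p\not\equiv 7\pmod 8$, let $\delta_p$ be an integer with $8\delta_p\equiv 1\pmod{p^2}$, and let $k,n\in\mathbb Z$ with $\left(\frac{k}{p}\right)=1$. Then $$N_A(p^2n+(pk+1)\delta_p)\equiv 0\pmod 4.$$
   Context: Let $(a;q)_n=\prod_{j=0}^{n-1}(1-aq^j)$. Define $N_A(n)$ by $A(q)=\sum_{n\ge0}N_A(n)q^n=\sum_{n\ge 0}\frac{q^{n+1}(-q^2;q^2)_n}{(q;q^2)_{n+1}}$, with $N_A(m)=0$ for $m<0$. $\left(\frac{\cdot}{\cdot}\right)$ is the Kronecker symbol. -}

module Defs where

open import Data.Nat as ℕ using (ℕ; zero; suc; _+_; _*_; _∸_; _≤ᵇ_; _≡ᵇ_; NonZero)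
open import Data.Bool using (Bool; true; false; if_then_else_; _∨_)
open import Data.Integer as ℤ using (ℤ; +_; -[1+_])
open import Data.Integer.DivMod using (_%ℕ_)
open import Data.List using (List; upTo; map)
open import Data.Nat.ListAction using (sum)
open import Data.Bool.ListAction using (any)

Series : Set
Series = ℕ → ℕ

one : Series
one zero = 1
one (suc _) = 0

shift : ℕ → Series → Series
shift s f i = if s ≤ᵇ i then f (i ∸ s) else 0

mulOnePlus : ℕ → Series → Series
mulOnePlus a f i = f i + shift a f i

-- multiplication by 1/(1 - q^a) = Σ_{t≥0} q^{a t}   (used only with a ≥ 1)
divOneMinus : ℕ → Series → Series
divOneMinus a f i = sum (map (λ t → shift (t * a) f i) (upTo (suc i)))

negQ2Poch : ℕ → Series → Series
negQ2Poch zero f = f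
negQ2Poch (suc n) f = mulOnePlus (2 * n + 2) (negQ2Poch n f)

divQPoch : ℕ → Series → Series
divQPoch zero f = f
divQPoch (suc m) f = divOneMinus (2 * m + 1) (divQPoch m f)

-- the n-th summand  q^{n+1} (-q^2;q^2)_n / (q;q^2)_{n+1}
termA : ℕ → Series
termA n = shift (suc n) (negQ2Poch n (divQPoch (suc n) one))

-- N_A(m): only summands with n + 1 ≤ m contribute to the coefficient of q^m
NAℕ : ℕ → ℕ
NAℕ m = sum (map (λ n → termA n m) (upTo m))

NA : ℤ → ℕ
NA (+ m) = NAℕ m
NA -[1+ _ ] = 0

legendre : (k : ℤ) (p : ℕ) → .{{NonZero p}} → ℤ
legendre k p with k %ℕ p
... | zero = + 0
... | r@(suc _) = if any (λ x → (x * x) ℕ.% p ≡ᵇ r) (upTo p) then + 1 else -[1+ 0 ]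

-- Put D = 8N − 1.  The hypotheses say that D = p m, where p ∤ m and m is a quadratic residue modulo p.
--
-- With Q = q², the series R(x;a) = Σ xⁿ (aQ;Q)_n / (x;Q)_{n+1} satisfies
--   (1 − x)² R(x;a) = 1 − axQ + x²Q (1 − aQ)² R(xQ;aQ),
-- so modulo 4 it does not change under (x, a) ↦ (− x, − a).  Hence A(q) = q R(q;−1) ≡ q R(−q;1), and R(−q;1) telescopes to a
-- double sum which shows N_A(N) ≡ ± (C₁ + 2 C₂) modulo 4, where C₁ = #{u < v, uv = D} and
-- C₂ = #{uv + e(u + v) = D, u < v odd, e > 0 even}.
--
-- Elementary maps in the style of Liouville on the solutions of uv + ef = D give C₂ ≡ #T + #{u < v, uv = D, v ≡ 3 (4)} modulo 2,
-- where T consists of the solutions with e, f even and u < v.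
--
-- Let q now be a prime ≡ 3 (4) and D = q^(2k+1) d with q ∤ d and d not a square.  Modulo q the rows (u, − e) and (f, v) are
-- proportional.  Whether their ratio is a square is changed by (u,v,e,f) ↦ (v,u,f,e), because − 1 is not a square, but not by
-- the involution ι.  The fixed points of ι, and the solutions with u = e on which ι is undefined, are indexed by divisors of d;
-- they cancel, and C₁ + 2 C₂ ≡ 0 modulo 4, as soon as the divisors of d have a fixed-point-free involution that preserves
-- residues modulo 4 and the quadratic character modulo q.
--
-- If p ≡ 3 (4), take q = p, d = m and h ↦ m / h.  If p ≡ 1 (4), then m ≡ 3 (4) contains some prime q ≡ 3 (4) to an odd power and
-- d = p a.  If d is a square modulo q use h ↦ d / h; if p is, move the factor p between the two divisors; otherwise a is, and
-- the two cofactors in a may be exchanged unless a is a perfect square.  In that case q would be a square modulo p but p not a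
-- square modulo q, and a pigeonhole argument would produce a nontrivial solution of X² + pY² = qZ², which is impossible modulo 4.

module Submission where

-- The invariance modulo 4 comes from `(1 − x)²` and `(1 + x)²` differing by `4x`, and likewise for
-- `1 ± aQ`, while the product `ax` keeps its sign. The argument `b = − q` is useful because
-- `(b;q²)_{n+1} (q²;q²)_n` is the single product `(b;b)_{2n+1}`, whose reciprocal is an explicit
-- finite sum.
--
-- Since C₁ is half the number of divisors of D, the claim means that C₁ is even and that C₁ / 2 and
-- C₂ have the same parity. The obstacle is the condition u < v in T: no involution at hand respects
-- it, and transposition merely carries T to its complement among the solutions with e, f even. The
-- square class of the row ratio also changes under transposition, so it cuts out another half of
-- these solutions, of the same size up to the degenerate ones, and this half is stable under ι.
-- This is the purpose of a prime q for which - 1 is a nonsquare.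
--
-- The condition p ≢ 7 (8) guarantees for p ≡ 3 (4) that m ≡ 5 (8), so that m is not a perfect
-- square.

open import Defs

-- Formal power series over the integers as a commutative ring with a solver.

module PowerSeries where

  open import Data.Nat as ℕ using (ℕ; zero; suc)
  import Data.Nat.Properties as ℕP
  open import Data.Integer as ℤ using (ℤ; +_)
  import Data.Integer.Properties as ℤP
  open import Data.Integer.Tactic.RingSolver using (solve-∀)
  open import Data.Product using (_,_)
  open import Data.Maybe using (Maybe; just; nothing)
  open import Relation.Nullary using (yes; no)
  open import Relation.Binary.PropositionalEquality
  open import Algebra.Bundles using (CommutativeRing)
  open import Algebra.Solver.Ring.AlmostCommutativeRing
  open import Function using (_∘_)

  PS : Set
  PS = ℕ → ℤ

  infix 4 _≐_
  _≐_ : PS → PS → Set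
  f ≐ g = ∀ n → f n ≡ g n

  infixl 6 _⊕_
  infixl 7 _⊗_
  infix 8 ⊖_

  private
    interchange : ∀ a b c d e → (a ℤ.+ b) ℤ.* c ℤ.+ (d ℤ.+ e) ≡ (a ℤ.* c ℤ.+ d) ℤ.+ (b ℤ.* c ℤ.+ e)
    interchange = solve-∀
    tail-lemma : ∀ a b c → a ℤ.+ (b ℤ.+ c) ≡ (a ℤ.+ b) ℤ.+ c
    tail-lemma = solve-∀
    assoc-lemma : ∀ a b c d e → a ℤ.* b ℤ.* c ℤ.+ (a ℤ.* d ℤ.+ e) ≡ a ℤ.* (b ℤ.* c ℤ.+ d) ℤ.+ e
    assoc-lemma = solve-∀
    scale-lemma : ∀ a b c d → a ℤ.* b ℤ.* c ℤ.+ a ℤ.* d ≡ a ℤ.* (b ℤ.* c ℤ.+ d)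
    scale-lemma = solve-∀
    neg-lemma : ∀ a b c → (ℤ.- a) ℤ.* b ℤ.+ (ℤ.- c) ≡ ℤ.- (a ℤ.* b ℤ.+ c)
    neg-lemma = solve-∀

  -- Opacity keeps goals in terms of the ring operations; otherwise unification would unfold the
  -- Cauchy product coefficient by coefficient.
  opaque
    _⊕_ _⊗_ : PS → PS → PS
    (f ⊕ g) n = f n ℤ.+ g n
    (f ⊗ g) zero    = f 0 ℤ.* g 0
    (f ⊗ g) (suc n) = f 0 ℤ.* g (suc n) ℤ.+ (f ∘ suc ⊗ g) n

    ⊖_ : PS → PS
    (⊖ f) n = ℤ.- f n

    const : ℤ → PS
    const c zero    = c
    const c (suc n) = + 0

  𝟘 𝟙 : PS
  𝟘 = const (+ 0)
  𝟙 = const (+ 1)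

  opaque
    unfolding _⊕_

    +-congˡ : ∀ a {b c} → b ≡ c → a ℤ.+ b ≡ a ℤ.+ c
    +-congˡ a = cong (λ b → a ℤ.+ b)

    ⊗-cong : ∀ {f f′ g g′} → f ≐ f′ → g ≐ g′ → f ⊗ g ≐ f′ ⊗ g′
    ⊗-cong p q zero    = cong₂ ℤ._*_ (p 0) (q 0)
    ⊗-cong p q (suc n) = cong₂ ℤ._+_ (cong₂ ℤ._*_ (p 0) (q (suc n))) (⊗-cong (p ∘ suc) q n)

    ⊗-distribʳ : ∀ h f g → (f ⊕ g) ⊗ h ≐ (f ⊗ h) ⊕ (g ⊗ h)
    ⊗-distribʳ h f g zero    = ℤP.*-distribʳ-+ (h 0) (f 0) (g 0)
    ⊗-distribʳ h f g (suc n) =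
      trans (+-congˡ ((f 0 ℤ.+ g 0) ℤ.* h (suc n)) (⊗-distribʳ h (f ∘ suc) (g ∘ suc) n))
            (interchange (f 0) (g 0) (h (suc n)) _ _)

    -- The product recurses on its left factor. Peeling off the constant term of the right factor
    -- gives the mirror image of that recursion, which commutativity needs.
    ⊗-tailʳ : ∀ f g n → (f ⊗ g) (suc n) ≡ (f ⊗ (g ∘ suc)) n ℤ.+ f (suc n) ℤ.* g 0
    ⊗-tailʳ f g zero    = refl
    ⊗-tailʳ f g (suc n) =
      trans (+-congˡ (f 0 ℤ.* g (suc (suc n))) (⊗-tailʳ (f ∘ suc) g n)) (tail-lemma (f 0 ℤ.* g (suc (suc n))) _ _)

    ⊗-comm : ∀ f g → f ⊗ g ≐ g ⊗ f
    ⊗-comm f g zero    = ℤP.*-comm (f 0) (g 0)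
    ⊗-comm f g (suc n) =
      trans (cong₂ ℤ._+_ (ℤP.*-comm (f 0) (g (suc n))) (⊗-comm (f ∘ suc) g n))
            (trans (ℤP.+-comm (g (suc n) ℤ.* f 0) _) (sym (⊗-tailʳ g f n)))

    scale : ℤ → PS → PS
    scale c f n = c ℤ.* f n

    ⊗-scaleˡ : ∀ c f g → scale c f ⊗ g ≐ scale c (f ⊗ g)
    ⊗-scaleˡ c f g zero    = ℤP.*-assoc c (f 0) (g 0)
    ⊗-scaleˡ c f g (suc n) = trans (+-congˡ (c ℤ.* f 0 ℤ.* g (suc n)) (⊗-scaleˡ c (f ∘ suc) g n))
                                   (scale-lemma c (f 0) (g (suc n)) _)

    -- By definition the tail of `f ⊗ g` is the sum of `scale (f 0) (g ∘ suc)` and `(f ∘ suc) ⊗ g`;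
    -- distributivity and the scaling law then reduce the claim to the tail of `f`.
    ⊗-assoc : ∀ f g h → (f ⊗ g) ⊗ h ≐ f ⊗ (g ⊗ h)
    ⊗-assoc f g h zero    = ℤP.*-assoc (f 0) (g 0) (h 0)
    ⊗-assoc f g h (suc n) = trans
      (+-congˡ (f 0 ℤ.* g 0 ℤ.* h (suc n))
        (trans (⊗-distribʳ h (scale (f 0) (g ∘ suc)) ((f ∘ suc) ⊗ g) n)
          (cong₂ ℤ._+_ (⊗-scaleˡ (f 0) (g ∘ suc) h n) (⊗-assoc (f ∘ suc) g h n))))
      (assoc-lemma (f 0) (g 0) (h (suc n)) _ _)

    ⊗-zeroˡ : ∀ {z} f → z ≐ (λ _ → + 0) → z ⊗ f ≐ (λ _ → + 0)
    ⊗-zeroˡ f z zero    = cong (ℤ._* f 0) (z 0)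
    ⊗-zeroˡ f z (suc n) = cong₂ ℤ._+_ (cong (ℤ._* f (suc n)) (z 0)) (⊗-zeroˡ f (z ∘ suc) n)

    ⊗-constˡ : ∀ c f → const c ⊗ f ≐ scale c f
    ⊗-constˡ c f zero    = refl
    ⊗-constˡ c f (suc n) = trans (+-congˡ (c ℤ.* f (suc n)) (⊗-zeroˡ f (λ _ → refl) n)) (ℤP.+-identityʳ _)

    const-⊗-at : ∀ c f n → (const c ⊗ f) n ≡ c ℤ.* f n
    const-⊗-at = ⊗-constˡ

    ⊗-identityˡ : ∀ f → 𝟙 ⊗ f ≐ f
    ⊗-identityˡ f n = trans (⊗-constˡ (+ 1) f n) (ℤP.*-identityˡ (f n))

    ⊗-negˡ : ∀ f g → (⊖ f) ⊗ g ≐ ⊖ (f ⊗ g)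
    ⊗-negˡ f g zero    = sym (ℤP.neg-distribˡ-* (f 0) (g 0))
    ⊗-negˡ f g (suc n) = trans (+-congˡ ((ℤ.- f 0) ℤ.* g (suc n)) (⊗-negˡ (f ∘ suc) g n)) (neg-lemma (f 0) (g (suc n)) _)

    𝟘-const : ∀ n → 𝟘 n ≡ + 0
    𝟘-const zero    = refl
    𝟘-const (suc n) = refl

    ⊕-at : ∀ f g n → (f ⊕ g) n ≡ f n ℤ.+ g n
    ⊕-at f g n = refl

    ⊖-at : ∀ f n → (⊖ f) n ≡ ℤ.- f n
    ⊖-at f n = refl

    const-at0 : ∀ c → const c 0 ≡ c
    const-at0 c = refl

    const-atsuc : ∀ c n → const c (suc n) ≡ + 0
    const-atsuc c n = refl

    ⊕-cong : ∀ {f f′ g g′} → f ≐ f′ → g ≐ g′ → f ⊕ g ≐ f′ ⊕ g′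
    ⊕-cong p q n = cong₂ ℤ._+_ (p n) (q n)

    ⊕-assoc : ∀ f g h → (f ⊕ g) ⊕ h ≐ f ⊕ (g ⊕ h)
    ⊕-assoc f g h n = ℤP.+-assoc (f n) (g n) (h n)

    ⊕-comm : ∀ f g → f ⊕ g ≐ g ⊕ f
    ⊕-comm f g n = ℤP.+-comm (f n) (g n)

    ⊕-identityˡ : ∀ f → 𝟘 ⊕ f ≐ f
    ⊕-identityˡ f n = trans (cong (ℤ._+ f n) (𝟘-const n)) (ℤP.+-identityˡ (f n))

    ⊖-inverseˡ : ∀ f → ⊖ f ⊕ f ≐ 𝟘
    ⊖-inverseˡ f n = trans (ℤP.+-inverseˡ (f n)) (sym (𝟘-const n))

    ⊖-cong : ∀ {f g} → f ≐ g → ⊖ f ≐ ⊖ g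
    ⊖-cong p n = cong ℤ.-_ (p n)

    const-+ : ∀ x y → const (x ℤ.+ y) ≐ const x ⊕ const y
    const-+ x y zero    = refl
    const-+ x y (suc n) = refl

    const-* : ∀ x y → const (x ℤ.* y) ≐ const x ⊗ const y
    const-* x y zero    = refl
    const-* x y (suc n) = sym (trans (⊗-constˡ x (const y) (suc n)) (ℤP.*-zeroʳ x))

    const-neg : ∀ x → const (ℤ.- x) ≐ ⊖ const x
    const-neg x zero    = refl
    const-neg x (suc n) = refl

  infix 4 _≈_
  -- A record instead of the pointwise equality itself, so that both series can be recovered by
  -- unification.
  record _≈_ (f g : PS) : Set where
    constructor pw
    field at : f ≐ g
  open _≈_ public

  psRing : CommutativeRing _ _
  psRing = record
    { Carrier = PS ; _≈_ = _≈_ ; _+_ = _⊕_ ; _*_ = _⊗_ ; -_ = ⊖_ ; 0# = 𝟘 ; 1# = 𝟙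
    ; isCommutativeRing = record
      { isRing = record
        { +-isAbelianGroup = record
          { isGroup = record
            { isMonoid = record
              { isSemigroup = record
                { isMagma = record
                  { isEquivalence = record
                    { refl = pw λ _ → refl ; sym = λ p → pw λ n → sym (at p n)
                    ; trans = λ p r → pw λ n → trans (at p n) (at r n) }
                  ; ∙-cong = λ p r → pw (⊕-cong (at p) (at r)) }
                ; assoc = λ f g h → pw (⊕-assoc f g h) }
              ; identity = (λ f → pw (⊕-identityˡ f)) , λ f → pw λ n → trans (⊕-comm f 𝟘 n) (⊕-identityˡ f n) }
            ; inverse = (λ f → pw (⊖-inverseˡ f)) , λ f → pw λ n → trans (⊕-comm f (⊖ f) n) (⊖-inverseˡ f n)
            ; ⁻¹-cong = λ p → pw (⊖-cong (at p)) }
          ; comm = λ f g → pw (⊕-comm f g) }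
        ; *-cong = λ p r → pw (⊗-cong (at p) (at r))
        ; *-assoc = λ f g h → pw (⊗-assoc f g h)
        ; *-identity = (λ f → pw (⊗-identityˡ f)) , λ f → pw λ n → trans (⊗-comm f 𝟙 n) (⊗-identityˡ f n)
        ; distrib = (λ f g h → pw λ n → trans (⊗-comm f (g ⊕ h) n)
                       (trans (⊗-distribʳ f g h n) (⊕-cong (⊗-comm g f) (⊗-comm h f) n)))
                  , λ f g h → pw (⊗-distribʳ f g h) }
      ; *-comm = λ f g → pw (⊗-comm f g) } }

  open import Algebra.Solver.Ring.AlmostCommutativeRing public using (fromCommutativeRing)

  psACR : AlmostCommutativeRing _ _
  psACR = fromCommutativeRing psRing

  constMorphism : ℤ.+-*-rawRing -Raw-AlmostCommutative⟶ psACR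
  constMorphism = record
    { ⟦_⟧ = const
    ; +-homo = λ x y → pw (const-+ x y)
    ; *-homo = λ x y → pw (const-* x y)
    ; -‿homo = λ x → pw (const-neg x)
    ; 0-homo = pw λ _ → refl
    ; 1-homo = pw λ _ → refl }

  const-≟ : ∀ x y → Maybe (const x ≈ const y)
  const-≟ x y with x ℤ.≟ y
  ... | yes p = just (pw (λ n → cong (λ c → const c n) p))
  ... | no _  = nothing

  import Algebra.Solver.Ring
  module PSSolver = Algebra.Solver.Ring ℤ.+-*-rawRing psACR constMorphism const-≟

  :0 :1 :2 :4 : ∀ {n} → PSSolver.Polynomial n
  :0 = PSSolver.con (+ 0)
  :1 = PSSolver.con (+ 1)
  :2 = PSSolver.con (+ 2)
  :4 = PSSolver.con (+ 4)

-- Orders of vanishing and geometric series.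

module PowerSeriesOrder where

  open PowerSeries
  open import Data.Nat as ℕ using (ℕ; zero; suc; z≤n; s≤s)
  import Data.Nat.Properties as ℕP
  open import Data.Integer as ℤ using (ℤ; +_)
  import Data.Integer.Properties as ℤP
  open import Relation.Binary.PropositionalEquality
  open import Algebra.Bundles using (CommutativeRing)
  open import Function using (_∘_)
  open PSSolver using (solve; _:=_; _:+_; _:*_; :-_; _:-_)

  module R = CommutativeRing psRing
  module ≈R where
    open import Relation.Binary.Reasoning.Setoid R.setoid public

  infixl 6 _⊝_
  _⊝_ : PS → PS → PS
  f ⊝ g = f ⊕ ⊖ g

  infixr 8 _^_
  _^_ : PS → ℕ → PS
  f ^ zero  = 𝟙
  f ^ suc n = f ⊗ f ^ n

  ^-+ : ∀ f m n → f ^ (m ℕ.+ n) ≈ f ^ m ⊗ f ^ n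
  ^-+ f zero    n = R.sym (R.*-identityˡ _)
  ^-+ f (suc m) n = R.trans (R.*-congˡ (^-+ f m n)) (R.sym (R.*-assoc _ _ _))

  ^-cong : ∀ {f g} n → f ≈ g → f ^ n ≈ g ^ n
  ^-cong zero    p = R.refl
  ^-cong (suc n) p = R.*-cong p (^-cong n p)

  ^-⊗ : ∀ f g n → (f ⊗ g) ^ n ≈ f ^ n ⊗ g ^ n
  ^-⊗ f g zero    = R.sym (R.*-identityˡ _)
  ^-⊗ f g (suc n) = R.trans (R.*-congˡ (^-⊗ f g n))
    (solve 4 (λ f g a b → f :* g :* (a :* b) := f :* a :* (g :* b)) R.refl f g (f ^ n) (g ^ n))

  -- `Ord k f` says that `f` is `O(q^k)`. Limits and infinite sums are everywhere replaced by
  -- congruences `Ord k (f ⊝ g)` between finite expressions.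
  record Ord (k : ℕ) (f : PS) : Set where
    constructor ord
    field vanish : ∀ n → n ℕ.< k → f n ≡ + 0
  open Ord

  Ord-≈ : ∀ {k f g} → f ≈ g → Ord k f → Ord k g
  Ord-≈ p o = ord λ n lt → trans (sym (at p n)) (vanish o n lt)

  Ord-≤ : ∀ {k l f} → k ℕ.≤ l → Ord l f → Ord k f
  Ord-≤ k≤l o = ord λ n lt → vanish o n (ℕP.<-≤-trans lt k≤l)

  Ord-0 : ∀ {f} → Ord 0 f
  Ord-0 = ord λ _ ()

  opaque
    unfolding _⊕_

    Ord-⊕ : ∀ {k f g} → Ord k f → Ord k g → Ord k (f ⊕ g)
    Ord-⊕ p q = ord λ n lt → cong₂ ℤ._+_ (vanish p n lt) (vanish q n lt)

    Ord-⊖ : ∀ {k f} → Ord k f → Ord k (⊖ f)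
    Ord-⊖ p = ord λ n lt → cong ℤ.-_ (vanish p n lt)

    private
      conv : ∀ k l {f g} → Ord k f → Ord l g → ∀ n → n ℕ.< k ℕ.+ l → (f ⊗ g) n ≡ + 0
      conv zero    zero    p q n ()
      conv zero    (suc l) {f} p q zero    lt = trans (cong (f 0 ℤ.*_) (vanish q 0 (s≤s z≤n))) (ℤP.*-zeroʳ (f 0))
      conv zero    (suc l) {f} p q (suc n) (s≤s lt) =
        cong₂ ℤ._+_ (trans (cong (f 0 ℤ.*_) (vanish q (suc n) (s≤s lt))) (ℤP.*-zeroʳ (f 0)))
                    (conv zero (suc l) {f ∘ suc} Ord-0 q n (ℕP.m≤n⇒m≤1+n lt))
      conv (suc k) l {f} {g} p q zero    lt = cong (ℤ._* g 0) (vanish p 0 (s≤s z≤n))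
      conv (suc k) l {f} {g} p q (suc n) (s≤s lt) =
        cong₂ ℤ._+_ (cong (ℤ._* g (suc n)) (vanish p 0 (s≤s z≤n)))
                    (conv k l {f ∘ suc} (ord λ m lt′ → vanish p (suc m) (s≤s lt′)) q n lt)

    Ord-⊗ : ∀ {k l f g} → Ord k f → Ord l g → Ord (k ℕ.+ l) (f ⊗ g)
    Ord-⊗ {k} {l} p q = ord (conv k l p q)

    ⊝-≡ : ∀ (f g : PS) {n} → (f ⊝ g) n ≡ + 0 → f n ≡ g n
    ⊝-≡ f g {n} = ℤP.i-j≡0⇒i≡j (f n) (g n)

    ≡-⊝ : ∀ (f g : PS) {n} → f n ≡ g n → (f ⊝ g) n ≡ + 0
    ≡-⊝ f g = ℤP.i≡j⇒i-j≡0

  Ord-⊗ʳ : ∀ {l} f {g} → Ord l g → Ord l (f ⊗ g)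
  Ord-⊗ʳ f o = Ord-⊗ {0} {f = f} Ord-0 o

  Ord-⊗ˡ : ∀ {l f} g → Ord l f → Ord l (f ⊗ g)
  Ord-⊗ˡ {l} {f} g o = Ord-≈ (R.*-comm g f) (Ord-⊗ʳ g o)

  Ord-^ : ∀ {f} → Ord 1 f → ∀ n → Ord n (f ^ n)
  Ord-^ o zero    = Ord-0
  Ord-^ o (suc n) = Ord-⊗ o (Ord-^ o n)

  -- inv x is the inverse of 1 − x; its n-th coefficient is read off the n-th partial sum of the geometric series
  geo : PS → ℕ → PS
  geo x zero    = 𝟙
  geo x (suc n) = 𝟙 ⊕ x ⊗ geo x n

  inv : PS → PS
  inv x n = geo x n n

  -- Consecutive partial sums differ by `x^(n+1)`.
  geo-step : ∀ {x} → Ord 1 x → ∀ n → Ord (suc n) (geo x (suc n) ⊝ geo x n)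
  geo-step {x} o zero    = Ord-≈ (solve 1 (λ x → x := :1 :+ x :* :1 :- :1) R.refl x) o
  geo-step {x} o (suc n) = Ord-≈
    (solve 3 (λ x a b → x :* (a :- b) := (:1 :+ x :* a) :- (:1 :+ x :* b)) R.refl x (geo x (suc n)) (geo x n))
    (Ord-⊗ o (geo-step o n))

  geo-stable : ∀ {x} → Ord 1 x → ∀ k {n} → geo x (k ℕ.+ n) n ≡ geo x n n
  geo-stable o zero    = refl
  geo-stable {x} o (suc k) {n} = trans
    (⊝-≡ (geo x (suc (k ℕ.+ n))) (geo x (k ℕ.+ n)) (vanish (geo-step o (k ℕ.+ n)) n (s≤s (ℕP.m≤n+m n k)))) (geo-stable o k)

  geo-inv : ∀ {x} → Ord 1 x → ∀ m → Ord (suc m) (geo x m ⊝ inv x)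
  geo-inv {x} o m = ord λ { n (s≤s n≤m) → ≡-⊝ (geo x m) (inv x)
    (trans (cong (λ j → geo x j n) (sym (ℕP.m∸n+n≡m n≤m))) (geo-stable o (m ℕ.∸ n))) }

  inv-rec : ∀ {x} → Ord 1 x → inv x ≈ 𝟙 ⊕ x ⊗ inv x
  inv-rec {x} o = pw λ n → ⊝-≡ (inv x) (𝟙 ⊕ x ⊗ inv x) (vanish (h n) n ℕP.≤-refl)
    where
    h : ∀ n → Ord (suc n) (inv x ⊝ (𝟙 ⊕ x ⊗ inv x))
    -- The partial sums satisfy the recursion by definition, and both `geo x n` and `geo x (suc n)`
    -- approximate `inv x`; this bounds the defect of `inv x` in the same recursion.
    h n = Ord-≈ (solve 3 (λ x a b → (x :* (a :- b)) :- ((:1 :+ x :* a) :- b) := b :- (:1 :+ x :* b)) R.refl x (geo x n) (inv x))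
      (Ord-⊕ (Ord-⊗ o (Ord-≤ (ℕP.n≤1+n n) (geo-inv o n))) (Ord-⊖ (Ord-≤ (ℕP.n≤1+n (suc n)) (geo-inv o (suc n)))))

  inv-* : ∀ {x} → Ord 1 x → (𝟙 ⊝ x) ⊗ inv x ≈ 𝟙
  inv-* {x} o = begin
    (𝟙 ⊝ x) ⊗ inv x              ≈⟨ solve 2 (λ x y → (:1 :- x) :* y := y :- x :* y) R.refl x (inv x) ⟩
    inv x ⊝ x ⊗ inv x            ≈⟨ R.+-congʳ (inv-rec o) ⟩
    (𝟙 ⊕ x ⊗ inv x) ⊝ x ⊗ inv x ≈⟨ solve 2 (λ o z → o :+ z :- z := o) R.refl 𝟙 (x ⊗ inv x) ⟩
    𝟙 ∎
    where open ≈R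

  inv-cong : ∀ {x y} → x ≈ y → inv x ≈ inv y
  inv-cong {x} {y} p = pw λ n → at (lemma n) n
    where
    lemma : ∀ k → geo x k ≈ geo y k
    lemma zero    = R.refl
    lemma (suc k) = R.+-congˡ (R.*-cong p (lemma k))

  cancel : ∀ {x f g} → Ord 1 x → (𝟙 ⊝ x) ⊗ f ≈ (𝟙 ⊝ x) ⊗ g → f ≈ g
  cancel {x} {f} {g} o p = begin
    f                        ≈⟨ R.sym (R.*-identityˡ f) ⟩
    𝟙 ⊗ f                    ≈⟨ R.*-congʳ (R.sym (inv-* o)) ⟩
    (𝟙 ⊝ x) ⊗ inv x ⊗ f     ≈⟨ solve 3 (λ a b c → a :* b :* c := b :* (a :* c)) R.refl (𝟙 ⊝ x) (inv x) f ⟩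
    inv x ⊗ ((𝟙 ⊝ x) ⊗ f)   ≈⟨ R.*-congˡ p ⟩
    inv x ⊗ ((𝟙 ⊝ x) ⊗ g)   ≈⟨ solve 3 (λ a b c → b :* (a :* c) := a :* b :* c) R.refl (𝟙 ⊝ x) (inv x) g ⟩
    (𝟙 ⊝ x) ⊗ inv x ⊗ g     ≈⟨ R.*-congʳ (inv-* o) ⟩
    𝟙 ⊗ g                    ≈⟨ R.*-identityˡ g ⟩
    g ∎
    where open ≈R

  ∑ : (ℕ → PS) → ℕ → PS
  ∑ t zero    = 𝟘
  ∑ t (suc k) = ∑ t k ⊕ t k

  q Q : PS
  q zero          = + 0
  q (suc zero)    = + 1
  q (suc (suc _)) = + 0
  Q = q ⊗ q

  q-Ord : Ord 1 q
  q-Ord = ord λ { zero _ → refl ; (suc _) (s≤s ()) }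

  Q-Ord : Ord 2 Q
  Q-Ord = Ord-⊗ q-Ord q-Ord

  opaque
    unfolding _⊕_
    q⊗-suc : ∀ f n → (q ⊗ f) (suc n) ≡ f n
    q⊗-suc f n = trans (cong₂ ℤ._+_ {x = + 0 ℤ.* f (suc n)} refl (tail n)) (ℤP.+-identityˡ (f n))
      where
      tail : ∀ n → ((q ∘ suc) ⊗ f) n ≡ f n
      tail n = trans (⊗-cong {q ∘ suc} {𝟙} {f} {f} (λ { zero → refl ; (suc _) → refl }) (λ _ → refl) n) (⊗-identityˡ f n)

    q⊗-zero : ∀ f → (q ⊗ f) 0 ≡ + 0
    q⊗-zero f = refl

-- The functional equation of R(x;a) and its invariance modulo 4.

module FunctionalEquation where

  open PowerSeries
  open PowerSeriesOrder
  open import Data.Nat as ℕ using (ℕ; zero; suc)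
  import Data.Nat.Properties as ℕP
  open import Data.Integer using (+_)
  open PSSolver using (solve; _:=_; _:+_; _:*_; :-_; _:-_)
  open ≈R

  -- t x a n = xⁿ (aQ;Q)_n / (x;Q)_{n+1}.
  t : PS → PS → ℕ → PS
  t x a zero    = inv x
  t x a (suc n) = x ⊗ (𝟙 ⊝ a ⊗ Q ^ suc n) ⊗ inv (x ⊗ Q ^ suc n) ⊗ t x a n

  -- The series weighted by `Qⁿ` is the bridge between `R(x;a)` and `R(xQ;aQ)`: the factor `Qⁿ`
  -- turns `xⁿ` into `(xQ)ⁿ`.
  S S′ : PS → PS → ℕ → PS
  S  x a = ∑ (t x a)
  S′ x a = ∑ (λ n → Q ^ n ⊗ t x a n)

  t-rec : ∀ {x} a n → Ord 1 x → x ⊗ (𝟙 ⊝ a ⊗ Q ^ suc n) ⊗ t x a n ≈ (𝟙 ⊝ x ⊗ Q ^ suc n) ⊗ t x a (suc n)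
  t-rec {x} a n o = begin
    x ⊗ A ⊗ t x a n           ≈⟨ R.*-identityˡ _ ⟨
    𝟙 ⊗ (x ⊗ A ⊗ t x a n)     ≈⟨ R.*-congʳ (inv-* (Ord-⊗ˡ (Q ^ suc n) o)) ⟨
    (𝟙 ⊝ x ⊗ Q ^ suc n) ⊗ inv (x ⊗ Q ^ suc n) ⊗ (x ⊗ A ⊗ t x a n)
      ≈⟨ solve 5 (λ y i x A t → y :* i :* (x :* A :* t) := y :* (x :* A :* i :* t)) R.refl (𝟙 ⊝ x ⊗ Q ^ suc n) (inv (x ⊗ Q ^ suc n)) x A (t x a n) ⟩
    (𝟙 ⊝ x ⊗ Q ^ suc n) ⊗ t x a (suc n) ∎
    where
    A = 𝟙 ⊝ a ⊗ Q ^ suc n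

  -- Summing `t-rec` over `n` gives `xS − aQxS′` on one side and `S − xS′ − 1` on the other; the
  -- last term of the first side finds no partner and remains as the boundary term.
  S-S′ : ∀ {x} a k → Ord 1 x →
    (𝟙 ⊝ x) ⊗ S x a (suc k) ⊕ x ⊗ (𝟙 ⊝ a ⊗ Q ^ suc k) ⊗ t x a k ≈ 𝟙 ⊕ (x ⊝ a ⊗ Q ⊗ x) ⊗ S′ x a (suc k)
  S-S′ {x} a zero o = begin
    (𝟙 ⊝ x) ⊗ (𝟘 ⊕ inv x) ⊕ x ⊗ (𝟙 ⊝ a ⊗ (Q ⊗ 𝟙)) ⊗ inv x
      ≈⟨ solve 4 (λ x a q i → (:1 :- x) :* (:0 :+ i) :+ x :* (:1 :- a :* (q :* :1)) :* i
                 := (:1 :- x) :* i :+ (x :- a :* q :* x) :* (:0 :+ :1 :* i)) R.refl x a Q (inv x) ⟩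
    (𝟙 ⊝ x) ⊗ inv x ⊕ (x ⊝ a ⊗ Q ⊗ x) ⊗ S′ x a 1 ≈⟨ R.+-congʳ (inv-* o) ⟩
    𝟙 ⊕ (x ⊝ a ⊗ Q ⊗ x) ⊗ S′ x a 1 ∎
  S-S′ {x} a (suc k) o = begin
    (𝟙 ⊝ x) ⊗ (s ⊕ τ′) ⊕ x ⊗ (𝟙 ⊝ a ⊗ (Q ⊗ z)) ⊗ τ′
      ≈⟨ solve 8 (λ x a q z s τ τ′ c → (:1 :- x) :* (s :+ τ′) :+ x :* (:1 :- a :* (q :* z)) :* τ′
          := ((:1 :- x) :* s :+ x :* (:1 :- a :* z) :* τ) :+ (x :- a :* q :* x) :* (z :* τ′)
             :+ ((:1 :- x :* z) :* τ′ :- x :* (:1 :- a :* z) :* τ))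
         R.refl x a Q z s τ τ′ 𝟙 ⟩
    ((𝟙 ⊝ x) ⊗ s ⊕ x ⊗ (𝟙 ⊝ a ⊗ z) ⊗ τ) ⊕ (x ⊝ a ⊗ Q ⊗ x) ⊗ (z ⊗ τ′)
      ⊕ ((𝟙 ⊝ x ⊗ z) ⊗ τ′ ⊝ x ⊗ (𝟙 ⊝ a ⊗ z) ⊗ τ)
      ≈⟨ R.+-cong (R.+-congʳ (S-S′ a k o)) (R.+-congˡ (R.-‿cong (t-rec a k o))) ⟩
    (𝟙 ⊕ (x ⊝ a ⊗ Q ⊗ x) ⊗ s′) ⊕ (x ⊝ a ⊗ Q ⊗ x) ⊗ (z ⊗ τ′) ⊕ ((𝟙 ⊝ x ⊗ z) ⊗ τ′ ⊝ (𝟙 ⊝ x ⊗ z) ⊗ τ′)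
      ≈⟨ solve 4 (λ c s z w → (:1 :+ c :* s) :+ c :* z :+ (w :- w) := :1 :+ c :* (s :+ z)) R.refl
           (x ⊝ a ⊗ Q ⊗ x) s′ (z ⊗ τ′) ((𝟙 ⊝ x ⊗ z) ⊗ τ′) ⟩
    𝟙 ⊕ (x ⊝ a ⊗ Q ⊗ x) ⊗ (s′ ⊕ z ⊗ τ′) ∎
    where
    z = Q ^ suc k
    s = S x a (suc k)
    s′ = S′ x a (suc k)
    τ = t x a k
    τ′ = t x a (suc k)

  -- The factors `1 − aQ` and `1 − x` split off from `(aQ;Q)_{n+1}` and `(x;Q)_{n+2}`, and what
  -- remains are the same products for `xQ` and `aQ`.
  t-shift : ∀ {x} a n → Ord 1 x →
    Q ^ suc n ⊗ t x a (suc n) ⊗ (𝟙 ⊝ x) ≈ (𝟙 ⊝ a ⊗ Q) ⊗ (x ⊗ Q) ⊗ t (x ⊗ Q) (a ⊗ Q) n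
  t-shift {x} a zero o = begin
    Q ⊗ 𝟙 ⊗ (x ⊗ (𝟙 ⊝ a ⊗ (Q ⊗ 𝟙)) ⊗ inv (x ⊗ (Q ⊗ 𝟙)) ⊗ inv x) ⊗ (𝟙 ⊝ x)
      ≈⟨ solve 5 (λ q x a i j → q :* :1 :* (x :* (:1 :- a :* (q :* :1)) :* i :* j) :* (:1 :- x)
           := (:1 :- a :* q) :* (x :* q) :* i :* ((:1 :- x) :* j)) R.refl Q x a (inv (x ⊗ (Q ⊗ 𝟙))) (inv x) ⟩
    (𝟙 ⊝ a ⊗ Q) ⊗ (x ⊗ Q) ⊗ inv (x ⊗ (Q ⊗ 𝟙)) ⊗ ((𝟙 ⊝ x) ⊗ inv x)
      ≈⟨ R.*-cong (R.*-congˡ (inv-cong (R.*-congˡ (R.*-identityʳ Q)))) (inv-* o) ⟩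
    (𝟙 ⊝ a ⊗ Q) ⊗ (x ⊗ Q) ⊗ inv (x ⊗ Q) ⊗ 𝟙 ≈⟨ R.*-identityʳ _ ⟩
    (𝟙 ⊝ a ⊗ Q) ⊗ (x ⊗ Q) ⊗ inv (x ⊗ Q) ∎
  t-shift {x} a (suc n) o = begin
    Q ⊗ z ⊗ (x ⊗ (𝟙 ⊝ a ⊗ (Q ⊗ z)) ⊗ inv (x ⊗ (Q ⊗ z)) ⊗ τ) ⊗ (𝟙 ⊝ x)
      ≈⟨ solve 6 (λ q z x a i τ → q :* z :* (x :* (:1 :- a :* (q :* z)) :* i :* τ) :* (:1 :- x)
           := q :* x :* (:1 :- (a :* q) :* z) :* i :* (z :* τ :* (:1 :- x))) R.refl Q z x a (inv (x ⊗ (Q ⊗ z))) τ ⟩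
    Q ⊗ x ⊗ (𝟙 ⊝ (a ⊗ Q) ⊗ z) ⊗ inv (x ⊗ (Q ⊗ z)) ⊗ (z ⊗ τ ⊗ (𝟙 ⊝ x))
      ≈⟨ R.*-cong (R.*-congˡ (inv-cong (R.sym (R.*-assoc x Q z)))) (t-shift a n o) ⟩
    Q ⊗ x ⊗ (𝟙 ⊝ (a ⊗ Q) ⊗ z) ⊗ inv ((x ⊗ Q) ⊗ z) ⊗ ((𝟙 ⊝ a ⊗ Q) ⊗ (x ⊗ Q) ⊗ t (x ⊗ Q) (a ⊗ Q) n)
      ≈⟨ solve 6 (λ q x A i a1 τ → q :* x :* A :* i :* (a1 :* (x :* q) :* τ) := a1 :* (x :* q) :* (x :* q :* A :* i :* τ)) R.refl
           Q x (𝟙 ⊝ (a ⊗ Q) ⊗ z) (inv ((x ⊗ Q) ⊗ z)) (𝟙 ⊝ a ⊗ Q) (t (x ⊗ Q) (a ⊗ Q) n) ⟩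
    (𝟙 ⊝ a ⊗ Q) ⊗ (x ⊗ Q) ⊗ t (x ⊗ Q) (a ⊗ Q) (suc n) ∎
    where
    z = Q ^ suc n
    τ = t x a (suc n)

  S′-shift : ∀ {x} a K → Ord 1 x →
    (𝟙 ⊝ x) ⊗ S′ x a (suc K) ≈ 𝟙 ⊕ (𝟙 ⊝ a ⊗ Q) ⊗ (x ⊗ Q) ⊗ S (x ⊗ Q) (a ⊗ Q) K
  S′-shift {x} a zero o = begin
    (𝟙 ⊝ x) ⊗ (𝟘 ⊕ 𝟙 ⊗ inv x) ≈⟨ solve 2 (λ y i → y :* (:0 :+ :1 :* i) := y :* i) R.refl (𝟙 ⊝ x) (inv x) ⟩
    (𝟙 ⊝ x) ⊗ inv x           ≈⟨ inv-* o ⟩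
    𝟙                          ≈⟨ solve 1 (λ c → :1 := :1 :+ c :* :0) R.refl ((𝟙 ⊝ a ⊗ Q) ⊗ (x ⊗ Q)) ⟩
    𝟙 ⊕ (𝟙 ⊝ a ⊗ Q) ⊗ (x ⊗ Q) ⊗ 𝟘 ∎
  S′-shift {x} a (suc K) o = begin
    (𝟙 ⊝ x) ⊗ (S′ x a (suc K) ⊕ u)
      ≈⟨ solve 3 (λ x s u → (:1 :- x) :* (s :+ u) := (:1 :- x) :* s :+ u :* (:1 :- x)) R.refl x (S′ x a (suc K)) u ⟩
    (𝟙 ⊝ x) ⊗ S′ x a (suc K) ⊕ u ⊗ (𝟙 ⊝ x)
      ≈⟨ R.+-cong (S′-shift a K o) (t-shift a K o) ⟩
    𝟙 ⊕ c ⊗ S (x ⊗ Q) (a ⊗ Q) K ⊕ c ⊗ t (x ⊗ Q) (a ⊗ Q) K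
      ≈⟨ solve 3 (λ c s t → :1 :+ c :* s :+ c :* t := :1 :+ c :* (s :+ t)) R.refl c (S (x ⊗ Q) (a ⊗ Q) K) (t (x ⊗ Q) (a ⊗ Q) K) ⟩
    𝟙 ⊕ c ⊗ S (x ⊗ Q) (a ⊗ Q) (suc K) ∎
    where
    u = Q ^ suc K ⊗ t x a (suc K)
    c = (𝟙 ⊝ a ⊗ Q) ⊗ (x ⊗ Q)

  tail : PS → PS → ℕ → PS
  tail x a K = (𝟙 ⊝ x) ⊗ (x ⊗ (𝟙 ⊝ a ⊗ Q ^ suc K) ⊗ t x a K)

  t-Ord : ∀ {x} a n → Ord 1 x → Ord n (t x a n)
  t-Ord a zero    o = Ord-0
  t-Ord {x} a (suc n) o = Ord-⊗ (Ord-⊗ˡ (inv (x ⊗ Q ^ suc n)) (Ord-⊗ˡ (𝟙 ⊝ a ⊗ Q ^ suc n) o)) (t-Ord a n o)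

  tail-Ord : ∀ {x} a K → Ord 1 x → Ord (suc K) (tail x a K)
  tail-Ord {x} a K o = Ord-⊗ʳ (𝟙 ⊝ x) (Ord-⊗ (Ord-⊗ˡ (𝟙 ⊝ a ⊗ Q ^ suc K) o) (t-Ord a K o))

  -- The functional equation for partial sums: `S′` is eliminated between `S-S′` and `S′-shift`, and
  -- the only error is `tail`, of order `K + 1`.
  S-rec : ∀ {x} a K → Ord 1 x → (𝟙 ⊝ x) ⊗ ((𝟙 ⊝ x) ⊗ S x a (suc K)) ⊕ tail x a K
    ≈ 𝟙 ⊝ a ⊗ Q ⊗ x ⊕ x ⊗ x ⊗ Q ⊗ ((𝟙 ⊝ a ⊗ Q) ⊗ (𝟙 ⊝ a ⊗ Q)) ⊗ S (x ⊗ Q) (a ⊗ Q) K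
  S-rec {x} a K o = begin
    (𝟙 ⊝ x) ⊗ ((𝟙 ⊝ x) ⊗ S x a (suc K)) ⊕ tail x a K ≈⟨ R.distribˡ (𝟙 ⊝ x) _ _ ⟨
    (𝟙 ⊝ x) ⊗ ((𝟙 ⊝ x) ⊗ S x a (suc K) ⊕ x ⊗ (𝟙 ⊝ a ⊗ Q ^ suc K) ⊗ t x a K) ≈⟨ R.*-congˡ (S-S′ a K o) ⟩
    (𝟙 ⊝ x) ⊗ (𝟙 ⊕ (x ⊝ a ⊗ Q ⊗ x) ⊗ S′ x a (suc K))
      ≈⟨ solve 3 (λ x c s → (:1 :- x) :* (:1 :+ c :* s) := (:1 :- x) :+ c :* ((:1 :- x) :* s)) R.refl
          x (x ⊝ a ⊗ Q ⊗ x) (S′ x a (suc K)) ⟩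
    (𝟙 ⊝ x) ⊕ (x ⊝ a ⊗ Q ⊗ x) ⊗ ((𝟙 ⊝ x) ⊗ S′ x a (suc K)) ≈⟨ R.+-congˡ (R.*-congˡ (S′-shift a K o)) ⟩
    (𝟙 ⊝ x) ⊕ (x ⊝ a ⊗ Q ⊗ x) ⊗ (𝟙 ⊕ (𝟙 ⊝ a ⊗ Q) ⊗ (x ⊗ Q) ⊗ S (x ⊗ Q) (a ⊗ Q) K)
      ≈⟨ solve 4 (λ x a q s → (:1 :- x) :+ (x :- a :* q :* x) :* (:1 :+ (:1 :- a :* q) :* (x :* q) :* s)
           := :1 :- a :* q :* x :+ x :* x :* q :* ((:1 :- a :* q) :* (:1 :- a :* q)) :* s) R.refl
           x a Q (S (x ⊗ Q) (a ⊗ Q) K) ⟩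
    _ ∎

  -- Div K f: the coefficients of f below K are divisible by 4.
  record Div (K : ℕ) (f : PS) : Set where
    constructor div
    field
      quotient : PS
      remainder-Ord : Ord K (f ⊝ const (+ 4) ⊗ quotient)

  Div-≈ : ∀ {K f g} → f ≈ g → Div K f → Div K g
  Div-≈ p (div h o) = div h (Ord-≈ (R.+-congʳ p) o)

  Div-⊕ : ∀ {K f g} → Div K f → Div K g → Div K (f ⊕ g)
  Div-⊕ {K} {f} {g} (div h o) (div k o′) = div (h ⊕ k) (Ord-≈
    (solve 4 (λ f g h k → f :- :4 :* h :+ (g :- :4 :* k) := f :+ g :- :4 :* (h :+ k)) R.refl f g h k) (Ord-⊕ o o′))

  Div-⊗ʳ : ∀ {k K f g} → Ord k f → Div K g → Div (k ℕ.+ K) (f ⊗ g)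
  Div-⊗ʳ {f = f} {g} p (div h o) = div (f ⊗ h) (Ord-≈
    (solve 3 (λ f g h → f :* (g :- :4 :* h) := f :* g :- :4 :* (f :* h)) R.refl f g h) (Ord-⊗ p o))

  Div-4 : ∀ {K} f → Div K (const (+ 4) ⊗ f)
  Div-4 f = div f (Ord-≈ (solve 1 (λ f → :0 := f :- f) R.refl (const (+ 4) ⊗ f)) (ord λ n _ → 𝟘-const n))

  Div-Ord : ∀ {K f} → Ord K f → Div K f
  Div-Ord {f = f} o = div 𝟘 (Ord-≈ (solve 1 (λ f → f := f :- :4 :* :0) R.refl f) o)

  Div-cancel : ∀ {K x f} → Ord 1 x → Div K ((𝟙 ⊝ x) ⊗ f) → Div K f
  Div-cancel {x = x} {f} o d = Div-≈ (begin
    inv x ⊗ ((𝟙 ⊝ x) ⊗ f) ≈⟨ solve 3 (λ i y f → i :* (y :* f) := y :* i :* f) R.refl (inv x) (𝟙 ⊝ x) f ⟩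
    (𝟙 ⊝ x) ⊗ inv x ⊗ f   ≈⟨ R.*-congʳ (inv-* o) ⟩
    𝟙 ⊗ f                 ≈⟨ R.*-identityˡ f ⟩
    f ∎) (Div-⊗ʳ Ord-0 d)

  -- Induction on the length of the partial sums through `S-rec`. The sign changes are assumed only
  -- up to `≈`, because the induction step meets `(⊖ x) ⊗ Q` where `⊖ (x ⊗ Q)` is wanted.
  S-cong-4 : ∀ K {x y a b} → Ord 1 x → y ≈ ⊖ x → b ≈ ⊖ a → Div K (S x a K ⊝ S y b K)
  S-cong-4 zero {x} {y} {a} {b} o p r = Div-Ord Ord-0
  S-cong-4 (suc K) {x} {y} {a} {b} o p r = Div-cancel o (Div-cancel o (Div-≈ eq
    (Div-⊕ (Div-⊕ (Div-⊗ʳ Ox IH) (Div-Ord (Ord-⊕ (Ord-⊖ (tail-Ord a K o)) (tail-Ord b K oy)))) (Div-4 M))))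
    where
    oy : Ord 1 y
    oy = Ord-≈ (R.sym p) (Ord-⊖ o)
    u = S x a (suc K)
    v = S y b (suc K)
    u⁺ = S (x ⊗ Q) (a ⊗ Q) K
    v⁺ = S (y ⊗ Q) (b ⊗ Q) K
    neg⊗ : ∀ {f g} → g ≈ ⊖ f → g ⊗ Q ≈ ⊖ (f ⊗ Q)
    neg⊗ {f} e = R.trans (R.*-congʳ e) (solve 2 (λ f q → (:- f) :* q := :- (f :* q)) R.refl f Q)
    IH : Div K (u⁺ ⊝ v⁺)
    IH = S-cong-4 K (Ord-⊗ˡ Q o) (neg⊗ p) (neg⊗ r)
    -- One factor `x` stands in front: it raises the order by one, which takes the induction
    -- hypothesis from `K` to `K + 1`.
    C = x ⊗ (x ⊗ Q ⊗ ((𝟙 ⊝ a ⊗ Q) ⊗ (𝟙 ⊝ a ⊗ Q)))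
    Ox : Ord 1 C
    Ox = Ord-⊗ˡ _ o
    -- Collects the terms `4x` and `4aQ` by which the squares of `1 ± x` and `1 ± aQ` differ.
    M = x ⊗ v ⊝ x ⊗ x ⊗ Q ⊗ (a ⊗ Q) ⊗ v⁺
    Rb : (𝟙 ⊕ x) ⊗ ((𝟙 ⊕ x) ⊗ v) ≈ 𝟙 ⊝ a ⊗ Q ⊗ x ⊕ x ⊗ x ⊗ Q ⊗ ((𝟙 ⊕ a ⊗ Q) ⊗ (𝟙 ⊕ a ⊗ Q)) ⊗ v⁺ ⊝ tail y b K
    Rb = begin
      (𝟙 ⊕ x) ⊗ ((𝟙 ⊕ x) ⊗ v)
        ≈⟨ R.*-cong e1 (R.*-congʳ e1) ⟩
      (𝟙 ⊝ y) ⊗ ((𝟙 ⊝ y) ⊗ v)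
        ≈⟨ solve 2 (λ z t → z := z :+ t :- t) R.refl _ (tail y b K) ⟩
      (𝟙 ⊝ y) ⊗ ((𝟙 ⊝ y) ⊗ v) ⊕ tail y b K ⊝ tail y b K ≈⟨ R.+-congʳ (S-rec b K oy) ⟩
      𝟙 ⊝ b ⊗ Q ⊗ y ⊕ y ⊗ y ⊗ Q ⊗ ((𝟙 ⊝ b ⊗ Q) ⊗ (𝟙 ⊝ b ⊗ Q)) ⊗ v⁺ ⊝ tail y b K
        ≈⟨ R.+-congʳ (R.+-cong (R.+-congˡ (R.-‿cong (R.*-cong (R.*-congʳ r) p)))
             (R.*-congʳ (R.*-cong (R.*-congʳ (R.*-cong p p)) (R.*-cong e2 e2)))) ⟩
      𝟙 ⊝ (⊖ a) ⊗ Q ⊗ (⊖ x) ⊕ (⊖ x) ⊗ (⊖ x) ⊗ Q ⊗ ((𝟙 ⊝ (⊖ a) ⊗ Q) ⊗ (𝟙 ⊝ (⊖ a) ⊗ Q)) ⊗ v⁺ ⊝ tail y b K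
        ≈⟨ solve 5 (λ x a q v t → :1 :- (:- a) :* q :* (:- x) :+ (:- x) :* (:- x) :* q :* ((:1 :- (:- a) :* q) :* (:1 :- (:- a) :* q)) :* v :- t
              := :1 :- a :* q :* x :+ x :* x :* q :* ((:1 :+ a :* q) :* (:1 :+ a :* q)) :* v :- t) R.refl x a Q v⁺ (tail y b K) ⟩
      _ ∎
      where
      e1 : 𝟙 ⊕ x ≈ 𝟙 ⊝ y
      e1 = R.+-congˡ (R.trans (solve 1 (λ x → x := :- (:- x)) R.refl x) (R.-‿cong (R.sym p)))
      e2 : 𝟙 ⊝ b ⊗ Q ≈ 𝟙 ⊝ (⊖ a) ⊗ Q
      e2 = R.+-congˡ (R.-‿cong (R.*-congʳ r))
    Ra : (𝟙 ⊝ x) ⊗ ((𝟙 ⊝ x) ⊗ u) ≈ 𝟙 ⊝ a ⊗ Q ⊗ x ⊕ x ⊗ x ⊗ Q ⊗ ((𝟙 ⊝ a ⊗ Q) ⊗ (𝟙 ⊝ a ⊗ Q)) ⊗ u⁺ ⊝ tail x a K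
    Ra = R.trans (solve 2 (λ z t → z := z :+ t :- t) R.refl _ (tail x a K)) (R.+-congʳ (S-rec a K o))
    eq : C ⊗ (u⁺ ⊝ v⁺) ⊕ (⊖ tail x a K ⊕ tail y b K) ⊕ const (+ 4) ⊗ M ≈ (𝟙 ⊝ x) ⊗ ((𝟙 ⊝ x) ⊗ (u ⊝ v))
    eq = begin
      _ ≈⟨ solve 8 (λ x a q u⁺ v⁺ tx ty v →
             x :* (x :* q :* ((:1 :- a :* q) :* (:1 :- a :* q))) :* (u⁺ :- v⁺) :+ (:- tx :+ ty) :+ :4 :* (x :* v :- x :* x :* q :* (a :* q) :* v⁺)
             := (:1 :- a :* q :* x :+ x :* x :* q :* ((:1 :- a :* q) :* (:1 :- a :* q)) :* u⁺ :- tx)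
                :- (:1 :- a :* q :* x :+ x :* x :* q :* ((:1 :+ a :* q) :* (:1 :+ a :* q)) :* v⁺ :- ty)
                :+ :4 :* x :* v) R.refl x a Q u⁺ v⁺ (tail x a K) (tail y b K) v ⟩
      _ ≈⟨ R.+-congʳ (R.+-cong Ra (R.-‿cong Rb)) ⟨
      (𝟙 ⊝ x) ⊗ ((𝟙 ⊝ x) ⊗ u) ⊝ (𝟙 ⊕ x) ⊗ ((𝟙 ⊕ x) ⊗ v) ⊕ const (+ 4) ⊗ x ⊗ v
        ≈⟨ solve 3 (λ x u v → (:1 :- x) :* ((:1 :- x) :* u) :- (:1 :+ x) :* ((:1 :+ x) :* v) :+ :4 :* x :* v
             := (:1 :- x) :* ((:1 :- x) :* (u :- v))) R.refl x u v ⟩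
      _ ∎

-- Telescoping R(-q;1) to a double sum.

module DoubleSum where

  open PowerSeries
  open PowerSeriesOrder
  open FunctionalEquation
  open import Data.Nat as ℕ using (ℕ; zero; suc; z≤n; s≤s; _+_; _*_)
  import Data.Nat.Properties as ℕP
  open import Data.Nat.Tactic.RingSolver using (solve-∀)
  open import Data.Integer as ℤ using (ℤ)
  open import Relation.Binary.PropositionalEquality as ≡ using (_≡_; refl; cong)
  open import Function using (_∘_)
  open PSSolver using (solve; _:=_; _:+_; _:*_; :-_; _:-_)
  open ≈R

  ∑′ : (ℕ → PS) → ℕ → PS
  ∑′ f zero    = 𝟘
  ∑′ f (suc n) = f 0 ⊕ ∑′ (f ∘ suc) n

  ∑-head : ∀ f n → ∑ f (suc n) ≈ f 0 ⊕ ∑ (f ∘ suc) n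
  ∑-head f zero    = R.+-comm 𝟘 (f 0)
  ∑-head f (suc n) = R.trans (R.+-congʳ (∑-head f n)) (R.+-assoc _ _ _)

  ∑-cong : ∀ {f g} n → (∀ i → f i ≈ g i) → ∑ f n ≈ ∑ g n
  ∑-cong zero    p = R.refl
  ∑-cong (suc n) p = R.+-cong (∑-cong n p) (p n)

  ∑-⊕ : ∀ f g n → ∑ (λ i → f i ⊕ g i) n ≈ ∑ f n ⊕ ∑ g n
  ∑-⊕ f g zero    = R.sym (R.+-identityˡ 𝟘)
  ∑-⊕ f g (suc n) = R.trans (R.+-congʳ (∑-⊕ f g n))
    (solve 4 (λ a b c d → a :+ b :+ (c :+ d) := a :+ c :+ (b :+ d)) R.refl (∑ f n) (∑ g n) (f n) (g n))

  ∑-⊗ : ∀ c f n → ∑ (λ i → c ⊗ f i) n ≈ c ⊗ ∑ f n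
  ∑-⊗ c f zero    = R.sym (R.zeroʳ c)
  ∑-⊗ c f (suc n) = R.trans (R.+-congʳ (∑-⊗ c f n)) (R.sym (R.distribˡ c _ _))

  ∑′-cong : ∀ {f g} n → (∀ i → f i ≈ g i) → ∑′ f n ≈ ∑′ g n
  ∑′-cong zero    p = R.refl
  ∑′-cong (suc n) p = R.+-cong (p 0) (∑′-cong n (p ∘ suc))

  ∑′-⊗ : ∀ c f n → ∑′ (λ i → c ⊗ f i) n ≈ c ⊗ ∑′ f n
  ∑′-⊗ c f zero    = R.sym (R.zeroʳ c)
  ∑′-⊗ c f (suc n) = R.trans (R.+-congˡ (∑′-⊗ c (f ∘ suc) n)) (R.sym (R.distribˡ c _ _))

  ad : (ℕ → ℕ → PS) → ℕ → PS
  ad f zero    = f 0 0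
  ad f (suc M) = f 0 (suc M) ⊕ ad (f ∘ suc) M

  ad-cong : ∀ {f g} M → (∀ i j → i + j ≡ M → f i j ≈ g i j) → ad f M ≈ ad g M
  ad-cong zero    p = p 0 0 refl
  ad-cong (suc M) p = R.+-cong (p 0 (suc M) refl) (ad-cong M (λ i j e → p (suc i) j (cong suc e)))

  ad-⊕ : ∀ f g M → ad (λ i j → f i j ⊕ g i j) M ≈ ad f M ⊕ ad g M
  ad-⊕ f g zero    = R.refl
  ad-⊕ f g (suc M) = R.trans (R.+-congˡ (ad-⊕ (f ∘ suc) (g ∘ suc) M))
    (solve 4 (λ a b c d → a :+ b :+ (c :+ d) := a :+ c :+ (b :+ d)) R.refl (f 0 (suc M)) (g 0 (suc M)) _ _)

  ad-⊗ : ∀ c f M → ad (λ i j → c ⊗ f i j) M ≈ c ⊗ ad f M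
  ad-⊗ c f zero    = R.refl
  ad-⊗ c f (suc M) = R.trans (R.+-congˡ (ad-⊗ c (f ∘ suc) M)) (R.sym (R.distribˡ c _ _))

  ad-last : ∀ f M → ad f (suc M) ≈ ad (λ i j → f i (suc j)) M ⊕ f (suc M) 0
  ad-last f zero    = R.refl
  ad-last f (suc M) = R.trans (R.+-congˡ (ad-last (f ∘ suc) M)) (R.sym (R.+-assoc _ _ _))

  ad-swap : ∀ f M → ad f M ≈ ad (λ i j → f j i) M
  ad-swap f zero    = R.refl
  ad-swap f (suc M) = R.trans (R.+-congˡ (ad-swap (f ∘ suc) M))
    (R.trans (R.+-comm _ _) (R.sym (ad-last (λ i j → f j i) M)))

  -- Unlike `2 * n` it exposes two successors at each step, so that `ad` and `B` unfold on it.
  dbl : ℕ → ℕ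
  dbl zero    = zero
  dbl (suc n) = suc (suc (dbl n))

  dbl≡ : ∀ n → dbl n ≡ n + n
  dbl≡ zero    = refl
  dbl≡ (suc n) = cong suc (≡.trans (cong suc (dbl≡ n)) (≡.sym (ℕP.+-suc n n)))

  -- An antidiagonal of odd index has no middle entry, so its entries pair off by symmetry; `2r + 1`
  -- is the difference of the two indices.
  ad-fold : ∀ f n → ad f (suc (dbl n)) ≈ ad (λ i r → f (i + suc (dbl r)) i ⊕ f i (i + suc (dbl r))) n
  ad-fold f zero    = R.+-comm _ _
  ad-fold f (suc n) = begin
    f 0 m ⊕ ad (f ∘ suc) (suc (suc (dbl n)))              ≈⟨ R.+-congˡ (ad-last (f ∘ suc) (suc (dbl n))) ⟩
    f 0 m ⊕ (ad (λ i j → f (suc i) (suc j)) (suc (dbl n)) ⊕ f m 0) ≈⟨ R.+-congˡ (R.+-congʳ (ad-fold (λ i j → f (suc i) (suc j)) n)) ⟩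
    f 0 m ⊕ (A ⊕ f m 0)                                   ≈⟨ solve 3 (λ x y z → x :+ (y :+ z) := z :+ x :+ y) R.refl (f 0 m) A (f m 0) ⟩
    f m 0 ⊕ f 0 m ⊕ A ∎
    where
    m = suc (dbl (suc n))
    A = ad (λ i r → f (suc i + suc (dbl r)) (suc i) ⊕ f (suc i) (suc i + suc (dbl r))) n

  Ord-≡ : ∀ {k l f} → k ≡ l → Ord k f → Ord l f
  Ord-≡ refl o = o

  -- A triangle summed by rows instead of antidiagonals. Row `r` is cut after `K − r` entries; since
  -- its error starts `c + r` orders later, replacing the row by its limit `h r` costs only order
  -- `c + K`. Each row removed in the induction raises `c` by one.
  ∑-ad : ∀ c J K (f : ℕ → ℕ → PS) h → K ℕ.≤ J → (∀ r L → L ℕ.≤ J → Ord (c + r + L) (∑ (f r) L ⊝ h r)) →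
    Ord (c + K) (∑ (ad f) K ⊝ ∑′ h K)
  ∑-ad c J zero    f h _ p = Ord-≈ (solve 1 (λ z → :0 := z :- z) R.refl 𝟘) (ord λ n _ → 𝟘-const n)
  ∑-ad c J (suc K) f h K<J p = Ord-≈ (begin
    (∑ (f 0) (suc K) ⊝ h 0) ⊕ (∑ (ad (f ∘ suc)) K ⊝ ∑′ (h ∘ suc) K)
      ≈⟨ R.+-congʳ (R.+-congʳ (∑-head (f 0) K)) ⟩
    (f 0 0 ⊕ ∑ (f 0 ∘ suc) K ⊝ h 0) ⊕ (∑ (ad (f ∘ suc)) K ⊝ ∑′ (h ∘ suc) K)
      ≈⟨ solve 5 (λ a b c d e → a :+ b :- c :+ (d :- e) := a :+ (b :+ d) :- (c :+ e)) R.refl _ _ _ _ _ ⟩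
    f 0 0 ⊕ (∑ (f 0 ∘ suc) K ⊕ ∑ (ad (f ∘ suc)) K) ⊝ (h 0 ⊕ ∑′ (h ∘ suc) K)
      ≈⟨ R.+-congʳ (R.+-congˡ (∑-⊕ (f 0 ∘ suc) (ad (f ∘ suc)) K)) ⟨
    f 0 0 ⊕ ∑ (ad f ∘ suc) K ⊝ (h 0 ⊕ ∑′ (h ∘ suc) K)
      ≈⟨ R.+-congʳ (∑-head (ad f) K) ⟨
    ∑ (ad f) (suc K) ⊝ ∑′ h (suc K) ∎)
    (Ord-⊕ (Ord-≡ (cong (_+ suc K) (ℕP.+-identityʳ c)) (p 0 (suc K) K<J))
      (Ord-≡ (≡.sym (ℕP.+-suc c K))
        (∑-ad (suc c) J K (f ∘ suc) (h ∘ suc) (ℕP.<⇒≤ K<J) (λ r L le → Ord-≡ (cong (_+ L) (ℕP.+-suc c r)) (p (suc r) L le)))))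

  b : PS
  b = ⊖ q

  b-Ord : Ord 1 b
  b-Ord = Ord-⊖ q-Ord

  b² : b ⊗ b ≈ Q
  b² = solve 1 (λ q → (:- q) :* (:- q) := q :* q) R.refl q

  Q^-Ord : ∀ n → Ord (suc n) (Q ^ suc n)
  Q^-Ord n = Ord-^ (Ord-≤ (s≤s z≤n) Q-Ord) (suc n)

  Q^-Ord1 : ∀ n → Ord 1 (Q ^ suc n)
  Q^-Ord1 n = Ord-≤ (s≤s z≤n) (Q^-Ord n)

  b^dbl : ∀ n → b ^ dbl n ≈ Q ^ n
  b^dbl zero    = R.refl
  b^dbl (suc n) = R.trans (R.sym (R.*-assoc b b _)) (R.*-cong b² (b^dbl n))

  Q^dbl : ∀ n → Q ^ dbl n ≈ Q ^ n ⊗ Q ^ n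
  Q^dbl zero    = R.sym (R.*-identityˡ 𝟙)
  Q^dbl (suc n) = R.trans (R.*-congˡ (R.*-congˡ (Q^dbl n)))
    (solve 2 (λ q z → q :* (q :* (z :* z)) := q :* z :* (q :* z)) R.refl Q (Q ^ n))

  -- EQ n = (Q;Q)_n and IQ n is its inverse.
  EQ IQ : ℕ → PS
  EQ zero    = 𝟙
  EQ (suc n) = (𝟙 ⊝ Q ^ suc n) ⊗ EQ n
  IQ zero    = 𝟙
  IQ (suc n) = inv (Q ^ suc n) ⊗ IQ n

  IQ-rec : ∀ n → (𝟙 ⊝ Q ^ suc n) ⊗ IQ (suc n) ≈ IQ n
  IQ-rec n = R.trans (R.sym (R.*-assoc _ _ _)) (R.trans (R.*-congʳ (inv-* (Q^-Ord1 n))) (R.*-identityˡ _))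

  EQ-IQ : ∀ n → EQ n ⊗ IQ n ≈ 𝟙
  EQ-IQ zero    = R.*-identityˡ 𝟙
  EQ-IQ (suc n) = begin
    y ⊗ EQ n ⊗ (i ⊗ IQ n)   ≈⟨ solve 4 (λ y e i j → y :* e :* (i :* j) := y :* i :* (e :* j)) R.refl y (EQ n) i (IQ n) ⟩
    y ⊗ i ⊗ (EQ n ⊗ IQ n)   ≈⟨ R.*-cong (inv-* (Q^-Ord1 n)) (EQ-IQ n) ⟩
    𝟙 ⊗ 𝟙                   ≈⟨ R.*-identityˡ 𝟙 ⟩
    𝟙 ∎
    where
    y = 𝟙 ⊝ Q ^ suc n
    i = inv (Q ^ suc n)

  -- B M = 1 / (b;b)_M, where b² = Q.
  F : ℕ → ℕ → PS
  F i j = b ^ i ⊗ (IQ i ⊗ IQ j)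

  B : ℕ → PS
  B = ad F

  -- The factor 1 − Q^(i+j) = (1 − Q^j) + Q^j (1 − Q^i) lowers j in the first part and i in the second.
  B-rec′ : ∀ M → (𝟙 ⊝ Q ^ suc M) ⊗ B (suc M) ≈ (𝟙 ⊕ b ^ suc M) ⊗ B M
  B-rec′ M = begin
    (𝟙 ⊝ Q ^ suc M) ⊗ B (suc M) ≈⟨ ad-⊗ _ F (suc M) ⟨
    ad (λ i j → (𝟙 ⊝ Q ^ suc M) ⊗ F i j) (suc M) ≈⟨ ad-cong (suc M) split ⟩
    ad (λ i j → U i j ⊕ V i j) (suc M) ≈⟨ ad-⊕ U V (suc M) ⟩
    ad U (suc M) ⊕ ad V (suc M) ≈⟨ R.+-cong Us Vs ⟩
    B M ⊕ b ^ suc M ⊗ B M ≈⟨ solve 2 (λ x y → y :+ x :* y := (:1 :+ x) :* y) R.refl (b ^ suc M) (B M) ⟩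
    (𝟙 ⊕ b ^ suc M) ⊗ B M ∎
    where
    U V : ℕ → ℕ → PS
    U i j = (𝟙 ⊝ Q ^ j) ⊗ F i j
    V i j = Q ^ j ⊗ (𝟙 ⊝ Q ^ i) ⊗ F i j
    split : ∀ i j → i + j ≡ suc M → (𝟙 ⊝ Q ^ suc M) ⊗ F i j ≈ U i j ⊕ V i j
    split i j e = begin
      (𝟙 ⊝ Q ^ suc M) ⊗ F i j ≈⟨ R.*-congʳ (R.+-congˡ (R.-‿cong (R.trans (R.reflexive (cong (Q ^_) (≡.sym e))) (^-+ Q i j)))) ⟩
      (𝟙 ⊝ Q ^ i ⊗ Q ^ j) ⊗ F i j
        ≈⟨ solve 3 (λ x y f → (:1 :- x :* y) :* f := (:1 :- y) :* f :+ y :* (:1 :- x) :* f) R.refl (Q ^ i) (Q ^ j) (F i j) ⟩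
      U i j ⊕ V i j ∎
    kill : ∀ f → (𝟙 ⊝ Q ^ 0) ⊗ f ≈ 𝟘
    kill f = solve 1 (λ f → (:1 :- :1) :* f := :0) R.refl f
    Us : ad U (suc M) ≈ B M
    Us = begin
      ad U (suc M) ≈⟨ ad-last U M ⟩
      ad (λ i j → U i (suc j)) M ⊕ U (suc M) 0 ≈⟨ R.+-cong (ad-cong M (λ i j _ → step i j)) (kill _) ⟩
      B M ⊕ 𝟘 ≈⟨ R.+-identityʳ _ ⟩
      B M ∎
      where
      step : ∀ i j → U i (suc j) ≈ F i j
      step i j = R.trans (solve 4 (λ y a c d → y :* (a :* (c :* d)) := a :* (c :* (y :* d))) R.refl _ (b ^ i) (IQ i) (IQ (suc j)))
        (R.*-congˡ (R.*-congˡ (IQ-rec j)))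
    Vs : ad V (suc M) ≈ b ^ suc M ⊗ B M
    Vs = begin
      Q ^ suc M ⊗ (𝟙 ⊝ Q ^ 0) ⊗ F 0 (suc M) ⊕ ad (V ∘ suc) M
        ≈⟨ R.+-congʳ (R.trans (R.*-assoc _ _ _) (R.trans (R.*-congˡ (kill _)) (R.zeroʳ _))) ⟩
      𝟘 ⊕ ad (V ∘ suc) M                          ≈⟨ R.+-identityˡ _ ⟩
      ad (V ∘ suc) M                              ≈⟨ ad-cong M step ⟩
      ad (λ i j → b ^ suc M ⊗ F j i) M            ≈⟨ ad-⊗ _ (λ i j → F j i) M ⟩
      b ^ suc M ⊗ ad (λ i j → F j i) M            ≈⟨ R.*-congˡ (ad-swap (λ i j → F j i) M) ⟩
      b ^ suc M ⊗ B M ∎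
      where
      step : ∀ i j → i + j ≡ M → V (suc i) j ≈ b ^ suc M ⊗ F j i
      step i j refl = begin
        Q ^ j ⊗ (𝟙 ⊝ Q ^ suc i) ⊗ (b ⊗ b ^ i ⊗ (IQ (suc i) ⊗ IQ j))
          ≈⟨ solve 6 (λ z y b x a d → z :* y :* (b :* x :* (a :* d)) := z :* (b :* x) :* ((y :* a) :* d)) R.refl (Q ^ j) _ b (b ^ i) (IQ (suc i)) (IQ j) ⟩
        Q ^ j ⊗ (b ⊗ b ^ i) ⊗ ((𝟙 ⊝ Q ^ suc i) ⊗ IQ (suc i) ⊗ IQ j)
          ≈⟨ R.*-cong (R.*-congʳ (R.trans (^-cong j (R.sym b²)) (^-⊗ b b j))) (R.*-congʳ (IQ-rec i)) ⟩
        (b ^ j ⊗ b ^ j) ⊗ (b ⊗ b ^ i) ⊗ (IQ i ⊗ IQ j)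
          ≈⟨ solve 5 (λ z b x a d → z :* z :* (b :* x) :* (a :* d) := b :* (x :* z) :* (z :* (d :* a))) R.refl (b ^ j) b (b ^ i) (IQ i) (IQ j) ⟩
        b ⊗ (b ^ i ⊗ b ^ j) ⊗ F j i ≈⟨ R.*-congʳ (R.*-congˡ (^-+ b i j)) ⟨
        b ^ suc (i + j) ⊗ F j i ∎

  -- As `1 − Q^M = (1 − b^M)(1 + b^M)`, this is `B-rec′` divided by `1 + b^(M+1)`. The sum defining
  -- `B` is Euler's: split the factors of `1 / (z;b)_∞` into `1 / (z;Q)_∞` and `1 / (zb;Q)_∞`,
  -- expand both, and compare coefficients of `z^M`.
  B-rec : ∀ M → (𝟙 ⊝ b ^ suc M) ⊗ B (suc M) ≈ B M
  B-rec M = cancel {⊖ (b ^ suc M)} (Ord-⊖ (Ord-≤ (s≤s z≤n) (Ord-^ b-Ord (suc M)))) (begin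
    (𝟙 ⊝ ⊖ x) ⊗ ((𝟙 ⊝ x) ⊗ B (suc M)) ≈⟨ solve 2 (λ x y → (:1 :- (:- x)) :* ((:1 :- x) :* y) := (:1 :- x :* x) :* y) R.refl x _ ⟩
    (𝟙 ⊝ x ⊗ x) ⊗ B (suc M) ≈⟨ R.*-congʳ (R.+-congˡ (R.-‿cong (R.trans (R.sym (^-⊗ b b (suc M))) (^-cong (suc M) b²)))) ⟩
    (𝟙 ⊝ Q ^ suc M) ⊗ B (suc M) ≈⟨ B-rec′ M ⟩
    (𝟙 ⊕ x) ⊗ B M ≈⟨ R.*-congʳ (solve 1 (λ x → :1 :+ x := :1 :- (:- x)) R.refl x) ⟩
    (𝟙 ⊝ ⊖ x) ⊗ B M ∎)
    where
    x = b ^ suc M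

  h : ℕ → PS
  h n = EQ n ⊗ EQ n ⊗ (b ^ suc n ⊗ B (suc (dbl n)))

  -- The even powers of `b` in `(b;b)_{2n+1}` make up `(Q;Q)_n` and the odd ones `(b;Q)_{n+1}`,
  -- whence `(Q;Q)_n / (b;Q)_{n+1} = (Q;Q)_n² / (b;b)_{2n+1}`.
  t≈h : ∀ n → b ⊗ t b 𝟙 n ≈ h n
  t≈h zero    = cancel {b} b-Ord (begin
    (𝟙 ⊝ b) ⊗ (b ⊗ inv b) ≈⟨ solve 3 (λ y b i → y :* (b :* i) := b :* (y :* i)) R.refl (𝟙 ⊝ b) b (inv b) ⟩
    b ⊗ ((𝟙 ⊝ b) ⊗ inv b) ≈⟨ R.*-congˡ (inv-* b-Ord) ⟩
    b ⊗ 𝟙 ≈⟨ R.*-congˡ (R.trans (R.*-identityˡ _) (R.*-identityˡ _)) ⟨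
    b ⊗ B 0 ≈⟨ R.*-congˡ (B-rec 0) ⟨
    b ⊗ ((𝟙 ⊝ b ⊗ 𝟙) ⊗ B 1) ≈⟨ solve 2 (λ b c → b :* ((:1 :- b :* :1) :* c) := (:1 :- b) :* (:1 :* :1 :* (b :* :1 :* c))) R.refl b (B 1) ⟩
    (𝟙 ⊝ b) ⊗ h 0 ∎)
  t≈h (suc n) = cancel {b ⊗ Q ^ suc n} (Ord-⊗ˡ _ b-Ord) (begin
    y ⊗ (b ⊗ t b 𝟙 (suc n)) ≈⟨ solve 3 (λ y b i → y :* (b :* i) := b :* (y :* i)) R.refl y b _ ⟩
    b ⊗ (y ⊗ t b 𝟙 (suc n)) ≈⟨ R.*-congˡ (t-rec 𝟙 n b-Ord) ⟨
    b ⊗ (b ⊗ (𝟙 ⊝ 𝟙 ⊗ z) ⊗ t b 𝟙 n) ≈⟨ solve 3 (λ b z t → b :* (b :* (:1 :- :1 :* z) :* t) := b :* (:1 :- z) :* (b :* t)) R.refl b z (t b 𝟙 n) ⟩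
    b ⊗ (𝟙 ⊝ z) ⊗ (b ⊗ t b 𝟙 n) ≈⟨ R.*-congˡ (t≈h n) ⟩
    b ⊗ (𝟙 ⊝ z) ⊗ (EQ n ⊗ EQ n ⊗ (b ^ suc n ⊗ B m)) ≈⟨ R.*-congˡ (R.*-congˡ (R.*-congˡ B2)) ⟨
    b ⊗ (𝟙 ⊝ z) ⊗ (EQ n ⊗ EQ n ⊗ (b ^ suc n ⊗ ((𝟙 ⊝ z) ⊗ (y ⊗ B (suc (suc m))))))
      ≈⟨ solve 6 (λ b z e x y B → b :* z :* (e :* e :* (x :* (z :* (y :* B)))) := y :* (z :* e :* (z :* e) :* (b :* x :* B))) R.refl b (𝟙 ⊝ z) (EQ n) (b ^ suc n) y (B (suc (suc m))) ⟩
    y ⊗ h (suc n) ∎)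
    where
    z = Q ^ suc n
    y = 𝟙 ⊝ b ⊗ z
    m = suc (dbl n)
    B2 : (𝟙 ⊝ z) ⊗ (y ⊗ B (suc (suc m))) ≈ B m
    B2 = R.trans (R.*-cong (R.+-congˡ (R.-‿cong (R.sym (b^dbl (suc n)))))
                   (R.trans (R.*-congʳ (R.+-congˡ (R.-‿cong (R.*-congˡ (R.sym (b^dbl (suc n))))))) (B-rec (suc m)))) (B-rec m)

  g : ℕ → ℕ → PS
  g r i = Q ^ i ⊗ (EQ (i + r) ⊗ EQ (i + r)) ⊗ (IQ i ⊗ IQ (i + suc (dbl r)))

  -- The two entries paired by `ad-fold` contribute `b^(n+1) b^(i+2r+1)` and `b^(n+1) b^i` with
  -- `n = i + r`; the common power `b^(2i) = Q^i` has gone into `g`.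
  W : ℕ → PS
  W r = b ^ (3 * r + 2) ⊕ b ^ (r + 1)

  h≈ad : ∀ n → h n ≈ ad (λ r i → W r ⊗ g r i) n
  h≈ad n = begin
    EQ n ⊗ EQ n ⊗ (b ^ suc n ⊗ B (suc (dbl n))) ≈⟨ R.*-assoc _ _ _ ⟨
    EQ n ⊗ EQ n ⊗ b ^ suc n ⊗ B (suc (dbl n)) ≈⟨ R.*-congˡ (ad-fold F n) ⟩
    EQ n ⊗ EQ n ⊗ b ^ suc n ⊗ ad (λ i r → F (i + suc (dbl r)) i ⊕ F i (i + suc (dbl r))) n ≈⟨ ad-⊗ _ _ n ⟨
    ad (λ i r → EQ n ⊗ EQ n ⊗ b ^ suc n ⊗ (F (i + suc (dbl r)) i ⊕ F i (i + suc (dbl r)))) n ≈⟨ ad-cong n step ⟩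
    ad (λ i r → W r ⊗ g r i) n ≈⟨ ad-swap (λ i r → W r ⊗ g r i) n ⟩
    ad (λ r i → W r ⊗ g r i) n ∎
    where
    pow : ∀ e i r → e ≡ i + i + r → b ^ e ≈ Q ^ i ⊗ b ^ r
    pow e i r refl = R.trans (^-+ b (i + i) r) (R.*-congʳ (R.trans (^-+ b i i) (R.trans (R.sym (^-⊗ b b i)) (^-cong i b²))))
    e1 : ∀ i r → suc (i + r) + (i + suc (r + r)) ≡ i + i + (3 * r + 2)
    e1 = solve-∀
    e2 : ∀ i r → suc (i + r) + i ≡ i + i + (r + 1)
    e2 = solve-∀
    step : ∀ i r → i + r ≡ n → EQ n ⊗ EQ n ⊗ b ^ suc n ⊗ (F (i + suc (dbl r)) i ⊕ F i (i + suc (dbl r))) ≈ W r ⊗ g r i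
    step i r refl = begin
      E ⊗ E ⊗ c ⊗ (b ^ k ⊗ (IQ k ⊗ IQ i) ⊕ b ^ i ⊗ (IQ i ⊗ IQ k))
        ≈⟨ solve 6 (λ E c x y i j → E :* E :* c :* (x :* (j :* i) :+ y :* (i :* j)) := (c :* x :+ c :* y) :* (E :* E) :* (i :* j)) R.refl E c (b ^ k) (b ^ i) (IQ i) (IQ k) ⟩
      (c ⊗ b ^ k ⊕ c ⊗ b ^ i) ⊗ (E ⊗ E) ⊗ (IQ i ⊗ IQ k)
        ≈⟨ R.*-congʳ (R.*-congʳ (R.+-cong
             (R.trans (R.sym (^-+ b (suc (i + r)) k)) (pow _ i (3 * r + 2) (≡.trans (cong (λ d → suc (i + r) + (i + suc d)) (dbl≡ r)) (e1 i r))))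
             (R.trans (R.sym (^-+ b (suc (i + r)) i)) (pow _ i (r + 1) (e2 i r))))) ⟩
      (Q ^ i ⊗ b ^ (3 * r + 2) ⊕ Q ^ i ⊗ b ^ (r + 1)) ⊗ (E ⊗ E) ⊗ (IQ i ⊗ IQ k)
        ≈⟨ solve 5 (λ z x y e i → (z :* x :+ z :* y) :* e :* i := (x :+ y) :* (z :* e :* i)) R.refl (Q ^ i) (b ^ (3 * r + 2)) (b ^ (r + 1)) (E ⊗ E) (IQ i ⊗ IQ k) ⟩
      W r ⊗ g r i ∎
      where
      E = EQ (i + r)
      c = b ^ suc (i + r)
      k = i + suc (dbl r)

  -- This is `(1 + Q^c) / (1 − Q^c)`, in the form that shows the coefficient 2 of C₂.
  w : ℕ → PS
  w c = 𝟙 ⊕ const (ℤ.+ 2) ⊗ (Q ^ c ⊗ inv (Q ^ c))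

  w-* : ∀ c → (𝟙 ⊝ Q ^ suc c) ⊗ w (suc c) ≈ 𝟙 ⊕ Q ^ suc c
  w-* c = begin
    (𝟙 ⊝ y) ⊗ w (suc c) ≈⟨ solve 2 (λ y i → (:1 :- y) :* (:1 :+ :2 :* (y :* i)) := (:1 :- y) :+ :2 :* y :* ((:1 :- y) :* i)) R.refl y (inv y) ⟩
    (𝟙 ⊝ y) ⊕ const (ℤ.+ 2) ⊗ y ⊗ ((𝟙 ⊝ y) ⊗ inv y) ≈⟨ R.+-congˡ (R.*-congˡ (inv-* (Q^-Ord1 c))) ⟩
    (𝟙 ⊝ y) ⊕ const (ℤ.+ 2) ⊗ y ⊗ 𝟙 ≈⟨ solve 1 (λ y → (:1 :- y) :+ :2 :* y :* :1 := :1 :+ y) R.refl y ⟩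
    𝟙 ⊕ y ∎
    where
    y = Q ^ suc c

  -- Certificate: (1 − Q^c)(g r i − Q^(2r+3) g (r+1) (i−1)) = (1 + Q^c)(d r i − d r (i−1)) with c = r + 1.
  d : ℕ → ℕ → PS
  d r L = EQ (suc L + r) ⊗ EQ (suc L + r) ⊗ (IQ L ⊗ IQ (suc L + suc (dbl r)))

  G : ℕ → ℕ → PS
  G r = ∑ (g r)

  Q^idx : ∀ r i → Q ^ (i + suc (suc (dbl r))) ≈ Q ^ suc r ⊗ Q ^ suc r ⊗ Q ^ i
  Q^idx r i = R.trans (^-+ Q i (dbl (suc r))) (R.trans (R.*-comm _ _) (R.*-congʳ (Q^dbl (suc r))))

  IQ-rec′ : ∀ r i → (𝟙 ⊝ Q ^ suc r ⊗ Q ^ suc r ⊗ Q ^ i) ⊗ IQ (suc i + suc (dbl r)) ≈ IQ (i + suc (dbl r))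
  IQ-rec′ r i = R.trans (R.*-congʳ (R.+-congˡ (R.-‿cong (R.trans (R.sym (Q^idx r i)) (R.reflexive (cong (Q ^_) (ℕP.+-suc i (suc (dbl r))))))))) (IQ-rec (i + suc (dbl r)))

  -- The certificate summed over `i`. As `d r L` tends to 1, the limits of the row sums are related
  -- by `G r = w (r + 1) + Q^(2r+3) G (r + 1)`.
  telescope : ∀ r L → (𝟙 ⊝ Q ^ suc r) ⊗ (G r (suc L) ⊝ Q ^ suc (dbl (suc r)) ⊗ G (suc r) L) ≈ (𝟙 ⊕ Q ^ suc r) ⊗ d r L
  telescope r zero = begin
    (𝟙 ⊝ y) ⊗ (𝟘 ⊕ 𝟙 ⊗ (E ⊗ E) ⊗ (𝟙 ⊗ IQ (suc (dbl r))) ⊝ v ⊗ 𝟘)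
      ≈⟨ R.*-congˡ (R.+-congʳ (R.+-congˡ (R.*-congˡ (R.*-congˡ (IQ-rec′ r 0))))) ⟨
    (𝟙 ⊝ y) ⊗ (𝟘 ⊕ 𝟙 ⊗ (E ⊗ E) ⊗ (𝟙 ⊗ ((𝟙 ⊝ y ⊗ y ⊗ 𝟙) ⊗ j)) ⊝ v ⊗ 𝟘)
      ≈⟨ solve 4 (λ y E j v → (:1 :- y) :* (:0 :+ :1 :* (E :* E) :* (:1 :* ((:1 :- y :* y :* :1) :* j)) :- v :* :0)
           := (:1 :+ y) :* ((:1 :- y) :* E :* ((:1 :- y) :* E) :* (:1 :* j))) R.refl y E j v ⟩
    (𝟙 ⊕ y) ⊗ d r 0 ∎
    where
    y = Q ^ suc r
    v = Q ^ suc (dbl (suc r))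
    E = EQ r
    j = IQ (suc (suc (dbl r)))
  telescope r (suc L) = begin
    (𝟙 ⊝ y) ⊗ (G r (suc L) ⊕ g r i ⊝ v ⊗ (G (suc r) L ⊕ g (suc r) L))
      ≈⟨ solve 6 (λ y G v g G′ g′ → (:1 :- y) :* (G :+ g :- v :* (G′ :+ g′)) := (:1 :- y) :* (G :- v :* G′) :+ (:1 :- y) :* (g :- v :* g′)) R.refl
           y (G r (suc L)) v (g r i) (G (suc r) L) (g (suc r) L) ⟩
    (𝟙 ⊝ y) ⊗ (G r (suc L) ⊝ v ⊗ G (suc r) L) ⊕ (𝟙 ⊝ y) ⊗ (g r i ⊝ v ⊗ g (suc r) L)
      ≈⟨ R.+-cong (telescope r L) (R.*-congˡ (R.+-cong gi (R.-‿cong gL))) ⟩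
    (𝟙 ⊕ y) ⊗ d r L ⊕ (𝟙 ⊝ y) ⊗ (Q ⊗ z ⊗ (E ⊗ E) ⊗ (I ⊗ ((𝟙 ⊝ y ⊗ y ⊗ (Q ⊗ z)) ⊗ j)) ⊝ Q ⊗ (y ⊗ y) ⊗ (z ⊗ (E ⊗ E) ⊗ ((𝟙 ⊝ Q ⊗ z) ⊗ I ⊗ j)))
      ≈⟨ R.+-congʳ (R.*-congˡ dL) ⟩
    (𝟙 ⊕ y) ⊗ (E ⊗ E ⊗ ((𝟙 ⊝ Q ⊗ z) ⊗ I ⊗ ((𝟙 ⊝ y ⊗ y ⊗ (Q ⊗ z)) ⊗ j))) ⊕ (𝟙 ⊝ y) ⊗ (Q ⊗ z ⊗ (E ⊗ E) ⊗ (I ⊗ ((𝟙 ⊝ y ⊗ y ⊗ (Q ⊗ z)) ⊗ j)) ⊝ Q ⊗ (y ⊗ y) ⊗ (z ⊗ (E ⊗ E) ⊗ ((𝟙 ⊝ Q ⊗ z) ⊗ I ⊗ j)))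
      ≈⟨ solve 6 (λ y Q z E I j →
          (:1 :+ y) :* (E :* E :* ((:1 :- Q :* z) :* I :* ((:1 :- y :* y :* (Q :* z)) :* j))) :+ (:1 :- y) :* (Q :* z :* (E :* E) :* (I :* ((:1 :- y :* y :* (Q :* z)) :* j)) :- Q :* (y :* y) :* (z :* (E :* E) :* ((:1 :- Q :* z) :* I :* j)))
          := (:1 :+ y) :* ((:1 :- Q :* z :* y) :* E :* ((:1 :- Q :* z :* y) :* E) :* (I :* j))) R.refl y Q z E I j ⟩
    (𝟙 ⊕ y) ⊗ ((𝟙 ⊝ Q ⊗ z ⊗ y) ⊗ E ⊗ ((𝟙 ⊝ Q ⊗ z ⊗ y) ⊗ E) ⊗ (I ⊗ j))
      ≈⟨ R.*-congˡ (R.*-congʳ (R.*-cong (R.*-congʳ zy) (R.*-congʳ zy))) ⟩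
    (𝟙 ⊕ y) ⊗ d r i ∎
    where
    i = suc L
    y = Q ^ suc r
    z = Q ^ L
    v = Q ^ suc (dbl (suc r))
    E = EQ (i + r)
    I = IQ i
    j = IQ (suc i + suc (dbl r))
    gi : g r i ≈ Q ⊗ z ⊗ (E ⊗ E) ⊗ (I ⊗ ((𝟙 ⊝ y ⊗ y ⊗ (Q ⊗ z)) ⊗ j))
    gi = R.*-congˡ (R.*-congˡ (R.sym (IQ-rec′ r i)))
    gL : v ⊗ g (suc r) L ≈ Q ⊗ (y ⊗ y) ⊗ (z ⊗ (E ⊗ E) ⊗ ((𝟙 ⊝ Q ⊗ z) ⊗ I ⊗ j))
    gL = R.*-cong (R.*-congˡ (Q^dbl (suc r))) (R.*-cong (R.*-congˡ (R.*-cong eE eE))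
           (R.*-cong (R.sym (IQ-rec L)) (R.reflexive (cong IQ (≡.trans (ℕP.+-suc L _) (cong suc (ℕP.+-suc L _)))))))
      where
      eE : EQ (L + suc r) ≈ E
      eE = R.reflexive (cong EQ (ℕP.+-suc L r))
    dL : d r L ≈ E ⊗ E ⊗ ((𝟙 ⊝ Q ⊗ z) ⊗ I ⊗ ((𝟙 ⊝ y ⊗ y ⊗ (Q ⊗ z)) ⊗ j))
    dL = R.*-congˡ (R.*-cong (R.sym (IQ-rec L)) (R.sym (IQ-rec′ r i)))
    zy : 𝟙 ⊝ Q ⊗ z ⊗ y ≈ 𝟙 ⊝ Q ^ (suc i + r)
    zy = R.+-congˡ (R.-‿cong (R.trans (R.sym (^-+ Q i (suc r))) (R.reflexive (cong (Q ^_) (ℕP.+-suc i r)))))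

  EQ-IQ-Ord₁ : ∀ L k → Ord (suc L) (EQ (k + L) ⊗ IQ L ⊝ 𝟙)
  EQ-IQ-Ord₁ L zero    = Ord-≈ (R.trans (solve 1 (λ x → :0 := x :- x) R.refl 𝟙) (R.+-congʳ (R.sym (EQ-IQ L)))) (ord λ n _ → 𝟘-const n)
  EQ-IQ-Ord₁ L (suc k) = Ord-≈ (solve 3 (λ x e i → e :* i :- :1 :- x :* (e :* i) := (:1 :- x) :* e :* i :- :1) R.refl (Q ^ suc (k + L)) (EQ (k + L)) (IQ L))
    (Ord-⊕ (EQ-IQ-Ord₁ L k) (Ord-⊖ (Ord-⊗ˡ _ (Ord-≤ (s≤s (ℕP.m≤n+m L k)) (Q^-Ord (k + L))))))

  EQ-IQ-Ord₂ : ∀ L k → Ord (suc L) (EQ L ⊗ IQ (k + L) ⊝ 𝟙)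
  EQ-IQ-Ord₂ L zero    = EQ-IQ-Ord₁ L 0
  EQ-IQ-Ord₂ L (suc k) = Ord-≈ (begin
    EQ L ⊗ IQ (k + L) ⊝ 𝟙 ⊕ x ⊗ (EQ L ⊗ IQ (suc k + L))
      ≈⟨ R.+-congʳ (R.+-congʳ (R.*-congˡ (IQ-rec (k + L)))) ⟨
    EQ L ⊗ ((𝟙 ⊝ x) ⊗ IQ (suc k + L)) ⊝ 𝟙 ⊕ x ⊗ (EQ L ⊗ IQ (suc k + L))
      ≈⟨ solve 3 (λ x e i → e :* ((:1 :- x) :* i) :- :1 :+ x :* (e :* i) := e :* i :- :1) R.refl x (EQ L) (IQ (suc k + L)) ⟩
    _ ∎) (Ord-⊕ (EQ-IQ-Ord₂ L k) (Ord-⊗ˡ _ (Ord-≤ (s≤s (ℕP.m≤n+m L k)) (Q^-Ord (k + L)))))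
    where
    x = Q ^ suc (k + L)

  d-Ord : ∀ r L → Ord (suc L) (d r L ⊝ 𝟙)
  d-Ord r L = Ord-≈ (begin
    (E ⊗ IQ L ⊝ 𝟙) ⊗ (E ⊗ J) ⊕ (E ⊗ J ⊝ 𝟙)
      ≈⟨ solve 3 (λ e i j → (e :* i :- :1) :* (e :* j) :+ (e :* j :- :1) := e :* e :* (i :* j) :- :1) R.refl E (IQ L) J ⟩
    d r L ⊝ 𝟙 ∎) (Ord-⊕ (Ord-⊗ˡ _ o1) o2)
    where
    E = EQ (suc L + r)
    J = IQ (suc L + suc (dbl r))
    o1 : Ord (suc L) (E ⊗ IQ L ⊝ 𝟙)
    o1 = Ord-≈ (R.+-congʳ (R.*-congʳ (R.reflexive (cong EQ (cong suc (ℕP.+-comm r L)))))) (EQ-IQ-Ord₁ L (suc r))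
    idx : ∀ r L → suc r + (suc L + r) ≡ suc L + suc (r + r)
    idx = solve-∀
    o2 : Ord (suc L) (E ⊗ J ⊝ 𝟙)
    o2 = Ord-≤ (ℕP.m≤n⇒m≤1+n (ℕP.m≤m+n (suc L) r)) (Ord-≈ (R.+-congʳ (R.*-congˡ (R.reflexive (cong IQ (≡.trans (idx r L) (cong (λ k → suc L + suc k) (≡.sym (dbl≡ r)))))))) (EQ-IQ-Ord₂ (suc L + r) (suc r)))

  -- Iterating the limit of `telescope` yields the row sum free of q-factorials.
  E : ℕ → ℕ → PS
  E r zero    = 𝟘
  E r (suc J) = w (suc r) ⊕ Q ^ suc (dbl (suc r)) ⊗ E (suc r) J

  G-E : ∀ r L J → L ℕ.≤ J → Ord L (G r L ⊝ E r J)
  G-E r zero    J       _       = Ord-0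
  G-E r (suc L) (suc J) (s≤s p) = Ord-≈ (begin
    inv y ⊗ ((𝟙 ⊕ y) ⊗ (d r L ⊝ 𝟙)) ⊕ v ⊗ (G (suc r) L ⊝ E (suc r) J)
      ≈⟨ R.+-congʳ (R.*-congˡ (begin
           (𝟙 ⊕ y) ⊗ (d r L ⊝ 𝟙) ≈⟨ solve 2 (λ y d → (:1 :+ y) :* (d :- :1) := (:1 :+ y) :* d :- (:1 :+ y)) R.refl y (d r L) ⟩
           (𝟙 ⊕ y) ⊗ d r L ⊝ (𝟙 ⊕ y) ≈⟨ R.+-cong (telescope r L) (R.-‿cong (w-* r)) ⟨
           (𝟙 ⊝ y) ⊗ (G r (suc L) ⊝ v ⊗ G (suc r) L) ⊝ (𝟙 ⊝ y) ⊗ w (suc r) ≈⟨ solve 3 (λ y a b → y :* a :- y :* b := y :* (a :- b)) R.refl (𝟙 ⊝ y) _ (w (suc r)) ⟩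
           (𝟙 ⊝ y) ⊗ (G r (suc L) ⊝ v ⊗ G (suc r) L ⊝ w (suc r)) ∎)) ⟩
    inv y ⊗ ((𝟙 ⊝ y) ⊗ (G r (suc L) ⊝ v ⊗ G (suc r) L ⊝ w (suc r))) ⊕ v ⊗ (G (suc r) L ⊝ E (suc r) J)
      ≈⟨ R.+-congʳ (R.trans (solve 3 (λ i y a → i :* (y :* a) := y :* i :* a) R.refl (inv y) (𝟙 ⊝ y) _) (R.trans (R.*-congʳ (inv-* (Q^-Ord1 r))) (R.*-identityˡ _))) ⟩
    (G r (suc L) ⊝ v ⊗ G (suc r) L ⊝ w (suc r)) ⊕ v ⊗ (G (suc r) L ⊝ E (suc r) J)
      ≈⟨ solve 5 (λ G v G′ w E → G :- v :* G′ :- w :+ v :* (G′ :- E) := G :- (w :+ v :* E)) R.refl (G r (suc L)) v (G (suc r) L) (w (suc r)) (E (suc r) J) ⟩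
    G r (suc L) ⊝ E r (suc J) ∎)
    (Ord-⊕ (Ord-⊗ʳ (inv y) (Ord-⊗ʳ (𝟙 ⊕ y) (d-Ord r L))) (Ord-⊗ (Q^-Ord1 (dbl (suc r))) (G-E (suc r) L J p)))
    where
    y = Q ^ suc r
    v = Q ^ suc (dbl (suc r))

  S-double : ∀ K → Ord (suc K) (b ⊗ S b 𝟙 K ⊝ ∑′ (λ r → W r ⊗ E r K) K)
  S-double K = Ord-≈ (R.+-congʳ (R.sym (begin
    b ⊗ S b 𝟙 K ≈⟨ ∑-⊗ b (t b 𝟙) K ⟨
    ∑ (λ n → b ⊗ t b 𝟙 n) K ≈⟨ ∑-cong K (λ n → R.trans (t≈h n) (h≈ad n)) ⟩
    ∑ (ad (λ r i → W r ⊗ g r i)) K ∎)))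
    (∑-ad 1 K K _ _ ℕP.≤-refl λ r L le → Ord-≈ (begin
      W r ⊗ (G r L ⊝ E r K) ≈⟨ solve 3 (λ w g e → w :* (g :- e) := w :* g :- w :* e) R.refl (W r) (G r L) (E r K) ⟩
      W r ⊗ G r L ⊝ W r ⊗ E r K ≈⟨ R.+-congʳ (∑-⊗ (W r) (g r) L) ⟨
      ∑ (λ i → W r ⊗ g r i) L ⊝ W r ⊗ E r K ∎) (Ord-⊗ (W-Ord r) (G-E r L K le)))
    where
    le1 : ∀ r → suc r ℕ.≤ 3 * r + 2
    le1 r = ℕP.≤-trans (ℕP.≤-reflexive (ℕP.+-comm 1 r)) (ℕP.+-mono-≤ (ℕP.m≤m+n r _) (s≤s z≤n))
    W-Ord : ∀ r → Ord (suc r) (W r)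
    W-Ord r = Ord-⊕ (Ord-≤ (le1 r) (Ord-^ b-Ord (3 * r + 2))) (Ord-≤ (ℕP.≤-reflexive (ℕP.+-comm 1 r)) (Ord-^ b-Ord (r + 1)))

-- Counting finite sets exactly and modulo 2 by maps.

module Enumeration where

  open import Data.Bool using (Bool; false; not; _xor_)
  import Data.Bool.Properties as 𝔹P
  open import Data.Nat using (ℕ; zero; suc; _+_; _≤_; _<_)
  import Data.Nat.Properties as ℕP
  open import Data.Fin using (Fin; zero; suc)
  import Data.Fin.Properties as FinP
  open import Data.List using (List; []; _∷_; length; filter; lookup; upTo; cartesianProduct)
  open import Data.List.Relation.Unary.Any using (index; here; there)
  open import Data.List.Relation.Unary.Any.Properties using (lookup-index)
  open import Data.List.Membership.Propositional using (_∈_)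
  open import Data.List.Membership.Propositional.Properties
  open import Data.List.Relation.Unary.Unique.Propositional using (Unique)
  import Data.List.Relation.Unary.Unique.Propositional.Properties as UP
  open import Data.List.Relation.Unary.AllPairs using ([]; _∷_)
  import Data.List.Relation.Unary.All as All
  open import Data.Product using (_×_; _,_; proj₁; proj₂; ∃-syntax)
  open import Data.Empty using (⊥-elim)
  open import Relation.Nullary using (¬_; yes; no; contradiction; ¬?)
  open import Relation.Unary using (Decidable)
  open import Relation.Binary.Definitions using (DecidableEquality)
  open import Relation.Binary.PropositionalEquality

  par : ℕ → Bool
  par zero    = false
  par (suc n) = not (par n)

  par-+ : ∀ m n → par (m + n) ≡ par m xor par n
  par-+ zero    n = refl
  par-+ (suc m) n = trans (cong not (par-+ m n)) (𝔹P.not-distribˡ-xor (par m) (par n))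

  -- The list is auxiliary: without repetitions and complete, it has a length depending only on the
  -- predicate, so cardinalities are compared by maps alone.
  record Enum {A : Set} (P : A → Set) : Set where
    field
      elems    : List A
      unique   : Unique elems
      sound    : ∀ {x} → x ∈ elems → P x
      complete : ∀ {x} → P x → x ∈ elems
  open Enum public

  private variable
    A B : Set
    P R : A → Set

  # : {P : A → Set} → Enum P → ℕ
  # E = length (elems E)

  ♯ : {P : A → Set} → Enum P → Bool
  ♯ E = par (# E)

  lookup-injective : {A : Set} {xs : List A} → Unique xs → ∀ i j → lookup xs i ≡ lookup xs j → i ≡ j
  lookup-injective (_ ∷ u) zero    zero    e = refl
  lookup-injective (a ∷ u) zero    (suc j) e = contradiction e (All.lookup a (∈-lookup j))
  lookup-injective (a ∷ u) (suc i) zero    e = contradiction (sym e) (All.lookup a (∈-lookup i))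
  lookup-injective (_ ∷ u) (suc i) (suc j) e = cong suc (lookup-injective u i j e)

  module _ {A B : Set} {P : A → Set} {R : B → Set} (E : Enum P) (F : Enum R) where

    #-≤ : (f : ∀ {x} → P x → B) → (∀ {x} (p : P x) → R (f p)) → (∀ {x y} (p : P x) (p′ : P y) → f p ≡ f p′ → x ≡ y) → # E ≤ # F
    #-≤ f f-R f-inj = FinP.injective⇒≤ {f = g} g-inj
      where
      at : Fin (# E) → A
      at = lookup (elems E)
      P-at : ∀ i → P (at i)
      P-at i = sound E (∈-lookup i)
      mem : ∀ i → f (P-at i) ∈ elems F
      mem i = complete F (f-R (P-at i))
      g : Fin (# E) → Fin (# F)
      g i = index (mem i)
      g-inj : ∀ {i j} → g i ≡ g j → i ≡ j
      g-inj {i} {j} e = lookup-injective (unique E) i j (f-inj (P-at i) (P-at j)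
        (trans (lookup-index (mem i)) (trans (cong (lookup (elems F)) e) (sym (lookup-index (mem j))))))

  module _ {A B : Set} {P : A → Set} {R : B → Set} (E : Enum P) (F : Enum R) where

    #-bij : (f : A → B) (g : B → A) → (∀ {x} → P x → R (f x)) → (∀ {y} → R y → P (g y)) →
      (∀ {x} → P x → g (f x) ≡ x) → (∀ {y} → R y → f (g y) ≡ y) → # E ≡ # F
    #-bij f g f-P g-R gf fg = ℕP.≤-antisym
      (#-≤ E F (λ {x} _ → f x) f-P (λ p p′ e → trans (sym (gf p)) (trans (cong g e) (gf p′))))
      (#-≤ F E (λ {y} _ → g y) g-R (λ r r′ e → trans (sym (fg r)) (trans (cong f e) (fg r′))))

    #-onto : (f : A → B) → (∀ {x} → P x → R (f x)) → (∀ {x y} → P x → P y → f x ≡ f y → x ≡ y) →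
      (∀ {y} → R y → ∃[ x ] P x × f x ≡ y) → # E ≡ # F
    #-onto f f-R f-inj onto = ℕP.≤-antisym (#-≤ E F (λ {x} _ → f x) f-R f-inj)
      (#-≤ F E (λ r → proj₁ (onto r)) (λ r → proj₁ (proj₂ (onto r)))
        (λ r r′ e → trans (sym (proj₂ (proj₂ (onto r)))) (trans (cong f e) (proj₂ (proj₂ (onto r′))))))

    ♯-bij : (f : A → B) (g : B → A) → (∀ {x} → P x → R (f x)) → (∀ {y} → R y → P (g y)) →
      (∀ {x} → P x → g (f x) ≡ x) → (∀ {y} → R y → f (g y) ≡ y) → ♯ E ≡ ♯ F
    ♯-bij f g f-P g-R gf fg = cong par (#-bij f g f-P g-R gf fg)

  #-ext : {P R : A → Set} (E : Enum P) (F : Enum R) → (∀ {x} → P x → R x) → (∀ {x} → R x → P x) → # E ≡ # F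
  #-ext E F f g = #-bij E F (λ x → x) (λ x → x) f g (λ _ → refl) (λ _ → refl)

  #-empty : {P : A → Set} (E : Enum P) → (∀ {x} → ¬ P x) → # E ≡ 0
  #-empty E p with elems E | sound E
  ... | []    | _ = refl
  ... | x ∷ _ | s = ⊥-elim (p (s (here refl)))

  infixl 6 _∩_
  _∩_ : Enum P → Decidable R → Enum (λ x → P x × R x)
  E ∩ R? = record
    { elems    = filter R? (elems E)
    ; unique   = UP.filter⁺ R? (unique E)
    ; sound    = λ i → sound E (proj₁ (∈-filter⁻ R? i)) , proj₂ (∈-filter⁻ R? {xs = elems E} i)
    ; complete = λ (p , r) → ∈-filter⁺ R? (complete E p) r }

  ∁ : {R : A → Set} → Decidable R → Decidable (λ x → ¬ R x)
  ∁ R? x = ¬? (R? x)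

  length-filter-∁ : {R : A → Set} (R? : Decidable R) (xs : List A) →
    length xs ≡ length (filter R? xs) + length (filter (∁ R?) xs)
  length-filter-∁ R? [] = refl
  length-filter-∁ R? (x ∷ xs) with R? x
  ... | yes _ = cong suc (length-filter-∁ R? xs)
  ... | no  _ = trans (cong suc (length-filter-∁ R? xs)) (sym (ℕP.+-suc _ _))

  #-split : {P R : A → Set} (E : Enum P) (R? : Decidable R) → # E ≡ # (E ∩ R?) + # (E ∩ ∁ R?)
  #-split E R? = length-filter-∁ R? (elems E)

  ♯-split : {P R : A → Set} (E : Enum P) (R? : Decidable R) → ♯ E ≡ ♯ (E ∩ R?) xor ♯ (E ∩ ∁ R?)
  ♯-split E R? = trans (cong par (#-split E R?)) (par-+ (# (E ∩ R?)) _)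

  -- A fixed-point-free involution swaps the elements listed before their image with those listed after it.
  module _ {A : Set} (_≟_ : DecidableEquality A) where

    position : List A → A → ℕ
    position []       x = 0
    position (y ∷ ys) x with y ≟ x
    ... | yes _ = 0
    ... | no _  = suc (position ys x)

    position-injective : ∀ xs {x y} → x ∈ xs → y ∈ xs → position xs x ≡ position xs y → x ≡ y
    position-injective (z ∷ zs) {x} {y} i j e with z ≟ x | z ≟ y
    ... | yes refl | yes refl = refl
    ... | no ¬p    | no ¬q    = position-injective zs (strip ¬p i) (strip ¬q j) (ℕP.suc-injective e)
      where
      strip : ∀ {x} → z ≢ x → x ∈ z ∷ zs → x ∈ zs
      strip n (here refl) = contradiction refl n
      strip n (there i)   = i

    module _ {P : A → Set} (E : Enum P) (f : A → A) (f-P : ∀ {x} → P x → P (f x)) (ff : ∀ {x} → P x → f (f x) ≡ x) where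

      ♯-free : (∀ {x} → P x → f x ≢ x) → ♯ E ≡ false
      ♯-free free = trans (♯-split E before?) (trans
        (cong (_xor ♯ (E ∩ ∁ before?)) (♯-bij (E ∩ before?) (E ∩ ∁ before?) f f to from (λ p → ff (proj₁ p)) (λ p → ff (proj₁ p))))
        (𝔹P.xor-same (♯ (E ∩ ∁ before?))))
        where
        pos : A → ℕ
        pos = position (elems E)
        Before : A → Set
        Before x = pos x < pos (f x)
        before? : Decidable Before
        before? x = pos x ℕP.<? pos (f x)
        to : ∀ {x} → P x × Before x → P (f x) × ¬ Before (f x)
        to {x} (p , lt) = f-P p , λ lt′ → ℕP.<-asym lt (subst (λ y → pos (f x) < pos y) (ff p) lt′)
        from : ∀ {x} → P x × ¬ Before x → P (f x) × Before (f x)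
        from {x} (p , nlt) = f-P p , subst (λ y → pos (f x) < pos y) (sym (ff p))
          (ℕP.≤∧≢⇒< (ℕP.≮⇒≥ nlt) (λ e → free p (position-injective (elems E) (complete E (f-P p)) (complete E p) e)))

    module _ {P R : A → Set} (E : Enum P) (F : Enum R) (f : A → A) (f-P : ∀ {x} → P x → P (f x)) (ff : ∀ {x} → P x → f (f x) ≡ x) where

      -- Off its fixed points the involution is free, so modulo 2 only these count.
      ♯-fixed : (∀ {x} → P x → f x ≡ x → R x) → (∀ {x} → R x → P x × f x ≡ x) → ♯ E ≡ ♯ F
      ♯-fixed to from = trans (♯-split E fix?) (trans (cong₂ _xor_
        (cong par (#-ext (E ∩ fix?) F (λ (p , e) → to p e) from))
        (♯-free (E ∩ ∁ fix?) f (λ (p , n) → f-P p , λ e → n (trans (sym e) (ff p)))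
          (λ (p , _) → ff p) (λ (_ , n) → n)))
        (𝔹P.xor-identityʳ _))
        where
        fix? : Decidable (λ x → f x ≡ x)
        fix? x = f x ≟ x

  bounded : (n : ℕ) → Enum (_< n)
  bounded n = record { elems = upTo n ; unique = UP.upTo⁺ n ; sound = ∈-upTo⁻ ; complete = ∈-upTo⁺ }

  infixr 5 _⊠_
  _⊠_ : {P : A → Set} {R : B → Set} → Enum P → Enum R → Enum (λ ((x , y) : A × B) → P x × R y)
  E ⊠ F = record
    { elems    = cartesianProduct (elems E) (elems F)
    ; unique   = UP.cartesianProduct⁺ (unique E) (unique F)
    ; sound    = λ i → let (a , b) = ∈-cartesianProduct⁻ (elems E) (elems F) i in sound E a , sound F b
    ; complete = λ (p , r) → ∈-cartesianProduct⁺ (complete E p) (complete F r) }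

  retype : {P R : A → Set} (E : Enum P) → (∀ {x} → P x → R x) → (∀ {x} → R x → P x) → Enum R
  retype E f g = record
    { elems = elems E ; unique = unique E ; sound = λ i → f (sound E i) ; complete = λ r → complete E (g r) }

-- From N_A(N) to the counts C₁ and C₂.

module Coefficients where

  open import Defs
  open PowerSeries
  open PowerSeriesOrder
  open FunctionalEquation
  open DoubleSum
  open Enumeration
  open import Data.Bool using (Bool; true; false)
  open import Data.Unit using (⊤; tt)
  open import Data.Nat as ℕ using (ℕ; zero; suc; _+_; _*_; _≟_; _<_)
  import Data.Nat.Properties as ℕP
  import Data.Nat.Divisibility as ℕD
  open import Data.Nat.Tactic.RingSolver using (solve-∀)
  open import Data.Nat.ListAction using (sum)
  open import Data.Integer as ℤ using (ℤ; +_)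
  import Data.Integer.Properties as ℤP
  import Data.Integer.Tactic.RingSolver as ℤS
  import Data.Integer.Divisibility.Signed as ℤD
  open import Data.List using (List; []; _∷_; length; filter; upTo; applyUpTo; map; cartesianProduct; _++_)
  open import Data.List.Properties using (filter-accept; filter-reject)
  open import Data.List.Relation.Unary.Any using (here; there)
  open import Data.List.Relation.Unary.AllPairs using ([]; _∷_)
  open import Data.List.Relation.Unary.All using ([]; _∷_)
  open import Data.Product using (_×_; _,_; uncurry)
  open import Relation.Nullary using (yes; no; contradiction)
  open import Relation.Unary using (Decidable)
  open import Relation.Binary.PropositionalEquality as ≡ using (_≡_; _≢_; refl; cong; cong₂; sym; trans)
  open import Function using (_∘_; id)
  open PSSolver using (solve; _:=_; _:+_; _:*_; :-_; _:-_)
  open ≈R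

  ∑L : {A : Set} → List A → (A → PS) → PS
  ∑L []       f = 𝟘
  ∑L (x ∷ xs) f = f x ⊕ ∑L xs f

  module _ {A : Set} where
    ∑L-cong : ∀ {f g : A → PS} xs → (∀ x → f x ≈ g x) → ∑L xs f ≈ ∑L xs g
    ∑L-cong []       p = R.refl
    ∑L-cong (x ∷ xs) p = R.+-cong (p x) (∑L-cong xs p)

    ∑L-⊕ : ∀ (f g : A → PS) xs → ∑L xs (λ x → f x ⊕ g x) ≈ ∑L xs f ⊕ ∑L xs g
    ∑L-⊕ f g []       = R.sym (R.+-identityˡ 𝟘)
    ∑L-⊕ f g (x ∷ xs) = R.trans (R.+-congˡ (∑L-⊕ f g xs))
      (solve 4 (λ a b c d → a :+ b :+ (c :+ d) := a :+ c :+ (b :+ d)) R.refl (f x) (g x) (∑L xs f) (∑L xs g))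

    ∑L-⊗ : ∀ c (f : A → PS) xs → ∑L xs (λ x → c ⊗ f x) ≈ c ⊗ ∑L xs f
    ∑L-⊗ c f []       = R.sym (R.zeroʳ c)
    ∑L-⊗ c f (x ∷ xs) = R.trans (R.+-congˡ (∑L-⊗ c f xs)) (R.sym (R.distribˡ c _ _))

    ∑L-Ord : ∀ {k} {f g : A → PS} xs → (∀ x → Ord k (f x ⊝ g x)) → Ord k (∑L xs f ⊝ ∑L xs g)
    ∑L-Ord []       p = Ord-≈ (solve 1 (λ z → :0 := z :- z) R.refl 𝟘) (ord λ n _ → 𝟘-const n)
    ∑L-Ord {f = f} {g} (x ∷ xs) p = Ord-≈
      (solve 4 (λ a b c d → a :- c :+ (b :- d) := a :+ b :- (c :+ d)) R.refl (f x) (∑L xs f) (g x) (∑L xs g))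
      (Ord-⊕ (p x) (∑L-Ord xs p))

  ∑L-++ : {A : Set} (f : A → PS) (xs ys : List A) → ∑L (xs ++ ys) f ≈ ∑L xs f ⊕ ∑L ys f
  ∑L-++ f []       ys = R.sym (R.+-identityˡ _)
  ∑L-++ f (x ∷ xs) ys = R.trans (R.+-congˡ (∑L-++ f xs ys)) (R.sym (R.+-assoc _ _ _))

  ∑L-map : {A B : Set} (f : B → PS) (g : A → B) (xs : List A) → ∑L (map g xs) f ≈ ∑L xs (f ∘ g)
  ∑L-map f g []       = R.refl
  ∑L-map f g (x ∷ xs) = R.+-congˡ (∑L-map f g xs)

  ∑L-× : {A B : Set} (f : A → B → PS) (xs : List A) (ys : List B) →
    ∑L xs (λ x → ∑L ys (f x)) ≈ ∑L (cartesianProduct xs ys) (uncurry f)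
  ∑L-× f []       ys = R.refl
  ∑L-× f (x ∷ xs) ys = R.sym (R.trans (∑L-++ (uncurry f) (map (x ,_) ys) _)
    (R.+-cong (∑L-map (uncurry f) (x ,_) ys) (R.sym (∑L-× f xs ys))))

  ∑′-list : ∀ f (g : ℕ → ℕ) n → ∑′ (f ∘ g) n ≈ ∑L (applyUpTo g n) f
  ∑′-list f g zero    = R.refl
  ∑′-list f g (suc n) = R.+-congˡ (∑′-list f (g ∘ suc) n)

  ∑′-upTo : ∀ f n → ∑′ f n ≈ ∑L (upTo n) f
  ∑′-upTo f n = ∑′-list f (λ i → i) n

  ∑-∑′ : ∀ f n → ∑ f n ≈ ∑′ f n
  ∑-∑′ f zero    = R.refl
  ∑-∑′ f (suc n) = R.trans (∑-head f n) (R.+-congˡ (∑-∑′ (f ∘ suc) n))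

  σ : ℕ → ℤ
  σ zero    = + 1
  σ (suc n) = ℤ.- σ n

  b⊗-suc : ∀ f n → (b ⊗ f) (suc n) ≡ ℤ.- f n
  b⊗-suc f n = trans (at (solve 2 (λ q f → (:- q) :* f := :- (q :* f)) R.refl q f) (suc n)) (trans (⊖-at (q ⊗ f) (suc n)) (cong ℤ.-_ (q⊗-suc f n)))

  b⊗-zero : ∀ f → (b ⊗ f) 0 ≡ + 0
  b⊗-zero f = trans (at (solve 2 (λ q f → (:- q) :* f := :- (q :* f)) R.refl q f) 0) (trans (⊖-at (q ⊗ f) 0) (cong ℤ.-_ (q⊗-zero f)))

  b^-same : ∀ n → (b ^ n) n ≡ σ n
  b^-same zero    = const-at0 (+ 1)
  b^-same (suc n) = trans (b⊗-suc (b ^ n) n) (cong ℤ.-_ (b^-same n))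

  b^-other : ∀ e n → e ≢ n → (b ^ e) n ≡ + 0
  b^-other zero    zero    p = contradiction refl p
  b^-other zero    (suc n) p = const-atsuc (+ 1) n
  b^-other (suc e) zero    p = b⊗-zero (b ^ e)
  b^-other (suc e) (suc n) p = trans (b⊗-suc (b ^ e) n) (cong ℤ.-_ (b^-other e n (p ∘ cong suc)))

  -- All powers of `b = − q` that reach `q^N` do so with the same sign `(−1)^N`, which is `σ N`;
  -- nothing cancels and counting exponents suffices.
  coefficient : {A : Set} (φ : A → ℕ) (N : ℕ) (xs : List A) →
    ∑L xs (λ x → b ^ φ x) N ≡ σ N ℤ.* + length (filter (λ x → φ x ≟ N) xs)
  coefficient φ N []       = trans (𝟘-const N) (sym (ℤP.*-zeroʳ (σ N)))
  coefficient φ N (x ∷ xs) = trans (⊕-at (b ^ φ x) (∑L xs (λ x → b ^ φ x)) N) (trans (cong (λ z → (b ^ φ x) N ℤ.+ z) (coefficient φ N xs)) step)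
    where
    P? : Decidable (λ x → φ x ≡ N)
    P? x = φ x ≟ N
    step : (b ^ φ x) N ℤ.+ σ N ℤ.* + length (filter P? xs) ≡ σ N ℤ.* + length (filter P? (x ∷ xs))
    step with φ x ≟ N
    ... | yes p = trans (cong (ℤ._+ _) (trans (cong (λ e → (b ^ e) N) p) (trans (b^-same N) (sym (ℤP.*-identityʳ (σ N))))))
      (trans (sym (ℤP.*-distribˡ-+ (σ N) (+ 1) _)) (cong (λ l → σ N ℤ.* + length l) (sym (filter-accept P? p))))
    ... | no p  = trans (cong (ℤ._+ _) (b^-other (φ x) N p)) (trans (ℤP.+-identityˡ _) (cong (λ l → σ N ℤ.* + length l) (sym (filter-reject P? p))))

  -- The Boolean selects one of the two summands of `W r`.
  base : Bool → ℕ → ℕ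
  base true  r = 3 * r + 2
  base false r = r + 1

  bools : List Bool
  bools = true ∷ false ∷ []

  W-list : ∀ r → W r ≈ ∑L bools (λ α → b ^ base α r)
  W-list r = R.+-congˡ (R.sym (R.+-identityʳ _))

  -- The sum of the exponents `2 (r + i) + 3`, `i < j`, collected while `E` is unrolled `j` times.
  ε : ℕ → ℕ → ℕ
  ε r j = j * j + 2 * (j * suc r)

  E-closed : ∀ r J → E r J ≈ ∑′ (λ j → Q ^ ε r j ⊗ w (suc (r + j))) J
  E-closed r zero    = R.refl
  E-closed r (suc J) = R.+-cong
    (R.trans (R.sym (R.*-identityˡ _)) (R.*-congˡ (R.reflexive (cong (w ∘ suc) (sym (ℕP.+-identityʳ r))))))
    (R.trans (R.*-congˡ (E-closed (suc r) J)) (R.trans (R.sym (∑′-⊗ _ _ J)) (∑′-cong J step)))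
    where
    idx : ∀ r j → suc (suc r + suc r) + (j * j + 2 * (j * suc (suc r))) ≡ suc j * suc j + 2 * (suc j * suc r)
    idx = solve-∀
    step : ∀ j → Q ^ suc (dbl (suc r)) ⊗ (Q ^ ε (suc r) j ⊗ w (suc (suc r + j))) ≈ Q ^ ε r (suc j) ⊗ w (suc (r + suc j))
    step j = R.trans (R.sym (R.*-assoc _ _ _)) (R.*-cong
      (R.trans (R.sym (^-+ Q (suc (dbl (suc r))) (ε (suc r) j))) (R.reflexive (cong (Q ^_) (trans (cong (λ d → suc d + ε (suc r) j) (dbl≡ (suc r))) (idx r j)))))
      (R.reflexive (cong (w ∘ suc) (sym (ℕP.+-suc r j)))))

  ^-* : ∀ f m n → (f ^ m) ^ n ≈ f ^ (n * m)
  ^-* f m zero    = R.refl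
  ^-* f m (suc n) = R.trans (R.*-congˡ (^-* f m n)) (R.sym (^-+ f m (n * m)))

  geo-∑′ : ∀ x k → geo x k ≈ ∑′ (x ^_) (suc k)
  geo-∑′ x zero    = R.sym (R.+-identityʳ 𝟙)
  geo-∑′ x (suc k) = R.+-congˡ (R.trans (R.*-congˡ (geo-∑′ x k)) (R.sym (∑′-⊗ x (x ^_) (suc k))))

  w-list : ∀ c k → Ord (suc k) (w (suc c) ⊝ (𝟙 ⊕ const (+ 2) ⊗ ∑L (upTo (suc k)) (λ m → Q ^ (suc m * suc c))))
  w-list c k = Ord-≈ (begin
    ⊖ (const (+ 2) ⊗ y ⊗ (geo y k ⊝ inv y)) ≈⟨ solve 3 (λ y g i → :- (:2 :* y :* (g :- i)) := :1 :+ :2 :* (y :* i) :- (:1 :+ :2 :* (y :* g))) R.refl y (geo y k) (inv y) ⟩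
    w (suc c) ⊝ (𝟙 ⊕ const (+ 2) ⊗ (y ⊗ geo y k))
      ≈⟨ R.+-congˡ (R.-‿cong (R.+-congˡ (R.*-congˡ (begin
           y ⊗ geo y k ≈⟨ R.*-congˡ (geo-∑′ y k) ⟩
           y ⊗ ∑′ (y ^_) (suc k) ≈⟨ ∑′-⊗ y (y ^_) (suc k) ⟨
           ∑′ (λ m → y ^ suc m) (suc k) ≈⟨ ∑′-cong (suc k) (λ m → ^-* Q (suc c) (suc m)) ⟩
           ∑′ (λ m → Q ^ (suc m * suc c)) (suc k) ≈⟨ ∑′-upTo (λ m → Q ^ (suc m * suc c)) (suc k) ⟩
           ∑L (upTo (suc k)) (λ m → Q ^ (suc m * suc c)) ∎)))) ⟩
    _ ∎) (Ord-⊖ (Ord-⊗ʳ _ (geo-inv (Q^-Ord1 c) k)))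
    where
    y = Q ^ suc c

  Index : Set
  Index = ℕ × (Bool × ℕ)

  exponent : Index → ℕ
  exponent (r , (α , j)) = base α r + (ε r j + ε r j)

  -- The additional summand comes from the term `Q^((m+1)(r+j+1))` in the geometric series inside
  -- `w (r + j + 1)`, each `Q` being `b²`.
  exponent₂ : Index × ℕ → ℕ
  exponent₂ ((r , (α , j)) , m) = exponent (r , (α , j)) + (suc m * suc (r + j) + suc m * suc (r + j))

  indices : ℕ → List Index
  indices N = cartesianProduct (upTo N) (cartesianProduct bools (upTo N))

  Q^b : ∀ n → Q ^ n ≈ b ^ (n + n)
  Q^b n = R.trans (^-cong n (R.sym b²)) (R.trans (^-⊗ b b n) (R.sym (^-+ b n n)))

  S-lists : ∀ N → Ord (suc N) (b ⊗ S b 𝟙 N ⊝ (∑L (indices N) (λ x → b ^ exponent x)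
    ⊕ const (+ 2) ⊗ ∑L (cartesianProduct (indices N) (upTo (suc N))) (λ x → b ^ exponent₂ x)))
  S-lists N = Ord-≈ (begin
    (H ⊝ T) ⊕ (∑L (indices N) U ⊝ ∑L (indices N) V)
      ≈⟨ R.+-congˡ (R.+-cong (R.sym T≈) (R.-‿cong V≈)) ⟩
    (H ⊝ T) ⊕ (T ⊝ X) ≈⟨ solve 3 (λ h t x → h :- t :+ (t :- x) := h :- x) R.refl H T X ⟩
    H ⊝ X ∎) (Ord-⊕ (S-double N) (∑L-Ord (indices N) UV))
    where
    H = b ⊗ S b 𝟙 N
    T = ∑′ (λ r → W r ⊗ E r N) N
    X = ∑L (indices N) (λ x → b ^ exponent x)
      ⊕ const (+ 2) ⊗ ∑L (cartesianProduct (indices N) (upTo (suc N))) (λ x → b ^ exponent₂ x)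
    U V : Index → PS
    U (r , (α , j)) = b ^ base α r ⊗ (Q ^ ε r j ⊗ w (suc (r + j)))
    V x@(r , (α , j)) = b ^ exponent x ⊕ const (+ 2) ⊗ ∑L (upTo (suc N)) (λ m → b ^ exponent₂ (x , m))
    Y : ℕ → PS
    Y r = ∑L (upTo N) (λ j → Q ^ ε r j ⊗ w (suc (r + j)))
    T≈ : T ≈ ∑L (indices N) U
    T≈ = begin
      T ≈⟨ ∑′-upTo (λ r → W r ⊗ E r N) N ⟩
      ∑L (upTo N) (λ r → W r ⊗ E r N) ≈⟨ ∑L-cong (upTo N) (λ r → begin
        W r ⊗ E r N ≈⟨ R.*-cong (W-list r) (R.trans (E-closed r N) (∑′-upTo (λ j → Q ^ ε r j ⊗ w (suc (r + j))) N)) ⟩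
        ∑L bools (λ α → b ^ base α r) ⊗ ∑L (upTo N) (λ j → Q ^ ε r j ⊗ w (suc (r + j)))
          ≈⟨ R.trans (R.*-comm _ (Y r)) (R.trans (R.sym (∑L-⊗ (Y r) (λ α → b ^ base α r) bools)) (∑L-cong bools (λ α → R.*-comm (Y r) (b ^ base α r)))) ⟩
        ∑L bools (λ α → b ^ base α r ⊗ ∑L (upTo N) (λ j → Q ^ ε r j ⊗ w (suc (r + j))))
          ≈⟨ ∑L-cong bools (λ α → R.sym (∑L-⊗ (b ^ base α r) (λ j → Q ^ ε r j ⊗ w (suc (r + j))) (upTo N))) ⟩
        ∑L bools (λ α → ∑L (upTo N) (λ j → U (r , (α , j)))) ≈⟨ ∑L-× (λ α j → U (r , (α , j))) bools (upTo N) ⟩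
        ∑L (cartesianProduct bools (upTo N)) (λ y → U (r , y)) ∎) ⟩
      ∑L (upTo N) (λ r → ∑L (cartesianProduct bools (upTo N)) (λ y → U (r , y))) ≈⟨ ∑L-× (λ r y → U (r , y)) (upTo N) _ ⟩
      ∑L (indices N) U ∎
    V≈ : ∑L (indices N) V ≈ X
    V≈ = R.trans (∑L-⊕ _ _ (indices N)) (R.+-congˡ (R.trans (∑L-⊗ _ _ (indices N)) (R.*-congˡ (∑L-× (λ x m → b ^ exponent₂ (x , m)) (indices N) (upTo (suc N))))))
    UV : ∀ x → Ord (suc N) (U x ⊝ V x)
    UV x@(r , (α , j)) = Ord-≈ (begin
      y ⊗ (w (suc (r + j)) ⊝ (𝟙 ⊕ const (+ 2) ⊗ ∑L (upTo (suc N)) z))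
        ≈⟨ solve 4 (λ a c w s → a :* c :* (w :- (:1 :+ :2 :* s)) := a :* (c :* w) :- (a :* c :+ :2 :* (a :* c :* s))) R.refl
            (b ^ base α r) (Q ^ ε r j) (w (suc (r + j))) (∑L (upTo (suc N)) z) ⟩
      U x ⊝ (y ⊕ const (+ 2) ⊗ (y ⊗ ∑L (upTo (suc N)) z)) ≈⟨ R.+-congˡ (R.-‿cong (R.+-cong y≈ (R.*-congˡ (begin
        y ⊗ ∑L (upTo (suc N)) z ≈⟨ ∑L-⊗ y z (upTo (suc N)) ⟨
        ∑L (upTo (suc N)) (λ m → y ⊗ z m) ≈⟨ ∑L-cong (upTo (suc N)) (λ m → R.trans (R.*-cong y≈ (Q^b (suc m * suc (r + j)))) (R.sym (^-+ b (exponent x) _))) ⟩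
        ∑L (upTo (suc N)) (λ m → b ^ exponent₂ (x , m)) ∎)))) ⟩
      U x ⊝ V x ∎) (Ord-⊗ʳ y (w-list (r + j) N))
      where
      y = b ^ base α r ⊗ Q ^ ε r j
      z = λ m → Q ^ (suc m * suc (r + j))
      y≈ : y ≈ b ^ exponent x
      y≈ = R.trans (R.*-congˡ (Q^b (ε r j))) (R.sym (^-+ b (base α r) _))

  ⟦_⟧ : (ℕ → ℕ) → PS
  ⟦ f ⟧ n = + f n

  shift-suc : ∀ s f i → shift (suc s) f (suc i) ≡ shift s f i
  shift-suc zero    f i = refl
  shift-suc (suc s) f i = refl

  ⟦shift⟧ : ∀ s f → ⟦ shift s f ⟧ ≈ q ^ s ⊗ ⟦ f ⟧
  ⟦shift⟧ zero    f = R.sym (R.*-identityˡ _)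
  ⟦shift⟧ (suc s) f = R.trans (pw step) (R.sym (R.*-assoc q (q ^ s) ⟦ f ⟧))
    where
    step : ∀ i → + shift (suc s) f i ≡ (q ⊗ (q ^ s ⊗ ⟦ f ⟧)) i
    step zero    = sym (q⊗-zero _)
    step (suc i) = trans (cong +_ (shift-suc s f i)) (trans (at (⟦shift⟧ s f) i) (sym (q⊗-suc _ i)))

  ⟦mulOnePlus⟧ : ∀ a f → ⟦ mulOnePlus a f ⟧ ≈ (𝟙 ⊕ q ^ a) ⊗ ⟦ f ⟧
  ⟦mulOnePlus⟧ a f = R.trans (pw λ i → sym (⊕-at ⟦ f ⟧ ⟦ shift a f ⟧ i)) (R.trans (R.+-congˡ (⟦shift⟧ a f))
    (solve 2 (λ x f → f :+ x :* f := (:1 :+ x) :* f) R.refl (q ^ a) ⟦ f ⟧))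

  sum-∑′ : ∀ (h : ℕ → ℕ) (H : ℕ → PS) i g k → (∀ t → + h t ≡ H t i) → + sum (map h (applyUpTo g k)) ≡ ∑′ (H ∘ g) k i
  sum-∑′ h H i g zero    p = sym (𝟘-const i)
  sum-∑′ h H i g (suc k) p = trans (cong₂ ℤ._+_ (p (g 0)) (sum-∑′ h H i (g ∘ suc) k p)) (sym (⊕-at (H (g 0)) _ i))

  -- For the coefficient of index `i` the definition sums exactly the `i`-th partial sum of the
  -- geometric series, which agrees with the inverse up to that coefficient.
  ⟦divOneMinus⟧ : ∀ a f → ⟦ divOneMinus (suc a) f ⟧ ≈ inv (q ^ suc a) ⊗ ⟦ f ⟧
  ⟦divOneMinus⟧ a f = pw λ i → trans
    (sum-∑′ (λ t → shift (t * suc a) f i) (λ t → q ^ (t * suc a) ⊗ ⟦ f ⟧) i id (suc i) (λ t → at (⟦shift⟧ (t * suc a) f) i))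
    (trans (at (geo≈ i) i) (⊝-≡ (geo x i ⊗ ⟦ f ⟧) (inv x ⊗ ⟦ f ⟧) (Ord.vanish (Ord-≈ (eq i) (Ord-⊗ˡ ⟦ f ⟧ (geo-inv ox i))) i ℕP.≤-refl)))
    where
    x = q ^ suc a
    ox : Ord 1 x
    ox = Ord-⊗ˡ (q ^ a) q-Ord
    eq : ∀ i → (geo x i ⊝ inv x) ⊗ ⟦ f ⟧ ≈ geo x i ⊗ ⟦ f ⟧ ⊝ inv x ⊗ ⟦ f ⟧
    eq i = solve 3 (λ a b c → (a :- b) :* c := a :* c :- b :* c) R.refl (geo x i) (inv x) ⟦ f ⟧
    geo≈ : ∀ i → ∑′ (λ t → q ^ (t * suc a) ⊗ ⟦ f ⟧) (suc i) ≈ geo x i ⊗ ⟦ f ⟧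
    geo≈ i = R.trans (∑′-cong (suc i) (λ t → R.trans (R.*-congʳ (R.sym (^-* q (suc a) t))) (R.*-comm (x ^ t) ⟦ f ⟧)))
      (R.trans (∑′-⊗ ⟦ f ⟧ (x ^_) (suc i)) (R.trans (R.*-comm _ _) (R.*-congʳ (R.sym (geo-∑′ x i)))))

  N⁺ D⁻ : ℕ → PS
  N⁺ zero    = 𝟙
  N⁺ (suc n) = (𝟙 ⊕ q ^ (2 * n + 2)) ⊗ N⁺ n
  D⁻ zero    = 𝟙
  D⁻ (suc m) = inv (q ^ (2 * m + 1)) ⊗ D⁻ m

  ⟦negQ2Poch⟧ : ∀ n f → ⟦ negQ2Poch n f ⟧ ≈ N⁺ n ⊗ ⟦ f ⟧
  ⟦negQ2Poch⟧ zero    f = R.sym (R.*-identityˡ _)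
  ⟦negQ2Poch⟧ (suc n) f = R.trans (⟦mulOnePlus⟧ (2 * n + 2) (negQ2Poch n f)) (R.trans (R.*-congˡ (⟦negQ2Poch⟧ n f)) (R.sym (R.*-assoc _ _ _)))

  ⟦divQPoch⟧ : ∀ m → ⟦ divQPoch m one ⟧ ≈ D⁻ m
  ⟦divQPoch⟧ zero    = pw λ { zero → sym (const-at0 (+ 1)) ; (suc n) → sym (const-atsuc (+ 1) n) }
  ⟦divQPoch⟧ (suc m) = R.trans (R.reflexive (cong (λ k → ⟦ divOneMinus k (divQPoch m one) ⟧) (ℕP.+-comm (2 * m) 1)))
    (R.trans (⟦divOneMinus⟧ (2 * m) (divQPoch m one))
      (R.*-cong (R.reflexive (cong (λ k → inv (q ^ k)) (ℕP.+-comm 1 (2 * m)))) (⟦divQPoch⟧ m)))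

  Q^q : ∀ n → Q ^ n ≈ q ^ (2 * n)
  Q^q n = R.trans (^-cong n (R.*-congˡ (R.sym (R.*-identityʳ q)))) (R.trans (^-* q 2 n) (R.reflexive (cong (q ^_) (ℕP.*-comm n 2))))

  -- For `x = q`, `a = − 1` the products `(aQ;Q)_n` and `(x;Q)_{n+1}` are `(−q²;q²)_n` and
  -- `(q;q²)_{n+1}`.
  q⊗t : ∀ n → q ⊗ t q (⊖ 𝟙) n ≈ q ^ suc n ⊗ (N⁺ n ⊗ D⁻ (suc n))
  q⊗t zero    = R.trans (R.*-congˡ (inv-cong (R.sym (R.*-identityʳ q))))
    (solve 2 (λ q i → q :* i := q :* :1 :* (:1 :* (i :* :1))) R.refl q _)
  q⊗t (suc n) = begin
    q ⊗ (q ⊗ (𝟙 ⊝ (⊖ 𝟙) ⊗ Q ^ suc n) ⊗ inv (q ⊗ Q ^ suc n) ⊗ t q (⊖ 𝟙) n)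
      ≈⟨ solve 4 (λ q z i t → q :* (q :* (:1 :- (:- :1) :* z) :* i :* t) := q :* (:1 :+ z) :* i :* (q :* t)) R.refl q (Q ^ suc n) _ _ ⟩
    q ⊗ (𝟙 ⊕ Q ^ suc n) ⊗ inv (q ⊗ Q ^ suc n) ⊗ (q ⊗ t q (⊖ 𝟙) n)
      ≈⟨ R.*-cong (R.*-cong (R.*-congˡ (R.+-congˡ (R.trans (Q^q (suc n)) (R.reflexive (cong (q ^_) (e1 n))))))
           (inv-cong (R.trans (R.*-congˡ (Q^q (suc n))) (R.reflexive (cong (q ^_) (e2 n)))))) (q⊗t n) ⟩
    q ⊗ (𝟙 ⊕ q ^ (2 * n + 2)) ⊗ inv (q ^ (2 * suc n + 1)) ⊗ (q ^ suc n ⊗ (N⁺ n ⊗ D⁻ (suc n)))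
      ≈⟨ solve 6 (λ q y i z a d → q :* y :* i :* (z :* (a :* d)) := q :* z :* (y :* a :* (i :* d))) R.refl q _ _ (q ^ suc n) (N⁺ n) (D⁻ (suc n)) ⟩
    q ^ suc (suc n) ⊗ (N⁺ (suc n) ⊗ D⁻ (suc (suc n))) ∎
    where
    e1 : ∀ n → 2 * suc n ≡ 2 * n + 2
    e1 = solve-∀
    e2 : ∀ n → suc (2 * suc n) ≡ 2 * suc n + 1
    e2 = solve-∀

  ⟦termA⟧ : ∀ n → ⟦ termA n ⟧ ≈ q ⊗ t q (⊖ 𝟙) n
  ⟦termA⟧ n = R.trans (⟦shift⟧ (suc n) _) (R.trans (R.*-congˡ (R.trans (⟦negQ2Poch⟧ n _) (R.*-congˡ (⟦divQPoch⟧ (suc n))))) (R.sym (q⊗t n)))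

  NAℕ-S : ∀ N → + NAℕ N ≡ (q ⊗ S q (⊖ 𝟙) N) N
  NAℕ-S N = trans (sum-∑′ (λ n → termA n N) (λ n → q ⊗ t q (⊖ 𝟙) n) N id N (λ n → at (⟦termA⟧ n) N))
    (at (R.trans (R.sym (∑-∑′ (λ n → q ⊗ t q (⊖ 𝟙) n) N)) (∑-⊗ q (t q (⊖ 𝟙)) N)) N)

  Bools : Enum (λ (_ : Bool) → ⊤)
  Bools = record
    { elems = bools ; unique = ((λ ()) ∷ []) ∷ [] ∷ [] ; sound = λ _ → tt
    ; complete = λ { {true} _ → here refl ; {false} _ → there (here refl) } }

  Indices : ∀ N → Enum (λ ((r , (α , j)) : Index) → r < N × (⊤ × j < N))
  Indices N = bounded N ⊠ (Bools ⊠ bounded N)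

  c₁ c₂ : ℕ → ℕ
  c₁ N = # (Indices N ∩ λ x → exponent x ≟ N)
  c₂ N = # ((Indices N ⊠ bounded (suc N)) ∩ λ x → exponent₂ x ≟ N)

  -- The sums at `(q, − 1)` and `(b, 1)` agree modulo 4, but the prefactors `q` and `b = − q` have
  -- opposite signs; hence `N_A(N) ≡ − (−1)^N (C₁ + 2 C₂)`.
  4∣NAℕ : ∀ N → 4 ℕD.∣ c₁ N + 2 * c₂ N → 4 ℕD.∣ NAℕ N
  4∣NAℕ N (ℕD.divides k e) with S-cong-4 N {q} {b} {⊖ 𝟙} {𝟙} q-Ord R.refl (solve 0 (:1 := :- (:- :1)) R.refl)
  ... | div h o = ℤD.∣⇒∣ᵤ (ℤD.divides (h′ N ℤ.+ ℤ.- (σ N ℤ.* + k)) (trans (NAℕ-S N) (trans eq₁ eq₂)))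
    where
    h′ = q ⊗ h
    u = q ⊗ S q (⊖ 𝟙) N
    v = b ⊗ S b 𝟙 N
    x = ∑L (indices N) (λ x → b ^ exponent x)
    y = ∑L (cartesianProduct (indices N) (upTo (suc N))) (λ x → b ^ exponent₂ x)
    X = x ⊕ const (+ 2) ⊗ y
    uv : Ord (suc N) (u ⊝ (⊖ X ⊕ const (+ 4) ⊗ h′))
    uv = Ord-≈ (solve 5 (λ q s s′ h X → q :* (s :- s′ :- :4 :* h) :- ((:- q) :* s′ :- X) := q :* s :- (:- X :+ :4 :* (q :* h))) R.refl q (S q (⊖ 𝟙) N) (S b 𝟙 N) h X)
      (Ord-⊕ (Ord-⊗ q-Ord o) (Ord-⊖ (S-lists N)))
    at-N : X N ≡ σ N ℤ.* + (c₁ N + 2 * c₂ N)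
    at-N = trans (⊕-at x (const (+ 2) ⊗ y) N) (trans (cong₂ ℤ._+_ (coefficient exponent N (indices N))
      (trans (const-⊗-at (+ 2) y N) (cong (+ 2 ℤ.*_) (coefficient exponent₂ N (cartesianProduct (indices N) (upTo (suc N)))))))
      (trans (arith (σ N) (+ c₁ N) (+ c₂ N)) (cong (λ z → σ N ℤ.* (+ c₁ N ℤ.+ z)) (sym (ℤP.pos-* 2 (c₂ N))))))
      where
      arith : ∀ s m n → s ℤ.* m ℤ.+ + 2 ℤ.* (s ℤ.* n) ≡ s ℤ.* (m ℤ.+ + 2 ℤ.* n)
      arith = ℤS.solve-∀
    eq₁ : u N ≡ ℤ.- X N ℤ.+ + 4 ℤ.* h′ N
    eq₁ = trans (⊝-≡ u _ (Ord.vanish uv N ℕP.≤-refl)) (trans (⊕-at (⊖ X) (const (+ 4) ⊗ h′) N) (cong₂ ℤ._+_ (⊖-at X N) (const-⊗-at (+ 4) h′ N)))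
    eq₂ : ℤ.- X N ℤ.+ + 4 ℤ.* h′ N ≡ (h′ N ℤ.+ ℤ.- (σ N ℤ.* + k)) ℤ.* + 4
    eq₂ = trans (cong (λ z → ℤ.- z ℤ.+ + 4 ℤ.* h′ N) (trans at-N (cong (σ N ℤ.*_) (trans (cong +_ e) (ℤP.pos-* k 4))))) (arith (σ N) (+ k) (h′ N))
      where
      arith : ∀ s k h → ℤ.- (s ℤ.* (k ℤ.* + 4)) ℤ.+ + 4 ℤ.* h ≡ (h ℤ.+ ℤ.- (s ℤ.* k)) ℤ.* + 4
      arith = ℤS.solve-∀

-- Linear arithmetic, solutions of uv + ef = D, parity and residues modulo 8.

module Arithmetic where

  open import Data.Bool using (Bool; true; false; not; _xor_; _∧_)
  import Data.Bool.Properties as 𝔹P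
  open import Data.Bool.Solver using (module xor-∧-Solver)
  open import Data.Unit using (⊤; tt)
  open import Data.Nat
  open import Data.Nat.Properties
  open import Data.Nat.DivMod hiding (result)
  open import Data.Nat.Divisibility
  open import Data.Nat.Primality
  open import Data.Nat.Coprimality using (coprime-Bézout; prime⇒coprime)
  open import Data.Nat.GCD using (module Bézout)
  open import Data.Nat.Induction using (<-rec)
  open import Data.Nat.Tactic.RingSolver using (solve; solve-∀)
  open import Data.Fin as Fin using (Fin; toℕ; fromℕ<; combine; remQuot)
  import Data.Fin.Properties as FinP
  open import Data.List using ([]; _∷_)
  import Data.List.Properties as ListP
  open import Data.Product using (_×_; _,_; proj₁; proj₂; ∃-syntax)
  open import Data.Product.Properties using (≡-dec)
  open import Data.Sum using (_⊎_; inj₁; inj₂)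
  open import Data.Empty using (⊥; ⊥-elim)
  open import Relation.Nullary using (¬_; yes; no; Dec; _×-dec_; _⊎-dec_; _→-dec_; ¬?; contradiction)
  open import Relation.Nullary.Decidable using (toWitness)
  open import Relation.Unary using (Decidable)
  open import Relation.Binary.Definitions using (DecidableEquality)
  open import Relation.Binary.PropositionalEquality
  open Enumeration

  module LinearArithmetic where

    -- Linear arithmetic without subtraction: a linear combination x ≡ y (or x ≤ y) of hypotheses yields the goal once a + y ≡ b + x is a ring identity.
    lin : ∀ {a b x y} → x ≡ y → a + y ≡ b + x → a ≡ b
    lin {a} {b} {x} refl e = +-cancelʳ-≡ x a b e

    lin≤ : ∀ {a b x y} → x ≤ y → a + y ≡ b + x → a ≤ b
    lin≤ {a} {b} {x} {y} lt e = +-cancelʳ-≤ y a b (subst (_≤ b + y) (sym e) (+-monoʳ-≤ b lt))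

    infixl 6 _⟨+⟩_
    _⟨+⟩_ : ∀ {a b c d : ℕ} → a ≡ b → c ≡ d → a + c ≡ b + d
    _⟨+⟩_ = cong₂ _+_
    infixl 7 _⟨*⟩_
    _⟨*⟩_ : ∀ {a b} c → a ≡ b → c * a ≡ c * b
    c ⟨*⟩ e = cong (c *_) e

  open LinearArithmetic

  module Quadruples where

    Quad Pair : Set
    Quad = ℕ × ℕ × ℕ × ℕ
    Pair = ℕ × ℕ

    _≟Q_ : DecidableEquality Quad
    _≟Q_ = ≡-dec _≟_ (≡-dec _≟_ (≡-dec _≟_ _≟_))

    _≟P_ : DecidableEquality Pair
    _≟P_ = ≡-dec _≟_ _≟_

    quad≡ : ∀ {u v e f u′ v′ e′ f′ : ℕ} → u ≡ u′ → v ≡ v′ → e ≡ e′ → f ≡ f′ → (u , v , e , f) ≡ (u′ , v′ , e′ , f′)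
    quad≡ refl refl refl refl = refl

    Ω : ℕ → Quad → Set
    Ω D (u , v , e , f) = (0 < u × 0 < v × 0 < e × 0 < f) × u * v + e * f ≡ D

    Π : ℕ → Pair → Set
    Π D (u , v) = (0 < u × 0 < v) × u * v ≡ D

    private
      factor≤ : ∀ {u v} → 0 < v → u ≤ u * v
      factor≤ {u} {suc v} _ = m≤m*n u (suc v)

    -- Positivity bounds every entry by `D`, so the search through a box is complete.
    Quads : ∀ D → Enum (Ω D)
    Quads D = retype ((bounded (suc D) ⊠ bounded (suc D) ⊠ bounded (suc D) ⊠ bounded (suc D)) ∩
        λ (u , v , e , f) → (0 <? u ×-dec 0 <? v ×-dec 0 <? e ×-dec 0 <? f) ×-dec u * v + e * f ≟ D)
      proj₂ bound
      where
      bound : ∀ {x} → Ω D x → let (u , v , e , f) = x in (u < suc D × v < suc D × e < suc D × f < suc D) × Ω D x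
      bound {u , v , e , f} o@((u0 , v0 , e0 , f0) , refl) =
        ( s≤s (≤-trans (factor≤ v0) (m≤m+n _ _))
        , s≤s (≤-trans (factor≤ u0) (≤-trans (≤-reflexive (*-comm v u)) (m≤m+n _ _)))
        , s≤s (≤-trans (factor≤ f0) (m≤n+m _ _))
        , s≤s (≤-trans (factor≤ e0) (≤-trans (≤-reflexive (*-comm f e)) (m≤n+m _ _)))) , o

    Pairs : ∀ D → Enum (Π D)
    Pairs D = retype ((bounded (suc D) ⊠ bounded (suc D)) ∩ λ (u , v) → (0 <? u ×-dec 0 <? v) ×-dec u * v ≟ D) proj₂ bound
      where
      bound : ∀ {x} → Π D x → let (u , v) = x in (u < suc D × v < suc D) × Π D x
      bound {u , v} o@((u0 , v0) , refl) = (s≤s (factor≤ v0) , s≤s (≤-trans (factor≤ u0) (≤-reflexive (*-comm v u)))) , o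

    Even Odd : ℕ → Set
    Even n = par n ≡ false
    Odd n  = par n ≡ true

    par-* : ∀ m n → par (m * n) ≡ par m ∧ par n
    par-* zero    n = refl
    par-* (suc m) n with par m in eq
    ... | true  = trans (par-+ n (m * n)) (trans (cong (par n xor_) (trans (par-* m n) (cong (_∧ par n) eq))) (𝔹P.xor-same (par n)))
    ... | false = trans (par-+ n (m * n)) (trans (cong (par n xor_) (trans (par-* m n) (cong (_∧ par n) eq))) (𝔹P.xor-identityʳ (par n)))

    even? : Decidable Even
    even? n = par n 𝔹P.≟ false

    odd? : Decidable Odd
    odd? n = par n 𝔹P.≟ true

    even-odd-⊥ : ∀ {n} → Even n → Odd n → ⊥
    even-odd-⊥ p q with trans (sym p) q
    ... | ()

    ¬even⇒odd : ∀ {n} → ¬ Even n → Odd n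
    ¬even⇒odd {n} p with par n
    ... | true  = refl
    ... | false = contradiction refl p

    ¬odd⇒even : ∀ {n} → ¬ Odd n → Even n
    ¬odd⇒even {n} p with par n
    ... | false = refl
    ... | true  = contradiction refl p

    -- Congruences modulo 8 are transported to `Fin 8` and decided there by running through all
    -- residues.
    residue : ℕ → Fin 8
    residue n = fromℕ< (m%n<n n 8)

    toℕ-residue : ∀ n → toℕ (residue n) ≡ n % 8
    toℕ-residue n = FinP.toℕ-fromℕ< (m%n<n n 8)

    infix 4 _≡₈_
    record _≡₈_ (a b : ℕ) : Set where
      constructor mod8
      field %≡ : a % 8 ≡ b % 8
    open _≡₈_

    infixl 6 _+₈_
    infixl 7 _*₈_
    _+₈_ : ∀ {a b c d} → a ≡₈ b → c ≡₈ d → a + c ≡₈ b + d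
    _+₈_ {a} {b} {c} {d} (mod8 p) (mod8 q) = mod8 (trans (%-distribˡ-+ a c 8) (trans (cong₂ (λ x y → (x + y) % 8) p q) (sym (%-distribˡ-+ b d 8))))

    _*₈_ : ∀ {a b c d} → a ≡₈ b → c ≡₈ d → a * c ≡₈ b * d
    _*₈_ {a} {b} {c} {d} (mod8 p) (mod8 q) = mod8 (trans (%-distribˡ-* a c 8) (trans (cong₂ (λ x y → (x * y) % 8) p q) (sym (%-distribˡ-* b d 8))))

    refl₈ : ∀ {a} → a ≡₈ a
    refl₈ = mod8 refl

    res : ∀ n → toℕ (residue n) ≡₈ n
    res n = mod8 (trans (cong (_% 8) (toℕ-residue n)) (m%n%n≡m%n n 8))

    par-% : ∀ n → par (n % 8) ≡ par n
    par-% n = sym (trans (cong par (m≡m%n+[m/n]*n n 8)) (trans (par-+ (n % 8) _)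
      (trans (cong (par (n % 8) xor_) (trans (par-* (n / 8) 8) (𝔹P.∧-zeroʳ (par (n / 8))))) (𝔹P.xor-identityʳ _))))

    par-residue : ∀ n → par (toℕ (residue n)) ≡ par n
    par-residue n = trans (cong par (toℕ-residue n)) (par-% n)

    half : ∀ {n} → Even n → ∃[ k ] n ≡ 2 * k
    half {zero}        _ = 0 , refl
    half {suc (suc n)} p with half {n} (trans (sym (𝔹P.not-involutive (par n))) p)
    ... | k , refl = suc k , eq k
      where
      eq : ∀ k → suc (suc (2 * k)) ≡ 2 * suc k
      eq = solve-∀

    even-2* : ∀ k → Even (2 * k)
    even-2* k = par-* 2 k

    odd-Ω : ∀ {D u v e f} → Odd D → u * v + e * f ≡ D → par e ∧ par f ≡ false → Odd u × Odd v
    odd-Ω {D} {u} {v} {e} {f} oD eq ef = split (par u) (par v) (trans (sym (trans (par-+ (u * v) (e * f))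
      (trans (cong₂ _xor_ (par-* u v) (trans (par-* e f) ef)) (𝔹P.xor-identityʳ _)))) (trans (cong par eq) oD))
      where
      split : ∀ a b → a ∧ b ≡ true → a ≡ true × b ≡ true
      split true true _ = refl , refl

    par+ : ∀ {m n a b} → par m ≡ a → par n ≡ b → par (m + n) ≡ a xor b
    par+ {m} {n} p q = trans (par-+ m n) (cong₂ _xor_ p q)

    par∸ : ∀ {m n k a b} → m + k ≡ n → par m ≡ a → par n ≡ b → par k ≡ a xor b
    par∸ {m} {n} {k} eq p q = trans (sym (trans (sym (𝔹P.xor-assoc (par m) (par m) (par k))) (cong (_xor par k) (𝔹P.xor-same (par m)))))
      (cong₂ _xor_ p (trans (sym (par-+ m k)) (trans (cong par eq) q)))

    odd-mod8 : ∀ {D} → D % 8 ≡ 7 → Odd D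
    odd-mod8 {D} m = trans (sym (par-% D)) (cong par m)

    -- The product `ef` is divisible by 4 and no square is 3 modulo 4. Thus `u = v` never occurs
    -- among solutions with `e`, `f` even.
    u²+ef≢7 : ∀ u e f → Even e → Even f → (u * u + e * f) % 8 ≢ 7
    u²+ef≢7 u e f ev ev′ m = toWitness {a? = FinP.all? λ a → FinP.all? λ b → FinP.all? λ c →
        even? (toℕ b) →-dec (even? (toℕ c) →-dec ¬? ((toℕ a * toℕ a + toℕ b * toℕ c) % 8 ≟ 7))} _
      (residue u) (residue e) (residue f) (trans (par-residue e) ev) (trans (par-residue f) ev′)
      (trans (%≡ (res u *₈ res u +₈ res e *₈ res f)) m)

    -- Here `u` is odd, so `u² ≡ 1` and `ek ≡ 3` modulo 4.
    u²+2ek-odd : ∀ u e k → Odd e → (u * u + e * (2 * k)) % 8 ≡ 7 → Odd k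
    u²+2ek-odd u e k oe m = trans (sym (par-residue k)) (toWitness {a? = FinP.all? λ a → FinP.all? λ b → FinP.all? λ c →
        odd? (toℕ b) →-dec ((toℕ a * toℕ a + toℕ b * (2 * toℕ c)) % 8 ≟ 7 →-dec odd? (toℕ c))} _
      (residue u) (residue e) (residue k) (trans (par-residue e) oe)
      (trans (%≡ (res u *₈ res u +₈ res e *₈ (refl₈ {2} *₈ res k))) m))

    -- With `u` odd, `2e²` would have to be 6 modulo 8, but it is 0 or 2.
    u²+2e²≢7 : ∀ u e → (u * u + e * (2 * e)) % 8 ≢ 7
    u²+2e²≢7 u e m = toWitness {a? = FinP.all? λ a → FinP.all? λ b → ¬? ((toℕ a * toℕ a + toℕ b * (2 * toℕ b)) % 8 ≟ 7)} _
      (residue u) (residue e)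
      (trans (%≡ (res u *₈ res u +₈ res e *₈ (refl₈ {2} *₈ res e))) m)

    half-2* : ∀ k → 2 * k / 2 ≡ k
    half-2* k = trans (cong (_/ 2) (*-comm 2 k)) (m*n/n≡m k 2)

    odd-half : ∀ {n} → Odd n → ∃[ k ] n ≡ suc (2 * k)
    odd-half {suc n} p with half {n} (𝔹P.not-injective p)
    ... | k , refl = k , refl

    odd-*⁻ : ∀ m n → Odd (m * n) → Odd m × Odd n
    odd-*⁻ m n p = split (par m) (par n) (trans (sym (par-* m n)) p)
      where
      split : ∀ a b → a ∧ b ≡ true → a ≡ true × b ≡ true
      split true true _ = refl , refl

    4k+ : ∀ {n} r k → n ≡ r + k * 4 → n % 4 ≡ r % 4
    4k+ r k refl = [m+kn]%n≡m%n r k 4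

    odd-mod4 : ∀ {n} → n % 4 ≡ 1 ⊎ n % 4 ≡ 3 → Odd n
    odd-mod4 {n} m = trans (cong par (m≡m%n+[m/n]*n n 4)) (trans (par+ {n % 4} {n / 4 * 4} (go m) (trans (par-* (n / 4) 4) (𝔹P.∧-zeroʳ (par (n / 4))))) refl)
      where
      go : n % 4 ≡ 1 ⊎ n % 4 ≡ 3 → Odd (n % 4)
      go (inj₁ e) = cong par e
      go (inj₂ e) = cong par e

    V≡3 : Pair → Set
    V≡3 (u , v) = v % 4 ≡ 3

    v≡3? : Decidable V≡3
    v≡3? (u , v) = v % 4 ≟ 3

    U<V₂ : Pair → Set
    U<V₂ (u , v) = u < v

    u<v₂? : Decidable U<V₂
    u<v₂? (u , v) = u <? v

    Om0 Om4 U<V : Quad → Set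
    Om0 (u , v , e , f) = Even e × Even f
    Om4 (u , v , e , f) = (Odd u × Even v) × (Odd e × Odd f)
    U<V (u , v , e , f) = u < v

    om0? : Decidable Om0
    om0? (u , v , e , f) = even? e ×-dec even? f
    om4? : Decidable Om4
    om4? (u , v , e , f) = (odd? u ×-dec even? v) ×-dec (odd? e ×-dec odd? f)
    u<v? : Decidable U<V
    u<v? (u , v , e , f) = u <? v

    mod4-odd : ∀ {n} → Odd n → n % 4 ≡ 1 ⊎ n % 4 ≡ 3
    mod4-odd {n} o with n % 4 in eq | m≡m%n+[m/n]*n n 4 | m%n<n n 4
    ... | 1 | _ | _ = inj₁ refl
    ... | 3 | _ | _ = inj₂ refl
    ... | 0 | e | _ = ⊥-elim (even-odd-⊥ {n} (trans (cong par e) (trans (par-* (n / 4) 4) (𝔹P.∧-zeroʳ (par (n / 4))))) o)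
    ... | 2 | e | _ = ⊥-elim (even-odd-⊥ {n} (trans (cong par e) (trans (par+ {2} {n / 4 * 4} refl (par-* (n / 4) 4)) (𝔹P.∧-zeroʳ (par (n / 4))))) o)
    ... | suc (suc (suc (suc _))) | _ | s≤s (s≤s (s≤s (s≤s ())))

    sw₂ : Pair → Pair
    sw₂ (u , v) = v , u

    swΠ : ∀ {N x} → Π N x → Π N (sw₂ x)
    swΠ {x = u , v} ((u0 , v0) , eq) = (v0 , u0) , trans (*-comm v u) eq

  open Quadruples

  -- Liouville's method: C₂ in terms of T and K modulo 2.

  module LiouvilleMaps (D : ℕ) (m : D % 8 ≡ 7) where

    oD : Odd D
    oD = odd-mod8 {D} m

    ∸-eq : ∀ {a b c} → a + b ≡ c → c ∸ a ≡ b
    ∸-eq {a} {b} refl = m+n∸m≡n a b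

    Om1 F<U F<V E<W F=W F=S V<E E=V V<S : Quad → Set
    Om1 (u , v , e , f) = Odd e × Even f
    F<U (u , v , e , f) = f < u
    F<V (u , v , e , f) = f < v
    E<W (u , v , e , f) = f < e + u + v
    F=W (u , v , e , f) = f ≡ e + u + v
    F=S (u , v , e , f) = f ≡ u + v
    V<E (u , v , e , f) = v < e
    E=V (u , v , e , f) = e ≡ v
    V<S (u , v , e , f) = v < u + f

    om1? : Decidable Om1
    om1? (u , v , e , f) = odd? e ×-dec even? f
    f<u? : Decidable F<U
    f<u? (u , v , e , f) = f <? u
    f<v? : Decidable F<V
    f<v? (u , v , e , f) = f <? v
    f<w? : Decidable E<W
    f<w? (u , v , e , f) = f <? e + u + v
    f=w? : Decidable F=W
    f=w? (u , v , e , f) = f ≟ e + u + v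
    f=s? : Decidable F=S
    f=s? (u , v , e , f) = f ≟ u + v
    v<e? : Decidable V<E
    v<e? (u , v , e , f) = v <? e
    e=v? : Decidable E=V
    e=v? (u , v , e , f) = e ≟ v
    v<s? : Decidable V<S
    v<s? (u , v , e , f) = v <? u + f

    -- ♯ G0 counts u v + e (u + v) = D with u < v odd and e even.
    Q0 = Quads D ∩ om0?
    Q1 = Quads D ∩ om1?
    T  = Q0 ∩ u<v?
    G0 = T ∩ f=s?
    K  = Pairs D ∩ u<v₂? ∩ v≡3?

    odd0 : ∀ {u v e f} → u * v + e * f ≡ D → Even e → Odd u × Odd v
    odd0 {u} {v} {e} {f} eq ev = odd-Ω {u = u} {v} {e} {f} oD eq (cong (_∧ par f) ev)

    odd1 : ∀ {u v e f} → u * v + e * f ≡ D → Even f → Odd u × Odd v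
    odd1 {u} {v} {e} {f} eq ev = odd-Ω {u = u} {v} {e} {f} oD eq (trans (cong (par e ∧_) ev) (𝔹P.∧-zeroʳ (par e)))

    parity-≢ : ∀ {a b} → Even a → Odd b → a ≢ b
    parity-≢ {a} p q refl = even-odd-⊥ {a} p q

    -- T is cut according to the position of f with respect to v and e + u + v; θ acts on the middle part.
    T2 = T ∩ ∁ f<v? ∩ f<w?
    T34 = T ∩ ∁ f<v? ∩ ∁ f<w?
    T3 = T34 ∩ f=w?
    T4 = T34 ∩ ∁ f=w?

    private
      θ : Quad → Quad
      θ (u , v , e , f) = f ∸ v , f ∸ u , (e + u + v) ∸ f , f

      T2P : Quad → Set
      T2P x = (((Ω D x × Om0 x) × U<V x) × ¬ F<V x) × E<W x

      θ-hyps : ∀ {u v e f} → T2P (u , v , e , f) → v < f × (f ∸ v + v ≡ f) × (f ∸ u + u ≡ f) × ((e + u + v) ∸ f + f ≡ e + u + v)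
      θ-hyps {u} {v} {e} {f} ((((((u0 , v0 , e0 , f0) , eq) , ee , ef) , u<v) , f≮v) , f<w) =
        v<f , m∸n+n≡m (<⇒≤ v<f) , m∸n+n≡m (<⇒≤ (<-trans u<v v<f)) , m∸n+n≡m (<⇒≤ f<w)
        where
        v<f = ≤∧≢⇒< (≮⇒≥ f≮v) (λ p → parity-≢ ef (proj₂ (odd0 {u} {v} {e} {f} eq ee)) (sym p))

      -- The differences enter as variables tied by additive equations, since truncated subtraction
      -- is out of reach of ring identities; the other maps are treated in the same way.
      θ-P : ∀ {u v e f u' v' e'} → T2P (u , v , e , f) → v < f → u' + v ≡ f → v' + u ≡ f → e' + f ≡ e + u + v → T2P (u' , v' , e' , f)
      θ-P {u} {v} {e} {f} {u'} {v'} {e'} ((((((u0 , v0 , e0 , f0) , h4) , ee , ef) , u<v) , f≮v) , f<w) v<f h1 h2 h3 =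
        (((((u'0 , v'0 , e'0 , f0) , (lin {u' * v' + e' * f} {D} (v' ⟨*⟩ h1 ⟨+⟩ f ⟨*⟩ h2 ⟨+⟩ v ⟨*⟩ sym h2 ⟨+⟩ f ⟨*⟩ h3 ⟨+⟩ h4) (solve (u' ∷ v' ∷ e' ∷ f ∷ D ∷ v ∷ u ∷ e ∷ []))) ) , ee' , ef) , (lin≤ {suc u'} {v'} u<v (lin (h1 ⟨+⟩ sym h2) (solve (u' ∷ v' ∷ u ∷ v ∷ f ∷ []))))) ,
          ≤⇒≯ (lin≤ {v'} {f} (z≤n {u}) (lin (h2) (solve (v' ∷ f ∷ u ∷ []))))) , (lin≤ {suc f} {e' + u' + v'} e0 (lin (sym h1 ⟨+⟩ sym h2 ⟨+⟩ sym h3) (solve (f ∷ e' ∷ u' ∷ v' ∷ e ∷ v ∷ u ∷ []))))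
        where
        u'0 : 0 < u'
        u'0 = (lin≤ {1} {u'} v<f (lin (sym h1) (solve (u' ∷ v ∷ f ∷ []))))
        v'0 : 0 < v'
        v'0 = (lin≤ {1} {v'} (<-trans u<v v<f) (lin (sym h2) (solve (v' ∷ u ∷ f ∷ []))))
        e'0 : 0 < e'
        e'0 = (lin≤ {1} {e'} f<w (lin (sym h3) (solve (e' ∷ f ∷ e ∷ u ∷ v ∷ []))))
        odds = odd0 {u} {v} {e} {f} h4 ee
        ee' : Even e'
        ee' = par∸ {f} {_} {e'} (trans (+-comm f e') h3) ef (par+ {e + u} {v} (par+ {e} {u} ee (proj₁ odds)) (proj₂ odds))

      θ-θ : ∀ {u v e f u' v' e'} → u' + v ≡ f → v' + u ≡ f → e' + f ≡ e + u + v → θ (u' , v' , e' , f) ≡ (u , v , e , f)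
      θ-θ {u} {v} {e} {f} {u'} {v'} {e'} h1 h2 h3 = quad≡ (∸-eq h2) (∸-eq h1) (∸-eq {f} (lin {f + e} {e' + u' + v'} (sym h1 ⟨+⟩ sym h2 ⟨+⟩ sym h3) (solve (f ∷ e ∷ e' ∷ u' ∷ v' ∷ v ∷ u ∷ [])))) refl

    -- For fixed `f`, `θ` reflects `(u, v)` to `(f − v, f − u)`; its fixed points are the solutions
    -- with `f = u + v`, the ones counted by C₂.
    ♯T2 : ♯ T2 ≡ ♯ G0
    ♯T2 = ♯-fixed _≟Q_ T2 G0 θ
      (λ p → let (a , h1 , h2 , h3) = θ-hyps p in θ-P p a h1 h2 h3)
      (λ p → let (a , h1 , h2 , h3) = θ-hyps p in θ-θ h1 h2 h3)
      (λ {x} p → fix {x} p)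
      (λ {x} p → unfix {x} p)
      where
      fix : ∀ {x} → T2P x → θ x ≡ x → ((Ω D x × Om0 x) × U<V x) × F=S x
      fix {u , v , e , f} p eq = proj₁ (proj₁ p) , trans (sym (proj₁ (proj₂ (θ-hyps p)))) (cong (_+ v) (cong proj₁ eq))
      unfix : ∀ {x} → ((Ω D x × Om0 x) × U<V x) × F=S x → T2P x × θ x ≡ x
      unfix {u , v , e , .(u + v)} (t@((((u0 , v0 , e0 , f0) , h4) , ee , ef) , u<v) , refl) =
        ((t , ≤⇒≯ (m≤n+m v u)) , (lin≤ {suc (u + v)} {e + u + v} e0 (solve (u ∷ v ∷ e ∷ [])))) ,
        quad≡ (m+n∸n≡m u v) (m+n∸m≡n u v) (∸-eq {u + v} {e} (solve (u ∷ v ∷ e ∷ []))) refl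

    -- The excess of `f` over `e + u + v` becomes the new `e`, and the old `e` becomes the new `f`,
    -- which lies below `u + e`. Expanding `(u + e)(v + e)` shows that `D` is kept.
    ♯T4 : ♯ T4 ≡ ♯ (T ∩ f<u?)
    ♯T4 = ♯-bij T4 (T ∩ f<u?)
      (λ (u , v , e , f) → u + e , v + e , f ∸ (e + u + v) , e)
      (λ (u , v , e , f) → u ∸ f , v ∸ f , f , e + (u ∸ f) + v)
      to from
      (λ { {u , v , e , f} p → quad≡ (m+n∸n≡m u e) (m+n∸n≡m v e) refl (back p) })
      (λ { {u , v , e , f} p → let (h1 , h2) = hyps p in quad≡ h1 h2 (∸-eq {f + (u ∸ f) + (v ∸ f)} (fwd {u} {v} {e} {f} {u ∸ f} h2)) refl })
      where
      T4P : Quad → Set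
      T4P x = ((((Ω D x × Om0 x) × U<V x) × ¬ F<V x) × ¬ E<W x) × ¬ F=W x
      hyps : ∀ {u v e f} → (((Ω D (u , v , e , f)) × (Even e × Even f)) × u < v) × f < u → (u ∸ f + f ≡ u) × (v ∸ f + f ≡ v)
      hyps ((_ , u<v) , f<u) = m∸n+n≡m (<⇒≤ f<u) , m∸n+n≡m (<⇒≤ (<-trans f<u u<v))
      hyp : ∀ {u v e f} → T4P (u , v , e , f) → f ∸ (e + u + v) + (e + u + v) ≡ f
      hyp ((_ , f≮w) , _) = m∸n+n≡m (≮⇒≥ f≮w)
      back : ∀ {u v e f} → T4P (u , v , e , f) → f ∸ (e + u + v) + (u + e ∸ e) + (v + e) ≡ f
      back {u} {v} {e} {f} p = trans (cong (λ z → f ∸ (e + u + v) + z + (v + e)) (m+n∸n≡m u e)) (go (f ∸ (e + u + v)) (hyp p))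
        where
        go : ∀ k → k + (e + u + v) ≡ f → k + u + (v + e) ≡ f
        go k h = (lin {k + u + (v + e)} {f} (h) (solve (k ∷ u ∷ v ∷ e ∷ f ∷ [])))
      fwd : ∀ {u v e f a c} → c + f ≡ v → f + a + c + e ≡ e + a + v
      fwd {u} {v} {e} {f} {a} {c} h2 = (lin {f + a + c + e} {e + a + v} (h2) (solve (f ∷ a ∷ c ∷ e ∷ v ∷ [])))
      to : ∀ {x} → T4P x → let (u , v , e , f) = x in (((Ω D (u + e , v + e , f ∸ (e + u + v) , e)) × (Even (f ∸ (e + u + v)) × Even e)) × u + e < v + e) × e < u + e
      to {u , v , e , f} p@((((((((u0 , v0 , e0 , f0) , h4) , ee , ef) , u<v) , f≮v) , f≮w) , f≢w)) = go (f ∸ (e + u + v)) (hyp p)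
        where
        odds = odd0 {u} {v} {e} {f} h4 ee
        w<f = ≤∧≢⇒< (≮⇒≥ f≮w) (λ q → f≢w (sym q))
        go : ∀ k → k + (e + u + v) ≡ f → (((Ω D (u + e , v + e , k , e)) × (Even k × Even e)) × u + e < v + e) × e < u + e
        go k h = ((((m≤n⇒m≤n+o e u0 , m≤n⇒m≤n+o e v0 , (lin≤ {1} {k} w<f (lin (sym h) (solve (k ∷ e ∷ u ∷ v ∷ f ∷ [])))) , e0) , (lin {(u + e) * (v + e) + k * e} {D} (e ⟨*⟩ h ⟨+⟩ h4) (solve (u ∷ v ∷ e ∷ k ∷ D ∷ f ∷ [])))) ,
          par∸ {e + u + v} {_} {k} (trans (+-comm (e + u + v) k) h) (par+ {e + u} {v} (par+ {e} {u} ee (proj₁ odds)) (proj₂ odds)) ef , ee) , +-monoˡ-< e u<v) , m<n+m e u0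
      from : ∀ {x} → (((Ω D x) × Om0 x) × U<V x) × F<U x → let (u , v , e , f) = x in T4P (u ∸ f , v ∸ f , f , e + (u ∸ f) + v)
      from {u , v , e , f} p@((((((u0 , v0 , e0 , f0) , h4) , ee , ef) , u<v) , f<u)) = go (u ∸ f) (v ∸ f) (proj₁ (hyps p)) (proj₂ (hyps p))
        where
        odds = odd0 {u} {v} {e} {f} h4 ee
        go : ∀ a c → a + f ≡ u → c + f ≡ v → T4P (a , c , f , e + a + v)
        go a c h1 h2 = (((((((lin≤ {1} {a} f<u (lin (sym h1) (solve (a ∷ f ∷ u ∷ [])))) , (lin≤ {1} {c} (<-trans f<u u<v) (lin (sym h2) (solve (c ∷ f ∷ v ∷ [])))) , f0 , m≤n⇒m≤n+o v (m≤n⇒m≤n+o a e0)) , (lin {a * c + f * (e + a + v)} {D} (v ⟨*⟩ h1 ⟨+⟩ a ⟨*⟩ h2 ⟨+⟩ h4) (solve (a ∷ c ∷ e ∷ f ∷ v ∷ D ∷ u ∷ [])))) ,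
          ef , par+ {e + a} {v} (par+ {e} {a} ee (par∸ {f} {_} {a} (trans (+-comm f a) h1) ef (proj₁ odds))) (proj₂ odds)) , (lin≤ {suc a} {c} u<v (lin (h1 ⟨+⟩ sym h2) (solve (a ∷ c ∷ u ∷ v ∷ f ∷ []))))) ,
          ≤⇒≯ (lin≤ {c} {e + a + v} (z≤n {e + a + f}) (lin (h2) (solve (c ∷ e ∷ a ∷ v ∷ f ∷ []))))) , ≤⇒≯ (lin≤ {f + a + c} {e + a + v} (z≤n {e}) (lin (h2) (solve (f ∷ a ∷ c ∷ e ∷ v ∷ []))))) ,
          λ q → n≮n 0 (subst (0 <_) (go2 q) e0)
          where
          go2 : e + a + v ≡ f + a + c → e ≡ 0
          go2 q = +-cancelʳ-≡ (a + v) e 0 (trans (sym (+-assoc e a v)) (trans q (go3 h2)))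
            where
            go3 : c + f ≡ v → f + a + c ≡ 0 + (a + v)
            go3 h2 = (lin {f + a + c} {0 + (a + v)} (h2) (solve (f ∷ a ∷ c ∷ v ∷ [])))

    Z = Q0 ∩ f<u?
    Q1> = Q1 ∩ v<e?
    Q1≤ = Q1 ∩ ∁ v<e?
    κ = Q1≤ ∩ e=v?

    -- Moving `f` out of `u` and `v` into `e` keeps `uv + ef`, and `e` becomes odd because `v` is
    -- odd.
    ♯Z : ♯ Z ≡ ♯ Q1>
    ♯Z = ♯-bij Z Q1> (λ (u , v , e , f) → u ∸ f , v , e + v , f) (λ (u , v , e , f) → u + f , v , e ∸ v , f) to from
      (λ { {u , v , e , f} (_ , lt) → quad≡ (m∸n+n≡m (<⇒≤ lt)) refl (m+n∸n≡m e v) refl })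
      (λ { {u , v , e , f} (_ , lt) → quad≡ (m+n∸n≡m u f) refl (m∸n+n≡m (<⇒≤ lt)) refl })
      where
      to : ∀ {x} → (Ω D x × Om0 x) × F<U x → let (u , v , e , f) = x in (Ω D (u ∸ f , v , e + v , f) × (Odd (e + v) × Even f)) × v < e + v
      to {u , v , e , f} ((((u0 , v0 , e0 , f0) , h4) , ee , ef) , f<u) = go (u ∸ f) (m∸n+n≡m (<⇒≤ f<u))
        where
        go : ∀ a → a + f ≡ u → (Ω D (a , v , e + v , f) × (Odd (e + v) × Even f)) × v < e + v
        go a h1 = ((((lin≤ {1} {a} f<u (lin (sym h1) (solve (a ∷ f ∷ u ∷ [])))) , v0 , m≤n⇒m≤n+o v e0 , f0) , (lin {a * v + (e + v) * f} {D} (v ⟨*⟩ h1 ⟨+⟩ h4) (solve (a ∷ v ∷ e ∷ f ∷ D ∷ u ∷ [])))) , par+ {e} {v} ee (proj₂ (odd0 {u} {v} {e} {f} h4 ee)) , ef) , m<n+m v e0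
      from : ∀ {x} → (Ω D x × Om1 x) × V<E x → let (u , v , e , f) = x in (Ω D (u + f , v , e ∸ v , f) × (Even (e ∸ v) × Even f)) × f < u + f
      from {u , v , e , f} ((((u0 , v0 , e0 , f0) , h4) , oe , ef) , v<e) = go (e ∸ v) (m∸n+n≡m (<⇒≤ v<e))
        where
        go : ∀ a → a + v ≡ e → (Ω D (u + f , v , a , f) × (Even a × Even f)) × f < u + f
        go a h1 = (((m≤n⇒m≤n+o f u0 , v0 , (lin≤ {1} {a} v<e (lin (sym h1) (solve (a ∷ v ∷ e ∷ [])))) , f0) , (lin {(u + f) * v + a * f} {D} (f ⟨*⟩ h1 ⟨+⟩ h4) (solve (u ∷ v ∷ f ∷ a ∷ D ∷ e ∷ [])))) ,
          par∸ {v} {_} {a} (trans (+-comm v a) h1) (proj₂ (odd1 {u} {v} {e} {f} h4 ef)) oe , ef) , m<n+m f u0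

    -- Transposing `u` and `v` turns the half `v < u` of `Z` into the solutions of `T` with `f < v`,
    -- so both outer pieces of `T` occur in `Z`.
    ♯Z-split : ♯ Z ≡ ♯ (T ∩ f<u?) xor ♯ (T ∩ f<v?)
    ♯Z-split = trans (♯-split Z u<v?) (cong₂ _xor_
      (cong par (#-ext (Z ∩ u<v?) (T ∩ f<u?) (λ ((a , b) , c) → (a , c) , b) (λ ((a , b) , c) → (a , c) , b)))
      (♯-bij (Z ∩ ∁ u<v?) (T ∩ f<v?) (λ (u , v , e , f) → v , u , e , f) (λ (u , v , e , f) → v , u , e , f)
        to from (λ _ → refl) (λ _ → refl)))
      where
      to : ∀ {x} → ((Ω D x × Om0 x) × F<U x) × ¬ U<V x → let (u , v , e , f) = x in ((Ω D (v , u , e , f) × (Even e × Even f)) × v < u) × f < u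
      to {u , v , e , f} (((((u0 , v0 , e0 , f0) , eq) , ee , ef) , f<u) , u≮v) =
        ((((v0 , u0 , e0 , f0) , trans (cong (_+ e * f) (*-comm v u)) eq) , ee , ef) ,
          ≤∧≢⇒< (≮⇒≥ u≮v) (λ { refl → u²+ef≢7 u e f ee ef (trans (cong (_% 8) eq) m) })) , f<u
      from : ∀ {x} → ((Ω D x × Om0 x) × U<V x) × F<V x → let (u , v , e , f) = x in ((Ω D (v , u , e , f) × (Even e × Even f)) × f < v) × ¬ v < u
      from {u , v , e , f} (((((u0 , v0 , e0 , f0) , eq) , ee , ef) , u<v) , f<v) =
        ((((v0 , u0 , e0 , f0) , trans (cong (_+ e * f) (*-comm v u)) eq) , ee , ef) , f<v) , <-asym u<v

    -- Transposition leaves `u² + ef = D`. There `f = 2k` with `k` odd, so `e` and `k` may be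
    -- exchanged, and `e = k` is impossible modulo 8.
    ♯Q1 : ♯ Q1 ≡ false
    ♯Q1 = trans (♯-fixed _≟Q_ Q1 Q1= (λ (u , v , e , f) → v , u , e , f)
        (λ { {u , v , e , f} (((u0 , v0 , e0 , f0) , eq) , o) → ((v0 , u0 , e0 , f0) , trans (cong (_+ e * f) (*-comm v u)) eq) , o })
        (λ _ → refl) (λ p q → p , sym (cong proj₁ q)) (λ { {u , v , e , f} (p , refl) → p , refl }))
      (♯-free _≟Q_ Q1= (λ (u , v , e , f) → u , v , f / 2 , 2 * e) step
        (λ { {u , v , e , f} ((_ , _ , ef) , _) → back ef }) free)
      where
      u=v? : Decidable (λ ((u , v , e , f) : Quad) → u ≡ v)
      u=v? (u , v , e , f) = u ≟ v
      Q1= = Q1 ∩ u=v?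
      back : ∀ {u v e f} → Even f → (u , v , 2 * e / 2 , 2 * (f / 2)) ≡ (u , v , e , f)
      back {u} {v} {e} {f} ef with half {f} ef
      ... | k , refl = quad≡ refl refl (half-2* e) (cong (2 *_) (half-2* k))
      data⁺ : ∀ {x} → (Ω D x × Om1 x) × (let (u , v , e , f) = x in u ≡ v) → let (u , v , e , f) = x in
        ∃[ k ] f ≡ 2 * k × f / 2 ≡ k × Odd k × 0 < k × (u * u + e * (2 * k)) % 8 ≡ 7
      data⁺ {u , .u , e , f} (((((u0 , v0 , e0 , f0) , eq) , oe , ef)) , refl) with half {f} ef
      ... | k , refl = k , refl , half-2* k , ok , pos k ok , mm
        where
        mm = trans (cong (_% 8) eq) m
        ok = u²+2ek-odd u e k oe mm
        pos : ∀ k → Odd k → 0 < k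
        pos (suc k) _ = s≤s z≤n
      step : ∀ {x} → (Ω D x × Om1 x) × (let (u , v , e , f) = x in u ≡ v) → let (u , v , e , f) = x in (Ω D (u , v , f / 2 , 2 * e) × (Odd (f / 2) × Even (2 * e))) × u ≡ v
      step {u , .u , e , f} p@(((((u0 , v0 , e0 , f0) , eq) , oe , ef)) , refl) with data⁺ p
      ... | k , refl , hk , ok , k0 , mm rewrite hk =
        (((u0 , v0 , k0 , ≤-trans e0 (m≤m+n e (1 * e))) , trans (cong (u * u +_) (arith k e)) eq) , ok , even-2* e) , refl
        where
        arith : ∀ k e → k * (2 * e) ≡ e * (2 * k)
        arith = solve-∀
      free : ∀ {x} → (Ω D x × Om1 x) × (let (u , v , e , f) = x in u ≡ v) → let (u , v , e , f) = x in (u , v , f / 2 , 2 * e) ≢ x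
      free {u , .u , e , f} p@(_ , refl) q with data⁺ p
      ... | k , refl , hk , ok , k0 , mm with trans (sym hk) (cong (λ x → proj₁ (proj₂ (proj₂ x))) q)
      ... | refl = u²+2e²≢7 u e mm

    u²+2uf≢7 : ∀ u f → Even f → (u * (f + u) + u * f) % 8 ≢ 7
    u²+2uf≢7 u f ev mm with half {f} ev
    ... | k , refl = u²+ef≢7 u (2 * u) (2 * k) (even-2* u) (even-2* k) (trans (cong (_% 8) (arith u k)) mm)
      where
      arith : ∀ u k → u * u + 2 * u * (2 * k) ≡ u * (2 * k + u) + u * (2 * k)
      arith = solve-∀

    -- For `e < v` the involution `(u, v, e, f) ↦ (e, f + u, u, v − e)` is free: at a fixed point
    -- `D = u² + 2uf` with `f` even. Only `e = v` survives.
    ♯Q1≤ : ♯ Q1≤ ≡ ♯ κ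
    ♯Q1≤ = trans (♯-split Q1≤ e=v?) (trans (cong (♯ κ xor_) (♯-free _≟Q_ (Q1≤ ∩ ∁ e=v?) (λ (u , v , e , f) → e , f + u , u , v ∸ e) step
      (λ { {u , v , e , f} (((_ , ≮) , _)) → quad≡ refl (m∸n+n≡m (≮⇒≥ ≮)) refl (m+n∸n≡m f u) }) free)) (𝔹P.xor-identityʳ _))
      where
      step : ∀ {x} → ((Ω D x × Om1 x) × ¬ V<E x) × ¬ E=V x → let (u , v , e , f) = x in
        ((Ω D (e , f + u , u , v ∸ e) × (Odd u × Even (v ∸ e))) × ¬ f + u < u) × u ≢ f + u
      step {u , v , e , f} (((((u0 , v0 , e0 , f0) , h4) , oe , ef) , v≮e) , e≢v) = go (v ∸ e) (m∸n+n≡m (≮⇒≥ v≮e))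
        where
        odds = odd1 {u} {v} {e} {f} h4 ef
        e<v = ≤∧≢⇒< (≮⇒≥ v≮e) e≢v
        go : ∀ a → a + e ≡ v → ((Ω D (e , f + u , u , a) × (Odd u × Even a)) × ¬ f + u < u) × u ≢ f + u
        go a h1 = ((((e0 , m≤n⇒m≤n+o u f0 , u0 , (lin≤ {1} {a} e<v (lin (sym h1) (solve (a ∷ e ∷ v ∷ []))))) , (lin {e * (f + u) + u * a} {D} (u ⟨*⟩ h1 ⟨+⟩ h4) (solve (e ∷ f ∷ u ∷ a ∷ D ∷ v ∷ [])))) , proj₁ odds ,
          par∸ {e} {_} {a} (trans (+-comm e a) h1) oe (proj₂ odds)) , ≤⇒≯ (m≤n+m u f)) , λ q → <⇒≢ (m<n+m u f0) q
      free : ∀ {x} → ((Ω D x × Om1 x) × ¬ V<E x) × ¬ E=V x → let (u , v , e , f) = x in (e , f + u , u , v ∸ e) ≢ x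
      free {u , v , e , f} (((((u0 , v0 , e0 , f0) , h4) , oe , ef) , v≮e) , e≢v) q
        with cong proj₁ q | cong (λ x → proj₁ (proj₂ x)) q
      ... | refl | refl = u²+2uf≢7 u f ef (trans (cong (_% 8) h4) m)

    κ> = κ ∩ v<s?
    κ≤ = κ ∩ ∁ v<s?

    -- With `f = e + u + v` the equation is `(u + e)(v + e) = D`, with `e = v` it is
    -- `v (u + f) = D`. Both sides describe a factorisation of `D` together with a splitting of its
    -- smaller factor.
    ♯T3 : ♯ T3 ≡ ♯ κ≤
    ♯T3 = ♯-bij T3 κ≤ (λ (u , v , e , f) → u , v + e , v + e , e) (λ (u , v , e , f) → u , v ∸ f , f , u + v) to from
      (λ { {u , v , e , f} (_ , refl) → quad≡ refl (m+n∸n≡m v e) refl (arith u v e) })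
      (λ { {u , v , e , f} p → let h = m∸n+n≡m (<⇒≤ (≤-<-trans (m≤n+m f u) (lt p))) in quad≡ refl h (trans h (sym (proj₂ (proj₁ p)))) refl })
      where
      arith : ∀ u v e → u + (v + e) ≡ e + u + v
      arith = solve-∀
      T3P κP : Quad → Set
      T3P x = ((((Ω D x × Om0 x) × U<V x) × ¬ F<V x) × ¬ E<W x) × F=W x
      κP x = (((Ω D x × Om1 x) × ¬ V<E x) × E=V x) × ¬ V<S x
      lt : ∀ {u v e f} → κP (u , v , e , f) → u + f < v
      lt {u} {v} {.v} {f} ((((((u0 , v0 , e0 , f0) , h4) , oe , ef) , _) , refl) , v≮s) = ≤∧≢⇒< (≮⇒≥ v≮s)
        λ { refl → u²+ef≢7 (u + f) 0 0 refl refl (trans (cong (_% 8) (trans (sq u f) h4)) m) }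
        where
        sq : ∀ u f → (u + f) * (u + f) + 0 * 0 ≡ u * (u + f) + (u + f) * f
        sq = solve-∀
      to : ∀ {x} → T3P x → let (u , v , e , f) = x in κP (u , v + e , v + e , e)
      to {u , v , e , .(e + u + v)} (((((((u0 , v0 , e0 , f0) , h4) , ee , ef) , u<v) , f≮v) , f≮w) , refl) =
        (((((u0 , m≤n⇒m≤n+o e v0 , m≤n⇒m≤n+o e v0 , e0) , (lin {u * (v + e) + (v + e) * e} {D} (h4) (solve (u ∷ v ∷ e ∷ D ∷ [])))) , par+ {v} {e} (proj₂ (odd0 {u} {v} {e} {e + u + v} h4 ee)) ee , ee) ,
          n≮n _) , refl) , ≤⇒≯ (+-monoˡ-≤ e (<⇒≤ u<v))
      from : ∀ {x} → κP x → let (u , v , e , f) = x in T3P (u , v ∸ f , f , u + v)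
      from {u , v , .v , f} p@((((((u0 , v0 , e0 , f0) , h4) , oe , ef) , _) , refl) , v≮s) = go (v ∸ f) (m∸n+n≡m (<⇒≤ (≤-<-trans (m≤n+m f u) (lt p))))
        where
        u+f<v = lt p
        odds = odd1 {u} {v} {v} {f} h4 ef
        go : ∀ a → a + f ≡ v → T3P (u , a , f , u + v)
        go a h1 = ((((((u0 , ≤-trans u0 (<⇒≤ u<a) , f0 , m≤n⇒m≤n+o v u0) , (lin {u * a + f * (u + v)} {D} (u ⟨*⟩ h1 ⟨+⟩ h4) (solve (a ∷ u ∷ f ∷ v ∷ D ∷ [])))) , ef , par+ {u} {v} (proj₁ odds) (proj₂ odds)) , u<a) ,
          ≤⇒≯ (lin≤ {a} {u + v} (z≤n {u + f}) (lin (h1) (solve (a ∷ u ∷ v ∷ f ∷ []))))) , ≤⇒≯ (lin≤ {f + u + a} {u + v} (z≤n {0}) (lin (h1) (solve (f ∷ u ∷ a ∷ v ∷ []))))) , (lin {u + v} {f + u + a} (sym h1) (solve (u ∷ v ∷ f ∷ a ∷ [])))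
          where
          u<a : u < a
          u<a = (lin≤ {suc u} {a} u+f<v (lin (sym h1) (solve (u ∷ a ∷ f ∷ v ∷ []))))

    -- The larger factor of `v (u + f) = D` is split into an odd `u` and an even `f`. Exchanging `u`
    -- and `f − 1` leaves only the splitting `f = u + 1`, which exists exactly when that factor is 3
    -- modulo 4.
    ♯κ> : ♯ κ> ≡ ♯ K
    ♯κ> = trans (♯-fixed _≟Q_ κ> F (λ (u , v , e , f) → f ∸ 1 , v , e , suc u) step
        (λ { {u , v , e , suc f} p → refl ; {u , v , e , zero} (((((((_ , _ , _ , ()) , _) , _) , _) , _)) , _) })
        (λ { {u , v , e , f} p q → p , sym (cong (λ x → proj₂ (proj₂ (proj₂ x))) q) })
        (λ { {u , v , e , .(suc u)} (p , refl) → p , refl }))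
      (cong par (#-onto F K (λ (u , v , e , f) → v , u + f) toK inj onto))
      where
      f=u+1? : Decidable (λ ((u , v , e , f) : Quad) → f ≡ suc u)
      f=u+1? (u , v , e , f) = f ≟ suc u
      F = κ> ∩ f=u+1?
      κ>P : Quad → Set
      κ>P x = (((Ω D x × Om1 x) × ¬ V<E x) × E=V x) × V<S x
      step : ∀ {x} → κ>P x → let (u , v , e , f) = x in κ>P (f ∸ 1 , v , e , suc u)
      step {u , v , .v , suc f} ((((((u0 , v0 , e0 , f0) , h4) , oe , ef) , v≮e) , refl) , v<s) =
        (((((pos f ef , v0 , e0 , s≤s z≤n) , trans (arith u v f) h4) , oe , cong not (proj₁ (odd1 {u} {v} {v} {suc f} h4 ef))) , v≮e) , refl) ,
          ≤-trans v<s (≤-reflexive (arith₂ u f))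
        where
        pos : ∀ f → Even (suc f) → 0 < f
        pos (suc f) _ = s≤s z≤n
        arith : ∀ u v f → f * v + v * suc u ≡ u * v + v * suc f
        arith = solve-∀
        arith₂ : ∀ u f → u + suc f ≡ f + suc u
        arith₂ = solve-∀
      step {u , v , e , zero} (((((((_ , _ , _ , ()) , _) , _) , _) , _)) , _)
      toK : ∀ {x} → κ>P x × (let (u , v , e , f) = x in f ≡ suc u) → let (u , v , e , f) = x in (Π D (v , u + f) × v < u + f) × (u + f) % 4 ≡ 3
      toK {u , v , .v , .(suc u)} (((((((u0 , v0 , e0 , f0) , h4) , oe , ef) , v≮e) , refl) , v<s) , refl) =
        (((v0 , m≤n⇒m≤n+o (suc u) u0) , trans (arith u v) h4) , v<s) , mod (half {suc u} ef)
        where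
        arith : ∀ u v → v * (u + suc u) ≡ u * v + v * suc u
        arith = solve-∀
        mod : ∃[ k ] suc u ≡ 2 * k → (u + suc u) % 4 ≡ 3
        mod (zero , ())
        mod (suc k , e) = trans (cong (_% 4) (trans (cong₂ _+_ (suc-injective e) e) (arith₃ k))) ([m+kn]%n≡m%n 3 k 4)
          where
          arith₃ : ∀ k → k + 1 * suc k + 2 * suc k ≡ 3 + k * 4
          arith₃ = solve-∀
      inj : ∀ {x y} → κ>P x × (let (u , v , e , f) = x in f ≡ suc u) → κ>P y × (let (u , v , e , f) = y in f ≡ suc u) →
        (let (u , v , e , f) = x in (v , u + f)) ≡ (let (u , v , e , f) = y in (v , u + f)) → x ≡ y
      inj {u , v , .v , .(suc u)} {u′ , v′ , .v′ , .(suc u′)} (((_ , refl) , _) , refl) (((_ , refl) , _) , refl) q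
        with cong proj₁ q | *-cancelˡ-≡ u u′ 2 (dbl u u′ (cong proj₂ q))
        where
        dbl : ∀ u u′ → u + suc u ≡ u′ + suc u′ → 2 * u ≡ 2 * u′
        dbl u u′ q = trans (arith u) (trans (suc-injective (trans (sym (+-suc u u)) (trans q (+-suc u′ u′)))) (sym (arith u′)))
          where
          arith : ∀ u → 2 * u ≡ u + u
          arith = solve-∀
      ... | refl | refl = refl
      onto : ∀ {y} → (Π D y × (let (v , c) = y in v < c)) × V≡3 y → ∃[ x ] (κ>P x × (let (u , v , e , f) = x in f ≡ suc u)) × (let (u , v , e , f) = x in (v , u + f)) ≡ y
      onto {v , c} ((((v0 , c0) , eq) , v<c) , c3) = (1 + 2 * t , v , v , 2 + 2 * t) ,
        (((((((s≤s z≤n , v0 , v0 , s≤s z≤n) , eq′) , ov , ef) , n≮n _) , refl) , ≤-trans v<c (≤-reflexive ct)) , refl) , cong (v ,_) (sym ct)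
        where
        t = c / 4
        arith : ∀ t → 3 + t * 4 ≡ 1 + 2 * t + (2 + 2 * t)
        arith = solve-∀
        ct : c ≡ 1 + 2 * t + (2 + 2 * t)
        ct = trans (m≡m%n+[m/n]*n c 4) (trans (cong (_+ t * 4) c3) (arith t))
        arith₂ : ∀ t v → (1 + 2 * t) * v + v * (2 + 2 * t) ≡ v * (1 + 2 * t + (2 + 2 * t))
        arith₂ = solve-∀
        eq′ : (1 + 2 * t) * v + v * (2 + 2 * t) ≡ D
        eq′ = trans (arith₂ t v) (trans (cong (v *_) (sym ct)) eq)
        ef : Even (2 + 2 * t)
        ef = trans (cong (λ z → not (not z)) (even-2* t)) refl
        ov : Odd v
        ov = proj₂ (odd1 {1 + 2 * t} {v} {v} {2 + 2 * t} eq′ ef)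

    -- Modulo 2, `T` consists of its part `f < v`, of `G0`, of `T3` and of its part `f < u`. The two
    -- outer parts together are `Z`, hence `Q1>`, hence `Q1≤`, hence `T3` plus `K`; everything but
    -- `T` and `K` cancels.
    ♯G0 : ♯ G0 ≡ ♯ T xor ♯ K
    ♯G0 = xor-combine (♯ T) (♯ (T ∩ f<v?)) (♯ G0) (♯ T3) (♯ (T ∩ f<u?)) (♯ K)
      (trans (♯-split T f<v?) (cong (♯ (T ∩ f<v?) xor_) (trans (♯-split (T ∩ ∁ f<v?) f<w?) (cong₂ _xor_ ♯T2
        (trans (♯-split T34 f=w?) (cong (♯ T3 xor_) ♯T4))))))
      (trans (sym ♯Z-split) (trans ♯Z (xor-false (♯ Q1>) (trans (trans (cong (♯ Q1> xor_) (sym κ-split)) (sym (♯-split Q1 v<e?))) ♯Q1))))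
      where
      xor-false : ∀ a {b} → a xor b ≡ false → a ≡ b
      xor-false true  {true}  _ = refl
      xor-false false {false} _ = refl
      κ-split : ♯ Q1≤ ≡ ♯ T3 xor ♯ K
      κ-split = trans ♯Q1≤ (trans (♯-split κ v<s?) (trans (cong₂ _xor_ ♯κ> (sym ♯T3)) (𝔹P.xor-comm (♯ K) (♯ T3))))
      xor-combine : ∀ t tv g t3 a k → t ≡ tv xor (g xor (t3 xor a)) → a xor tv ≡ t3 xor k → g ≡ t xor k
      xor-combine t tv g t3 a k refl e = trans (xor-∧-Solver.solve 3 (λ g t3 k → g := g :+ (t3 :+ k) :+ (t3 :+ k)) refl g t3 k)
        (trans (cong (λ z → (g xor z) xor (t3 xor k)) (sym e)) (xor-∧-Solver.solve 5 (λ g t3 a tv k → g :+ (a :+ tv) :+ (t3 :+ k) := tv :+ (g :+ (t3 :+ a)) :+ k) refl g t3 a tv k))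
        where open xor-∧-Solver using (_:=_; _:+_)

  -- Indices of the double sum as factorisations of D.

  module CoefficientCounts where

    open Coefficients using (base; ε; Index; exponent; exponent₂; Indices; c₁; c₂)

    -- The factors of `8 · exponent − 1`: `lo` is the smaller one, and the Boolean records whether
    -- it is 3 or 1 modulo 4.
    lo : Bool → ℕ → ℕ
    lo true  j = 4 * j + 3
    lo false j = 4 * j + 1

    hi : Bool → ℕ → ℕ → ℕ
    hi true  r j = 8 * r + 4 * j + 5
    hi false r j = 8 * r + 4 * j + 7

    lo<hi : ∀ α r j → lo α j < hi α r j
    lo<hi true  r j = lin≤ {suc (4 * j + 3)} {8 * r + 4 * j + 5} (z≤n {8 * r + 1}) (solve (r ∷ j ∷ []))
    lo<hi false r j = lin≤ {suc (4 * j + 1)} {8 * r + 4 * j + 7} (z≤n {8 * r + 5}) (solve (r ∷ j ∷ []))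

    lo-mod : ∀ α j → lo α j % 4 ≡ lo α 0
    lo-mod true  j = trans (cong (_% 4) (trans (+-comm (4 * j) 3) (cong (3 +_) (*-comm 4 j)))) ([m+kn]%n≡m%n 3 j 4)
    lo-mod false j = trans (cong (_% 4) (trans (+-comm (4 * j) 1) (cong (1 +_) (*-comm 4 j)))) ([m+kn]%n≡m%n 1 j 4)

    lo-injective : ∀ {α β i j} → lo α i ≡ lo β j → α ≡ β × i ≡ j
    lo-injective {true}  {true}  {i} {j} e = refl , *-cancelˡ-≡ i j 4 (+-cancelʳ-≡ 3 (4 * i) (4 * j) e)
    lo-injective {false} {false} {i} {j} e = refl , *-cancelˡ-≡ i j 4 (+-cancelʳ-≡ 1 (4 * i) (4 * j) e)
    lo-injective {true}  {false} {i} {j} e with trans (sym (lo-mod true i)) (trans (cong (_% 4) e) (lo-mod false j))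
    ... | ()
    lo-injective {false} {true}  {i} {j} e with trans (sym (lo-mod false i)) (trans (cong (_% 4) e) (lo-mod true j))
    ... | ()

    hi-injective : ∀ α {r s} j → hi α r j ≡ hi α s j → r ≡ s
    hi-injective true  {r} {s} j e = *-cancelˡ-≡ r s 8 (+-cancelʳ-≡ (4 * j) (8 * r) (8 * s) (+-cancelʳ-≡ 5 (8 * r + 4 * j) (8 * s + 4 * j) e))
    hi-injective false {r} {s} j e = *-cancelˡ-≡ r s 8 (+-cancelʳ-≡ (4 * j) (8 * r) (8 * s) (+-cancelʳ-≡ 7 (8 * r + 4 * j) (8 * s + 4 * j) e))

    encode : Index → Pair
    encode (r , (α , j)) = lo α j , hi α r j

    encode-injective : ∀ {x y} → encode x ≡ encode y → x ≡ y
    encode-injective {r , (α , j)} {s , (β , i)} e with lo-injective {α} {β} {j} {i} (cong proj₁ e)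
    ... | refl , refl with hi-injective α {r} {s} j (cong proj₂ e)
    ... | refl = refl

    8*exponent : ∀ r α j → 8 * exponent (r , (α , j)) ≡ suc (lo α j * hi α r j)
    8*exponent r true  j = eq r j
      where
      eq : ∀ r j → 8 * (3 * r + 2 + (j * j + 2 * (j * suc r) + (j * j + 2 * (j * suc r)))) ≡ suc ((4 * j + 3) * (8 * r + 4 * j + 5))
      eq = solve-∀
    8*exponent r false j = eq r j
      where
      eq : ∀ r j → 8 * (r + 1 + (j * j + 2 * (j * suc r) + (j * j + 2 * (j * suc r)))) ≡ suc ((4 * j + 1) * (8 * r + 4 * j + 7))
      eq = solve-∀

    lo+hi : ∀ α r j → lo α j + hi α r j ≡ 8 * suc (r + j)
    lo+hi true  r j = eq r j
      where
      eq : ∀ r j → 4 * j + 3 + (8 * r + 4 * j + 5) ≡ 8 * suc (r + j)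
      eq = solve-∀
    lo+hi false r j = eq r j
      where
      eq : ∀ r j → 4 * j + 1 + (8 * r + 4 * j + 7) ≡ 8 * suc (r + j)
      eq = solve-∀

    8*exponent₂ : ∀ r α j m → 8 * exponent₂ ((r , (α , j)) , m) ≡ suc (lo α j * hi α r j + 2 * suc m * (lo α j + hi α r j))
    8*exponent₂ r α j m = trans (arith (exponent (r , (α , j))) (suc m) (suc (r + j))) (cong₂ (λ x y → x + 2 * suc m * y) (8*exponent r α j) (sym (lo+hi α r j)))
      where
      arith : ∀ a b c → 8 * (a + (b * c + b * c)) ≡ 8 * a + 2 * b * (8 * c)
      arith = solve-∀

    lo-pos : ∀ α j → 0 < lo α j
    lo-pos true  j = ≤-trans (s≤s z≤n) (m≤n+m 3 (4 * j))
    lo-pos false j = ≤-trans (s≤s z≤n) (m≤n+m 1 (4 * j))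

    -- Needed for surjectivity, since `lo + hi` is always a multiple of 8.
    u+v≡0 : ∀ u v e → Odd u → Even e → (u * v + e * (u + v)) % 8 ≡ 7 → (u + v) % 8 ≡ 0
    u+v≡0 u v e ou ee mm = trans (sym (_≡₈_.%≡ (res u +₈ res v))) (toWitness {a? = FinP.all? λ a → FinP.all? λ b → FinP.all? λ c →
        odd? (toℕ a) →-dec (even? (toℕ c) →-dec ((toℕ a * toℕ b + toℕ c * (toℕ a + toℕ b)) % 8 ≟ 7 →-dec (toℕ a + toℕ b) % 8 ≟ 0))} _
      (residue u) (residue v) (residue e) (trans (par-residue u) ou) (trans (par-residue e) ee)
      (trans (_≡₈_.%≡ (res u *₈ res v +₈ res e *₈ (res u +₈ res v))) mm))

    lo-of : ∀ u → Odd u → ∃[ α ] u ≡ lo α (u / 4)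
    lo-of u ou with u % 4 in eq | m≡m%n+[m/n]*n u 4 | m%n<n u 4
    ... | 1 | e | _ = false , trans e (trans (+-comm 1 (u / 4 * 4)) (cong (_+ 1) (*-comm (u / 4) 4)))
    ... | 3 | e | _ = true , trans e (trans (+-comm 3 (u / 4 * 4)) (cong (_+ 3) (*-comm (u / 4) 4)))
    ... | 0 | e | _ = contradiction (trans (cong par e) (par-* (u / 4) 4)) (λ p → even-odd-⊥ {u} (trans p (∧-falseʳ (par (u / 4)))) ou)
      where
      ∧-falseʳ : ∀ b → b ∧ false ≡ false
      ∧-falseʳ true  = refl
      ∧-falseʳ false = refl
    ... | 2 | e | _ = contradiction (trans (cong par e) (par+ {2} {u / 4 * 4} refl (par-* (u / 4) 4))) (λ p → even-odd-⊥ {u} (trans p (∧-falseʳ (par (u / 4)))) ou)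
      where
      ∧-falseʳ : ∀ b → b ∧ false ≡ false
      ∧-falseʳ true  = refl
      ∧-falseʳ false = refl
    ... | suc (suc (suc (suc _))) | _ | s≤s (s≤s (s≤s (s≤s ())))

    decode : ∀ u v e → Odd u → Even e → (u * v + e * (u + v)) % 8 ≡ 7 → u < v → ∃[ x ] encode x ≡ (u , v)
    decode u v e ou ee mm u<v with lo-of u ou
    ... | α , eu = (s ∸ suc j , (α , j)) , cong₂ _,_ (sym eu) (sym (+-cancelˡ-≡ u v (hi α (s ∸ suc j) j) (trans h1 (trans sum (trans (sym (lo+hi α (s ∸ suc j) j)) (cong (_+ hi α (s ∸ suc j) j) (sym eu)))))))
      where
      -- By `lo+hi` the sum `u + v` is `8 (r + j + 1)`; once `j = u / 4` is known this determines
      -- `r`, and `u < v` makes it non-negative.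
      s = (u + v) / 8
      j = u / 4
      h1 : u + v ≡ s * 8
      h1 = trans (m≡m%n+[m/n]*n (u + v) 8) (cong (_+ s * 8) (u+v≡0 u v e ou ee mm))
      4j≤ : ∀ α j → j * 4 < lo α j
      4j≤ true  j = lin≤ {suc (j * 4)} {4 * j + 3} (z≤n {2}) (solve (j ∷ []))
      4j≤ false j = lin≤ {suc (j * 4)} {4 * j + 1} (z≤n {0}) (solve (j ∷ []))
      u≤ : 2 * u < 2 * (s * 4)
      u≤ = go s h1
        where
        go : ∀ s → u + v ≡ s * 8 → 2 * u < 2 * (s * 4)
        go s h1 = (lin≤ {suc (2 * u)} {2 * (s * 4)} u<v (lin (h1) (solve (u ∷ s ∷ v ∷ []))))
      j<s : j < s
      j<s = *-cancelʳ-< 4 j s (<-trans (subst (j * 4 <_) (sym eu) (4j≤ α j)) (*-cancelˡ-< 2 u (s * 4) u≤))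
      sum : s * 8 ≡ 8 * suc (s ∸ suc j + j)
      sum = trans (*-comm s 8) (cong (8 *_) (trans (sym (m∸n+n≡m j<s)) (+-suc (s ∸ suc j) j)))

    module _ (N D : ℕ) (D+1 : suc D ≡ 8 * N) where

      D≡7 : D % 8 ≡ 7
      D≡7 = go N D+1
        where
        go : ∀ N → suc D ≡ 8 * N → D % 8 ≡ 7
        go zero ()
        go (suc N) e = trans (cong (_% 8) (suc-injective (trans e (arith N)))) ([m+kn]%n≡m%n 7 N 8)
          where
          arith : ∀ N → 8 * suc N ≡ suc (7 + N * 8)
          arith = solve-∀

      open LiouvilleMaps D D≡7

      exponent-D : ∀ r α j → exponent (r , (α , j)) ≡ N → lo α j * hi α r j ≡ D
      exponent-D r α j e = suc-injective (trans (sym (8*exponent r α j)) (trans (cong (8 *_) e) (sym D+1)))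

      base-pos : ∀ α r → r < base α r
      base-pos true  r = lin≤ {suc r} {3 * r + 2} (z≤n {2 * r + 1}) (solve (r ∷ []))
      base-pos false r = lin≤ {suc r} {r + 1} (z≤n {0}) (solve (r ∷ []))

      ε≥ : ∀ r j → j ≤ ε r j
      ε≥ r j = ≤-trans (≤-trans (m≤m*n j (suc r)) (m≤m+n (j * suc r) _)) (m≤n+m _ (j * j))

      -- The lists of indices stop below `N`; no index with exponent at most `N` is lost.
      in-box : ∀ r α j → exponent (r , (α , j)) ≤ N → r < N × (⊤ × j < N)
      in-box r α j e = ≤-trans (base-pos α r) (≤-trans (m≤m+n (base α r) _) e) , tt ,
        ≤-trans (+-mono-≤ (≤-trans (s≤s z≤n) (base-pos α r)) (≤-trans (ε≥ r j) (m≤m+n (ε r j) (ε r j)))) e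

      c₁≡ : c₁ N ≡ # (Pairs D ∩ u<v₂?)
      c₁≡ = #-onto (Indices N ∩ λ x → exponent x ≟ N) (Pairs D ∩ u<v₂?) encode
        (λ { {r , (α , j)} (_ , e) → ((lo-pos α j , <-trans (lo-pos α j) (lo<hi α r j)) , exponent-D r α j e) , lo<hi α r j })
        (λ {x} {y} _ _ → encode-injective {x} {y})
        (λ {y} → onto {y})
        where
        onto : ∀ {y} → Π D y × (let (u , v) = y in u < v) → ∃[ x ] (((let (r , (α , j)) = x in r < N × (⊤ × j < N)) × exponent x ≡ N) × encode x ≡ y)
        onto {u , v} (((u0 , v0) , eq) , u<v) = finish (decode u v 0 (proj₁ (odd0 {u} {v} {0} {0} eq′ refl)) refl (trans (cong (_% 8) eq′) D≡7) u<v) eq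
          where
          eq′ : u * v + 0 ≡ D
          eq′ = trans (+-identityʳ (u * v)) eq
          finish : ∀ {u v} → ∃[ x ] encode x ≡ (u , v) → u * v ≡ D →
            ∃[ x ] (((let (r , (α , j)) = x in r < N × (⊤ × j < N)) × exponent x ≡ N) × encode x ≡ (u , v))
          finish ((r , (α , j)) , refl) eq = (r , (α , j)) , (in-box r α j (≤-reflexive ex) , ex) , refl
            where
            ex : exponent (r , (α , j)) ≡ N
            ex = *-cancelˡ-≡ (exponent (r , (α , j))) N 8 (trans (8*exponent r α j) (trans (cong suc eq) D+1))

      c₂≡ : c₂ N ≡ # G0
      c₂≡ = #-onto ((Indices N ⊠ bounded (suc N)) ∩ λ x → exponent₂ x ≟ N) G0
        (λ ((r , (α , j)) , m) → lo α j , hi α r j , 2 * suc m , lo α j + hi α r j) (λ {x} → to {x}) (λ {x} {y} → inj {x} {y}) (λ {y} → onto {y})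
        where
        lo-odd : ∀ α j → Odd (lo α j)
        lo-odd true  j = par+ {4 * j} {3} (par-* 4 j) refl
        lo-odd false j = par+ {4 * j} {1} (par-* 4 j) refl
        hi-odd : ∀ α r j → Odd (hi α r j)
        hi-odd true  r j = par+ {8 * r + 4 * j} {5} (par+ {8 * r} {4 * j} (par-* 8 r) (par-* 4 j)) refl
        hi-odd false r j = par+ {8 * r + 4 * j} {7} (par+ {8 * r} {4 * j} (par-* 8 r) (par-* 4 j)) refl
        to : ∀ {x} → ((let ((r , (α , j)) , m) = x in (r < N × (⊤ × j < N)) × m < suc N) × exponent₂ x ≡ N) →
          let ((r , (α , j)) , m) = x; y = (lo α j , hi α r j , 2 * suc m , lo α j + hi α r j) in ((Ω D y × Om0 y) × U<V y) × F=S y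
        to {(r , (α , j)) , m} (_ , e) =
          ((((lo-pos α j , <-trans (lo-pos α j) (lo<hi α r j) , s≤s z≤n , m≤n⇒m≤n+o (hi α r j) (lo-pos α j)) ,
            suc-injective (trans (sym (8*exponent₂ r α j m)) (trans (cong (8 *_) e) (sym D+1)))) ,
            even-2* (suc m) , par+ {lo α j} {hi α r j} (lo-odd α j) (hi-odd α r j)) , lo<hi α r j) , refl
        inj : ∀ {x y} → ((let ((r , (α , j)) , m) = x in (r < N × (⊤ × j < N)) × m < suc N) × exponent₂ x ≡ N) →
          ((let ((r , (α , j)) , m) = y in (r < N × (⊤ × j < N)) × m < suc N) × exponent₂ y ≡ N) →
          (let ((r , (α , j)) , m) = x in _≡_ {A = Quad} (lo α j , hi α r j , 2 * suc m , lo α j + hi α r j)) (let ((r , (α , j)) , m) = y in (lo α j , hi α r j , 2 * suc m , lo α j + hi α r j)) → x ≡ y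
        inj {x , m} {y , m′} _ _ e = cong₂ _,_ (encode-injective {x} {y} (cong (λ (u , v , _) → u , v) e))
          (suc-injective (*-cancelˡ-≡ (suc m) (suc m′) 2 (cong (λ (_ , _ , z , _) → z) e)))
        onto : ∀ {y} → ((Ω D y × Om0 y) × U<V y) × F=S y → ∃[ x ] (((let ((r , (α , j)) , m) = x in (r < N × (⊤ × j < N)) × m < suc N) × exponent₂ x ≡ N) ×
          (let ((r , (α , j)) , m) = x in (lo α j , hi α r j , 2 * suc m , lo α j + hi α r j)) ≡ y)
        onto {u , v , e , .(u + v)} (((((u0 , v0 , e0 , f0) , eq) , ee , ef) , u<v) , refl) =
          finish (decode u v e (proj₁ (odd0 {u} {v} {e} {u + v} eq ee)) ee (trans (cong (_% 8) eq) D≡7) u<v) (half {e} ee) e0 eq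
          where
          finish : ∀ {u v e} → ∃[ x ] encode x ≡ (u , v) → ∃[ k ] e ≡ 2 * k → 0 < e → u * v + e * (u + v) ≡ D →
            ∃[ x ] (((let ((r , (α , j)) , m) = x in (r < N × (⊤ × j < N)) × m < suc N) × exponent₂ x ≡ N) ×
              (let ((r , (α , j)) , m) = x in (lo α j , hi α r j , 2 * suc m , lo α j + hi α r j)) ≡ (u , v , e , u + v))
          finish _ (zero , refl) e0 eq = contradiction e0 (n≮n 0)
          finish ((r , (α , j)) , refl) (suc m , refl) e0 eq = ((r , (α , j)) , m) , ((in-box r α j (≤-trans (m≤m+n _ _) (≤-reflexive ex)) ,
            s≤s (≤-trans (n≤1+n m) (≤-trans (m≤m*n (suc m) (suc (r + j))) (≤-trans (m≤m+n _ _) (≤-trans (m≤n+m _ (exponent (r , (α , j)))) (≤-reflexive ex)))))) , ex) , refl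
            where
            ex : exponent₂ ((r , (α , j)) , m) ≡ N
            ex = *-cancelˡ-≡ (exponent₂ ((r , (α , j)) , m)) N 8 (trans (8*exponent₂ r α j m) (trans (cong suc eq) D+1))

  -- The involution ι.

  module Iota (D : ℕ) (oD : Odd D) where

    -- Two of the three parity classes of S0 are exchanged by ι, u > e and u < e deciding which two; the third is preserved.
    S0 U=E : Quad → Set
    S0 (u , v , e , f) = par e ≡ par f × ¬ (Even u × Even v)
    U=E (u , v , e , f) = u ≡ e

    s0? : Decidable S0
    s0? (u , v , e , f) = par e 𝔹P.≟ par f ×-dec ¬? (even? u ×-dec even? v)

    u=e? : Decidable U=E
    u=e? (u , v , e , f) = u ≟ e

    -- In terms of the matrix with rows `(u, − e)` and `(f, v)`, whose determinant is `D`: the rows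
    -- are swapped, and the columns `c₁`, `c₂` become `c₁ + c₂`, `− c₂` if `e < u`, and `c₁`,
    -- `− (c₁ + c₂)` otherwise. Both column operations are involutions of determinant `− 1`, so `D`
    -- is preserved.
    ι : Quad → Quad
    ι (u , v , e , f) with e <? u
    ... | yes _ = f + v , e , v , u ∸ e
    ... | no _  = f , e ∸ u , v + f , u

    ι-hi : ∀ {u v e f} → e < u → ι (u , v , e , f) ≡ (f + v , e , v , u ∸ e)
    ι-hi {u} {v} {e} {f} lt with e <? u
    ... | yes _ = refl
    ... | no n  = contradiction lt n

    ι-lo : ∀ {u v e f} → ¬ e < u → ι (u , v , e , f) ≡ (f , e ∸ u , v + f , u)
    ι-lo {u} {v} {e} {f} nlt with e <? u
    ... | yes p = contradiction p nlt
    ... | no _  = refl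

    Ω-par : ∀ {u v e f} → u * v + e * f ≡ D → (par u ∧ par v) xor (par e ∧ par f) ≡ true
    Ω-par {u} {v} {e} {f} eq = trans (sym (par+ {u * v} {e * f} (par-* u v) (par-* e f))) (trans (cong par eq) oD)

    hi-par : ∀ a b c d → (a ∧ b) xor (c ∧ d) ≡ true → c ≡ d → ¬ (a ≡ false × b ≡ false) → (b ≡ c xor a) × ¬ (d xor b ≡ false × c ≡ false)
    hi-par true  true  false .false _ refl _ = refl , λ { (() , _) }
    hi-par true  false true  .true  _ refl _ = refl , λ { (_ , ()) }
    hi-par false true  true  .true  _ refl _ = refl , λ { (_ , ()) }
    hi-par false false c d _ _ n = contradiction (refl , refl) n

    lo-par : ∀ a b c d → (a ∧ b) xor (c ∧ d) ≡ true → c ≡ d → ¬ (a ≡ false × b ≡ false) → (b xor d ≡ a) × ¬ (d ≡ false × a xor c ≡ false)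
    lo-par true  true  false .false _ refl _ = refl , λ { (_ , ()) }
    lo-par true  false true  .true  _ refl _ = refl , λ { (() , _) }
    lo-par false true  true  .true  _ refl _ = refl , λ { (() , _) }
    lo-par false false c d _ _ n = contradiction (refl , refl) n

    V : Quad → Set
    V x = (Ω D x × S0 x) × ¬ U=E x

    ι-V-hi : ∀ {u v e f} → e < u → V (u , v , e , f) → V (f + v , e , v , u ∸ e)
    ι-V-hi {u} {v} {e} {f} lt ((((u0 , v0 , e0 , f0) , h4) , s , n) , _) = go (u ∸ e) (m∸n+n≡m (<⇒≤ lt))
      where
      go : ∀ a → a + e ≡ u → V (f + v , e , v , a)
      go a h1 = (((m≤n⇒m≤n+o v f0 , e0 , v0 , (lin≤ {1} {a} lt (lin (sym h1) (solve (a ∷ e ∷ u ∷ []))))) , (lin {(f + v) * e + v * a} {D} (v ⟨*⟩ h1 ⟨+⟩ h4) (solve (e ∷ f ∷ v ∷ a ∷ D ∷ u ∷ [])))) ,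
        trans (proj₁ P) (sym (par∸ {e} {u} {a} (trans (+-comm e a) h1) refl refl)) , λ (x , y) → proj₂ P (trans (sym (par-+ f v)) x , y)) ,
        λ q → <⇒≢ (m<n+m v f0) (sym q)
        where
        P = hi-par (par u) (par v) (par e) (par f) (Ω-par {u} {v} {e} {f} h4) s n

    ι-V-lo : ∀ {u v e f} → ¬ e < u → V (u , v , e , f) → V (f , e ∸ u , v + f , u)
    ι-V-lo {u} {v} {e} {f} nlt ((((u0 , v0 , e0 , f0) , h4) , s , n) , u≢e) = go (e ∸ u) (m∸n+n≡m (≮⇒≥ nlt))
      where
      u<e = ≤∧≢⇒< (≮⇒≥ nlt) u≢e
      go : ∀ a → a + u ≡ e → V (f , a , v + f , u)
      go a h1 = (((f0 , (lin≤ {1} {a} u<e (lin (sym h1) (solve (a ∷ u ∷ e ∷ [])))) , m≤n⇒m≤n+o f v0 , u0) , (lin {f * a + (v + f) * u} {D} (f ⟨*⟩ h1 ⟨+⟩ h4) (solve (a ∷ f ∷ u ∷ v ∷ D ∷ e ∷ [])))) ,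
        trans (par-+ v f) (proj₁ P) , λ (x , y) → proj₂ P (x , trans (sym (par∸ {u} {e} {a} (trans (+-comm u a) h1) refl refl)) y)) ,
        λ q → <⇒≢ (m<n+m f v0) q
        where
        P = lo-par (par u) (par v) (par e) (par f) (Ω-par {u} {v} {e} {f} h4) s n

    ι-V : ∀ {x} → V x → V (ι x)
    ι-V {u , v , e , f} p = by (e <? u)
      where
      by : Dec (e < u) → V (ι (u , v , e , f))
      by (yes lt) = subst V (sym (ι-hi lt)) (ι-V-hi lt p)
      by (no nlt) = subst V (sym (ι-lo nlt)) (ι-V-lo nlt p)

    ι-ι : ∀ {x} → V x → ι (ι x) ≡ x
    ι-ι {u , v , e , f} p@((((u0 , v0 , e0 , f0) , h4) , s , n) , u≢e) = by (e <? u)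
      where
      by : Dec (e < u) → ι (ι (u , v , e , f)) ≡ (u , v , e , f)
      by (yes lt) = trans (cong ι (ι-hi lt)) (trans (ι-hi (m<n+m v f0)) (quad≡ (m∸n+n≡m (<⇒≤ lt)) refl refl (m+n∸n≡m f v)))
      by (no nlt) = trans (cong ι (ι-lo nlt)) (trans (ι-lo (≤⇒≯ (m≤n+m f v))) (quad≡ refl (m+n∸n≡m v f) (m∸n+n≡m (≮⇒≥ nlt)) refl))

    fix? : Decidable (λ x → ι x ≡ x)
    fix? x = ι x ≟Q x

    fixed-hi : ∀ {u v e f} → e < u → ι (u , v , e , f) ≡ (u , v , e , f) → e ≡ v × u ≡ f + v
    fixed-hi lt q with trans (sym (ι-hi lt)) q
    ... | r = cong (λ (_ , v , _) → v) r , sym (cong proj₁ r)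

    fixed-lo : ∀ {u v e f} → ¬ e < u → ι (u , v , e , f) ≡ (u , v , e , f) → f ≡ u × e ≡ v + f
    fixed-lo nlt q with trans (sym (ι-lo nlt)) q
    ... | r = cong proj₁ r , sym (cong (λ (_ , _ , e , _) → e) r)

    module _ {Y : Quad → Set} (Y? : Decidable Y) (Y-ι : ∀ {x} → V x → Y x → Y (ι x)) where

      -- The condition `Y` is arbitrary because the count is used both for all of `S0` and for the
      -- solutions with square row ratio.
      ♯-ι : ♯ (Quads D ∩ s0? ∩ Y?) ≡ ♯ (Quads D ∩ s0? ∩ Y? ∩ u=e?) xor ♯ (Quads D ∩ s0? ∩ Y? ∩ ∁ u=e? ∩ fix?)
      ♯-ι = trans (♯-split E u=e?) (cong (♯ (E ∩ u=e?) xor_)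
        (♯-fixed _≟Q_ (E ∩ ∁ u=e?) (E ∩ ∁ u=e? ∩ fix?) ι
          (λ { {x} ((o , y) , n) → let ((o′ , n′)) = ι-V {x} (o , n) in (o′ , Y-ι (o , n) y) , n′ })
          (λ ((o , _) , n) → ι-ι (o , n)) _,_ (λ p → p)))
        where
        E = Quads D ∩ s0? ∩ Y?

  -- Solutions with e and f even for a nonsquare P ≡ 1 (4).

  module EvenSolutions (P : ℕ) (P≡1 : P % 4 ≡ 1) (nonsquare : ∀ s → s * s ≢ P) where

    oP : Odd P
    oP = odd-mod4 {P} (inj₁ P≡1)

    open Iota P oP

    E1 = Quads P ∩ s0?

    ⊤? : Decidable (λ (_ : Quad) → ⊤)
    ⊤? _ = yes tt

    x[x+2f]≡3 : ∀ {x f} → Odd x → Odd f → (x * (x + 2 * f)) % 4 ≡ 3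
    x[x+2f]≡3 {x} {f} ox of = go (odd-half {x} ox) (odd-half {f} of)
      where
      arith : ∀ a b → suc (2 * a) * (suc (2 * a) + 2 * suc (2 * b)) ≡ 3 + (a * a + 2 * a * b + 2 * a + b) * 4
      arith = solve-∀
      go : ∃[ a ] x ≡ suc (2 * a) → ∃[ b ] f ≡ suc (2 * b) → (x * (x + 2 * f)) % 4 ≡ 3
      go (a , ea) (b , eb) = 4k+ 3 (a * a + 2 * a * b + 2 * a + b) (trans (cong₂ (λ x f → x * (x + 2 * f)) ea eb) (arith a b))

    ≢3 : ∀ {n} → n ≡ P → n % 4 ≢ 3
    ≢3 refl e with trans (sym P≡1) e
    ... | ()

    -- The two classes of `S0` with `e` and `f` odd are exchanged by transposition and cancel.
    ♯S0 : ♯ (Quads P ∩ om0?) ≡ ♯ E1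
    ♯S0 = sym (trans (♯-split E1 ev?) (trans (cong₂ _xor_
        (cong par (#-ext (E1 ∩ ev?) (Quads P ∩ om0?) (λ { {u , v , e , f} p → toOm0 p }) (λ { {u , v , e , f} p → fromOm0 p })))
        (trans (♯-split (E1 ∩ ∁ ev?) uv?) (trans (cong (_xor ♯ (E1 ∩ ∁ ev? ∩ ∁ uv?))
          (♯-bij (E1 ∩ ∁ ev? ∩ uv?) (E1 ∩ ∁ ev? ∩ ∁ uv?) sw sw (λ { {u , v , e , f} p → to p }) (λ { {u , v , e , f} p → from p }) (λ _ → refl) (λ _ → refl)))
          (𝔹P.xor-same (♯ (E1 ∩ ∁ ev? ∩ ∁ uv?))))))
      (𝔹P.xor-identityʳ _)))
      where
      Ev Uv : Quad → Set
      Ev (u , v , e , f) = Even e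
      Uv (u , v , e , f) = Even u
      ev? : Decidable Ev
      ev? (u , v , e , f) = even? e
      uv? : Decidable Uv
      uv? (u , v , e , f) = even? u
      sw : Quad → Quad
      sw (u , v , e , f) = v , u , f , e
      swΩ : ∀ {u v e f} → Ω P (u , v , e , f) → Ω P (v , u , f , e)
      swΩ {u} {v} {e} {f} ((u0 , v0 , e0 , f0) , eq) = (v0 , u0 , f0 , e0) , trans (cong₂ _+_ (*-comm v u) (*-comm f e)) eq
      toOm0 : ∀ {u v e f} → (Ω P (u , v , e , f) × S0 (u , v , e , f)) × Even e → Ω P (u , v , e , f) × (Even e × Even f)
      toOm0 ((o , s , _) , ee) = o , ee , trans (sym s) ee
      fromOm0 : ∀ {u v e f} → Ω P (u , v , e , f) × (Even e × Even f) → (Ω P (u , v , e , f) × S0 (u , v , e , f)) × Even e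
      fromOm0 {u} {v} {e} {f} (o , ee , ef) = (o , trans ee (sym ef) , λ (eu , _) → even-odd-⊥ {u} eu (proj₁ (odd-Ω {u = u} {v} {e} {f} oP (proj₂ o) (cong (_∧ par f) ee)))) , ee
      to : ∀ {u v e f} → ((Ω P (u , v , e , f) × S0 (u , v , e , f)) × ¬ Even e) × Even u → ((Ω P (v , u , f , e) × S0 (v , u , f , e)) × ¬ Even f) × ¬ Even v
      to {f = f} (((o , s , n) , oe) , eu) = ((swΩ o , sym s , λ (a , b) → n (b , a)) , λ ef → oe (trans s ef)) , λ evn → n (eu , evn)
      from : ∀ {u v e f} → ((Ω P (u , v , e , f) × S0 (u , v , e , f)) × ¬ Even e) × ¬ Even u → ((Ω P (v , u , f , e) × S0 (v , u , f , e)) × ¬ Even f) × Even v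
      from {u} {v} {e} {f} (((o , s , n) , oe) , ou) = ((swΩ o , sym s , λ (a , b) → n (b , a)) , λ ef → oe (trans s ef)) ,
        ¬odd⇒even {v} λ ov → bad (par u) (par v) (par e) (par f) (Ω-par {u} {v} {e} {f} (proj₂ o)) (¬even⇒odd {u} ou) ov (¬even⇒odd {e} oe) (trans (sym s) (¬even⇒odd {e} oe))
        where
        bad : ∀ a b c d → (a ∧ b) xor (c ∧ d) ≡ true → a ≡ true → b ≡ true → c ≡ true → d ≡ true → ⊥
        bad true true true true () _ _ _ _

    EndP : Quad → Set
    EndP x = ((Ω P x × S0 x) × ⊤) × U=E x

    end-parity : ∀ {u v e f} → EndP (u , v , e , f) → Odd u × Even v × Odd f
    end-parity {u} {v} {.u} {f} (((((u0 , v0 , e0 , f0) , eq) , s , n) , tt) , refl) = ou , ev , trans (sym s) ou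
      where
      odds = odd-*⁻ u (v + f) (trans (cong par (trans (*-distribˡ-+ u v f) eq)) oP)
      ou = proj₁ odds
      ev : Even v
      ev = par∸ {f} {v + f} {v} (+-comm f v) (trans (sym s) ou) (proj₂ odds)

    -- For `u = e` the equation is `u (v + f) = P` with `v` even and `f` odd. Exchanging `v` and
    -- `f + 1` leaves the factorisations with second factor 3 modulo 4; then the first factor is 3
    -- as well, and swapping them is free because `P` is not a square.
    ♯ends : ♯ (E1 ∩ ⊤? ∩ u=e?) ≡ false
    ♯ends = trans (♯-fixed _≟Q_ (E1 ∩ ⊤? ∩ u=e?) Fx (λ (u , v , e , f) → u , suc f , e , v ∸ 1) (λ { {u , v , e , f} p → step p })
        (λ { {u , suc v , e , f} p → refl ; {u , zero , e , f} ((((((_ , () , _) , _) , _) , _) , _)) })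
        (λ { {u , v , e , f} p q → p , sym (cong (λ (_ , v , _) → v) q) })
        (λ { {u , .(suc f) , e , f} (p , refl) → p , refl }))
      (trans (cong par (#-onto Fx (Pairs P ∩ v≡3?) (λ (u , v , e , f) → u , v + f) (λ { {u , v , e , f} p → toPair p }) (λ { {u , v , e , f} {u′ , v′ , e′ , f′} p p′ q → inj p p′ q })
        (λ { {h , M} p → onto p })))
      (♯-free _≟P_ (Pairs P ∩ v≡3?) (λ (u , v) → v , u) (λ { {h , M} (((h0 , M0) , eq) , m3) → ((M0 , h0) , trans (*-comm M h) eq) , h≡3 h M eq m3 }) (λ _ → refl)
        (λ { {h , M} ((_ , eq) , _) q → nonsquare h (trans (cong (h *_) (sym (cong proj₁ q))) eq) })))
      where
      v=f+1? : Decidable (λ ((u , v , e , f) : Quad) → v ≡ suc f)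
      v=f+1? (u , v , e , f) = v ≟ suc f
      Fx = E1 ∩ ⊤? ∩ u=e? ∩ v=f+1?
      step : ∀ {u v e f} → EndP (u , v , e , f) → EndP (u , suc f , e , v ∸ 1)
      step {u} {suc v} {.u} {f} p@(((((u0 , v0 , e0 , f0) , eq) , s , n) , tt) , refl) =
        ((((u0 , s≤s z≤n , e0 , pos v (proj₁ (proj₂ (end-parity p)))) , trans (arith u v f) eq) , trans (proj₁ (end-parity p)) (sym (𝔹P.not-injective (proj₁ (proj₂ (end-parity p))))) ,
          λ (eu , _) → even-odd-⊥ {u} eu (proj₁ (end-parity p))) , tt) , refl
        where
        pos : ∀ v → Even (suc v) → 0 < v
        pos (suc v) _ = s≤s z≤n
        arith : ∀ u v f → u * suc f + u * v ≡ u * suc v + u * f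
        arith = solve-∀
      step {v = zero} (((((_ , () , _) , _) , _) , _) , _)
      toPair : ∀ {u v e f} → EndP (u , v , e , f) × v ≡ suc f → Π P (u , v + f) × (v + f) % 4 ≡ 3
      toPair {u} {.(suc f)} {.u} {f} (p@(((((u0 , v0 , e0 , f0) , eq) , s , n) , tt) , refl) , refl) =
        ((u0 , s≤s z≤n) , trans (*-distribˡ-+ u (suc f) f) eq) , go (odd-half {f} (proj₂ (proj₂ (end-parity p))))
        where
        arith : ∀ b → suc (suc (2 * b)) + suc (2 * b) ≡ 3 + b * 4
        arith = solve-∀
        go : ∃[ b ] f ≡ suc (2 * b) → (suc f + f) % 4 ≡ 3
        go (b , eb) = 4k+ 3 b (trans (cong (λ f → suc f + f) eb) (arith b))
      inj : ∀ {u v e f u′ v′ e′ f′} → EndP (u , v , e , f) × v ≡ suc f → EndP (u′ , v′ , e′ , f′) × v′ ≡ suc f′ →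
        _≡_ {A = Pair} (u , v + f) (u′ , v′ + f′) → _≡_ {A = Quad} (u , v , e , f) (u′ , v′ , e′ , f′)
      inj {u} {.(suc f)} {.u} {f} {u′} {.(suc f′)} {.u′} {f′} ((_ , refl) , refl) ((_ , refl) , refl) q = same (cong proj₁ q) (*-cancelˡ-≡ f f′ 2 (trans (dbl f) (trans (suc-injective (cong proj₂ q)) (sym (dbl f′)))))
        where
        dbl : ∀ f → 2 * f ≡ f + f
        dbl = solve-∀
        same : u ≡ u′ → f ≡ f′ → _≡_ {A = Quad} (u , suc f , u , f) (u′ , suc f′ , u′ , f′)
        same refl refl = refl
      onto : ∀ {h M} → Π P (h , M) × M % 4 ≡ 3 → ∃[ x ] (EndP x × (let (u , v , e , f) = x in v ≡ suc f)) × (let (u , v , e , f) = x in (u , v + f)) ≡ (h , M)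
      onto {h} {M} (((h0 , M0) , eq) , m3) = (h , suc f , h , f) ,
        ((((((h0 , s≤s z≤n , h0 , s≤s z≤n) , trans (sym (*-distribˡ-+ h (suc f) f)) (trans (cong (h *_) (sym M≡)) eq)) , trans oh (sym of) , λ (eh , _) → even-odd-⊥ {h} eh oh) , tt) , refl) , refl) ,
        cong (h ,_) (sym M≡)
        where
        t = M / 4
        f = suc (2 * t)
        of : Odd f
        of = cong not (even-2* t)
        oh : Odd h
        oh = proj₁ (odd-*⁻ h M (trans (cong par eq) oP))
        arith : ∀ t → 3 + t * 4 ≡ suc (suc (2 * t)) + suc (2 * t)
        arith = solve-∀
        M≡ : M ≡ suc f + f
        M≡ = trans (m≡m%n+[m/n]*n M 4) (trans (cong (_+ t * 4) m3) (arith t))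
      h≡3 : ∀ h M → h * M ≡ P → M % 4 ≡ 3 → h % 4 ≡ 3
      h≡3 h M eq m3 = go (mod4-odd {h} (proj₁ (odd-*⁻ h M (trans (cong par eq) oP))))
        where
        go : h % 4 ≡ 1 ⊎ h % 4 ≡ 3 → h % 4 ≡ 3
        go (inj₂ e) = e
        go (inj₁ e) = contradiction (trans (%-distribˡ-* h M 4) (cong₂ (λ a b → (a * b) % 4) e m3)) (≢3 eq)

    FixP : Quad → Set
    FixP x = (((Ω P x × S0 x) × ⊤) × ¬ U=E x) × ι x ≡ x

    -- A fixed point with `e < u` would give `P = v (v + 2f)` with `v` and `f` odd, which is 3
    -- modulo 4.
    fix-shape : ∀ {u v e f} → FixP (u , v , e , f) → f ≡ u × e ≡ v + u × Even v
    fix-shape {u} {v} {e} {f} (((((((u0 , v0 , e0 , f0) , eq) , s , n)) , tt) , u≢e) , q) = by (e <? u)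
      where
      by : Dec (e < u) → f ≡ u × e ≡ v + u × Even v
      by (yes lt) = hi (fixed-hi lt q) s eq
        where
        hi : e ≡ v × u ≡ f + v → par e ≡ par f → u * v + e * f ≡ P → f ≡ u × e ≡ v + u × Even v
        hi (refl , refl) s eq = contradiction (x[x+2f]≡3 {v} {f} ov (trans (sym s) ov)) (≢3 (trans (arith v f) eq))
          where
          arith : ∀ v f → v * (v + 2 * f) ≡ (f + v) * v + v * f
          arith = solve-∀
          ov : Odd v
          ov = proj₁ (odd-*⁻ v (v + 2 * f) (trans (cong par (trans (arith v f) eq)) oP))
      by (no nlt) = lo (fixed-lo nlt q) s
        where
        lo : f ≡ u × e ≡ v + f → par e ≡ par f → f ≡ u × e ≡ v + u × Even v
        lo (refl , refl) s = refl , refl , trans (par∸ {f} {v + f} {v} (+-comm f v) refl s) (𝔹P.xor-same (par f))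

    -- The remaining fixed points satisfy `P = u (u + 2v)`. Conversely two factors of `P` agree
    -- modulo 4, so half their difference is even, as `S0` demands.
    ♯fixed : ♯ (E1 ∩ ⊤? ∩ ∁ u=e? ∩ fix?) ≡ ♯ (Pairs P ∩ u<v₂?)
    ♯fixed = cong par (#-onto (E1 ∩ ⊤? ∩ ∁ u=e? ∩ fix?) (Pairs P ∩ u<v₂?) (λ (u , v , e , f) → u , u + 2 * v) (λ { {u , v , e , f} p → to p })
      (λ { {u , v , e , f} {u′ , v′ , e′ , f′} p p′ q → inj (fix-shape p) (fix-shape p′) q }) (λ { {x , y} p → onto p }))
      where
      arith : ∀ u v → u * (u + 2 * v) ≡ u * v + (v + u) * u
      arith = solve-∀
      to : ∀ {u v e f} → FixP (u , v , e , f) → Π P (u , u + 2 * v) × u < u + 2 * v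
      to {u} {v} {e} {f} p@(((((((u0 , v0 , e0 , f0) , eq) , s , n)) , tt) , u≢e) , q) = go (fix-shape p) eq
        where
        go : f ≡ u × e ≡ v + u × Even v → u * v + e * f ≡ P → Π P (u , u + 2 * v) × u < u + 2 * v
        go (refl , refl , _) eq = ((u0 , m≤n⇒m≤n+o (2 * v) u0) , trans (arith u v) eq) , m<m+n u (≤-trans v0 (m≤m+n v (1 * v)))
      inj : ∀ {u v e f u′ v′ e′ f′} → f ≡ u × e ≡ v + u × Even v → f′ ≡ u′ × e′ ≡ v′ + u′ × Even v′ → _≡_ {A = Pair} (u , u + 2 * v) (u′ , u′ + 2 * v′) →
        _≡_ {A = Quad} (u , v , e , f) (u′ , v′ , e′ , f′)
      inj {u} {v} {u′ = u′} {v′} (refl , refl , _) (refl , refl , _) q = same (cong proj₁ q) (cong proj₂ q)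
        where
        same : u ≡ u′ → u + 2 * v ≡ u′ + 2 * v′ → _≡_ {A = Quad} (u , v , v + u , u) (u′ , v′ , v′ + u′ , u′)
        same refl e = cong (λ v → (u , v , v + u , u)) (*-cancelˡ-≡ v v′ 2 (+-cancelˡ-≡ u (2 * v) (2 * v′) e))
      onto : ∀ {x y} → Π P (x , y) × x < y → ∃[ z ] FixP z × (let (u , v , e , f) = z in (u , u + 2 * v)) ≡ (x , y)
      onto {x} {y} (((x0 , y0) , eq) , x<y) = finish (m≤n⇒∃[o]m+o≡n (<⇒≤ x<y))
        where
        odds = odd-*⁻ x y (trans (cong par eq) oP)
        finish : ∃[ g ] x + g ≡ y → ∃[ z ] FixP z × (let (u , v , e , f) = z in (u , u + 2 * v)) ≡ (x , y)
        finish (g , refl) = finish₂ (half {g} (par∸ {x} {x + g} {g} refl (proj₁ odds) (proj₂ odds))) eq x<y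
          where
          finish₂ : ∃[ v ] g ≡ 2 * v → x * (x + g) ≡ P → x < x + g → ∃[ z ] FixP z × (let (u , v , e , f) = z in (u , u + 2 * v)) ≡ (x , x + g)
          finish₂ (zero , refl) _ lt = contradiction lt (≤⇒≯ (≤-reflexive (+-identityʳ x)))
          finish₂ (v@(suc _) , refl) eq _ = (x , v , v + x , x) ,
            ((((((x0 , s≤s z≤n , s≤s z≤n , x0) , trans (sym (arith x v)) eq) , trans (par+ {v} {x} ev refl) refl , λ (ex , _) → even-odd-⊥ {x} ex (proj₁ odds)) , tt) ,
              (λ p → <⇒≢ (m<n+m x (s≤s z≤n)) p)) , trans (ι-lo (≤⇒≯ (m≤n+m x v))) (quad≡ refl (m+n∸n≡m v x) refl refl)) , refl
            where
            ev : Even v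
            ev = ¬odd⇒even {v} λ ov → ≢3 eq (x[x+2f]≡3 {x} {v} (proj₁ odds) ov)

    ♯Om0 : ♯ (Quads P ∩ om0?) ≡ ♯ (Pairs P ∩ u<v₂?)
    ♯Om0 = trans ♯S0 (trans (cong par (#-ext E1 (E1 ∩ ⊤?) (λ p → p , tt) proj₁)) (trans (♯-ι ⊤? (λ _ _ → tt)) (cong₂ _xor_ ♯ends ♯fixed)))

  -- Squares modulo a prime q ≡ 3 (4).

  module QuadraticResidues where

    module Modular (q : ℕ) .{{_ : NonZero q}} where

      infix 4 _≋_
      record _≋_ (a b : ℕ) : Set where
        constructor mod
        field %≡ : a % q ≡ b % q
      open _≋_ public

      ≋-refl : ∀ {a} → a ≋ a
      ≋-refl = mod refl

      ≋-sym : ∀ {a b} → a ≋ b → b ≋ a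
      ≋-sym (mod e) = mod (sym e)

      ≋-trans : ∀ {a b c} → a ≋ b → b ≋ c → a ≋ c
      ≋-trans (mod e) (mod f) = mod (trans e f)

      ≡⇒≋ : ∀ {a b} → a ≡ b → a ≋ b
      ≡⇒≋ refl = ≋-refl

      infixl 6 _+≋_
      infixl 7 _*≋_
      _+≋_ : ∀ {a b c d} → a ≋ b → c ≋ d → a + c ≋ b + d
      _+≋_ {a} {b} {c} {d} (mod e) (mod f) = mod (trans (%-distribˡ-+ a c q) (trans (cong₂ (λ x y → (x + y) % q) e f) (sym (%-distribˡ-+ b d q))))

      _*≋_ : ∀ {a b c d} → a ≋ b → c ≋ d → a * c ≋ b * d
      _*≋_ {a} {b} {c} {d} (mod e) (mod f) = mod (trans (%-distribˡ-* a c q) (trans (cong₂ (λ x y → (x * y) % q) e f) (sym (%-distribˡ-* b d q))))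

      %≋ : ∀ a → a % q ≋ a
      %≋ a = mod (m%n%n≡m%n a q)

      ∣⇒≋0 : ∀ {a} → q ∣ a → a ≋ 0
      ∣⇒≋0 {a} d = mod (trans (n∣m⇒m%n≡0 a q d) (sym (m<n⇒m%n≡m (>-nonZero⁻¹ q))))

      ≋0⇒∣ : ∀ {a} → a ≋ 0 → q ∣ a
      ≋0⇒∣ {a} (mod e) = m%n≡0⇒n∣m a q (trans e (m<n⇒m%n≡m (>-nonZero⁻¹ q)))

      ∣-cong : ∀ {a b} → a ≋ b → q ∣ a → q ∣ b
      ∣-cong e d = ≋0⇒∣ (≋-trans (≋-sym e) (∣⇒≋0 d))

      +-∣ : ∀ {a b} → q ∣ b → a + b ≋ a
      +-∣ {a} d = ≋-trans (≋-refl +≋ ∣⇒≋0 d) (≡⇒≋ (+-identityʳ a))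

      ≋-by : ∀ {a b s t} → a + s * q ≡ b + t * q → a ≋ b
      ≋-by {a} {b} {s} {t} e = mod (trans (sym ([m+kn]%n≡m%n a s q)) (trans (cong (_% q) e) ([m+kn]%n≡m%n b t q)))

      ≋⇒≡ : ∀ {a b} → a < q → b < q → a ≋ b → a ≡ b
      ≋⇒≡ la lb (mod e) = trans (sym (m<n⇒m%n≡m la)) (trans e (m<n⇒m%n≡m lb))

      -- both sums vanish, so a and b are the same negative
      neg-unique : ∀ {a b c} → q ∣ a + c → q ∣ b + c → a ≋ b
      neg-unique {a} {b} {c} d d′ = ≋-trans (≋-sym (+-∣ d′)) (≋-trans (≡⇒≋ (arith a b c)) (+-∣ d))
        where
        arith : ∀ a b c → a + (b + c) ≡ b + (a + c)
        arith = solve-∀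

      -- Negation modulo `q` as multiplication by `q − 1`.
      neg : ℕ → ℕ
      neg x = (q ∸ 1) * x

      neg-∣ : ∀ x → q ∣ x + neg x
      neg-∣ x = divides x (trans (cong (_* x) (m+[n∸m]≡n (>-nonZero⁻¹ q))) (*-comm q x))

      +-cancel : ∀ x {y z} → x + y ≋ x + z → y ≋ z
      +-cancel x {y} {z} e = ≋-trans (≋-sym (lemma y)) (≋-trans (≋-refl {neg x} +≋ e) (lemma z))
        where
        lemma : ∀ y → neg x + (x + y) ≋ y
        lemma y = ≋-trans (≡⇒≋ (arith (neg x) x y)) (+-∣ (neg-∣ x))
          where
          arith : ∀ n x y → n + (x + y) ≡ y + (x + n)
          arith = solve-∀

    module PrimeModular (q : ℕ) (q-prime : Prime q) where

      instance
        q≢0 : NonZero q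
        q≢0 = prime⇒nonZero q-prime

      open Modular q public

      Unit : ℕ → Set
      Unit x = ¬ q ∣ x

      unit-* : ∀ {a b} → Unit a → Unit b → Unit (a * b)
      unit-* {a} {b} ua ub d with euclidsLemma a b q-prime d
      ... | inj₁ x = ua x
      ... | inj₂ x = ub x

      unit-*ˡ : ∀ {a b} → Unit (a * b) → Unit a
      unit-*ˡ {a} {b} u d = u (∣-trans d (m∣m*n b))

      unit-*ʳ : ∀ {a b} → Unit (a * b) → Unit b
      unit-*ʳ {a} {b} u d = u (∣-trans d (n∣m*n a))

      unit-cong : ∀ {a b} → a ≋ b → Unit a → Unit b
      unit-cong e u d = u (∣-cong (≋-sym e) d)

      1<q : 1 < q
      1<q = nonTrivial⇒n>1 q {{prime⇒nonTrivial q-prime}}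

      1-unit : Unit 1
      1-unit d = contradiction (∣⇒≤ d) (<⇒≱ 1<q)

      small-unit : ∀ {y} → 0 < y → y < q → Unit y
      small-unit {suc y} _ lt d = contradiction (∣⇒≤ d) (<⇒≱ lt)

      inverse : ∀ {y} → Unit y → ∃[ z ] z * y ≋ 1
      inverse {y} u = go (y % q) refl (m%n<n y q)
        where
        go : ∀ r → r ≡ y % q → r < q → ∃[ z ] z * y ≋ 1
        go zero    e _  = contradiction (m%n≡0⇒n∣m y q (sym e)) u
        go (suc r) e lt with coprime-Bézout (prime⇒coprime q-prime lt)
        ... | Bézout.-+ a b eq = b , ≋-trans (≋-refl {b} *≋ ≋-trans (≋-sym (%≋ y)) (≡⇒≋ (sym e))) (≋-by {s = 0} {t = a} (trans (+-identityʳ _) (sym eq)))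
        -- With this sign Bézout gives `br ≡ − 1`; as `(br)² ≡ 1`, the inverse of `r` is `brb`.
        ... | Bézout.+- a b eq = b * suc r * b , ≋-trans (≋-refl {b * suc r * b} *≋ ≋-trans (≋-sym (%≋ y)) (≡⇒≋ (sym e)))
          (≋-trans (≋-by {s = a} {t = a * (b * suc r)} (trans (cong (b * suc r * b * suc r +_) (sym eq)) (trans (arith b (suc r)) (cong (λ z → 1 + z) (trans (cong (_* (b * suc r)) eq) (arith₂ a q (b * suc r))))))) ≋-refl)
          where
          arith : ∀ b r → b * r * b * r + (1 + b * r) ≡ 1 + (1 + b * r) * (b * r)
          arith = solve-∀
          arith₂ : ∀ a q x → a * q * x ≡ a * x * q
          arith₂ = solve-∀

      inv : ℕ → ℕ
      inv y with anyUpTo? (λ z → z * y % q ≟ 1 % q) q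
      ... | yes (z , _) = z
      ... | no _        = 0

      inv-* : ∀ {y} → Unit y → inv y * y ≋ 1
      inv-* {y} u with anyUpTo? (λ z → z * y % q ≟ 1 % q) q
      ... | yes (z , _ , e) = mod e
      ... | no n = let (z , e) = inverse u in contradiction (z % q , m%n<n z q , %≡ (≋-trans (%≋ z *≋ ≋-refl) e)) n

      unit-inv : ∀ {y} → Unit y → Unit (inv y)
      unit-inv u = unit-*ˡ (unit-cong (≋-sym (inv-* u)) 1-unit)

      cancel : ∀ {a x y} → Unit a → a * x ≋ a * y → x ≋ y
      cancel {a} {x} {y} u e = ≋-trans (≋-sym (lemma x)) (≋-trans (≋-refl {inv a} *≋ e) (lemma y))
        where
        lemma : ∀ x → inv a * (a * x) ≋ x
        lemma x = ≋-trans (≡⇒≋ (sym (*-assoc (inv a) a x))) (≋-trans (inv-* u *≋ ≋-refl) (≡⇒≋ (*-identityˡ x)))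

      sq-eq : ∀ {a b} → a * a ≋ b * b → a ≋ b ⊎ q ∣ a + b
      sq-eq {a} {b} e with ≤-total a b
      ... | inj₁ le = go le e
        where
        go : ∀ {a b} → a ≤ b → a * a ≋ b * b → a ≋ b ⊎ q ∣ a + b
        go {a} {b} le e with m≤n⇒∃[o]m+o≡n le
        ... | c , refl with euclidsLemma c (a + (a + c)) q-prime (≋0⇒∣ (≋-sym (+-cancel (a * a) (≋-trans (≡⇒≋ (+-identityʳ (a * a))) (≋-trans e (≡⇒≋ (arith a c)))))))
          where
          arith : ∀ a c → (a + c) * (a + c) ≡ a * a + c * (a + (a + c))
          arith = solve-∀
        ... | inj₁ d = inj₁ (≋-sym (+-∣ d))
        ... | inj₂ d = inj₂ d
      ... | inj₂ le with m≤n⇒∃[o]m+o≡n le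
      ... | c , refl with euclidsLemma c (b + (b + c)) q-prime (≋0⇒∣ (≋-sym (+-cancel (b * b) (≋-trans (≡⇒≋ (+-identityʳ (b * b))) (≋-trans (≋-sym e) (≡⇒≋ (arith b c)))))))
        where
        arith : ∀ a c → (a + c) * (a + c) ≡ a * a + c * (a + (a + c))
        arith = solve-∀
      ... | inj₁ d = inj₁ (+-∣ d)
      ... | inj₂ d = inj₂ (subst (q ∣_) (+-comm b (b + c)) d)

    module Residues (q : ℕ) (q-prime : Prime q) (q≡3 : q % 4 ≡ 3) where

      open PrimeModular q q-prime public

      -- This is `(q − 1) / 2`; it is odd because `q ≡ 3` modulo 4.
      k : ℕ
      k = q / 4 * 2 + 1

      q≡ : q ≡ suc (k + k)
      q≡ = trans (m≡m%n+[m/n]*n q 4) (trans (cong (_+ q / 4 * 4) q≡3) (arith (q / 4)))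
        where
        arith : ∀ t → 3 + t * 4 ≡ suc (t * 2 + 1 + (t * 2 + 1))
        arith = solve-∀

      k-odd : Odd k
      k-odd = par+ {q / 4 * 2} {1} (trans (cong par (*-comm (q / 4) 2)) (par-* 2 (q / 4))) refl

      2-unit : Unit 2
      2-unit = small-unit (s≤s z≤n) (subst (2 <_) (sym q≡) (s≤s (+-mono-≤ (m≤n+m 1 (q / 4 * 2)) (m≤n+m 1 (q / 4 * 2)))))

      k≤ : ∀ {y} → y ≤ k → y < q
      k≤ le = subst (_ <_) (sym q≡) (s≤s (≤-trans le (m≤m+n k k)))

      -- Up to sign, i.e. up to equality of squares modulo q, every unit has a unique representative in 1 … k, where q = 2k + 1.
      rep-unique : ∀ {a b} → 0 < a → a ≤ k → b ≤ k → a * a ≋ b * b → a ≡ b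
      rep-unique {a} {b} a0 ak bk e with sq-eq e
      ... | inj₁ c = ≋⇒≡ (k≤ ak) (k≤ bk) c
      ... | inj₂ d = contradiction d (small-unit (m≤n⇒m≤n+o b a0) (subst (a + b <_) (sym q≡) (s≤s (+-mono-≤ ak bk))))

      norm : ℕ → ℕ
      norm n with n % q ≤? k
      ... | yes _ = n % q
      ... | no _  = q ∸ n % q

      norm-sq : ∀ n → norm n * norm n ≋ n * n
      norm-sq n with n % q ≤? k
      ... | yes _ = %≋ n *≋ %≋ n
      ... | no _  = ≋-trans (go (q ∸ n % q) (m∸n+n≡m (<⇒≤ (m%n<n n q)))) (%≋ n *≋ %≋ n)
        where
        go : ∀ y → y + n % q ≡ q → y * y ≋ n % q * (n % q)
        go y e = ≋-by {s = n % q} {t = y} (trans (cong (λ z → y * y + n % q * z) (sym e)) (trans (arith y (n % q)) (cong (λ z → n % q * (n % q) + y * z) e)))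
          where
          arith : ∀ y r → y * y + r * (y + r) ≡ r * r + y * (y + r)
          arith = solve-∀

      norm-pos : ∀ {n} → Unit n → 0 < norm n
      norm-pos {n} u with norm n in eq
      ... | suc _ = s≤s z≤n
      ... | zero  = contradiction (≋0⇒∣ (≋-sym (≋-trans (≡⇒≋ (sym (cong₂ _*_ eq eq))) (norm-sq n)))) (unit-* u u)

      norm≤k : ∀ n → norm n ≤ k
      norm≤k n with n % q ≤? k
      ... | yes p = p
      ... | no p  = lin≤ {q ∸ n % q} {k} (≰⇒> p) (trans (m∸n+n≡m (<⇒≤ (m%n<n n q))) (trans q≡ (sym (+-suc k k))))

      Reps : Enum (λ y → y < k)
      Reps = bounded k

      -- The k representatives are an odd number, so an involution on them has a fixed point.
      no-free-involution : (f : ℕ → ℕ) → (∀ {y} → Unit y → Unit (f y)) → (∀ {y} → Unit y → f (norm (f y)) * f (norm (f y)) ≋ y * y) →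
        (∀ {y} → Unit y → 0 < y → y ≤ k → ¬ f y * f y ≋ y * y) → ⊥
      no-free-involution f f-unit f-f free = even-odd-⊥ {k} (trans (cong par (sym (ListP.length-upTo k))) (♯-free _≟_ Reps g g-< g-g g-free)) k-odd
        where
        g : ℕ → ℕ
        g y = pred (norm (f (suc y)))
        sg : ∀ {y} → y < k → suc (g y) ≡ norm (f (suc y))
        sg {y} lt = suc-pred (norm (f (suc y))) {{>-nonZero (norm-pos (f-unit (small-unit (s≤s z≤n) (k≤ lt))))}}
        g-< : ∀ {y} → y < k → g y < k
        g-< {y} lt = ≤-trans (≤-reflexive (sg lt)) (norm≤k _)
        g-g : ∀ {y} → y < k → g (g y) ≡ y
        g-g {y} lt = suc-injective (trans (sg (g-< lt)) (trans (cong (λ z → norm (f z)) (sg lt))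
          (rep-unique (norm-pos (f-unit (unit-norm (f-unit u)))) (norm≤k _) lt (≋-trans (norm-sq _) (f-f u)))))
          where
          u = small-unit (s≤s z≤n) (k≤ lt)
          unit-norm : ∀ {n} → Unit n → Unit (norm n)
          unit-norm {n} u = small-unit (norm-pos u) (k≤ (norm≤k n))
        g-free : ∀ {y} → y < k → g y ≢ y
        g-free {y} lt e = free (small-unit (s≤s z≤n) (k≤ lt)) (s≤s z≤n) lt
          (≋-trans (≋-sym (norm-sq _)) (≡⇒≋ (cong₂ _*_ p p)))
          where
          p = trans (sym (sg lt)) (cong suc e)

      swap₄ : ∀ a b c d → a * b * (c * d) ≡ a * c * (b * d)
      swap₄ = solve-∀

      -- Multiplication by a square root `i` of `− 1` is an involution up to sign; a fixed
      -- representative would give `y² ≡ − y²`.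
      ¬-1-square : ∀ {i} → q ∣ i * i + 1 → ⊥
      ¬-1-square {i} d = no-free-involution (i *_) (unit-* ui) ff free
        where
        ui : Unit i
        ui d′ = 1-unit (∣m+n∣m⇒∣n d (∣-trans d′ (m∣m*n i)))
        i⁴ : i * i * (i * i) ≋ 1
        i⁴ = neg-unique {c = i * i} (subst (q ∣_) (arith (i * i)) (∣-trans d (m∣m*n (i * i)))) (subst (q ∣_) (+-comm (i * i) 1) d)
          where
          arith : ∀ x → (x + 1) * x ≡ x * x + x
          arith = solve-∀
        ff : ∀ {y} → Unit y → i * norm (i * y) * (i * norm (i * y)) ≋ y * y
        ff {y} _ = ≋-trans (≡⇒≋ (swap₄ i _ i _)) (≋-trans (≋-refl {i * i} *≋ norm-sq (i * y))
          (≋-trans (≡⇒≋ (arith i y)) (≋-trans (i⁴ *≋ ≋-refl {y * y}) (≡⇒≋ (*-identityˡ (y * y))))))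
          where
          arith : ∀ i y → i * i * (i * y * (i * y)) ≡ i * i * (i * i) * (y * y)
          arith = solve-∀
        free : ∀ {y} → Unit y → 0 < y → y ≤ k → ¬ i * y * (i * y) ≋ y * y
        free {y} u _ _ e = unit-* 2-unit (unit-* u u) (subst (q ∣_) (arith₂ (y * y))
          (∣-cong (e +≋ ≋-refl {y * y}) (subst (q ∣_) (arith i y) (∣-trans d (m∣m*n (y * y))))))
          where
          arith : ∀ i y → (i * i + 1) * (y * y) ≡ i * y * (i * y) + y * y
          arith = solve-∀
          arith₂ : ∀ x → x + x ≡ 2 * x
          arith₂ = solve-∀

      -- Restricted to units, so that divisibility by `q` is a third case beside squares and
      -- nonsquares.
      Sq : ℕ → Set
      Sq x = Unit x × ∃[ y ] (y < q × y * y ≋ x)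

      sq? : Decidable Sq
      sq? x = ¬? (q ∣? x) ×-dec anyUpTo? (λ y → Dec-≋ (y * y) x) q
        where
        Dec-≋ : ∀ a b → Dec (a ≋ b)
        Dec-≋ a b with a % q ≟ b % q
        ... | yes e = yes (mod e)
        ... | no n  = no λ (mod e) → n e

      mk-Sq : ∀ {x} y → Unit x → y * y ≋ x → Sq x
      mk-Sq y u e = u , y % q , m%n<n y q , ≋-trans (%≋ y *≋ %≋ y) e

      Sq-cong : ∀ {x y} → x ≋ y → Sq x → Sq y
      Sq-cong e (u , a , _ , p) = mk-Sq a (unit-cong e u) (≋-trans p e)

      Sq-square : ∀ {x} → Unit x → Sq (x * x)
      Sq-square {x} u = mk-Sq x (unit-* u u) ≋-refl

      Sq-* : ∀ {x y} → Sq x → Sq y → Sq (x * y)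
      Sq-* {x} {y} (u , a , _ , p) (v , b , _ , r) = mk-Sq (a * b) (unit-* u v) (≋-trans (≡⇒≋ (swap₄ a b a b)) (p *≋ r))

      Sq-/ : ∀ {x y} → Sq x → Sq (x * y) → Sq y
      Sq-/ {x} {y} (u , a , _ , p) (v , b , _ , r) = mk-Sq (inv a * b) (unit-*ʳ {x} v)
        (≋-trans (≡⇒≋ (swap₄ (inv a) b (inv a) b)) (≋-trans (≋-refl {inv a * inv a} *≋ ≋-trans r (≋-sym p *≋ ≋-refl {y}))
          (≋-trans (≡⇒≋ (arith (inv a) a y)) (≋-trans (inv-* ua *≋ inv-* ua *≋ ≋-refl {y}) (≡⇒≋ (*-identityˡ y))))))
        where
        ua : Unit a
        ua = unit-*ˡ (unit-cong (≋-sym p) u)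
        arith : ∀ i a y → i * i * (a * a * y) ≡ i * a * (i * a) * y
        arith = solve-∀

      Sq-neg : ∀ {x y} → q ∣ x + y → Sq x → ¬ Sq y
      Sq-neg {x} {y} d (u , a , _ , p) (v , b , _ , r) = ¬-1-square {inv b * a}
        (∣-cong (≋-trans (≡⇒≋ (arith (inv b) a b)) (≋-trans (≋-refl +≋ (inv-* ub *≋ inv-* ub)) (≡⇒≋ refl)))
          (∣-trans (∣-cong (≋-sym p +≋ ≋-sym r) d) (n∣m*n (inv b * inv b))))
        where
        ub : Unit b
        ub = unit-*ˡ (unit-cong (≋-sym r) v)
        arith : ∀ i a b → i * i * (a * a + b * b) ≡ i * a * (i * a) + i * b * (i * b)
        arith = solve-∀

      -- The involution y ↦ x / y on representatives has a fixed point, so x or − x is a square.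
      Sq-± : ∀ {x y} → Unit x → ¬ Sq x → q ∣ x + y → Sq y
      Sq-± {x} {y} u n d with sq? y
      ... | yes s = s
      ... | no n′ = ⊥-elim (no-free-involution (λ z → x * inv z) (λ v → unit-* u (unit-inv v)) ff free)
        where
        uy : Unit y
        uy d′ = u (∣m+n∣m⇒∣n (subst (q ∣_) (+-comm x y) d) d′)
        prod : ∀ {z} → Unit z → x * inv z * (x * inv z) * (z * z) ≋ x * x
        prod {z} v = ≋-trans (≡⇒≋ (arith x (inv z) z)) (≋-trans (≋-refl {x * x} *≋ (inv-* v *≋ inv-* v)) (≡⇒≋ (*-identityʳ (x * x))))
          where
          arith : ∀ x i z → x * i * (x * i) * (z * z) ≡ x * x * (i * z * (i * z))
          arith = solve-∀
        ff : ∀ {z} → Unit z → x * inv (norm (x * inv z)) * (x * inv (norm (x * inv z))) ≋ z * z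
        ff {z} v = cancel {w * w} (unit-* uw uw) (≋-trans (≡⇒≋ (*-comm (w * w) _)) (≋-trans (≋-refl {x * inv (norm w) * (x * inv (norm w))} *≋ ≋-sym (norm-sq w)) (≋-trans (prod unw) (≋-sym (prod v)))))
          where
          w = x * inv z
          uw : Unit w
          uw = unit-* u (unit-inv v)
          unw : Unit (norm w)
          unw = small-unit (norm-pos uw) (k≤ (norm≤k w))
        free : ∀ {z} → Unit z → 0 < z → z ≤ k → ¬ x * inv z * (x * inv z) ≋ z * z
        free {z} v _ _ e with sq-eq {z * z} {x} (≋-trans (≋-sym e *≋ ≋-refl) (prod v))
        ... | inj₁ s = n (mk-Sq z u s)
        ... | inj₂ s = n′ (mk-Sq z uy (neg-unique s (subst (q ∣_) (+-comm x y) d)))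

      -- Both `− x` and `− y` are squares, and their product is `(− 1)² xy`.
      nonSq-* : ∀ {x y} → Unit x → Unit y → ¬ Sq x → ¬ Sq y → Sq (x * y)
      nonSq-* {x} {y} u v n m = Sq-/ (Sq-square un) (Sq-cong (≡⇒≋ (arith (q ∸ 1) x y)) (Sq-* (Sq-± u n (neg-∣ x)) (Sq-± v m (neg-∣ y))))
        where
        un : Unit (q ∸ 1)
        un = unit-*ˡ {q ∸ 1} {x} (λ d → u (∣m+n∣m⇒∣n (subst (q ∣_) (+-comm x (neg x)) (neg-∣ x)) d))
        arith : ∀ n x y → n * x * (n * y) ≡ n * n * (x * y)
        arith = solve-∀

  open QuadraticResidues

  -- Solutions classified by the square class of their row ratio modulo q.

  module RowRatio (q : ℕ) (q-prime : Prime q) (q≡3 : q % 4 ≡ 3) (D : ℕ) (m : D % 8 ≡ 7) (q∣D : q ∣ D) where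

    open Residues q q-prime q≡3

    oD : Odd D
    oD = odd-mod8 {D} m

    oq : Odd q
    oq = odd-mod4 {q} (inj₂ q≡3)

    open Iota D oD public

    NS : ℕ → Set
    NS x = Unit x × ¬ Sq x

    ns? : Decidable NS
    ns? x = ¬? (q ∣? x) ×-dec ¬? (sq? x)

    -- The two rows (u, − e) and (f, v) are proportional modulo q; ν₀ and ν₁ say that the ratio is a square or a nonsquare.
    ν₀ ν₁ A₁ A₂ : Quad → Set
    ν₀ (u , v , e , f) = Sq (u * f) ⊎ NS (e * v)
    ν₁ (u , v , e , f) = NS (u * f) ⊎ Sq (e * v)
    A₁ (u , v , e , f) = q ∣ u × q ∣ e
    A₂ (u , v , e , f) = q ∣ v × q ∣ f

    ν₀? : Decidable ν₀
    ν₀? (u , v , e , f) = sq? (u * f) ⊎-dec ns? (e * v)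
    ν₁? : Decidable ν₁
    ν₁? (u , v , e , f) = ns? (u * f) ⊎-dec sq? (e * v)
    a₁? : Decidable A₁
    a₁? (u , v , e , f) = (q ∣? u) ×-dec (q ∣? e)
    a₂? : Decidable A₂
    a₂? (u , v , e , f) = (q ∣? v) ×-dec (q ∣? f)

    sw : Quad → Quad
    sw (u , v , e , f) = v , u , f , e

    swΩ : ∀ {u v e f} → Ω D (u , v , e , f) → Ω D (v , u , f , e)
    swΩ {u} {v} {e} {f} ((u0 , v0 , e0 , f0) , eq) = (v0 , u0 , f0 , e0) , trans (cong₂ _+_ (*-comm v u) (*-comm f e)) eq

    Sq-comm : ∀ a b → Sq (a * b) → Sq (b * a)
    Sq-comm a b = subst Sq (*-comm a b)

    NS-comm : ∀ a b → NS (a * b) → NS (b * a)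
    NS-comm a b = subst NS (*-comm a b)

    ν₀-sw : ∀ {u v e f} → ν₀ (u , v , e , f) → ν₁ (v , u , f , e)
    ν₀-sw {u} {v} {e} {f} (inj₁ s) = inj₂ (Sq-comm u f s)
    ν₀-sw {u} {v} {e} {f} (inj₂ s) = inj₁ (NS-comm e v s)

    ν₁-sw : ∀ {u v e f} → ν₁ (u , v , e , f) → ν₀ (v , u , f , e)
    ν₁-sw {u} {v} {e} {f} (inj₁ s) = inj₂ (NS-comm u f s)
    ν₁-sw {u} {v} {e} {f} (inj₂ s) = inj₁ (Sq-comm e v s)

    -- Since `uv ≡ − ef` modulo `q`, the product is `− (ef)²`.
    product-nonsquare : ∀ {u v e f} → Ω D (u , v , e , f) → Unit (u * f) → Unit (e * v) → ¬ Sq (u * f * (e * v))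
    product-nonsquare {u} {v} {e} {f} (_ , eq) a b s = Sq-neg (subst (q ∣_) (arith u v e f) (∣-trans (subst (q ∣_) (sym eq) q∣D) (n∣m*n (e * f)))) s
      (Sq-square {e * f} (unit-* (unit-*ˡ {e} b) (unit-*ʳ {u} a)))
      where
      arith : ∀ u v e f → e * f * (u * v + e * f) ≡ u * f * (e * v) + e * f * (e * f)
      arith = solve-∀

    ν₀-ν₁ : ∀ {x} → Ω D x → ν₀ x → ν₁ x → ⊥
    ν₀-ν₁ {u , v , e , f} o (inj₁ s) (inj₁ (_ , n)) = n s
    ν₀-ν₁ {u , v , e , f} o (inj₁ s) (inj₂ t) = product-nonsquare o (proj₁ s) (proj₁ t) (Sq-* s t)
    ν₀-ν₁ {u , v , e , f} o (inj₂ (a , n)) (inj₁ (b , k)) = product-nonsquare o b a (nonSq-* b a k n)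
    ν₀-ν₁ {u , v , e , f} o (inj₂ (_ , n)) (inj₂ t) = n t

    -- If each column of the matrix contains a zero modulo `q`, the vanishing determinant forces a
    -- whole row to vanish.
    ¬ν⇒ : ∀ {x} → Ω D x → ¬ ν₀ x → ¬ ν₁ x → A₁ x ⊎ A₂ x
    ¬ν⇒ {u , v , e , f} (_ , eq) n₀ n₁ = go (euclidsLemma u f q-prime uf) (euclidsLemma e v q-prime ev)
      where
      uf : q ∣ u * f
      uf with q ∣? u * f | sq? (u * f)
      ... | yes d | _     = d
      ... | no n  | yes s = contradiction (inj₁ s) n₀
      ... | no n  | no s  = contradiction (inj₁ (n , s)) n₁
      ev : q ∣ e * v
      ev with q ∣? e * v | sq? (e * v)
      ... | yes d | _     = d
      ... | no n  | yes s = contradiction (inj₂ s) n₁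
      ... | no n  | no s  = contradiction (inj₂ (n , s)) n₀
      d : q ∣ u * v + e * f
      d = subst (q ∣_) (sym eq) q∣D
      go : q ∣ u ⊎ q ∣ f → q ∣ e ⊎ q ∣ v → A₁ (u , v , e , f) ⊎ A₂ (u , v , e , f)
      go (inj₁ a) (inj₁ b) = inj₁ (a , b)
      go (inj₂ a) (inj₂ b) = inj₂ (b , a)
      go (inj₁ a) (inj₂ b) = by (euclidsLemma e f q-prime (∣m+n∣m⇒∣n d (∣-trans a (m∣m*n v))))
        where
        by : q ∣ e ⊎ q ∣ f → A₁ (u , v , e , f) ⊎ A₂ (u , v , e , f)
        by (inj₁ c) = inj₁ (a , c)
        by (inj₂ c) = inj₂ (b , c)
      go (inj₂ a) (inj₁ b) = by (euclidsLemma u v q-prime (∣m+n∣m⇒∣n (subst (q ∣_) (+-comm (u * v) (e * f)) d) (∣-trans b (m∣m*n f))))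
        where
        by : q ∣ u ⊎ q ∣ v → A₁ (u , v , e , f) ⊎ A₂ (u , v , e , f)
        by (inj₁ c) = inj₁ (c , b)
        by (inj₂ c) = inj₂ (c , a)

    A⇒¬ν₀ : ∀ {x} → A₁ x ⊎ A₂ x → ¬ ν₀ x
    A⇒¬ν₀ {u , v , e , f} (inj₁ (a , b)) (inj₁ s) = proj₁ s (∣-trans a (m∣m*n f))
    A⇒¬ν₀ {u , v , e , f} (inj₁ (a , b)) (inj₂ s) = proj₁ s (∣-trans b (m∣m*n v))
    A⇒¬ν₀ {u , v , e , f} (inj₂ (a , b)) (inj₁ s) = proj₁ s (∣-trans b (n∣m*n u))
    A⇒¬ν₀ {u , v , e , f} (inj₂ (a , b)) (inj₂ s) = proj₁ s (∣-trans a (n∣m*n e))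

    A⇒¬ν₁ : ∀ {x} → A₁ x ⊎ A₂ x → ¬ ν₁ x
    A⇒¬ν₁ {u , v , e , f} (inj₁ (a , b)) (inj₁ s) = proj₁ s (∣-trans a (m∣m*n f))
    A⇒¬ν₁ {u , v , e , f} (inj₁ (a , b)) (inj₂ s) = proj₁ s (∣-trans b (m∣m*n v))
    A⇒¬ν₁ {u , v , e , f} (inj₂ (a , b)) (inj₁ s) = proj₁ s (∣-trans b (n∣m*n u))
    A⇒¬ν₁ {u , v , e , f} (inj₂ (a , b)) (inj₂ s) = proj₁ s (∣-trans a (n∣m*n e))

    -- Inclusion and exclusion modulo 2 for the solutions with a vanishing row.
    ♯-imprimitive : {P : Quad → Set} (E : Enum P) → (∀ {x} → P x → Ω D x) →
      ♯ (E ∩ ∁ ν₀? ∩ ∁ ν₁?) ≡ ♯ (E ∩ a₁?) xor (♯ (E ∩ a₂?) xor ♯ (E ∩ a₂? ∩ a₁?))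
    ♯-imprimitive E Pω = trans (♯-split (E ∩ ∁ ν₀? ∩ ∁ ν₁?) a₁?) (cong₂ _xor_
      (cong par (#-ext (E ∩ ∁ ν₀? ∩ ∁ ν₁? ∩ a₁?) (E ∩ a₁?) (λ (((p , _) , _) , a) → p , a) (λ {x} (p , a) → ((p , A⇒¬ν₀ {x} (inj₁ a)) , A⇒¬ν₁ {x} (inj₁ a)) , a)))
      (trans (cong par (#-ext (E ∩ ∁ ν₀? ∩ ∁ ν₁? ∩ ∁ a₁?) (E ∩ a₂? ∩ ∁ a₁?)
          (λ (((p , n₀) , n₁) , n) → (p , other (¬ν⇒ (Pω p) n₀ n₁) n) , n) (λ {x} ((p , a) , n) → ((p , A⇒¬ν₀ {x} (inj₂ a)) , A⇒¬ν₁ {x} (inj₂ a)) , n)))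
        (trans (xor-move (♯ (E ∩ a₂? ∩ a₁?)) (♯ (E ∩ a₂? ∩ ∁ a₁?))) (cong (_xor ♯ (E ∩ a₂? ∩ a₁?)) (sym (♯-split (E ∩ a₂?) a₁?))))))
      where
      other : ∀ {x} → A₁ x ⊎ A₂ x → ¬ A₁ x → A₂ x
      other (inj₁ a) n = contradiction a n
      other (inj₂ a) _ = a
      xor-move : ∀ a b → b ≡ (a xor b) xor a
      xor-move = xor-∧-Solver.solve 2 (λ a b → b := a :+ b :+ a) refl
        where open xor-∧-Solver using (_:=_; _:+_)

    Q0 = Quads D ∩ om0?
    T  = Q0 ∩ u<v?

    u≢v : ∀ {u v e f} → Ω D (u , v , e , f) → Even e → Even f → u ≢ v
    u≢v {u} {.u} {e} {f} (_ , eq) ee ef refl = u²+ef≢7 u e f ee ef (trans (cong (_% 8) eq) m)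

    sw-T : ∀ {u v e f} → (Ω D (u , v , e , f) × (Even e × Even f)) × u < v → (Ω D (v , u , f , e) × (Even f × Even e)) × ¬ v < u
    sw-T ((o , ee , ef) , lt) = (swΩ o , ef , ee) , <-asym lt

    sw-¬T : ∀ {u v e f} → (Ω D (u , v , e , f) × (Even e × Even f)) × ¬ u < v → (Ω D (v , u , f , e) × (Even f × Even e)) × v < u
    sw-¬T ((o , ee , ef) , nlt) = (swΩ o , ef , ee) , ≤∧≢⇒< (≮⇒≥ nlt) λ p → u≢v o ee ef (sym p)

    -- Transposition carries the nonsquare part of `T` to the square part of its complement, so the
    -- half `u < v` is traded for the half `ν₀`.
    ♯T-ν : ♯ T ≡ ♯ (Q0 ∩ ν₀?) xor ♯ (T ∩ ∁ ν₀? ∩ ∁ ν₁?)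
    ♯T-ν = trans (♯-split T ν₀?) (trans (cong (♯ (T ∩ ν₀?) xor_) (trans (♯-split (T ∩ ∁ ν₀?) ν₁?) (cong (_xor ♯ (T ∩ ∁ ν₀? ∩ ∁ ν₁?))
        (♯-bij (T ∩ ∁ ν₀? ∩ ν₁?) (Q0 ∩ ν₀? ∩ ∁ u<v?) sw sw
          (λ { {u , v , e , f} ((p , _) , n) → let (a , b) = sw-T p in (a , ν₁-sw {u} {v} {e} {f} n) , b })
          (λ { {u , v , e , f} ((p , n) , b) → let p′ = sw-¬T (p , b) in (p′ , λ n′ → ν₀-ν₁ (proj₁ (proj₁ p′)) n′ (ν₀-sw {u} {v} {e} {f} n)) , ν₀-sw {u} {v} {e} {f} n })
          (λ _ → refl) (λ _ → refl)))))
      (trans (sym (𝔹P.xor-assoc (♯ (T ∩ ν₀?)) _ _)) (cong (_xor ♯ (T ∩ ∁ ν₀? ∩ ∁ ν₁?))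
        (trans (cong (_xor ♯ (Q0 ∩ ν₀? ∩ ∁ u<v?)) (cong par (#-ext (T ∩ ν₀?) (Q0 ∩ ν₀? ∩ u<v?) (λ ((p , b) , n) → (p , n) , b) (λ ((p , n) , b) → (p , b) , n))))
          (sym (♯-split (Q0 ∩ ν₀?) u<v?))))))

    -- Transposition interchanges the two rows, which again removes the condition `u < v`.
    ♯T-A : ♯ (T ∩ a₁?) xor ♯ (T ∩ a₂?) ≡ ♯ (Q0 ∩ a₁?)
    ♯T-A = sym (trans (♯-split (Q0 ∩ a₁?) u<v?) (cong₂ _xor_
      (cong par (#-ext (Q0 ∩ a₁? ∩ u<v?) (T ∩ a₁?) (λ ((p , n) , b) → (p , b) , n) (λ ((p , b) , n) → (p , n) , b)))
      (♯-bij (Q0 ∩ a₁? ∩ ∁ u<v?) (T ∩ a₂?) sw sw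
        (λ { {u , v , e , f} ((p , a) , b) → sw-¬T (p , b) , a })
        (λ { {u , v , e , f} (p , a) → let (x , b) = sw-T p in (x , a) , b }) (λ _ → refl) (λ _ → refl))))

    ♯T-split : ♯ T ≡ ♯ (Q0 ∩ ν₀?) xor (♯ (Q0 ∩ a₁?) xor ♯ (T ∩ a₂? ∩ a₁?))
    ♯T-split = trans ♯T-ν (cong (♯ (Q0 ∩ ν₀?) xor_) (trans (♯-imprimitive T (λ p → proj₁ (proj₁ p)))
      (trans (sym (𝔹P.xor-assoc (♯ (T ∩ a₁?)) (♯ (T ∩ a₂?)) (♯ (T ∩ a₂? ∩ a₁?)))) (cong (_xor ♯ (T ∩ a₂? ∩ a₁?)) ♯T-A))))

    Q4 = Quads D ∩ om4?

    module _ {Y : Quad → Set} (Y? : Decidable Y) (Y-swap : ∀ {u v e f} → Y (u , v , e , f) → Y (u , v , f , e))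
      (Y-half : ∀ {u k e f} → Y (u , 2 * k , e , f) → Y (k , 2 * u , e , f)) where

      -- Exchanging `e` and `f` leaves `uv + e² = D` with `v = 2k` and `k` odd; exchanging `u` and
      -- `k` is then free modulo 8. The condition `Y` need only survive both exchanges.
      ♯Q4-Y : ♯ (Q4 ∩ Y?) ≡ false
      ♯Q4-Y = trans (♯-fixed _≟Q_ (Q4 ∩ Y?) (Q4 ∩ Y? ∩ e=f?) (λ (u , v , e , f) → u , v , f , e)
          (λ { {u , v , e , f} (((((u0 , v0 , e0 , f0) , eq) , ouv , oe , of)) , y) → ((((u0 , v0 , f0 , e0) , trans (cong (u * v +_) (*-comm f e)) eq) , ouv , of , oe) , Y-swap y) })
          (λ _ → refl) (λ { {u , v , e , f} p q → p , sym (cong (λ (_ , _ , e , _) → e) q) }) (λ { {u , v , e , f} (p , refl) → p , refl }))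
        (♯-free _≟Q_ (Q4 ∩ Y? ∩ e=f?) (λ (u , v , e , f) → v / 2 , 2 * u , e , f) (λ { {u , v , e , f} p → step p (shape p) })
          (λ { {u , v , e , f} p → back (shape p) }) (λ { {u , v , e , f} p q → free p (shape p) q }))
        where
        e=f? : Decidable (λ ((u , v , e , f) : Quad) → e ≡ f)
        e=f? (u , v , e , f) = e ≟ f
        P4 : Quad → Set
        P4 x = ((Ω D x × Om4 x) × Y x) × (let (u , v , e , f) = x in e ≡ f)
        shape : ∀ {u v e f} → P4 (u , v , e , f) → ∃[ k ] v ≡ 2 * k × v / 2 ≡ k × e ≡ f × (e * e + u * (2 * k)) % 8 ≡ 7
        shape {u} {v} {e} {.e} ((((_ , eq) , (_ , ev) , _) , _) , refl) = go (half {v} ev) eq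
          where
          go : ∃[ k ] v ≡ 2 * k → u * v + e * e ≡ D → ∃[ k ] v ≡ 2 * k × v / 2 ≡ k × e ≡ e × (e * e + u * (2 * k)) % 8 ≡ 7
          go (k , refl) eq = k , refl , half-2* k , refl , trans (cong (_% 8) (trans (+-comm (e * e) (u * (2 * k))) eq)) m
        step : ∀ {u v e f} → P4 (u , v , e , f) → ∃[ k ] v ≡ 2 * k × v / 2 ≡ k × e ≡ f × (e * e + u * (2 * k)) % 8 ≡ 7 → P4 (v / 2 , 2 * u , e , f)
        step {u} {v} {e} {f} ((((((u0 , v0 , e0 , f0) , eq) , (ou , ev) , oe , of)) , y) , _) (k , refl , h , refl , mm) =
          ((((k0 , ≤-trans u0 (m≤m+n u (1 * u)) , e0 , f0) , trans (cong (λ z → z * (2 * u) + e * e) h) (trans (arith k u e) eq)) , (trans (cong par h) (u²+2ek-odd e u k ou mm) , even-2* u) , oe , of) ,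
            subst (λ z → Y (z , 2 * u , e , f)) (sym h) (Y-half y)) , refl
          where
          k0 : 0 < 2 * k / 2
          k0 = subst (0 <_) (sym h) (pos k v0)
            where
            pos : ∀ k → 0 < 2 * k → 0 < k
            pos (suc k) _ = s≤s z≤n
          arith : ∀ k u e → k * (2 * u) + e * e ≡ u * (2 * k) + e * e
          arith = solve-∀
        back : ∀ {u v e f} → ∃[ k ] v ≡ 2 * k × v / 2 ≡ k × e ≡ f × (e * e + u * (2 * k)) % 8 ≡ 7 → _≡_ {A = Quad} (2 * u / 2 , 2 * (v / 2) , e , f) (u , v , e , f)
        back {u} (k , refl , h , _) = quad≡ (half-2* u) (cong (2 *_) h) refl refl
        free : ∀ {u v e f} → P4 (u , v , e , f) → ∃[ k ] v ≡ 2 * k × v / 2 ≡ k × e ≡ f × (e * e + u * (2 * k)) % 8 ≡ 7 → _≡_ {A = Quad} (v / 2 , 2 * u , e , f) (u , v , e , f) → ⊥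
        free {u} {v} {e} {f} p (k , refl , h , refl , mm) q = go (trans (sym h) (cong proj₁ q)) mm
          where
          go : k ≡ u → (e * e + u * (2 * k)) % 8 ≡ 7 → ⊥
          go refl mm = u²+2e²≢7 e u mm

    X0 = Quads D ∩ s0? ∩ ν₀?

    -- The third parity class of `S0` is the transpose of `Q4`, where `ν₀` has turned into `ν₁`.
    ♯X0-Q4 : ♯ X0 ≡ ♯ (Q0 ∩ ν₀?) xor (♯ (Q4 ∩ ν₀?) xor ♯ (Q4 ∩ ∁ ν₀? ∩ ν₁?))
    ♯X0-Q4 = trans (♯-split X0 ee?) (cong₂ _xor_
      (cong par (#-ext (X0 ∩ ee?) (Q0 ∩ ν₀?) (λ { {u , v , e , f} p → toOm0 p }) (λ { {u , v , e , f} p → fromOm0 p })))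
      (trans (♯-split (X0 ∩ ∁ ee?) ev?) (cong₂ _xor_
        (cong par (#-ext (X0 ∩ ∁ ee? ∩ ev?) (Q4 ∩ ν₀?) (λ { {u , v , e , f} p → toOm4 p }) (λ { {u , v , e , f} p → fromOm4 p })))
        (♯-bij (X0 ∩ ∁ ee? ∩ ∁ ev?) (Q4 ∩ ∁ ν₀? ∩ ν₁?) sw sw (λ { {u , v , e , f} p → toSw p }) (λ { {u , v , e , f} p → fromSw p }) (λ _ → refl) (λ _ → refl)))))
      where
      Ee Ev : Quad → Set
      Ee (u , v , e , f) = Even e
      Ev (u , v , e , f) = Even v
      ee? : Decidable Ee
      ee? (u , v , e , f) = even? e
      ev? : Decidable Ev
      ev? (u , v , e , f) = even? v
      X : Quad → Set
      X x = (Ω D x × S0 x) × ν₀ x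
      toOm0 : ∀ {u v e f} → X (u , v , e , f) × Even e → (Ω D (u , v , e , f) × (Even e × Even f)) × ν₀ (u , v , e , f)
      toOm0 (((o , s , _) , n) , ee) = (o , ee , trans (sym s) ee) , n
      fromOm0 : ∀ {u v e f} → (Ω D (u , v , e , f) × (Even e × Even f)) × ν₀ (u , v , e , f) → X (u , v , e , f) × Even e
      fromOm0 {u} {v} {e} {f} ((o , ee , ef) , n) = ((o , trans ee (sym ef) , λ (eu , _) → even-odd-⊥ {u} eu (proj₁ (odd-Ω {u = u} {v} {e} {f} oD (proj₂ o) (cong (_∧ par f) ee)))) , n) , ee
      parities : ∀ {u v e f} → Ω D (u , v , e , f) × S0 (u , v , e , f) → ¬ Even e → (Odd u × Even v) ⊎ (Even u × Odd v)
      parities {u} {v} {e} {f} (o , s , n) ne = go (par u) (par v) (par e) (par f) (Ω-par {u} {v} {e} {f} (proj₂ o)) s n ne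
        where
        go : ∀ a b c d → (a ∧ b) xor (c ∧ d) ≡ true → c ≡ d → ¬ (a ≡ false × b ≡ false) → ¬ c ≡ false → (a ≡ true × b ≡ false) ⊎ (a ≡ false × b ≡ true)
        go a b false d _ _ _ ne = contradiction refl ne
        go true false true d _ _ _ _ = inj₁ (refl , refl)
        go false true true d _ _ _ _ = inj₂ (refl , refl)
        go false false true d _ _ n _ = contradiction (refl , refl) n
        go true true true .true () refl _ _
      toOm4 : ∀ {u v e f} → (X (u , v , e , f) × ¬ Even e) × Even v → (Ω D (u , v , e , f) × ((Odd u × Even v) × (Odd e × Odd f))) × ν₀ (u , v , e , f)
      toOm4 {u} {v} {e} {f} (((os@(o , s , _) , n) , ne) , ev) = (o , by (parities os ne) , ¬even⇒odd {e} ne , trans (sym s) (¬even⇒odd {e} ne)) , n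
        where
        by : (Odd u × Even v) ⊎ (Even u × Odd v) → Odd u × Even v
        by (inj₁ p) = p
        by (inj₂ (_ , ov)) = ⊥-elim (even-odd-⊥ {v} ev ov)
      fromOm4 : ∀ {u v e f} → (Ω D (u , v , e , f) × ((Odd u × Even v) × (Odd e × Odd f))) × ν₀ (u , v , e , f) → (X (u , v , e , f) × ¬ Even e) × Even v
      fromOm4 {u} {v} {e} {f} ((o , (ou , ev) , oe , of) , n) = (((o , trans oe (sym of) , λ (eu , _) → even-odd-⊥ {u} eu ou) , n) , λ ee → even-odd-⊥ {e} ee oe) , ev
      toSw : ∀ {u v e f} → (X (u , v , e , f) × ¬ Even e) × ¬ Even v → ((Ω D (v , u , f , e) × ((Odd v × Even u) × (Odd f × Odd e))) × ¬ ν₀ (v , u , f , e)) × ν₁ (v , u , f , e)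
      toSw {u} {v} {e} {f} (((os@(o , s , _) , n) , ne) , nv) = ((swΩ o , by (parities os ne) , trans (sym s) oe , oe) , λ n₀ → ν₀-ν₁ (swΩ o) n₀ (ν₀-sw {u} {v} {e} {f} n)) , ν₀-sw {u} {v} {e} {f} n
        where
        oe = ¬even⇒odd {e} ne
        by : (Odd u × Even v) ⊎ (Even u × Odd v) → Odd v × Even u
        by (inj₁ (_ , ev)) = contradiction ev nv
        by (inj₂ (eu , ov)) = ov , eu
      fromSw : ∀ {u v e f} → ((Ω D (u , v , e , f) × ((Odd u × Even v) × (Odd e × Odd f))) × ¬ ν₀ (u , v , e , f)) × ν₁ (u , v , e , f) → (X (v , u , f , e) × ¬ Even f) × ¬ Even u
      fromSw {u} {v} {e} {f} (((o , (ou , ev) , oe , of) , _) , n) = (((swΩ o , trans of (sym oe) , λ (_ , eu) → even-odd-⊥ {u} eu ou) , ν₁-sw {u} {v} {e} {f} n) , λ ef → even-odd-⊥ {f} ef of) , λ eu → even-odd-⊥ {u} eu ou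

    -- A factor `q` is moved from the first row to the second; parities do not change because `q` is
    -- odd.
    ♯Q4-A : ♯ (Q4 ∩ a₁?) ≡ ♯ (Q4 ∩ a₂?)
    ♯Q4-A = ♯-bij (Q4 ∩ a₁?) (Q4 ∩ a₂?) (λ (u , v , e , f) → u / q , v * q , e / q , f * q) (λ (u , v , e , f) → u * q , v / q , e * q , f / q)
      (λ { {u , v , e , f} p → to p }) (λ { {u , v , e , f} p → from p })
      (λ { {u , v , e , f} (_ , du , de) → quad≡ (m/n*n≡m du) (m*n/n≡m v q) (m/n*n≡m de) (m*n/n≡m f q) })
      (λ { {u , v , e , f} (_ , dv , df) → quad≡ (m*n/n≡m u q) (m/n*n≡m dv) (m*n/n≡m e q) (m/n*n≡m df) })
      where
      par-*q : ∀ x → par (x * q) ≡ par x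
      par-*q x = trans (par-* x q) (trans (cong (par x ∧_) oq) (𝔹P.∧-identityʳ (par x)))
      par-/q : ∀ {x} → q ∣ x → par (x / q) ≡ par x
      par-/q {x} d = trans (sym (par-*q (x / q))) (cong par (m/n*n≡m d))
      q0 : 0 < q
      q0 = <-trans (s≤s z≤n) 1<q
      pos-* : ∀ {x} → 0 < x → 0 < x * q
      pos-* {x} x0 = *-mono-≤ x0 q0
      pos-/ : ∀ {x} → q ∣ x → 0 < x → 0 < x / q
      pos-/ {x} d x0 = m≥n⇒m/n>0 (∣⇒≤ {{>-nonZero x0}} d)
      eqn : ∀ {x y} → q ∣ x → (x / q) * (y * q) ≡ x * y
      eqn {x} {y} d = trans (arith (x / q) y q) (cong (_* y) (m/n*n≡m d))
        where
        arith : ∀ a y q → a * (y * q) ≡ a * q * y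
        arith = solve-∀
      to : ∀ {u v e f} → (Ω D (u , v , e , f) × Om4 (u , v , e , f)) × (q ∣ u × q ∣ e) →
        (Ω D (u / q , v * q , e / q , f * q) × Om4 (u / q , v * q , e / q , f * q)) × (q ∣ v * q × q ∣ f * q)
      to {u} {v} {e} {f} ((((u0 , v0 , e0 , f0) , eq) , (ou , ev) , oe , of) , du , de) =
        (((pos-/ du u0 , pos-* v0 , pos-/ de e0 , pos-* f0) , trans (cong₂ _+_ (eqn du) (eqn de)) eq) ,
          (trans (par-/q du) ou , trans (par-*q v) ev) , trans (par-/q de) oe , trans (par-*q f) of) , n∣m*n v , n∣m*n f
      from : ∀ {u v e f} → (Ω D (u , v , e , f) × Om4 (u , v , e , f)) × (q ∣ v × q ∣ f) →
        (Ω D (u * q , v / q , e * q , f / q) × Om4 (u * q , v / q , e * q , f / q)) × (q ∣ u * q × q ∣ e * q)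
      from {u} {v} {e} {f} ((((u0 , v0 , e0 , f0) , eq) , (ou , ev) , oe , of) , dv , df) =
        (((pos-* u0 , pos-/ dv v0 , pos-* e0 , pos-/ df f0) , trans (cong₂ _+_ (trans (*-comm (u * q) (v / q)) (trans (eqn dv) (*-comm v u))) (trans (*-comm (e * q) (f / q)) (trans (eqn df) (*-comm f e)))) eq) ,
          (trans (par-*q u) ou , trans (par-/q dv) ev) , trans (par-*q e) oe , trans (par-/q df) of) , n∣m*n u , n∣m*n e

    -- In `Q4` the total and the solutions with both rows vanishing are even in number, and either
    -- row vanishes equally often; so the parts `ν₀` and `ν₁` of `Q4` cancel modulo 2.
    ♯X0≡ : ♯ X0 ≡ ♯ (Q0 ∩ ν₀?)
    ♯X0≡ = trans ♯X0-Q4 (trans (cong (♯ (Q0 ∩ ν₀?) xor_) (lemma (♯ (Q4 ∩ ν₀?)) (♯ (Q4 ∩ ∁ ν₀? ∩ ν₁?)) (♯ (Q4 ∩ ∁ ν₀? ∩ ∁ ν₁?)) (♯ (Q4 ∩ a₂?)) (♯ (Q4 ∩ a₂? ∩ a₁?))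
        (trans (cong (♯ (Q4 ∩ ν₀?) xor_) (sym (♯-split (Q4 ∩ ∁ ν₀?) ν₁?))) (trans (sym (♯-split Q4 ν₀?)) all-even))
        (trans (♯-imprimitive Q4 proj₁) (cong (_xor (♯ (Q4 ∩ a₂?) xor ♯ (Q4 ∩ a₂? ∩ a₁?))) ♯Q4-A))
        both-even)) (𝔹P.xor-identityʳ _))
      where
      all-even : ♯ Q4 ≡ false
      all-even = trans (cong par (#-ext Q4 (Q4 ∩ λ _ → yes tt) (λ p → p , tt) proj₁)) (♯Q4-Y {Y = λ _ → ⊤} (λ _ → yes tt) (λ _ → tt) (λ _ → tt))
      A₁₂ : Quad → Set
      A₁₂ x = A₂ x × A₁ x
      2∤ : ∀ {k} → q ∣ 2 * k → q ∣ k
      2∤ {k} d with euclidsLemma 2 k q-prime d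
      ... | inj₁ x = contradiction x 2-unit
      ... | inj₂ x = x
      both-even : ♯ (Q4 ∩ a₂? ∩ a₁?) ≡ false
      both-even = trans (cong par (#-ext (Q4 ∩ a₂? ∩ a₁?) (Q4 ∩ λ x → a₂? x ×-dec a₁? x) (λ ((p , a) , b) → p , a , b) (λ (p , a , b) → (p , a) , b)))
        (♯Q4-Y {Y = A₁₂} (λ x → a₂? x ×-dec a₁? x) (λ { {u} {v} {e} {f} ((dv , df) , du , de) → (dv , de) , du , df })
          (λ { {u} {k} {e} {f} ((dv , df) , du , de) → (∣-trans du (n∣m*n 2) , df) , 2∤ dv , de }))
      lemma : ∀ a b c x y → a xor (b xor c) ≡ false → c ≡ x xor (x xor y) → y ≡ false → a xor b ≡ false
      lemma true  true  _ _ _ _ _ _ = refl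
      lemma false false _ _ _ _ _ _ = refl
      lemma true  false .(true xor (true xor false)) true .false () refl refl
      lemma true  false .(false xor (false xor false)) false .false () refl refl
      lemma false true  .(true xor (true xor false)) true .false () refl refl
      lemma false true  .(false xor (false xor false)) false .false () refl refl

    -- `ι` swaps the rows and applies one column operation to both, so the ratio is inverted and
    -- keeps its square class. Cases arise because a column that vanishes modulo `q` does not show
    -- the ratio, and the other column must then be used.
    ν₀-ι : ∀ {x} → V x → ν₀ x → ν₀ (ι x)
    ν₀-ι {u , v , e , f} (((_ , eq) , _) , _) n = by (e <? u)
      where
      d : q ∣ u * v + e * f
      d = subst (q ∣_) (sym eq) q∣D
      d′ : q ∣ e * f + u * v
      d′ = subst (q ∣_) (+-comm (u * v) (e * f)) d
      o′ : Unit (u * f) → Unit (e * v) → ¬ Sq (u * f * (e * v))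
      o′ a b s = Sq-neg (subst (q ∣_) (arith u v e f) (∣-trans d (n∣m*n (e * f)))) s (Sq-square {e * f} (unit-* (unit-*ˡ {e} b) (unit-*ʳ {u} a)))
        where
        arith : ∀ u v e f → e * f * (u * v + e * f) ≡ u * f * (e * v) + e * f * (e * f)
        arith = solve-∀
      hi : ∀ a → a + e ≡ u → ν₀ (u , v , e , f) → ν₀ (f + v , e , v , a)
      hi a h (inj₂ t) = inj₂ (NS-comm e v t)
      hi a h (inj₁ s) with q ∣? e * v | sq? (e * v)
      ... | no k | yes t = contradiction (Sq-* s t) (o′ (proj₁ s) k)
      ... | no k | no t  = inj₂ (NS-comm e v (k , t))
      ... | yes k | _    = inj₁ (Sq-cong (≋-trans (≡⇒≋ (*-comm u f)) (≋-sym (+-∣ {f} (proj₂ ev) *≋ ≋-trans (≋-sym (+-∣ {a} (proj₁ ev))) (≡⇒≋ h)))) s)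
        where
        ev : q ∣ e × q ∣ v
        ev with euclidsLemma e v q-prime k
        ... | inj₁ de with euclidsLemma u v q-prime (∣m+n∣m⇒∣n d′ (∣-trans de (m∣m*n f)))
        ...   | inj₁ du = contradiction (∣-trans du (m∣m*n f)) (proj₁ s)
        ...   | inj₂ dv = de , dv
        ev | inj₂ dv with euclidsLemma e f q-prime (∣m+n∣m⇒∣n d (∣-trans dv (n∣m*n u)))
        ...   | inj₁ de = de , dv
        ...   | inj₂ df = contradiction (∣-trans df (n∣m*n u)) (proj₁ s)
      lo : ∀ a → a + u ≡ e → ν₀ (u , v , e , f) → ν₀ (f , a , v + f , u)
      lo a h (inj₁ s) = inj₁ (Sq-comm u f s)
      lo a h (inj₂ (t , t′)) with q ∣? u * f | sq? (u * f)
      ... | no k | yes s = inj₁ (Sq-comm u f s)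
      ... | no k | no s  = contradiction (nonSq-* k t s t′) (o′ k t)
      ... | yes k | _    = inj₂ (NS-cong (≋-sym (≋-trans (+-∣ {v} (proj₂ uf) *≋ ≋-trans (≋-sym (+-∣ {a} (proj₁ uf))) (≡⇒≋ h)) (≡⇒≋ (*-comm v e)))) (t , t′))
        where
        NS-cong : ∀ {x y} → x ≋ y → NS x → NS y
        NS-cong c (a , b) = unit-cong c a , λ s → b (Sq-cong (≋-sym c) s)
        uf : q ∣ u × q ∣ f
        uf with euclidsLemma u f q-prime k
        ... | inj₁ du with euclidsLemma e f q-prime (∣m+n∣m⇒∣n d (∣-trans du (m∣m*n v)))
        ...   | inj₁ de = contradiction (∣-trans de (m∣m*n v)) t
        ...   | inj₂ df = du , df
        uf | inj₂ df with euclidsLemma u v q-prime (∣m+n∣m⇒∣n d′ (∣-trans df (n∣m*n e)))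
        ...   | inj₁ du = du , df
        ...   | inj₂ dv = contradiction (∣-trans dv (n∣m*n e)) t
      by : Dec (e < u) → ν₀ (ι (u , v , e , f))
      by (yes lt) = subst ν₀ (sym (ι-hi lt)) (hi (u ∸ e) (m∸n+n≡m (<⇒≤ lt)) n)
      by (no nlt) = subst ν₀ (sym (ι-lo nlt)) (lo (e ∸ u) (m∸n+n≡m (≮⇒≥ nlt)) n)

    Ends = X0 ∩ u=e?

    D≡3 : D % 4 ≡ 3
    D≡3 = 4k+ 7 (D / 8 * 2) (trans (m≡m%n+[m/n]*n D 8) (cong₂ _+_ m (arith (D / 8))))
      where
      arith : ∀ t → t * 8 ≡ t * 2 * 4
      arith = solve-∀

    ≢1 : ∀ {n} → n ≡ D → n % 4 ≢ 1
    ≢1 refl e with trans (sym D≡3) e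
    ... | ()

    x[x+2f]≡1 : ∀ {x f} → Odd x → Even f → (x * (x + 2 * f)) % 4 ≡ 1
    x[x+2f]≡1 {x} {f} ox ef = go (odd-half {x} ox) (half {f} ef)
      where
      arith : ∀ a b → suc (2 * a) * (suc (2 * a) + 2 * (2 * b)) ≡ 1 + (a * a + a + 2 * a * b + b) * 4
      arith = solve-∀
      go : ∃[ a ] x ≡ suc (2 * a) → ∃[ b ] f ≡ 2 * b → (x * (x + 2 * f)) % 4 ≡ 1
      go (a , ea) (b , eb) = 4k+ 1 (a * a + a + 2 * a * b + b) (trans (cong₂ (λ x f → x * (x + 2 * f)) ea eb) (arith a b))

    ∤v? : Decidable (λ ((u , v) : Pair) → ¬ q ∣ v)
    ∤v? (u , v) = ¬? (q ∣? v)

    FixP : Quad → Set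
    FixP x = (((Ω D x × S0 x) × ν₀ x) × ¬ U=E x) × ι x ≡ x

    Shape : Quad → Set
    Shape (u , v , e , f) = e ≡ v × u ≡ f + v × q ∣ v × Unit (v + 2 * f)

    -- A fixed point with `e < u` gives `D = v (v + 2f)`; if `q` divided `v + 2f`, then
    -- `(f + v) f ≡ − f²` would not be a square. The other kind of fixed point would make `D ≡ 1`
    -- modulo 4.
    fix-shape : ∀ {u v e f} → FixP (u , v , e , f) → Shape (u , v , e , f)
    fix-shape {u} {v} {e} {f} (((((((u0 , v0 , e0 , f0) , eq) , s , n)) , ν) , u≢e) , r) = by (e <? u)
      where
      by : Dec (e < u) → Shape (u , v , e , f)
      by (yes lt) = hi (fixed-hi lt r) eq ν
        where
        hi : e ≡ v × u ≡ f + v → u * v + e * f ≡ D → ν₀ (u , v , e , f) → Shape (u , v , e , f)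
        hi (refl , refl) eq (inj₂ (a , b)) = contradiction (Sq-square (unit-*ˡ {v} a)) b
        hi (refl , refl) eq (inj₁ s) = refl , refl , q∣v , λ d′ → n′ d′
          where
          n′ : Unit (v + 2 * f)
          n′ d′ = Sq-neg (subst (q ∣_) (arith₂ v f) (∣-trans d′ (n∣m*n f))) s (Sq-square (unit-*ʳ {f + v} (proj₁ s)))
            where
            arith₂ : ∀ v f → f * (v + 2 * f) ≡ (f + v) * f + f * f
            arith₂ = solve-∀
          arith : ∀ v f → (f + v) * v + v * f ≡ v * (v + 2 * f)
          arith = solve-∀
          q∣v : q ∣ v
          q∣v with euclidsLemma v (v + 2 * f) q-prime (subst (q ∣_) (trans (sym eq) (arith v f)) q∣D)
          ... | inj₁ d = d
          ... | inj₂ d = contradiction d n′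
      by (no nlt) = ⊥-elim (lo (fixed-lo nlt r) s eq)
        where
        arith : ∀ u v → u * v + (v + u) * u ≡ u * (u + 2 * v)
        arith = solve-∀
        lo : f ≡ u × e ≡ v + f → par e ≡ par f → u * v + e * f ≡ D → ⊥
        lo (refl , refl) s eq = ≢1 {u * (u + 2 * v)} eq′ (x[x+2f]≡1 {u} {v} (proj₁ (odd-*⁻ u (u + 2 * v) (trans (cong par eq′) oD)))
          (trans (par∸ {u} {v + u} {v} (+-comm u v) refl s) (𝔹P.xor-same (par u))))
          where
          eq′ = trans (sym (arith u v)) eq

    ♯Fix : ♯ (X0 ∩ ∁ u=e? ∩ fix?) ≡ ♯ (Pairs D ∩ u<v₂? ∩ ∤v?)
    ♯Fix = cong par (#-onto (X0 ∩ ∁ u=e? ∩ fix?) (Pairs D ∩ u<v₂? ∩ ∤v?) (λ (u , v , e , f) → v , v + 2 * f) (λ { {u , v , e , f} p → to p })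
      (λ { {u , v , e , f} {u′ , v′ , e′ , f′} p p′ q → inj (fix-shape p) (fix-shape p′) q }) (λ { {x , y} p → onto p }))
      where
      arith : ∀ v f → v * (v + 2 * f) ≡ (f + v) * v + v * f
      arith = solve-∀
      to : ∀ {u v e f} → FixP (u , v , e , f) → (Π D (v , v + 2 * f) × v < v + 2 * f) × ¬ q ∣ v + 2 * f
      to {u} {v} {e} {f} p@(((((((u0 , v0 , e0 , f0) , eq) , s , n)) , _) , _) , _) = go (fix-shape p) eq
        where
        go : Shape (u , v , e , f) → u * v + e * f ≡ D → (Π D (v , v + 2 * f) × v < v + 2 * f) × ¬ q ∣ v + 2 * f
        go (refl , refl , _ , n) eq = (((v0 , m≤n⇒m≤n+o (2 * f) v0) , trans (arith v f) eq) , m<m+n v (≤-trans f0 (m≤m+n f (1 * f)))) , n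
      inj : ∀ {u v e f u′ v′ e′ f′} → Shape (u , v , e , f) → Shape (u′ , v′ , e′ , f′) → _≡_ {A = Pair} (v , v + 2 * f) (v′ , v′ + 2 * f′) → _≡_ {A = Quad} (u , v , e , f) (u′ , v′ , e′ , f′)
      inj {v = v} {f = f} {v′ = v′} {f′ = f′} (refl , refl , _) (refl , refl , _) r = same (cong proj₁ r) (cong proj₂ r)
        where
        same : v ≡ v′ → v + 2 * f ≡ v′ + 2 * f′ → _≡_ {A = Quad} (f + v , v , v , f) (f′ + v′ , v′ , v′ , f′)
        same refl e = cong (λ f → (f + v , v , v , f)) (*-cancelˡ-≡ f f′ 2 (+-cancelˡ-≡ v (2 * f) (2 * f′) e))
      onto : ∀ {x y} → (Π D (x , y) × x < y) × ¬ q ∣ y → ∃[ z ] FixP z × (let (u , v , e , f) = z in (v , v + 2 * f)) ≡ (x , y)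
      onto {x} {y} ((((x0 , y0) , eq) , x<y) , ny) = finish (m≤n⇒∃[o]m+o≡n (<⇒≤ x<y))
        where
        odds = odd-*⁻ x y (trans (cong par eq) oD)
        q∣x : q ∣ x
        q∣x with euclidsLemma x y q-prime (subst (q ∣_) (sym eq) q∣D)
        ... | inj₁ d = d
        ... | inj₂ d = contradiction d ny
        finish : ∃[ g ] x + g ≡ y → ∃[ z ] FixP z × (let (u , v , e , f) = z in (v , v + 2 * f)) ≡ (x , y)
        finish (g , refl) = finish₂ (half {g} (par∸ {x} {x + g} {g} refl (proj₁ odds) (proj₂ odds))) eq x<y ny
          where
          finish₂ : ∃[ f ] g ≡ 2 * f → x * (x + g) ≡ D → x < x + g → ¬ q ∣ x + g → ∃[ z ] FixP z × (let (u , v , e , f) = z in (v , v + 2 * f)) ≡ (x , x + g)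
          finish₂ (zero , refl) _ lt _ = contradiction lt (≤⇒≯ (≤-reflexive (+-identityʳ x)))
          finish₂ (f@(suc _) , refl) eq _ ny = (f + x , x , x , f) ,
            ((((((s≤s z≤n , x0 , x0 , s≤s z≤n) , trans (sym (arith x f)) eq) , trans (proj₁ odds) (sym of) , λ (_ , ex) → even-odd-⊥ {x} ex (proj₁ odds)) ,
              inj₁ (Sq-cong (≋-sym (+-∣ {f} q∣x *≋ ≋-refl {f})) (Sq-square {f} uf))) ,
              (λ p → <⇒≢ (m<n+m x (s≤s z≤n)) (sym p))) , trans (ι-hi (m<n+m x (s≤s z≤n))) (quad≡ refl refl refl (m+n∸n≡m f x))) , refl
            where
            of : Odd f
            of = ¬even⇒odd {f} λ ef → ≢1 eq (x[x+2f]≡1 {x} {f} (proj₁ odds) ef)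
            uf : Unit f
            uf d = ny (∣m∣n⇒∣m+n q∣x (∣-trans d (n∣m*n 2)))

    ♯X0 : ♯ X0 ≡ ♯ Ends xor ♯ (Pairs D ∩ u<v₂? ∩ ∤v?)
    ♯X0 = trans (♯-ι ν₀? ν₀-ι) (cong (♯ Ends xor_) ♯Fix)

  -- The solutions with u = e, where ι is undefined.

  module Ends (q : ℕ) (q-prime : Prime q) (q≡3 : q % 4 ≡ 3) (D : ℕ) (m : D % 8 ≡ 7) (q∣D : q ∣ D)
    (d Qk : ℕ) .{{Qk≢0 : NonZero Qk}} (q∣Qk : q ∣ Qk) (q∤d : ¬ q ∣ d)
    (cofactor : ∀ {h M} → ¬ q ∣ h → h * M ≡ D → ∃[ h₁ ] h * h₁ ≡ d × M ≡ Qk * h₁)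
    (D≡ : D ≡ Qk * d)
    (σ : Pair → Pair) (σ-Π : ∀ {x} → Π d x → Π d (σ x)) (σ-σ : ∀ {x} → Π d x → σ (σ x) ≡ x) (σ-free : ∀ {x} → Π d x → σ x ≢ x)
    (σ-Sq : ∀ {x} → Π d x → Residues.Sq q q-prime q≡3 (proj₁ x) → Residues.Sq q q-prime q≡3 (proj₁ (σ x)))
    (σ-mod4 : ∀ {x} → Π d x → proj₂ (σ x) % 4 ≡ proj₂ x % 4) where

    open Residues q q-prime q≡3
    open RowRatio q q-prime q≡3 D m q∣D

    -- The conditions on `v`, its parity and its class modulo `q`, have period `2q`; a block of two
    -- periods contains each admissible class twice.
    L : ℕ
    L = 4 * q

    instance
      L≢0 : NonZero L
      L≢0 = m*n≢0 4 q

    %-block : ∀ r t → r < L → (r + t * L) % L ≡ r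
    %-block r t lt = trans ([m+kn]%n≡m%n r t L) (m<n⇒m%n≡m lt)

    /-block : ∀ r t → r < L → (r + t * L) / L ≡ t
    /-block r t lt = trans (+-distrib-/-∣ʳ r {t * L} {L} (n∣m*n t)) (cong₂ _+_ (m<n⇒m/n≡0 lt) (m*n/n≡m t L))

    block : ∀ v → v ≡ v % L + v / L * L
    block v = m≡m%n+[m/n]*n v L

    /-< : ∀ {v M} → v / L < M / L → v < M
    /-< {v} {M} lt = ≰⇒> λ le → <⇒≱ lt (/-monoˡ-≤ L le)

    q∣L : ∀ t → q ∣ t * L
    q∣L t = ∣-trans (n∣m*n 4) (n∣m*n t)

    even-L : ∀ t → Even (t * L)
    even-L t = trans (par-* t L) (trans (cong (par t ∧_) (par-* 4 q)) (𝔹P.∧-zeroʳ (par t)))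

    -- β exchanges the two halves of each block of length L = 4q; on complete blocks it pairs off the admissible v.
    β₀ : ℕ → ℕ
    β₀ r with r <? 2 * q
    ... | yes _ = r + 2 * q
    ... | no _  = r ∸ 2 * q

    arith-L : 2 * q + 2 * q ≡ L
    arith-L = sym (*-distribʳ-+ q 2 2)

    β₀-< : ∀ {r} → r < L → β₀ r < L
    β₀-< {r} lt with r <? 2 * q
    ... | yes p = subst (r + 2 * q <_) arith-L (+-monoˡ-< (2 * q) p)
    ... | no _  = ≤-<-trans (m∸n≤m r (2 * q)) lt

    β₀-β₀ : ∀ {r} → r < L → β₀ (β₀ r) ≡ r
    β₀-β₀ {r} lt with r <? 2 * q
    ... | yes p with r + 2 * q <? 2 * q
    ...   | yes p′ = contradiction p′ (≤⇒≯ (m≤n+m (2 * q) r))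
    ...   | no _   = m+n∸n≡m r (2 * q)
    β₀-β₀ {r} lt | no p with r ∸ 2 * q <? 2 * q
    ...   | yes _ = m∸n+n≡m (≮⇒≥ p)
    ...   | no n  = contradiction (+-cancelʳ-< (2 * q) (r ∸ 2 * q) (2 * q) (subst₂ _<_ (sym (m∸n+n≡m (≮⇒≥ p))) (sym arith-L) lt)) n

    0<2q : 0 < 2 * q
    0<2q = *-mono-≤ {1} {2} (s≤s z≤n) (<-trans (s≤s z≤n) 1<q)

    β₀-free : ∀ {r} → β₀ r ≢ r
    β₀-free {r} with r <? 2 * q
    ... | yes p = λ e → <⇒≢ (m<m+n r 0<2q) (sym e)
    ... | no p  = λ e → <⇒≢ (m<n+m (r ∸ 2 * q) 0<2q) (trans e (sym (m+[n∸m]≡n (≮⇒≥ p))))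

    β₀-≋ : ∀ {r} → β₀ r ≋ r
    β₀-≋ {r} with r <? 2 * q
    ... | yes _ = +-∣ (n∣m*n 2)
    ... | no p  = ≋-trans (≋-sym (+-∣ (n∣m*n 2))) (≡⇒≋ (m∸n+n≡m (≮⇒≥ p)))

    β₀-par : ∀ {r} → par (β₀ r) ≡ par r
    β₀-par {r} with r <? 2 * q
    ... | yes _ = trans (par-+ r (2 * q)) (trans (cong (par r xor_) (par-* 2 q)) (𝔹P.xor-identityʳ (par r)))
    ... | no p  = trans (par∸ {2 * q} {r} {r ∸ 2 * q} (m+[n∸m]≡n (≮⇒≥ p)) (par-* 2 q) refl) refl

    β : ℕ → ℕ
    β v = β₀ (v % L) + v / L * L

    β-% : ∀ v → β v % L ≡ β₀ (v % L)
    β-% v = %-block (β₀ (v % L)) (v / L) (β₀-< (m%n<n v L))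

    β-/ : ∀ v → β v / L ≡ v / L
    β-/ v = /-block (β₀ (v % L)) (v / L) (β₀-< (m%n<n v L))

    β-β : ∀ v → β (β v) ≡ v
    β-β v = trans (cong₂ (λ r t → β₀ r + t * L) (β-% v) (β-/ v)) (trans (cong (_+ v / L * L) (β₀-β₀ (m%n<n v L))) (sym (block v)))

    β-free : ∀ v → β v ≢ v
    β-free v e = β₀-free (trans (sym (β-% v)) (cong (_% L) e))

    β-≋ : ∀ v → β v ≋ v
    β-≋ v = ≋-trans (β₀-≋ +≋ ≋-refl {v / L * L}) (≡⇒≋ (sym (block v)))

    β-par : ∀ v → par (β v) ≡ par v
    β-par v = trans (par-+ (β₀ (v % L)) (v / L * L)) (trans (cong (_xor par (v / L * L)) β₀-par) (trans (sym (par-+ (v % L) (v / L * L))) (cong par (sym (block v)))))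

    End : Quad → Set
    End x = ((Ω D x × S0 x) × ν₀ x) × U=E x

    -- From `hv ≡ − hf` it follows that `hv` is a nonsquare as soon as `hf` is a square, so one
    -- alternative of `ν₀` remains.
    End′ : ℕ → ℕ → ℕ → Set
    End′ h v f = (0 < h × 0 < v × 0 < f) × h * (v + f) ≡ D × Even v × NS (h * v)

    from-End : ∀ {u v e f} → End (u , v , e , f) → u ≡ e × End′ u v f
    from-End {u} {v} {.u} {f} (((((u0 , v0 , e0 , f0) , eq) , s , n) , ν) , refl) = refl , (u0 , v0 , f0) , eq′ , ev , ns ν
      where
      eq′ = trans (*-distribˡ-+ u v f) eq
      odds = odd-*⁻ u (v + f) (trans (cong par eq′) oD)
      ev : Even v
      ev = par∸ {f} {v + f} {v} (+-comm f v) (trans (sym s) (proj₁ odds)) (proj₂ odds)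
      ns : Sq (u * f) ⊎ NS (u * v) → NS (u * v)
      ns (inj₂ n) = n
      ns (inj₁ s) = (λ dv → proj₁ s (∣m+n∣m⇒∣n dvd dv)) , Sq-neg (subst (q ∣_) (+-comm (u * v) (u * f)) dvd) s
        where
        dvd : q ∣ u * v + u * f
        dvd = subst (q ∣_) (sym eq) q∣D

    to-End : ∀ {h v f} → End′ h v f → End (h , v , h , f)
    to-End {h} {v} {f} ((h0 , v0 , f0) , eq , ev , n) = ((((h0 , v0 , h0 , f0) , trans (sym (*-distribˡ-+ h v f)) eq) ,
      trans (proj₁ odds) (sym of) , λ (eh , _) → even-odd-⊥ {h} eh (proj₁ odds)) , inj₂ n) , refl
      where
      odds = odd-*⁻ h (v + f) (trans (cong par eq) oD)
      of : Odd f
      of = par∸ {v} {v + f} {f} refl ev (proj₂ odds)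

    -- The block of `v` is completed before `v + f`, so that the partner of `v` under `β` is also
    -- admissible.
    Low : Quad → Set
    Low (u , v , e , f) = v / L < (v + f) / L

    low? : Decidable Low
    low? (u , v , e , f) = v / L <? (v + f) / L

    positive : ∀ {x y} → Unit (x * y) → 0 < y
    positive {x} {zero}  u = contradiction (subst (q ∣_) (sym (*-zeroʳ x)) (q ∣0)) u
    positive {x} {suc y} u = s≤s z≤n

    NS-≋ : ∀ {x y} → x ≋ y → NS x → NS y
    NS-≋ c (a , b) = unit-cong c a , λ s → b (Sq-cong (≋-sym c) s)

    ♯Low : ♯ (Ends ∩ low?) ≡ false
    ♯Low = ♯-free _≟Q_ (Ends ∩ low?) (λ (u , v , e , f) → u , β v , e , (v + f) ∸ β v) (λ { {u , v , e , f} (p , l) → step (from-End p) l })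
      (λ { {u , v , e , f} (_ , l) → let h = sum l in quad≡ refl (β-β v) refl (trans (cong₂ _∸_ h (β-β v)) (m+n∸m≡n v f)) })
      (λ { {u , v , e , f} _ r → β-free v (cong (λ (_ , v , _) → v) r) })
      where
      sum : ∀ {v f} → v / L < (v + f) / L → β v + ((v + f) ∸ β v) ≡ v + f
      sum {v} {f} l = m+[n∸m]≡n (<⇒≤ (/-< (subst (_< (v + f) / L) (sym (β-/ v)) l)))
      step : ∀ {u v e f} → u ≡ e × End′ u v f → v / L < (v + f) / L → End (u , β v , e , (v + f) ∸ β v) × β v / L < (β v + ((v + f) ∸ β v)) / L
      step {u} {v} {.u} {f} (refl , ((h0 , v0 , f0) , eq , ev , n)) l = to-End ((h0 , positive {u} (proj₁ n′) , m<n⇒0<n∸m lt) , trans (cong (u *_) (sum l)) eq , trans (β-par v) ev , n′) ,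
        subst₂ (λ a b → a < b / L) (sym (β-/ v)) (sym (sum l)) l
        where
        lt : β v < v + f
        lt = /-< (subst (_< (v + f) / L) (sym (β-/ v)) l)
        n′ : NS (u * β v)
        n′ = NS-≋ (≋-refl {u} *≋ ≋-sym (β-≋ v)) n

    -- Since `q` divides `Qk`, the remainder modulo `4q` sees the other factor only modulo 4.
    Qk*-%L : ∀ {a b} → a % 4 ≡ b % 4 → Qk * a % L ≡ Qk * b % L
    Qk*-%L {a} {b} e = go q∣Qk
      where
      go : q ∣ Qk → Qk * a % L ≡ Qk * b % L
      go (divides c r) = trans (lemma a) (trans (cong (_* q) (trans (%-distribˡ-* c a 4) (trans (cong (λ x → (c % 4 * x) % 4) e) (sym (%-distribˡ-* c b 4))))) (sym (lemma b)))
        where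
        lemma : ∀ a → Qk * a % L ≡ (c * a) % 4 * q
        lemma a = trans (cong (_% L) (trans (cong (_* a) r) (arith c q a))) (sym (m%n*o≡m*o%[n*o] (c * a) 4 q))
          where
          arith : ∀ c q a → c * q * a ≡ c * a * q
          arith = solve-∀

    module _ where

      -- In the incomplete last block replace the divisor h by its partner and keep the position of v in the block;
      -- the length of that block only depends on h modulo 4.
      next : ℕ → Pair → Quad
      next v (h , h₁) = h , v′ , h , Qk * h₁ ∸ v′
        where v′ = v % L + Qk * h₁ / L * L

      ψ : Quad → Quad
      ψ (u , v , e , f) = next v (σ (u , (v + f) / Qk))

      HighP : Quad → Set
      HighP x = End x × ¬ Low x

      -- Recovers the divisor pair of `d` on which `σ` acts: `h` is prime to `q`, hence the whole
      -- power `Qk` lies in `v + f`.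
      data Coords : Quad → Set where
        coords : ∀ h h₁ v f → Π d (h , h₁) → v + f ≡ Qk * h₁ → (v + f) / Qk ≡ h₁ → v / L ≡ Qk * h₁ / L → v % L < Qk * h₁ % L → Even v → NS (h * v) → 0 < v → 0 < f → Coords (h , v , h , f)

      to-Coords : ∀ {u v e f} → HighP (u , v , e , f) → Coords (u , v , e , f)
      to-Coords {u} {v} {e} {f} (p , nl) = go (from-End p) nl
        where
        go : u ≡ e × End′ u v f → ¬ v / L < (v + f) / L → Coords (u , v , e , f)
        go (refl , ((h0 , v0 , f0) , eq , ev , n)) nl = go₂ (cofactor (unit-*ˡ {u} (proj₁ n)) eq)
          where
          go₂ : ∃[ h₁ ] u * h₁ ≡ d × v + f ≡ Qk * h₁ → Coords (u , v , u , f)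
          go₂ (h₁ , e₁ , e₂) = coords u h₁ v f ((h0 , pos h₁ e₂) , e₁) e₂ (trans (cong (_/ Qk) (trans e₂ (*-comm Qk h₁))) (m*n/n≡m h₁ Qk)) same
            (subst (λ M → v % L < M % L) e₂ lt) ev n v0 f0
            where
            pos : ∀ h₁ → v + f ≡ Qk * h₁ → 0 < h₁
            pos zero e = contradiction (trans e (*-zeroʳ Qk)) (λ z → <⇒≢ (m≤n⇒m≤n+o f v0) (sym z))
            pos (suc _) _ = s≤s z≤n
            same₀ : v / L ≡ (v + f) / L
            same₀ = ≤-antisym (/-monoˡ-≤ L (m≤m+n v f)) (≮⇒≥ nl)
            same : v / L ≡ Qk * h₁ / L
            same = trans same₀ (cong (_/ L) e₂)
            lt : v % L < (v + f) % L
            lt = +-cancelʳ-< (v / L * L) (v % L) ((v + f) % L) (subst₂ _<_ (block v) (trans (block (v + f)) (cong (λ t → (v + f) % L + t * L) (sym same₀))) (m<m+n v f0))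

      ψ-coords : ∀ {x} → Coords x → HighP (ψ x)
      ψ-coords (coords h h₁ v f π e₂ r same lt ev n v0 f0) = subst HighP (sym (cong (λ z → next v (σ (h , z))) r)) (go (σ (h , h₁)) (σ-Π π) (σ-mod4 π) (σ-Sq π) (λ s → subst (λ z → Sq (proj₁ z)) (σ-σ π) (σ-Sq (σ-Π π) s)))
        where
        go : ∀ y → Π d y → proj₂ y % 4 ≡ h₁ % 4 → (Sq h → Sq (proj₁ y)) → (Sq (proj₁ y) → Sq h) → HighP (next v y)
        go (h′ , h₁′) ((h′0 , h₁′0) , e′) m4 s→ s← = to-End ((h′0 , positive {h′} (proj₁ n′) , m<n⇒0<n∸m v′<M) ,
            trans (cong (h′ *_) sum) (trans (arith h′ Qk h₁′) (trans (cong (Qk *_) e′) (sym D≡))) ,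
            trans (par-+ (v % L) _) (trans (cong (par (v % L) xor_) (even-L (Qk * h₁′ / L))) (trans (𝔹P.xor-identityʳ _) (trans (sym (par-block v)) ev))) , n′) ,
          λ l → <⇒≢ l (trans (/-block (v % L) _ (m%n<n v L)) (cong (_/ L) (sym sum)))
          where
          M′ = Qk * h₁′
          v′ = v % L + M′ / L * L
          par-block : ∀ v → par v ≡ par (v % L)
          par-block v = trans (cong par (block v)) (trans (par-+ (v % L) (v / L * L)) (trans (cong (par (v % L) xor_) (even-L (v / L))) (𝔹P.xor-identityʳ _)))
          v′<M : v′ < M′
          v′<M = subst (v′ <_) (sym (block M′)) (+-monoˡ-< (M′ / L * L) (subst (v % L <_) (Qk*-%L (sym m4)) lt))
          sum : v′ + (M′ ∸ v′) ≡ M′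
          sum = m+[n∸m]≡n (<⇒≤ v′<M)
          arith : ∀ h Q a → h * (Q * a) ≡ Q * (h * a)
          arith = solve-∀
          v≋ : v ≋ v′
          v≋ = ≋-trans (≡⇒≋ (block v)) (≋-trans (+-∣ (q∣L (v / L))) (≋-sym (+-∣ (q∣L (M′ / L)))))
          uh′ : Unit h′
          uh′ dv = q∤d (subst (q ∣_) e′ (∣-trans dv (m∣m*n h₁′)))
          uv : Unit v
          uv = unit-*ʳ {h} (proj₁ n)
          n′ : NS (h′ * v′)
          n′ = unit-* uh′ (unit-cong v≋ uv) , λ s → bad (Sq-cong (≋-refl {h′} *≋ ≋-sym v≋) s)
            where
            -- `h` and `h′` have the same character, as `σ-Sq` applies to `σ` and, `σ` being an
            -- involution, also backwards.
            bad : Sq (h′ * v) → ⊥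
            bad s with sq? h
            ... | yes sh = proj₂ n (Sq-* sh (Sq-/ (s→ sh) s))
            ... | no nh  = proj₂ n (nonSq-* (unit-*ˡ {h} (proj₁ n)) uv nh λ sv → nh (s← (Sq-/ sv (subst Sq (*-comm h′ v) s))))

      ψ-ψ : ∀ {x} → Coords x → ψ (ψ x) ≡ x
      ψ-ψ c@(coords h h₁ v f π e₂ r same lt ev n v0 f0) = trans (cong ψ (cong (λ z → next v (σ (h , z))) r)) (go (σ (h , h₁)) (σ-Π π) (σ-σ π) (ψ-coords′))
        where
        ψ-coords′ : HighP (next v (σ (h , h₁)))
        ψ-coords′ = subst HighP (cong (λ z → next v (σ (h , z))) r) (ψ-coords c)
        go : ∀ y → Π d y → σ y ≡ (h , h₁) → HighP (next v y) → ψ (next v y) ≡ (h , v , h , f)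
        go (h′ , h₁′) π′ σy hp = trans (cong (λ z → next v′ (σ (h′ , z))) M/Q) (trans (cong (next v′) σy) (quad≡ refl v″ refl (trans (cong₂ _∸_ (sym e₂) v″) (m+n∸m≡n v f))))
          where
          M′ = Qk * h₁′
          v′ = v % L + M′ / L * L
          v′%L : v′ % L ≡ v % L
          v′%L = %-block (v % L) (M′ / L) (m%n<n v L)
          v″ : v′ % L + Qk * h₁ / L * L ≡ v
          v″ = trans (cong₂ (λ a b → a + b * L) v′%L (sym same)) (sym (block v))
          h₁≡ : ∀ {x} → Coords x → x ≡ next v (h′ , h₁′) → (v′ + (M′ ∸ v′)) / Qk ≡ h₁′
          h₁≡ (coords h″ h₁″ v₂ f₂ ((h0 , _) , p) e r′ _ _ _ _ _ _) q with cong proj₁ q | cong (λ (_ , v , _) → v) q | cong (λ (_ , _ , _ , f) → f) q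
          ... | refl | refl | refl = trans r′ (*-cancelˡ-≡ h₁″ h₁′ h″ {{>-nonZero h0}} (trans p (sym (proj₂ π′))))
          M/Q : (v′ + (M′ ∸ v′)) / Qk ≡ h₁′
          M/Q = h₁≡ (to-Coords hp) refl

      ψ-free : ∀ {x} → Coords x → ψ x ≢ x
      ψ-free (coords h h₁ v f π e₂ r same lt ev n v0 f0) q = go (σ (h , h₁)) (σ-Π π) (σ-free π) (trans (sym (cong (λ z → next v (σ (h , z))) r)) q)
        where
        go : ∀ y → Π d y → y ≢ (h , h₁) → next v y ≢ (h , v , h , f)
        go (h′ , h₁′) ((h′0 , _) , p) ne q with cong proj₁ q
        ... | refl = ne (cong (h ,_) (*-cancelˡ-≡ h₁′ h₁ h {{>-nonZero h′0}} (trans p (sym (proj₂ π)))))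

    ♯High : ♯ (Ends ∩ ∁ low?) ≡ false
    ♯High = ♯-free _≟Q_ (Ends ∩ ∁ low?) ψ (λ { {u , v , e , f} p → ψ-coords (to-Coords p) }) (λ { {u , v , e , f} p → ψ-ψ (to-Coords p) }) (λ { {u , v , e , f} p → ψ-free (to-Coords p) })

    ♯Ends : ♯ Ends ≡ false
    ♯Ends = trans (♯-split Ends low?) (cong₂ _xor_ ♯Low ♯High)

  -- Factorisations of d and of its multiples by powers of q.

  module DivisorPairs (q : ℕ) (q-prime : Prime q) (d : ℕ) (d≡1 : d % 4 ≡ 1) (q∤d : ¬ q ∣ d) (d-nonsquare : ∀ s → s * s ≢ d) where

    ∤v? : Decidable (λ ((u , v) : Pair) → ¬ q ∣ v)
    ∤v? (u , v) = ¬? (q ∣? v)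

    ∤u? : Decidable (λ ((u , v) : Pair) → ¬ q ∣ u)
    ∤u? (u , v) = ¬? (q ∣? u)

    both? : Decidable (λ ((u , v) : Pair) → q ∣ v × q ∣ u)
    both? (u , v) = (q ∣? v) ×-dec (q ∣? u)

    ¬¬∣ : ∀ {x} → ¬ ¬ q ∣ x → q ∣ x
    ¬¬∣ {x} n with q ∣? x
    ... | yes d = d
    ... | no k  = contradiction k n

    mod4-product : ∀ {N u v} → u * v ≡ N → Odd N → (u % 4 ≡ 1 ⊎ u % 4 ≡ 3) × (v % 4 ≡ 1 ⊎ v % 4 ≡ 3) × N % 4 ≡ (u % 4 * (v % 4)) % 4
    mod4-product {N} {u} {v} refl o = mod4-odd {u} (proj₁ odds) , mod4-odd {v} (proj₂ odds) , %-distribˡ-* u v 4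
      where
      odds = odd-*⁻ u v o

    clash : ∀ {a b : ℕ} {x y : ℕ} → x ≡ y → x ≡ a → y ≡ b → a ≡ b
    clash refl refl e = e

    τ₂ : ℕ
    τ₂ = # (Pairs d ∩ u<v₂?)

    #d : # (Pairs d) ≡ 2 * τ₂
    #d = trans (#-split (Pairs d) u<v₂?) (cong (τ₂ +_) (trans (#-bij (Pairs d ∩ ∁ u<v₂?) (Pairs d ∩ u<v₂?) sw₂ sw₂
      (λ { {u , v} (p , n) → swΠ p , ≤∧≢⇒< (≮⇒≥ n) λ { refl → d-nonsquare u (proj₂ p) } }) (λ { {u , v} (p , l) → swΠ p , <-asym l }) (λ _ → refl) (λ _ → refl))
      (sym (+-identityʳ τ₂))))

    -- Complementary divisors of `d ≡ 1` modulo 4 are congruent modulo 4, and swapping them is free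
    -- because `d` is not a square.
    ♯d-≢3 : ♯ (Pairs d ∩ ∁ v≡3?) ≡ false
    ♯d-≢3 = ♯-free _≟P_ (Pairs d ∩ ∁ v≡3?) sw₂ (λ { {u , v} (p , n) → swΠ p , λ u3 → n (v3 u v (proj₂ p) u3) }) (λ _ → refl)
      (λ { {u , v} (p , _) e → d-nonsquare u (trans (cong (u *_) (sym (cong proj₁ e))) (proj₂ p)) })
      where
      v3 : ∀ u v → u * v ≡ d → u % 4 ≡ 3 → v % 4 ≡ 3
      v3 u v eq u3 with mod4-product {d} {u} {v} eq (odd-mod4 {d} (inj₁ d≡1))
      ... | _ , inj₂ e , _ = e
      ... | _ , inj₁ e , m = contradiction (clash m d≡1 (cong₂ (λ a b → a * b % 4) u3 e)) λ ()

    module Level (N Q : ℕ) .{{_ : NonZero Q}} (N≡ : N ≡ Q * d) (q∣Q : q ∣ Q)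
      (cofactor : ∀ {h M} → ¬ q ∣ h → h * M ≡ N → ∃[ h₁ ] h * h₁ ≡ d × M ≡ Q * h₁) where

      q∣N : q ∣ N
      q∣N = subst (q ∣_) (sym N≡) (∣-trans q∣Q (m∣m*n d))

      other : ∀ {u v} → u * v ≡ N → ¬ q ∣ v → q ∣ u
      other {u} {v} eq n with euclidsLemma u v q-prime (subst (q ∣_) (sym eq) q∣N)
      ... | inj₁ a = a
      ... | inj₂ a = contradiction a n

      lift : Pair → Pair
      lift (h , h₁) = Q * h , h₁

      lift-Π : ∀ {h h₁} → Π d (h , h₁) → Π N (Q * h , h₁) × ¬ q ∣ h₁
      lift-Π {h} {h₁} ((h0 , h₁0) , eq) = ((*-mono-≤ (>-nonZero⁻¹ Q) h0 , h₁0) , trans (*-assoc Q h h₁) (trans (cong (Q *_) eq) (sym N≡))) ,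
        λ dv → q∤d (subst (q ∣_) eq (∣-trans dv (n∣m*n h)))

      lift-inj : ∀ {x y} → lift x ≡ lift y → x ≡ y
      lift-inj {h , h₁} {k , k₁} e = cong₂ _,_ (*-cancelˡ-≡ h k Q (cong proj₁ e)) (cong proj₂ e)

      lift-onto : ∀ {u v} → Π N (u , v) × ¬ q ∣ v → ∃[ x ] Π d x × lift x ≡ (u , v)
      lift-onto {u} {v} (((u0 , v0) , eq) , n) = go (cofactor n (trans (*-comm v u) eq))
        where
        go : ∃[ h₁ ] v * h₁ ≡ d × u ≡ Q * h₁ → ∃[ x ] Π d x × lift x ≡ (u , v)
        go (h , e₁ , e₂) = (h , v) , ((pos h e₂ , v0) , trans (*-comm h v) e₁) , cong (_, v) (sym e₂)
          where
          pos : ∀ h → u ≡ Q * h → 0 < h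
          pos zero e = contradiction (subst (0 <_) (trans e (*-zeroʳ Q)) u0) (n≮n 0)
          pos (suc _) _ = s≤s z≤n

      P< = Pairs N ∩ u<v₂?
      F< = P< ∩ ∤v?

      swap-∤ : # (P< ∩ ∁ ∤v? ∩ ∤u?) ≡ # (Pairs N ∩ ∤v? ∩ ∁ u<v₂?)
      swap-∤ = #-bij (P< ∩ ∁ ∤v? ∩ ∤u?) (Pairs N ∩ ∤v? ∩ ∁ u<v₂?) sw₂ sw₂
        (λ { {u , v} (((p , l) , _) , n) → (swΠ p , n) , <-asym l })
        (λ { {u , v} ((p , n) , nl) → ((swΠ p , ≤∧≢⇒< (≮⇒≥ nl) λ { refl → n (other (proj₂ p) n) }) , λ n′ → n′ (other (proj₂ p) n)) , n })
        (λ _ → refl) (λ _ → refl)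

      #∤ : # (Pairs N ∩ ∤v?) ≡ # (Pairs d)
      #∤ = sym (#-onto (Pairs d) (Pairs N ∩ ∤v?) lift (λ { {h , h₁} p → lift-Π p }) (λ _ _ → lift-inj) (λ { {u , v} p → lift-onto p }))

      -- If `q` divides only one factor, that factor contains all of `Q`; removing it leaves an
      -- arbitrary ordered factorisation of `d`, and there are `2 τ₂` of these.
      #P< : # P< ≡ # (P< ∩ both?) + 2 * τ₂
      #P< = trans (#-split P< ∤v?) (trans (cong (# F< +_) (#-split (P< ∩ ∁ ∤v?) ∤u?)) (trans
        (cong₂ _+_ (#-ext F< (Pairs N ∩ ∤v? ∩ u<v₂?) (λ ((a , b) , c) → (a , c) , b) (λ ((a , b) , c) → (a , c) , b))
          (cong₂ _+_ swap-∤ (#-ext (P< ∩ ∁ ∤v? ∩ ∁ ∤u?) (P< ∩ both?) (λ ((a , b) , c) → a , ¬¬∣ b , ¬¬∣ c) (λ (a , b , c) → (a , λ n → n b) , λ n → n c))))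
        (trans (arith (# (Pairs N ∩ ∤v? ∩ u<v₂?)) (# (Pairs N ∩ ∤v? ∩ ∁ u<v₂?)) (# (P< ∩ both?)))
          (cong (# (P< ∩ both?) +_) (trans (sym (#-split (Pairs N ∩ ∤v?) u<v₂?)) (trans #∤ #d))))))
        where
        arith : ∀ a b c → a + (b + c) ≡ c + (a + b)
        arith = solve-∀

      ♯P< : ♯ P< ≡ ♯ (P< ∩ both?)
      ♯P< = trans (cong par #P<) (trans (par-+ (# (P< ∩ both?)) (2 * τ₂)) (trans (cong (♯ (P< ∩ both?) xor_) (par-* 2 τ₂)) (𝔹P.xor-identityʳ _)))

      K = Pairs N ∩ u<v₂? ∩ v≡3?

      -- As `N ≡ 3` modulo 4, swapping turns the pairs of `K` with `q ∤ u` into pairs with `q ∤ v`,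
      -- `v ≢ 3` and `v < u`. Modulo 2 these match the part `v ≢ 3` of `F<`, because together they
      -- correspond to the divisor pairs counted in `♯d-≢3`.
      ♯K : N % 4 ≡ 3 → ♯ K ≡ ♯ F< xor ♯ (K ∩ both?)
      ♯K N3 = trans (♯-split K ∤v?) (trans (cong (♯ (K ∩ ∤v?) xor_) (♯-split (K ∩ ∁ ∤v?) ∤u?)) (trans (cong₂ _xor_
          (cong par (#-ext (K ∩ ∤v?) (F< ∩ v≡3?) (λ ((a , b) , c) → (a , c) , b) (λ ((a , b) , c) → (a , c) , b)))
          (cong₂ _xor_ swap-K (cong par (#-ext (K ∩ ∁ ∤v? ∩ ∁ ∤u?) (K ∩ both?) (λ ((a , b) , c) → a , ¬¬∣ b , ¬¬∣ c) (λ (a , b , c) → (a , λ n → n b) , λ n → n c)))))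
        (lemma (♯ F<) (♯ (F< ∩ v≡3?)) (♯ (F< ∩ ∁ v≡3?)) (♯ (Pairs N ∩ ∤v? ∩ ∁ v≡3? ∩ ∁ u<v₂?)) (♯ (K ∩ both?)) (♯-split F< v≡3?) total)))
        where
        oN : Odd N
        oN = odd-mod4 {N} (inj₂ N3)
        swap-K : ♯ (K ∩ ∁ ∤v? ∩ ∤u?) ≡ ♯ (Pairs N ∩ ∤v? ∩ ∁ v≡3? ∩ ∁ u<v₂?)
        swap-K = ♯-bij (K ∩ ∁ ∤v? ∩ ∤u?) (Pairs N ∩ ∤v? ∩ ∁ v≡3? ∩ ∁ u<v₂?) sw₂ sw₂
          (λ { {u , v} ((((p , l) , v3) , _) , n) → ((swΠ p , n) , λ u3 → both-3 u v (proj₂ p) u3 v3) , <-asym l })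
          (λ { {u , v} (((p , n) , n3) , nl) → (((swΠ p , ≤∧≢⇒< (≮⇒≥ nl) λ { refl → n (other (proj₂ p) n) }) , u3 u v (proj₂ p) n3) , λ n′ → n′ (other (proj₂ p) n)) , n })
          (λ _ → refl) (λ _ → refl)
          where
          both-3 : ∀ u v → u * v ≡ N → u % 4 ≡ 3 → v % 4 ≡ 3 → ⊥
          both-3 u v eq a b with mod4-product {N} {u} {v} eq oN
          ... | _ , _ , m = contradiction (clash m N3 (cong₂ (λ a b → a * b % 4) a b)) λ ()
          u3 : ∀ u v → u * v ≡ N → ¬ v % 4 ≡ 3 → u % 4 ≡ 3
          u3 u v eq n with mod4-product {N} {u} {v} eq oN
          ... | inj₂ e , _ = e
          ... | inj₁ _ , inj₂ e , _ = contradiction e n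
          ... | inj₁ a , inj₁ b , m = contradiction (clash m N3 (cong₂ (λ a b → a * b % 4) a b)) λ ()
        total : ♯ (F< ∩ ∁ v≡3?) xor ♯ (Pairs N ∩ ∤v? ∩ ∁ v≡3? ∩ ∁ u<v₂?) ≡ false
        total = trans (cong (_xor ♯ (Pairs N ∩ ∤v? ∩ ∁ v≡3? ∩ ∁ u<v₂?)) (cong par (#-ext (F< ∩ ∁ v≡3?) (Pairs N ∩ ∤v? ∩ ∁ v≡3? ∩ u<v₂?)
            (λ (((a , b) , c) , e) → ((a , c) , e) , b) (λ (((a , c) , e) , b) → ((a , b) , c) , e))))
          (trans (sym (♯-split (Pairs N ∩ ∤v? ∩ ∁ v≡3?) u<v₂?)) (trans (cong par (sym (#-onto (Pairs d ∩ ∁ v≡3?) (Pairs N ∩ ∤v? ∩ ∁ v≡3?) lift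
            (λ { {h , h₁} (p , n) → lift-Π p , n }) (λ _ _ → lift-inj)
            (λ { {u , v} ((p , n) , n3) → onto p n n3 (lift-onto (p , n)) })))) ♯d-≢3))
          where
          onto : ∀ {u v} → Π N (u , v) → ¬ q ∣ v → ¬ v % 4 ≡ 3 → ∃[ x ] Π d x × lift x ≡ (u , v) → ∃[ x ] (Π d x × ¬ proj₂ x % 4 ≡ 3) × lift x ≡ (u , v)
          onto p n n3 ((h , h₁) , π , refl) = (h , h₁) , (π , n3) , refl
        lemma : ∀ f a b c k → f ≡ a xor b → b xor c ≡ false → a xor (c xor k) ≡ f xor k
        lemma _ a true  true  k refl _ = go a k
          where
          go : ∀ a k → a xor not k ≡ (a xor true) xor k
          go true  k = 𝔹P.not-involutive k
          go false k = refl
        lemma _ a false false k refl _ = cong (_xor k) (sym (𝔹P.xor-identityʳ a))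

    module Both (N N′ : ℕ) (N≡ : N ≡ q * q * N′) where

      instance
        q≢0 : NonZero q
        q≢0 = prime⇒nonZero q-prime

      scale₂ : Pair → Pair
      scale₂ (u , v) = u * q , v * q

      scale₂-inj : ∀ {x y} → scale₂ x ≡ scale₂ y → x ≡ y
      scale₂-inj {a , b} {c , e} p = cong₂ _,_ (*-cancelʳ-≡ a c q (cong proj₁ p)) (*-cancelʳ-≡ b e q (cong proj₂ p))

      pos-* : ∀ {x} → 0 < x → 0 < x * q
      pos-* x0 = *-mono-≤ x0 (>-nonZero⁻¹ q)

      arith : ∀ u v q → u * q * (v * q) ≡ q * q * (u * v)
      arith = solve-∀

      scale-Π : ∀ {u v} → Π N′ (u , v) → Π N (u * q , v * q)
      scale-Π {u} {v} ((u0 , v0) , eq) = (pos-* u0 , pos-* v0) , trans (arith u v q) (trans (cong (q * q *_) eq) (sym N≡))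

      unscale-Π : ∀ {u v} → Π N (u * q , v * q) → Π N′ (u , v)
      unscale-Π {u} {v} ((u0 , v0) , eq) = (pos u u0 , pos v v0) , *-cancelˡ-≡ (u * v) N′ (q * q) {{m*n≢0 q q}} (trans (sym (arith u v q)) (trans eq N≡))
        where
        pos : ∀ x → 0 < x * q → 0 < x
        pos (suc x) _ = s≤s z≤n

      #both : # (Pairs N ∩ u<v₂? ∩ both?) ≡ # (Pairs N′ ∩ u<v₂?)
      #both = sym (#-onto (Pairs N′ ∩ u<v₂?) (Pairs N ∩ u<v₂? ∩ both?) scale₂
        (λ { {u , v} (p , l) → (scale-Π p , *-monoˡ-< q l) , n∣m*n v , n∣m*n u }) (λ _ _ → scale₂-inj)
        (λ { {u , v} ((p , l) , divides b refl , divides a refl) → (a , b) , (unscale-Π p , *-cancelʳ-< q a b l) , refl }))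

      -- Multiplication by `q ≡ 3` exchanges the two odd residues modulo 4.
      ♯K-both : q % 4 ≡ 3 → Odd N′ → ♯ (Pairs N ∩ u<v₂? ∩ v≡3? ∩ both?) ≡ ♯ (Pairs N′ ∩ u<v₂? ∩ ∁ v≡3?)
      ♯K-both q3 oN = cong par (sym (#-onto (Pairs N′ ∩ u<v₂? ∩ ∁ v≡3?) (Pairs N ∩ u<v₂? ∩ v≡3? ∩ both?) scale₂
        (λ { {u , v} ((p , l) , n) → ((scale-Π p , *-monoˡ-< q l) , to3 v (proj₂ (odd-*⁻ u v (trans (cong par (proj₂ p)) oN))) n) , n∣m*n v , n∣m*n u }) (λ _ _ → scale₂-inj)
        (λ { {u , v} (((p , l) , v3) , divides b refl , divides a refl) → (a , b) , ((unscale-Π p , *-cancelʳ-< q a b l) , from3 b v3) , refl })))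
        where
        to3 : ∀ v → Odd v → ¬ v % 4 ≡ 3 → v * q % 4 ≡ 3
        to3 v o n with mod4-odd {v} o
        ... | inj₂ e = contradiction e n
        ... | inj₁ e = trans (%-distribˡ-* v q 4) (cong₂ (λ a b → a * b % 4) e q3)
        from3 : ∀ b → b * q % 4 ≡ 3 → ¬ b % 4 ≡ 3
        from3 b m e = contradiction (clash (%-distribˡ-* b q 4) m (cong₂ (λ a b → a * b % 4) e q3)) λ ()

  -- Induction on the power of q in D.

  module PrimePower (q : ℕ) (q-prime : Prime q) (q≡3 : q % 4 ≡ 3) (d : ℕ) (d≡1 : d % 4 ≡ 1) (q∤d : ¬ q ∣ d) (d-nonsquare : ∀ s → s * s ≢ d)
    (qd≡7 : (q * d) % 8 ≡ 7)
    (σ : Pair → Pair) (σ-Π : ∀ {x} → Π d x → Π d (σ x)) (σ-σ : ∀ {x} → Π d x → σ (σ x) ≡ x) (σ-free : ∀ {x} → Π d x → σ x ≢ x)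
    (σ-Sq : ∀ {x} → Π d x → Residues.Sq q q-prime q≡3 (proj₁ x) → Residues.Sq q q-prime q≡3 (proj₁ (σ x)))
    (σ-mod4 : ∀ {x} → Π d x → proj₂ (σ x) % 4 ≡ proj₂ x % 4) where

    instance
      q≢0 : NonZero q
      q≢0 = prime⇒nonZero q-prime

    P Q D : ℕ → ℕ
    P zero    = d
    P (suc k) = q * q * P k
    Q zero    = q
    Q (suc k) = q * q * Q k
    D k = q * P k

    Q≢0 : ∀ k → NonZero (Q k)
    Q≢0 zero    = q≢0
    Q≢0 (suc k) = m*n≢0 (q * q) (Q k) {{m*n≢0 q q}} {{Q≢0 k}}

    q∣Q : ∀ k → q ∣ Q k
    q∣Q zero    = ∣-refl
    q∣Q (suc k) = ∣-trans (q∣Q k) (n∣m*n (q * q))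

    P-step : ∀ k → P (suc k) ≡ q * D k
    P-step k = *-assoc q q (P k)

    D≡ : ∀ k → D k ≡ Q k * d
    D≡ zero    = refl
    D≡ (suc k) = trans (arith q (P k)) (trans (cong (q * q *_) (D≡ k)) (sym (*-assoc (q * q) (Q k) d)))
      where
      arith : ∀ q x → q * (q * q * x) ≡ q * q * (q * x)
      arith = solve-∀

    P≡ : ∀ k → P (suc k) ≡ q * Q k * d
    P≡ k = trans (P-step k) (trans (cong (q *_) (D≡ k)) (sym (*-assoc q (Q k) d)))

    Cofactor : ℕ → ℕ → Set
    Cofactor N Q = ∀ {h M} → ¬ q ∣ h → h * M ≡ N → ∃[ h₁ ] h * h₁ ≡ d × M ≡ Q * h₁

    cofactor-step : ∀ {N Q} → Cofactor N Q → Cofactor (q * N) (q * Q)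
    cofactor-step {N} {Q} c {h} {M} n e with euclidsLemma h M q-prime (subst (q ∣_) (sym e) (m∣m*n N))
    ... | inj₁ a = contradiction a n
    ... | inj₂ (divides M′ refl) with c n (*-cancelˡ-≡ (h * M′) N q (trans (arith q h M′) e))
      where
      arith : ∀ q h M → q * (h * M) ≡ h * (M * q)
      arith = solve-∀
    ...   | h₁ , e₁ , refl = h₁ , e₁ , trans (*-comm (Q * h₁) q) (sym (*-assoc q Q h₁))

    cofactor-D : ∀ k → Cofactor (D k) (Q k)
    cofactor-D zero    {h} {M} n e = subst (λ z → ∃[ h₁ ] h * h₁ ≡ d × M ≡ z * h₁) (*-identityʳ q)
      (cofactor-step {d} {1} (λ {h} {M} _ e → M , e , sym (*-identityˡ M)) n e)
    cofactor-D (suc k) {h} {M} n e = subst (λ z → ∃[ h₁ ] h * h₁ ≡ d × M ≡ z * h₁) (sym (*-assoc q q (Q k)))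
      (cofactor-step (cofactor-step (cofactor-D k)) n (trans e (cong (q *_) (P-step k))))

    cofactor-P : ∀ k → Cofactor (P (suc k)) (q * Q k)
    cofactor-P k n e = cofactor-step (cofactor-D k) n (trans e (P-step k))

    q²≡1 : q * q % 8 ≡ 1
    q²≡1 with odd-half {q} (odd-mod4 {q} (inj₂ q≡3))
    ... | a , e = go a e
      where
      arith : ∀ t → suc (2 * (2 * t)) * suc (2 * (2 * t)) ≡ 1 + (2 * t * t + t) * 8
      arith = solve-∀
      arith₂ : ∀ t → suc (2 * suc (2 * t)) * suc (2 * suc (2 * t)) ≡ 1 + (2 * t * t + 3 * t + 1) * 8
      arith₂ = solve-∀
      go : ∀ a → q ≡ suc (2 * a) → q * q % 8 ≡ 1
      go a e with even? a
      ... | yes ea with half {a} ea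
      ...   | t , refl = trans (cong (λ z → z * z % 8) e) (trans (cong (_% 8) (arith t)) ([m+kn]%n≡m%n 1 (2 * t * t + t) 8))
      go a e | no na with odd-half {a} (¬even⇒odd {a} na)
      ...   | t , refl = trans (cong (λ z → z * z % 8) e) (trans (cong (_% 8) (arith₂ t)) ([m+kn]%n≡m%n 1 (2 * t * t + 3 * t + 1) 8))

    P≡1 : ∀ k → P k % 4 ≡ 1
    P≡1 zero    = d≡1
    P≡1 (suc k) = trans (%-distribˡ-* (q * q) (P k) 4) (cong₂ (λ a b → a * b % 4) (trans (%-distribˡ-* q q 4) (cong (λ a → a * a % 4) q≡3)) (P≡1 k))

    D≡7 : ∀ k → D k % 8 ≡ 7
    D≡7 zero    = qd≡7
    D≡7 (suc k) = trans (cong (_% 8) (arith q (P k))) (trans (%-distribˡ-* (q * q) (D k) 8) (cong₂ (λ a b → a * b % 8) q²≡1 (D≡7 k)))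
      where
      arith : ∀ q x → q * (q * q * x) ≡ q * q * (q * x)
      arith = solve-∀

    P-nonsquare : ∀ k s → s * s ≢ P k
    P-nonsquare zero    s e = d-nonsquare s e
    P-nonsquare (suc k) s e with euclidsLemma s s q-prime (subst (q ∣_) (sym e) (∣-trans (m∣m*n q) (m∣m*n (P k))))
    ... | inj₁ (divides c refl) = P-nonsquare k c (*-cancelˡ-≡ (c * c) (P k) (q * q) {{m*n≢0 q q}} (trans (arith q c) e))
      where
      arith : ∀ q c → q * q * (c * c) ≡ c * q * (c * q)
      arith = solve-∀
    ... | inj₂ (divides c refl) = P-nonsquare k c (*-cancelˡ-≡ (c * c) (P k) (q * q) {{m*n≢0 q q}} (trans (arith q c) e))
      where
      arith : ∀ q c → q * q * (c * c) ≡ c * q * (c * q)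
      arith = solve-∀

    open DivisorPairs q q-prime d d≡1 q∤d d-nonsquare

    -- Passing from `P k` to `P (suc k)` adds `2 τ₂` pairs, so the parity remains that of `d`.
    ♯π : ∀ k → ♯ (Pairs (P k) ∩ u<v₂?) ≡ par τ₂
    ♯π zero    = refl
    ♯π (suc k) = trans (Level.♯P< (P (suc k)) (q * Q k) {{m*n≢0 q (Q k) {{q≢0}} {{Q≢0 k}}}} (P≡ k) (m∣m*n (Q k)) (cofactor-P k))
      (trans (cong par (Both.#both (P (suc k)) (P k) refl)) (♯π k))

    T : ∀ k → Enum (λ x → (Ω (D k) x × Om0 x) × U<V x)
    T k = Quads (D k) ∩ om0? ∩ u<v?

    module _ (k : ℕ) where

      open RowRatio q q-prime q≡3 (D k) (D≡7 k) (m∣m*n (P k)) using (a₁?; a₂?; ♯T-split; ♯X0≡; ♯X0; oq)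
      open Ends q q-prime q≡3 (D k) (D≡7 k) (m∣m*n (P k)) d (Q k) {{Q≢0 k}} (q∣Q k) q∤d (cofactor-D k) (D≡ k) σ σ-Π σ-σ σ-free σ-Sq σ-mod4 using (♯Ends)
      open Level (D k) (Q k) {{Q≢0 k}} (D≡ k) (q∣Q k) (cofactor-D k) public using (F<; P<; K; #P<; ♯K)

      D≡3 : D k % 4 ≡ 3
      D≡3 = trans (%-distribˡ-* q (P k) 4) (cong₂ (λ a b → a * b % 4) q≡3 (P≡1 k))

      par-*q : ∀ x → par (x * q) ≡ par x
      par-*q x = trans (par-* x q) (trans (cong (par x ∧_) oq) (𝔹P.∧-identityʳ (par x)))

      pos-*q : ∀ {x} → 0 < x → 0 < x * q
      pos-*q x0 = *-mono-≤ x0 (>-nonZero⁻¹ q)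

      unpos-*q : ∀ {x} → 0 < x * q → 0 < x
      unpos-*q {suc x} _ = s≤s z≤n

      -- Dividing the first row by `q` gives the even solutions for `P k`, which is 1 modulo 4 and
      -- not a square.
      ♯A₁ : ♯ (Quads (D k) ∩ om0? ∩ a₁?) ≡ par τ₂
      ♯A₁ = trans (cong par (sym (#-onto (Quads (P k) ∩ om0?) (Quads (D k) ∩ om0? ∩ a₁?) (λ (u , v , e , f) → u * q , v , e * q , f)
          (λ { {u , v , e , f} (((u0 , v0 , e0 , f0) , eq) , ee , ef) →
            (((pos-*q u0 , v0 , pos-*q e0 , f0) , trans (arith u v e f q) (cong (q *_) eq)) , trans (par-*q e) ee , ef) , n∣m*n u , n∣m*n e })
          (λ { {u , v , e , f} {u′ , v′ , e′ , f′} _ _ r → quad≡ (*-cancelʳ-≡ u u′ q (cong proj₁ r)) (cong (λ (_ , v , _) → v) r) (*-cancelʳ-≡ e e′ q (cong (λ (_ , _ , e , _) → e) r)) (cong (λ (_ , _ , _ , f) → f) r) })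
          (λ { {u , v , e , f} ((((u0 , v0 , e0 , f0) , eq) , ee , ef) , divides a refl , divides c refl) →
            (a , v , c , f) , (((unpos-*q u0 , v0 , unpos-*q e0 , f0) , *-cancelˡ-≡ (a * v + c * f) (P k) q (trans (sym (arith a v c f q)) eq)) , trans (sym (par-*q c)) ee , ef) , refl }))))
        (trans (EvenSolutions.♯Om0 (P k) (P≡1 k) (P-nonsquare k)) (♯π k))
        where
        arith : ∀ u v e f q → u * q * v + e * q * f ≡ q * (u * v + e * f)
        arith = solve-∀

      ♯T≡ : ♯ (T k) ≡ ♯ F< xor (par τ₂ xor ♯ (T k ∩ a₂? ∩ a₁?))
      ♯T≡ = trans ♯T-split (cong₂ (λ a b → a xor (b xor ♯ (T k ∩ a₂? ∩ a₁?))) (trans (sym ♯X0≡) (trans ♯X0 (cong (_xor ♯ F<) ♯Ends))) ♯A₁)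

      -- The form of the claim that passes through the induction: C₁ is even and C₁ / 2 has the
      -- parity of `T` plus `K`, that is, of C₂.
      R : Set
      R = ∃[ h ] # P< ≡ 2 * h × par h ≡ ♯ (T k) xor ♯ K

      -- h″, T″, K″ refer to the solutions all of whose entries are divisible by q
      assemble : ∀ h″ → # (P< ∩ both?) ≡ 2 * h″ → par h″ ≡ ♯ (T k ∩ a₂? ∩ a₁?) xor ♯ (K ∩ both?) → R
      assemble h″ e p = h″ + τ₂ , trans #P< (trans (cong (_+ 2 * τ₂) e) (sym (*-distribˡ-+ 2 h″ τ₂))) ,
        trans (par-+ h″ τ₂) (trans (cong (_xor par τ₂) p) (trans (lemma (♯ F<) (par τ₂) (♯ (T k ∩ a₂? ∩ a₁?)) (♯ (K ∩ both?))) (sym (cong₂ _xor_ ♯T≡ (♯K D≡3)))))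
        where
        open import Data.Bool.Solver using (module xor-∧-Solver)
        open xor-∧-Solver using (_:=_; _:+_)
        lemma : ∀ f t a b → (a xor b) xor t ≡ (f xor (t xor a)) xor (f xor b)
        lemma = xor-∧-Solver.solve 4 (λ f t a b → a :+ b :+ t := f :+ (t :+ a) :+ (f :+ b)) refl

    q²∤ : ∀ {a} → q * q * a ≢ q * d
    q²∤ {a} e = q∤d (divides a (*-cancelˡ-≡ d (a * q) q (trans (sym e) (arith q a))))
      where
      arith : ∀ q a → q * q * a ≡ q * (a * q)
      arith = solve-∀

    R-zero : R 0
    R-zero = assemble 0 0 (#-empty (P< 0 ∩ both?) (λ { {u , v} ((p , _) , b) → no-both p b }))
      (sym (cong₂ _xor_ (cong par (#-empty (T 0 ∩ a₂? ∩ a₁?) (λ { {u , v , e , f} ((((( _ , eq) , _) , _) , (divides v′ refl , divides f′ refl)) , divides u′ refl , divides e′ refl) →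
          q²∤ {u′ * v′ + e′ * f′} (trans (arith u′ v′ e′ f′ q) eq) })))
        (cong par (#-empty (K 0 ∩ both?) (λ { {u , v} (((p , _) , _) , b) → no-both p b })))))
      where
      open RowRatio q q-prime q≡3 (D 0) (D≡7 0) (m∣m*n (P 0)) using (a₁?; a₂?)
      arith : ∀ u v e f q → q * q * (u * v + e * f) ≡ u * q * (v * q) + e * q * (f * q)
      arith = solve-∀
      arith₂ : ∀ u v q → q * q * (u * v) ≡ u * q * (v * q)
      arith₂ = solve-∀
      no-both : ∀ {u v} → Π (D 0) (u , v) → ¬ (q ∣ v × q ∣ u)
      no-both (_ , eq) (divides v′ refl , divides u′ refl) =
        q²∤ {u′ * v′} (trans (arith₂ u′ v′ q) eq)

    -- Dividing all entries by `q` leads from `D (suc k)` to `D k`. In `K` this flips the residue of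
    -- `v` modulo 4, which is harmless because `P< k` has an even number of elements.
    R-suc : ∀ k → R k → R (suc k)
    R-suc k (h , e , p) = assemble (suc k) h (trans (Both.#both (D (suc k)) (D k) D-step) e)
      (trans p (cong₂ _xor_ (sym ♯T″) (sym ♯K″)))
      where
      open RowRatio q q-prime q≡3 (D (suc k)) (D≡7 (suc k)) (m∣m*n (P (suc k))) using (a₁?; a₂?)
      D-step : D (suc k) ≡ q * q * D k
      D-step = arith q (P k)
        where
        arith : ∀ q x → q * (q * q * x) ≡ q * q * (q * x)
        arith = solve-∀
      ♯K″ : ♯ (K (suc k) ∩ both?) ≡ ♯ (K k)
      ♯K″ = trans (Both.♯K-both (D (suc k)) (D k) D-step q≡3 (odd-mod8 {D k} (D≡7 k)))
        (xor-even (♯ (K k)) (♯ (Pairs (D k) ∩ u<v₂? ∩ ∁ v≡3?)) (trans (sym (♯-split (P< k) v≡3?)) (trans (cong par e) (par-* 2 h))))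
        where
        xor-even : ∀ a b → a xor b ≡ false → b ≡ a
        xor-even true  true  _ = refl
        xor-even false false _ = refl
      ♯T″ : ♯ (T (suc k) ∩ a₂? ∩ a₁?) ≡ ♯ (T k)
      ♯T″ = cong par (sym (#-onto (T k) (T (suc k) ∩ a₂? ∩ a₁?) (λ (u , v , e , f) → u * q , v * q , e * q , f * q)
        (λ { {u , v , e , f} ((((u0 , v0 , e0 , f0) , eq) , ee , ef) , l) →
          (((((pos-*q k u0 , pos-*q k v0 , pos-*q k e0 , pos-*q k f0) , trans (arith u v e f q) (trans (cong (q * q *_) eq) (sym D-step))) , trans (par-*q k e) ee , trans (par-*q k f) ef) ,
            *-monoˡ-< q l) , n∣m*n v , n∣m*n f) , n∣m*n u , n∣m*n e })
        (λ { {u , v , e , f} {u′ , v′ , e′ , f′} _ _ r → quad≡ (*-cancelʳ-≡ u u′ q (cong proj₁ r)) (*-cancelʳ-≡ v v′ q (cong (λ (_ , v , _) → v) r))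
          (*-cancelʳ-≡ e e′ q (cong (λ (_ , _ , e , _) → e) r)) (*-cancelʳ-≡ f f′ q (cong (λ (_ , _ , _ , f) → f) r)) })
        (λ { {u , v , e , f} (((((( u0 , v0 , e0 , f0) , eq) , ee , ef) , l) , (divides b refl , divides g refl)) , divides a refl , divides c refl) →
          (a , b , c , g) , ((((unpos-*q k u0 , unpos-*q k v0 , unpos-*q k e0 , unpos-*q k f0) ,
            *-cancelˡ-≡ (a * b + c * g) (D k) (q * q) {{m*n≢0 q q}} (trans (sym (arith a b c g q)) (trans eq D-step))) , trans (sym (par-*q k c)) ee , trans (sym (par-*q k g)) ef) , *-cancelʳ-< q a b l) , refl })))
        where
        arith : ∀ u v e f q → u * q * (v * q) + e * q * (f * q) ≡ q * q * (u * v + e * f)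
        arith = solve-∀

    R-all : ∀ k → R k
    R-all zero    = R-zero
    R-all (suc k) = R-suc k (R-all k)

  -- A case of quadratic reciprocity by pigeonhole and descent.

  module Reciprocity (p q : ℕ) (p-prime : Prime p) (q-prime : Prime q) (p≡1 : p % 4 ≡ 1) (q≡3 : q % 4 ≡ 3) where

    open Residues q q-prime q≡3 using (Sq; sq?; Sq-±; small-unit; q≢0)
    module q = Residues q q-prime q≡3

    instance
      p≢0 : NonZero p
      p≢0 = prime⇒nonZero p-prime

    module p = Modular p

    sq4 : ∀ n → (Even n × ∃[ t ] n * n ≡ 0 + t * 4) ⊎ (Odd n × ∃[ t ] n * n ≡ 1 + t * 4)
    sq4 n with even? n
    ... | yes e with half {n} e
    ...   | k , refl = inj₁ (e , k * k , arith k)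
      where
      arith : ∀ k → 2 * k * (2 * k) ≡ k * k * 4
      arith = solve-∀
    sq4 n | no ne with odd-half {n} (¬even⇒odd {n} ne)
    ...   | k , refl = inj₂ (¬even⇒odd {n} ne , k * k + k , arith k)
      where
      arith : ∀ k → suc (2 * k) * suc (2 * k) ≡ 1 + (k * k + k) * 4
      arith = solve-∀

    bit : Bool → ℕ
    bit true  = 1
    bit false = 0

    sq%4 : ∀ n → n * n % 4 ≡ bit (par n)
    sq%4 n with sq4 n
    ... | inj₁ (e , t , eq) = trans (4k+ {n * n} 0 t eq) (cong bit (sym e))
    ... | inj₂ (o , t , eq) = trans (4k+ {n * n} 1 t eq) (cong bit (sym o))

    -- Modulo 4 the equation is X² + Y² + Z² ≡ 0, so X, Y and Z are even.
    all-even : ∀ X Y Z → X * X + p * (Y * Y) ≡ q * (Z * Z) → Even X × Even Y × Even Z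
    all-even X Y Z e = go (par X) (par Y) (par Z) (trans (sym left) (trans (cong (_% 4) e) right))
      where
      left : (X * X + p * (Y * Y)) % 4 ≡ (bit (par X) + (1 * bit (par Y)) % 4) % 4
      left = trans (%-distribˡ-+ (X * X) (p * (Y * Y)) 4) (cong₂ (λ a b → (a + b) % 4) (sq%4 X)
        (trans (%-distribˡ-* p (Y * Y) 4) (cong₂ (λ a b → (a * b) % 4) p≡1 (sq%4 Y))))
      right : q * (Z * Z) % 4 ≡ (3 * bit (par Z)) % 4
      right = trans (%-distribˡ-* q (Z * Z) 4) (cong₂ (λ a b → (a * b) % 4) q≡3 (sq%4 Z))
      go : ∀ x y z → (bit x + (1 * bit y) % 4) % 4 ≡ (3 * bit z) % 4 → x ≡ false × y ≡ false × z ≡ false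
      go false false false _ = refl , refl , refl
      go false false true ()
      go false true false ()
      go false true true ()
      go true false false ()
      go true false true ()
      go true true false ()
      go true true true ()

    -- All three unknowns are even, so they can be halved indefinitely.
    descent : ∀ Z X Y → X * X + p * (Y * Y) ≡ q * (Z * Z) → Z ≡ 0
    descent = <-rec (λ Z → ∀ X Y → X * X + p * (Y * Y) ≡ q * (Z * Z) → Z ≡ 0) step
      where
      arith : ∀ p x y → 4 * (x * x + p * (y * y)) ≡ 2 * x * (2 * x) + p * (2 * y * (2 * y))
      arith = solve-∀
      arith₂ : ∀ q z → q * (2 * z * (2 * z)) ≡ 4 * (q * (z * z))
      arith₂ = solve-∀
      step : ∀ Z → (∀ {z} → z < Z → ∀ X Y → X * X + p * (Y * Y) ≡ q * (z * z) → z ≡ 0) → ∀ X Y → X * X + p * (Y * Y) ≡ q * (Z * Z) → Z ≡ 0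
      step Z rec X Y e with all-even X Y Z e
      ... | eX , eY , eZ with half {X} eX | half {Y} eY | half {Z} eZ
      ... | x , refl | y , refl | zero , refl = refl
      ... | x , refl | y , refl | z@(suc _) , refl = cong (2 *_) (rec (m<m*n z 2 (s≤s (s≤s z≤n)) ⟨∙⟩ *-comm z 2) x y
          (*-cancelˡ-≡ (x * x + p * (y * y)) (q * (z * z)) 4 (trans (arith p x y) (trans e (arith₂ q z)))))
        where
        _⟨∙⟩_ : ∀ {a b c} → a < b → b ≡ c → a < c
        lt ⟨∙⟩ refl = lt

    √ : ∀ n → ∃[ r ] r * r ≤ n × n < suc r * suc r
    √ zero    = 0 , z≤n , s≤s z≤n
    √ (suc n) with √ n
    ... | r , lo , hi with suc r * suc r ≤? suc n
    ...   | yes le = suc r , le , ≤-<-trans hi (*-mono-< {suc r} {suc (suc r)} ≤-refl ≤-refl)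
    ...   | no nle = r , m≤n⇒m≤1+n lo , ≰⇒> nle

    Diff : ℕ → ℕ → ℕ → Set
    Diff m n d = m ≡ n + d ⊎ n ≡ m + d

    diff : ∀ {m n B} → m ≤ B → n ≤ B → ∃[ d ] Diff m n d × d ≤ B
    diff {m} {n} mB nB with ≤-total m n
    ... | inj₁ le = n ∸ m , inj₂ (sym (m+[n∸m]≡n le)) , ≤-trans (m∸n≤m n m) nB
    ... | inj₂ le = m ∸ n , inj₁ (sym (m+[n∸m]≡n le)) , ≤-trans (m∸n≤m m n) mB

    Diff-0 : ∀ {m n} → Diff m n 0 → m ≡ n
    Diff-0 {m} {n} (inj₁ e) = trans e (+-identityʳ n)
    Diff-0 {m} {n} (inj₂ e) = sym (trans e (+-identityʳ m))

    module SquareDiff (n : ℕ) .{{_ : NonZero n}} where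
      open Modular n

      neg-sq : ∀ {a b} → n ∣ a + b → a * a ≋ b * b
      neg-sq {a} {b} d = ≋-trans (≋-sym (+-∣ (∣-trans d (n∣m*n b)))) (≋-trans (≡⇒≋ (arith a b)) (+-∣ (∣-trans d (n∣m*n a))))
        where
        arith : ∀ a b → a * a + b * (a + b) ≡ b * b + a * (a + b)
        arith = solve-∀

      -- Differences are taken in absolute value, so their signs are unknown; the relation becomes
      -- insensitive to them once it is squared.
      square-diff : ∀ {x a₁ a₂ c₁ c₂ a c} → Diff a₁ a₂ a → Diff c₁ c₂ c → a₁ + x * c₁ ≋ a₂ + x * c₂ → a * a ≋ x * c * (x * c)
      square-diff {x} {a₂ = a₂} {c₂ = c₂} {a} {c} (inj₁ refl) (inj₁ refl) e = neg-sq {a} {x * c} (≋0⇒∣ (+-cancel (a₂ + x * c₂) (≋-trans (≡⇒≋ (arith x a₂ a c₂ c)) (≋-trans e (≡⇒≋ (sym (+-identityʳ _)))))))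
        where
        arith : ∀ x a₂ a c₂ c → a₂ + x * c₂ + (a + x * c) ≡ a₂ + a + x * (c₂ + c)
        arith = solve-∀
      square-diff {x} {a₁} {c₁ = c₁} {a = a} {c} (inj₂ refl) (inj₂ refl) e = neg-sq {a} {x * c} (≋0⇒∣ (+-cancel (a₁ + x * c₁) (≋-trans (≡⇒≋ (arith x a₁ a c₁ c)) (≋-trans (≋-sym e) (≡⇒≋ (sym (+-identityʳ _)))))))
        where
        arith : ∀ x a₂ a c₂ c → a₂ + x * c₂ + (a + x * c) ≡ a₂ + a + x * (c₂ + c)
        arith = solve-∀
      square-diff {x} {a₂ = a₂} {c₁ = c₁} {a = a} {c} (inj₁ refl) (inj₂ refl) e = h *≋ h
        where
        arith : ∀ x a₂ a c₁ → a₂ + x * c₁ + a ≡ a₂ + a + x * c₁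
        arith = solve-∀
        arith₂ : ∀ x a₂ c₁ c → a₂ + x * (c₁ + c) ≡ a₂ + x * c₁ + x * c
        arith₂ = solve-∀
        h : a ≋ x * c
        h = +-cancel (a₂ + x * c₁) (≋-trans (≡⇒≋ (arith x a₂ a c₁)) (≋-trans e (≡⇒≋ (arith₂ x a₂ c₁ c))))
      square-diff {x} {a₁} {c₂ = c₂} {a = a} {c} (inj₂ refl) (inj₁ refl) e = h *≋ h
        where
        arith : ∀ x a₂ a c₁ → a₂ + x * c₁ + a ≡ a₂ + a + x * c₁
        arith = solve-∀
        arith₂ : ∀ x a₂ c₁ c → a₂ + x * (c₁ + c) ≡ a₂ + x * c₁ + x * c
        arith₂ = solve-∀
        h : a ≋ x * c
        h = +-cancel (a₁ + x * c₂) (≋-trans (≡⇒≋ (arith x a₁ a c₂)) (≋-trans (≋-sym e) (≡⇒≋ (arith₂ x a₁ c₂ c))))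

    -- Pigeonhole on the box a ≤ √(pq), b ≤ √q, c ≤ √p, which has more than pq points.
    module Representation (x : ℕ) (x²≋q : x * x p.≋ q) (y : ℕ) (d : q ∣ y * y + p) (A B C : ℕ)
      (A≤ : A * A ≤ p * q) (<A : p * q < suc A * suc A) (B≤ : B * B ≤ q) (<B : q < suc B * suc B) (C≤ : C * C ≤ p) (<C : p < suc C * suc C) where

      a⁺ b⁺ c⁺ : ℕ
      a⁺ = suc A
      b⁺ = suc B
      c⁺ = suc C

      -- Compared after squaring, where the three bounds multiply to `(pq)²`.
      box-large : p * q < a⁺ * (b⁺ * c⁺)
      box-large = ≰⇒> λ le → <⇒≱ (square-mono <A <B <C) (*-mono-≤ le le)
        where
        arith : ∀ a b c → a * (b * c) * (a * (b * c)) ≡ a * a * (b * b * (c * c))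
        arith = solve-∀
        square-mono : p * q < a⁺ * a⁺ → q < b⁺ * b⁺ → p < c⁺ * c⁺ → p * q * (p * q) < a⁺ * (b⁺ * c⁺) * (a⁺ * (b⁺ * c⁺))
        square-mono h i j = subst (p * q * (p * q) <_) (sym (arith a⁺ b⁺ c⁺)) (*-mono-< h (subst (_< b⁺ * b⁺ * (c⁺ * c⁺)) (*-comm q p) (*-mono-< i j)))

      Box : Set
      Box = Fin (a⁺ * (b⁺ * c⁺))

      fa fb fc : Box → ℕ
      fa i = toℕ (proj₁ (remQuot {a⁺} (b⁺ * c⁺) i))
      fb i = toℕ (proj₁ (remQuot {b⁺} c⁺ (proj₂ (remQuot {a⁺} (b⁺ * c⁺) i))))
      fc i = toℕ (proj₂ (remQuot {b⁺} c⁺ (proj₂ (remQuot {a⁺} (b⁺ * c⁺) i))))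

      f-inj : ∀ {i j} → fa i ≡ fa j → fb i ≡ fb j → fc i ≡ fc j → i ≡ j
      f-inj {i} {j} e₁ e₂ e₃ = remQuot-inj (b⁺ * c⁺) i j (FinP.toℕ-injective e₁) (remQuot-inj c⁺ _ _ (FinP.toℕ-injective e₂) (FinP.toℕ-injective e₃))
        where
        remQuot-inj : ∀ {m} n (i j : Fin (m * n)) → proj₁ (remQuot {m} n i) ≡ proj₁ (remQuot {m} n j) → proj₂ (remQuot {m} n i) ≡ proj₂ (remQuot {m} n j) → i ≡ j
        remQuot-inj {m} n i j e e′ = trans (sym (FinP.combine-remQuot {m} n i)) (trans (cong₂ combine e e′) (FinP.combine-remQuot {m} n j))

      ra : Box → Fin p
      ra i = fromℕ< (m%n<n (fa i + x * fc i) p)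
      rb : Box → Fin q
      rb i = fromℕ< (m%n<n (fa i + y * fb i) q)

      value : Box → Fin (p * q)
      value i = combine (ra i) (rb i)

      collision : ∃[ i ] ∃[ j ] i ≢ j × (fa i + x * fc i) % p ≡ (fa j + x * fc j) % p × (fa i + y * fb i) % q ≡ (fa j + y * fb j) % q
      collision = from (FinP.pigeonhole box-large value)
        where
        from : ∃[ i ] ∃[ j ] i Fin.< j × value i ≡ value j → _
        from (i , j , i<j , e) = i , j , FinP.<⇒≢ i<j , FinP.fromℕ<-injective _ _ _ _ (FinP.combine-injectiveˡ (ra i) (rb i) (ra j) (rb j) e) , FinP.fromℕ<-injective _ _ _ _ (FinP.combine-injectiveʳ (ra i) (rb i) (ra j) (rb j) e)

      Solution : ℕ → ℕ → ℕ → Set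
      Solution a b c = ¬ (a ≡ 0 × b ≡ 0 × c ≡ 0) × a * a ≤ p * q × b * b ≤ q × c * c ≤ p × a * a p.≋ q * (c * c) × q ∣ a * a + p * (b * b)

      solution : ∃[ a ] ∃[ b ] ∃[ c ] Solution a b c
      solution = from collision
        where
        arith : ∀ x c → x * c * (x * c) ≡ x * x * (c * c)
        arith = solve-∀
        arith₂ : ∀ y b p → y * b * (y * b) + p * (b * b) ≡ (y * y + p) * (b * b)
        arith₂ = solve-∀
        bound : ∀ {n} (k : Fin (suc n)) → toℕ k ≤ n
        bound k = ≤-pred (FinP.toℕ<n k)
        fa≤ : ∀ i → fa i ≤ A
        fa≤ i = bound (proj₁ (remQuot {a⁺} (b⁺ * c⁺) i))
        fb≤ : ∀ i → fb i ≤ B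
        fb≤ i = bound (proj₁ (remQuot {b⁺} c⁺ (proj₂ (remQuot {a⁺} (b⁺ * c⁺) i))))
        fc≤ : ∀ i → fc i ≤ C
        fc≤ i = bound (proj₂ (remQuot {b⁺} c⁺ (proj₂ (remQuot {a⁺} (b⁺ * c⁺) i))))
        build : ∀ {a₁ a₂ b₁ b₂ c₁ c₂} → (a₁ ≡ a₂ → b₁ ≡ b₂ → c₁ ≡ c₂ → ⊥) → (a₁ + x * c₁) % p ≡ (a₂ + x * c₂) % p → (a₁ + y * b₁) % q ≡ (a₂ + y * b₂) % q →
          ∃[ a ] Diff a₁ a₂ a × a ≤ A → ∃[ b ] Diff b₁ b₂ b × b ≤ B → ∃[ c ] Diff c₁ c₂ c × c ≤ C → ∃[ a ] ∃[ b ] ∃[ c ] Solution a b c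
        build ne ep eq (a , da , a≤) (b , db , b≤) (c , dc , c≤) = a , b , c , (λ { (refl , refl , refl) → ne (Diff-0 da) (Diff-0 db) (Diff-0 dc) }) ,
          ≤-trans (*-mono-≤ a≤ a≤) A≤ , ≤-trans (*-mono-≤ b≤ b≤) B≤ , ≤-trans (*-mono-≤ c≤ c≤) C≤ ,
          p.≋-trans (SquareDiff.square-diff p {x} da dc (p.mod ep)) (p.≋-trans (p.≡⇒≋ (arith x c)) (x²≋q p.*≋ p.≋-refl {c * c})) ,
          q.∣-cong (q.≋-sym (q.≋-trans (SquareDiff.square-diff q {y} da db (q.mod eq) q.+≋ q.≋-refl {p * (b * b)}) (q.≡⇒≋ (arith₂ y b p)))) (∣-trans d (m∣m*n (b * b)))
        from : ∃[ i ] ∃[ j ] i ≢ j × (fa i + x * fc i) % p ≡ (fa j + x * fc j) % p × (fa i + y * fb i) % q ≡ (fa j + y * fb j) % q → ∃[ a ] ∃[ b ] ∃[ c ] Solution a b c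
        from (i , j , i≢j , ep , eq) = build (λ e₁ e₂ e₃ → i≢j (f-inj e₁ e₂ e₃)) ep eq (diff (fa≤ i) (fa≤ j)) (diff (fb≤ i) (fb≤ j)) (diff (fc≤ i) (fc≤ j))

      q∤p : ¬ q ∣ p
      q∤p h with prime⇒irreducible p-prime h
      ... | inj₁ e = contradiction (trans (sym (cong (_% 4) e)) q≡3) λ ()
      ... | inj₂ e = contradiction (trans (sym p≡1) (trans (sym (cong (_% 4) e)) q≡3)) λ ()

      pq∣ : ∀ {g} → p ∣ g → q ∣ g → p * q ∣ g
      pq∣ {g} (divides c refl) h with euclidsLemma c p q-prime h
      ... | inj₁ (divides e refl) = divides e (arith e q p)
        where
        arith : ∀ e q p → e * q * p ≡ e * (p * q)
        arith = solve-∀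
      ... | inj₂ h′ = contradiction h′ q∤p

      ¬square-p : ∀ c → c * c ≢ p
      ¬square-p c e with euclidsLemma c c p-prime (subst (p ∣_) (sym e) ∣-refl)
      ... | h with prime⇒irreducible p-prime (divides c (sym e))
      ...   | inj₁ refl = contradiction (subst (1 <_) (sym e) (nonTrivial⇒n>1 p {{prime⇒nonTrivial p-prime}})) (n≮n 1)
      ...   | inj₂ refl = contradiction (*-cancelʳ-≡ c 1 c (trans e (sym (+-identityʳ c)))) λ c≡1 → <⇒≢ (nonTrivial⇒n>1 p {{prime⇒nonTrivial p-prime}}) (sym c≡1)

      ¬square-q : ∀ b → b * b ≢ q
      ¬square-q b e with sq%4 b
      ... | m = bad (par b) (trans (sym m) (trans (cong (_% 4) e) q≡3))
        where
        bad : ∀ x → bit x ≡ 3 → ⊥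
        bad true  ()
        bad false ()

      diff-sq : ∀ {m n d} → Diff m n d → d * d + 2 * (m * n) ≡ m * m + n * n
      diff-sq {n = n} {d} (inj₁ refl) = arith n d
        where
        arith : ∀ n d → d * d + 2 * ((n + d) * n) ≡ (n + d) * (n + d) + n * n
        arith = solve-∀
      diff-sq {m} {d = d} (inj₂ refl) = arith m d
        where
        arith : ∀ m d → d * d + 2 * (m * (m + d)) ≡ m * m + (m + d) * (m + d)
        arith = solve-∀

      -- The form a² + p b² represents q c² or q (c² + p); in the second case multiply by c² + p.
      impossible : ⊥
      impossible = refute solution
       where
       refute : ∃[ a ] ∃[ b ] ∃[ c ] Solution a b c → ⊥
       refute (a , b , c , nontrivial , a≤ , b≤ , c≤ , ≋p , q∣W) = by (≤-total W V)
        where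
        W = a * a + p * (b * b)
        V = q * (c * c)
        W≋V : W p.≋ V
        W≋V = p.≋-trans (p.+-∣ (m∣m*n (b * b))) ≋p
        p0 : 0 < p
        p0 = >-nonZero⁻¹ p
        -- The bounds are strict because `p` and `q` are not perfect squares. They leave 0 and `pq`
        -- as the only possible values of `W − V`.
        V<pq : V < p * q
        V<pq = subst (V <_) (*-comm q p) (*-monoʳ-< q (≤∧≢⇒< c≤ (¬square-p c)))
        W<2pq : W < p * q + p * q
        W<2pq = +-mono-≤-< a≤ (*-monoʳ-< p (≤∧≢⇒< b≤ (¬square-q b)))
        zero-case : W ≡ V → ⊥
        zero-case e = nontrivial (sq0 a (m+n≡0⇒m≡0 (a * a) W0) , sq0 b (pb0 (m+n≡0⇒n≡0 (a * a) W0)) , c0)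
          where
          c0 : c ≡ 0
          c0 = descent c a b e
          W0 : W ≡ 0
          W0 = trans e (trans (cong (λ c → q * (c * c)) c0) (*-zeroʳ q))
          sq0 : ∀ n → n * n ≡ 0 → n ≡ 0
          sq0 zero _ = refl
          pb0 : p * (b * b) ≡ 0 → b * b ≡ 0
          pb0 z with m*n≡0⇒m≡0∨n≡0 p z
          ... | inj₁ r = contradiction r (λ r → <⇒≢ p0 (sym r))
          ... | inj₂ r = r
        one-case : W ≡ V + p * q → ⊥
        one-case h2 = from (diff {c * b} {a} {c * b + a} (m≤m+n (c * b) a) (m≤n+m a (c * b)))
          where
          from : ∃[ Y ] Diff (c * b) a Y × Y ≤ c * b + a → ⊥
          -- Brahmagupta's identity `(a² + pb²)(c² + p) = (ca + pb)² + p (cb −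
          -- a)²` yields a solution with last entry `c² + p > 0`.
          from (Y , dY , _) = <⇒≢ (m≤n⇒m≤o+n (c * c) p0) (sym (descent (c * c + p) (c * a + p * b) Y (go {p} {q} {a} {b} {c} {Y} (diff-sq dY) h2)))
            where
            go : ∀ {p q a b c Y} → Y * Y + 2 * (c * b * a) ≡ c * b * (c * b) + a * a → a * a + p * (b * b) ≡ q * (c * c) + p * q →
              (c * a + p * b) * (c * a + p * b) + p * (Y * Y) ≡ q * ((c * c + p) * (c * c + p))
            go {p} {q} {a} {b} {c} {Y} h1 h2 = (lin {(c * a + p * b) * (c * a + p * b) + p * (Y * Y)} {q * ((c * c + p) * (c * c + p))} (p ⟨*⟩ h1 ⟨+⟩ (c * c + p) ⟨*⟩ h2) (solve (a ∷ c ∷ b ∷ p ∷ Y ∷ q ∷ [])))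
        p∣diff : ∀ {u v g} → u p.≋ v → v ≡ u + g → p ∣ g
        p∣diff {u} e refl = p.≋0⇒∣ (p.≋-sym (p.+-cancel u (p.≋-trans (p.≡⇒≋ (+-identityʳ u)) e)))
        q∣diff : ∀ {u v g} → q ∣ u → q ∣ v → v ≡ u + g → q ∣ g
        q∣diff h h′ refl = ∣m+n∣m⇒∣n h′ h
        q∣V : q ∣ V
        q∣V = m∣m*n (c * c)
        small : ∀ {g n} → p * q ∣ g → g < n → n ≡ p * q → g ≡ 0
        small {zero}  _ _ _ = refl
        small {suc g} h lt refl = contradiction (∣⇒≤ h) (<⇒≱ lt)
        by : W ≤ V ⊎ V ≤ W → ⊥
        by (inj₁ le) = zero-case (trans (sym (+-identityʳ W)) (trans (cong (W +_) (sym g0)) V≡))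
          where
          V≡ : W + (V ∸ W) ≡ V
          V≡ = m+[n∸m]≡n le
          g0 : V ∸ W ≡ 0
          g0 = small (pq∣ (p∣diff W≋V (sym V≡)) (q∣diff q∣W q∣V (sym V≡))) (≤-<-trans (m∸n≤m V W) V<pq) refl
        by (inj₂ le) = by₂ (pq∣ (p∣diff (p.≋-sym W≋V) (sym W≡)) (q∣diff q∣V q∣W (sym W≡)))
          where
          W≡ : V + (W ∸ V) ≡ W
          W≡ = m+[n∸m]≡n le
          by₂ : p * q ∣ W ∸ V → ⊥
          by₂ (divides zero e) = zero-case (trans (sym W≡) (trans (cong (V +_) e) (+-identityʳ V)))
          by₂ (divides 1 e) = one-case (trans (sym W≡) (cong (V +_) (trans e (+-identityʳ (p * q)))))
          by₂ (divides (suc (suc k)) e) = <⇒≱ (≤-<-trans (m∸n≤m W V) W<2pq) (subst (p * q + p * q ≤_) (sym e) (+-monoʳ-≤ (p * q) (m≤m+n (p * q) (k * (p * q)))))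

    reciprocity : ∀ x → x * x p.≋ q → Sq p
    reciprocity x e = by (sq? p)
      where
      Root : ℕ → Set
      Root n = ∃[ r ] r * r ≤ n × n < suc r * suc r
      contra : ∀ y → q ∣ y * y + p → Root (p * q) → Root q → Root p → Sq p
      contra y d (A , a , a′) (B , b , b′) (C , c , c′) = ⊥-elim (Representation.impossible x e y d A B C a a′ b b′ c c′)
      q∤p′ : ¬ q ∣ p
      q∤p′ h with prime⇒irreducible p-prime h
      ... | inj₁ e = contradiction (trans (sym (cong (_% 4) e)) q≡3) λ ()
      ... | inj₂ e = contradiction (trans (sym p≡1) (trans (sym (cong (_% 4) e)) q≡3)) λ ()
      by : Dec (Sq p) → Sq p
      by (yes s) = s
      by (no ns) = from (Sq-± q∤p′ ns (q.neg-∣ p))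
        where
        from : Sq (q.neg p) → Sq p
        -- As `p` is not a square modulo `q`, its negative is, and a root `y` satisfies
        -- `y² + p ≡ 0`.
        from (_ , y , _ , r) = contra y (q.∣-cong (q.≋-sym r q.+≋ q.≋-refl {p}) (subst (q ∣_) (+-comm p (q.neg p)) (q.neg-∣ p))) (√ (p * q)) (√ q) (√ p)

  -- The choice of the prime q and of the involution on divisors.

  module Pairing where

    Result : ℕ → Set
    Result D = ∃[ h ] # (Pairs D ∩ u<v₂?) ≡ 2 * h × par h ≡ ♯ (Quads D ∩ om0? ∩ u<v?) xor ♯ (Pairs D ∩ u<v₂? ∩ v≡3?)

    module M4 = Modular 4
    module M8 = Modular 8

    %8%4 : ∀ n → n % 4 ≡ n % 8 % 4
    %8%4 n = 4k+ {n} (n % 8) (n / 8 * 2) (trans (m≡m%n+[m/n]*n n 8) (cong (n % 8 +_) (arith (n / 8))))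
      where
      arith : ∀ t → t * 8 ≡ t * 2 * 4
      arith = solve-∀

    -- Only `a ≡ 3` modulo 8 remains, and 3 is its own inverse, so `b ≡ 3 · 7 ≡ 5`.
    product≡7 : ∀ {a b} → a * b % 8 ≡ 7 → a % 4 ≡ 3 → a % 8 ≢ 7 → b % 8 ≡ 5
    product≡7 {a} {b} e a3 a≢7 = trans (sym (toℕ-residue b)) (toWitness {a? = FinP.all? λ x → FinP.all? λ y →
        (toℕ x * toℕ y) % 8 ≟ 7 →-dec (toℕ x % 4 ≟ 3 →-dec (¬? (toℕ x ≟ 7) →-dec toℕ y ≟ 5))} _
      (residue a) (residue b) (trans (_≡₈_.%≡ (res a *₈ res b)) e)
      (trans (cong (_% 4) (toℕ-residue a)) (trans (sym (%8%4 a)) a3)) λ z → a≢7 (trans (sym (toℕ-residue a)) z))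

    square≢5 : ∀ s → s * s % 8 ≢ 5
    square≢5 s e = toWitness {a? = FinP.all? λ x → ¬? ((toℕ x * toℕ x) % 8 ≟ 5)} _ (residue s) (trans (_≡₈_.%≡ (res s *₈ res s)) e)

    same-mod4 : ∀ {d u v} → d % 4 ≡ 1 → u * v ≡ d → u % 4 ≡ v % 4
    same-mod4 {d} {u} {v} d1 refl = go (mod4-odd {u} (proj₁ odds)) (mod4-odd {v} (proj₂ odds)) (%-distribˡ-* u v 4)
      where
      odds = odd-*⁻ u v (odd-mod4 {d} (inj₁ d1))
      bad : ∀ {a b} → u % 4 ≡ a → v % 4 ≡ b → d % 4 ≡ (u % 4 * (v % 4)) % 4 → 1 ≡ (a * b) % 4
      bad refl refl m = trans (sym d1) m
      go : u % 4 ≡ 1 ⊎ u % 4 ≡ 3 → v % 4 ≡ 1 ⊎ v % 4 ≡ 3 → d % 4 ≡ (u % 4 * (v % 4)) % 4 → u % 4 ≡ v % 4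
      go (inj₁ a) (inj₁ b) _ = trans a (sym b)
      go (inj₂ a) (inj₂ b) _ = trans a (sym b)
      go (inj₁ a) (inj₂ b) m = contradiction (bad a b m) λ ()
      go (inj₂ a) (inj₁ b) m = contradiction (bad a b m) λ ()

    module Swap (q : ℕ) (q-prime : Prime q) (q≡3 : q % 4 ≡ 3) (d : ℕ) (d≡1 : d % 4 ≡ 1) (q∤d : ¬ q ∣ d) (d-nonsquare : ∀ s → s * s ≢ d) (qd≡7 : (q * d) % 8 ≡ 7)
      (d-Sq : Residues.Sq q q-prime q≡3 d) where

      open Residues q q-prime q≡3
      sw-free : ∀ {x} → Π d x → sw₂ x ≢ x
      sw-free {u , v} (_ , e) r = d-nonsquare u (trans (cong (u *_) (sym (cong proj₁ r))) e)

      sw-Sq : ∀ {x} → Π d x → Sq (proj₁ x) → Sq (proj₁ (sw₂ x))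
      sw-Sq {u , v} (_ , e) s = Sq-/ s (subst Sq (sym e) d-Sq)

      sw-mod4 : ∀ {x} → Π d x → proj₂ (sw₂ x) % 4 ≡ proj₂ x % 4
      sw-mod4 {u , v} (_ , e) = same-mod4 {d} {u} {v} d≡1 e

      sw-sw : ∀ {x} → Π d x → sw₂ (sw₂ x) ≡ x
      sw-sw _ = refl

      open PrimePower q q-prime q≡3 d d≡1 q∤d d-nonsquare qd≡7 sw₂ swΠ sw-sw sw-free sw-Sq sw-mod4 public using (P; R-all)

    -- p divides exactly one of two complementary divisors of d = p a; toggle moves it to the other one, and cross exchanges the cofactors in a instead.
    module Toggle (p a d : ℕ) (p-prime : Prime p) (p≡1 : p % 4 ≡ 1) (p∤a : ¬ p ∣ a) (d≡pa : d ≡ p * a) where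

      instance
        p≢0 : NonZero p
        p≢0 = prime⇒nonZero p-prime

      toggle : Pair → Pair
      toggle (h , h₁) with p ∣? h
      ... | yes _ = h / p , h₁ * p
      ... | no _  = h * p , h₁ / p

      -- Stores the value of `toggle` with the position of `p`, so that the divisibility test is not
      -- repeated in later arguments.
      data View : Pair → Set where
        left  : ∀ b c → b * c ≡ a → toggle (b * p , c) ≡ (b , c * p) → View (b * p , c)
        right : ∀ b c → b * c ≡ a → toggle (b , c * p) ≡ (b * p , c) → View (b , c * p)

      toggle-left : ∀ b c → toggle (b * p , c) ≡ (b , c * p)
      toggle-left b c with p ∣? b * p
      ... | yes _ = cong (_, c * p) (m*n/n≡m b p)
      ... | no n  = contradiction (n∣m*n b) n

      toggle-right : ∀ b c → ¬ p ∣ b → toggle (b , c * p) ≡ (b * p , c)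
      toggle-right b c n with p ∣? b
      ... | yes x = contradiction x n
      ... | no _  = cong (b * p ,_) (m*n/n≡m c p)

      reduce : ∀ {x y} → x * p * y ≡ d → x * y ≡ a
      reduce {x} {y} e = *-cancelˡ-≡ (x * y) a p (trans (arith p x y) (trans e d≡pa))
        where
        arith : ∀ p x y → p * (x * y) ≡ x * p * y
        arith = solve-∀

      view : ∀ {h h₁} → Π d (h , h₁) → View (h , h₁)
      view {h} {h₁} (_ , e) = by (euclidsLemma h h₁ p-prime (subst (p ∣_) (sym (trans e d≡pa)) (m∣m*n a))) e
        where
        by : p ∣ h ⊎ p ∣ h₁ → h * h₁ ≡ d → View (h , h₁)
        by (inj₁ (divides b refl)) e = left b h₁ (reduce {b} {h₁} e) (toggle-left b h₁)
        by (inj₂ (divides c refl)) e = right h c hc (toggle-right h c λ x → p∤a (subst (p ∣_) hc (∣-trans x (m∣m*n c))))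
          where
          arith : ∀ h c p → h * p * c ≡ h * (c * p)
          arith = solve-∀
          hc : h * c ≡ a
          hc = reduce {h} {c} (trans (arith h c p) e)

      1<p : 1 < p
      1<p = nonTrivial⇒n>1 p {{prime⇒nonTrivial p-prime}}

      a0 : 0 < a
      a0 = n≢0⇒n>0 λ { refl → p∤a (p ∣0) }

      pos² : ∀ {b c} → b * c ≡ a → 0 < b × 0 < c
      pos² {zero}  {c}     e = contradiction (subst (0 <_) (sym e) a0) (n≮n 0)
      pos² {suc b} {zero}  e = contradiction (subst (0 <_) (sym (trans (sym (*-zeroʳ (suc b))) e)) a0) (n≮n 0)
      pos² {suc b} {suc c} e = s≤s z≤n , s≤s z≤n

      Π-left : ∀ {b c} → b * c ≡ a → Π d (b * p , c)
      Π-left {b} {c} e = (*-mono-≤ (proj₁ (pos² {b} {c} e)) (<⇒≤ 1<p) , proj₂ (pos² {b} {c} e)) , trans (arith b c p) (trans (cong (p *_) e) (sym d≡pa))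
        where
        arith : ∀ b c p → b * p * c ≡ p * (b * c)
        arith = solve-∀

      Π-right : ∀ {b c} → b * c ≡ a → Π d (b , c * p)
      Π-right {b} {c} e = (proj₁ (pos² {b} {c} e) , *-mono-≤ (proj₂ (pos² {b} {c} e)) (<⇒≤ 1<p)) , trans (arith b c p) (trans (cong (p *_) e) (sym d≡pa))
        where
        arith : ∀ b c p → b * (c * p) ≡ p * (b * c)
        arith = solve-∀

      p∤ : ∀ {b c} → b * c ≡ a → ¬ p ∣ b
      p∤ {b} {c} e x = p∤a (subst (p ∣_) e (∣-trans x (m∣m*n c)))

      toggle-Π : ∀ {x} → Π d x → Π d (toggle x)
      toggle-Π {h , h₁} π = by (view π)
        where
        by : ∀ {x} → View x → Π d (toggle x)
        by (left b c e t) = subst (Π d) (sym t) (Π-right {b} {c} e)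
        by (right b c e t) = subst (Π d) (sym t) (Π-left {b} {c} e)

      toggle-toggle : ∀ {x} → Π d x → toggle (toggle x) ≡ x
      toggle-toggle {h , h₁} π = by (view π)
        where
        by : ∀ {x} → View x → toggle (toggle x) ≡ x
        by (left b c e t) = trans (cong toggle t) (toggle-right b c (p∤ {b} {c} e))
        by (right b c e t) = trans (cong toggle t) (toggle-left b c)

      b*p≢b : ∀ {b} → 0 < b → b * p ≢ b
      b*p≢b {b} b0 e = <⇒≢ (m<m*n b p {{>-nonZero b0}} 1<p) (sym e)

      toggle-free : ∀ {x} → Π d x → toggle x ≢ x
      toggle-free {h , h₁} π = by (view π)
        where
        by : ∀ {x} → View x → toggle x ≢ x
        by (left b c e t) r = b*p≢b (proj₁ (pos² {b} {c} e)) (sym (cong proj₁ (trans (sym t) r)))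
        by (right b c e t) r = b*p≢b (proj₁ (pos² {b} {c} e)) (cong proj₁ (trans (sym t) r))

      *p%4 : ∀ c → c * p % 4 ≡ c % 4
      *p%4 c = trans (%-distribˡ-* c p 4) (trans (cong (λ z → c % 4 * z % 4) p≡1) (trans (cong (_% 4) (*-identityʳ (c % 4))) (m%n%n≡m%n c 4)))

      toggle-mod4 : ∀ {x} → Π d x → proj₂ (toggle x) % 4 ≡ proj₂ x % 4
      toggle-mod4 {h , h₁} π = by (view π)
        where
        by : ∀ {x} → View x → proj₂ (toggle x) % 4 ≡ proj₂ x % 4
        by (left b c e t) = trans (cong (λ z → proj₂ z % 4) t) (*p%4 c)
        by (right b c e t) = trans (cong (λ z → proj₂ z % 4) t) (sym (*p%4 c))

      cross : Pair → Pair
      cross x = sw₂ (toggle x)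

      cross-cross : ∀ {x} → Π d x → cross (cross x) ≡ x
      cross-cross {h , h₁} π = by (view π)
        where
        by : ∀ {x} → View x → cross (cross x) ≡ x
        by (left b c e t) = trans (cong (λ z → cross (sw₂ z)) t) (cong sw₂ (toggle-left c b))
        by (right b c e t) = trans (cong (λ z → cross (sw₂ z)) t) (cong sw₂ (toggle-right c b (p∤ {c} {b} (trans (*-comm c b) e))))

      cross-mod4 : a % 4 ≡ 1 → ∀ {x} → Π d x → proj₂ (cross x) % 4 ≡ proj₂ x % 4
      cross-mod4 a1 {h , h₁} π = by (view π)
        where
        by : ∀ {x} → View x → proj₂ (cross x) % 4 ≡ proj₂ x % 4
        by (left b c e t) = trans (cong (λ z → proj₁ z % 4) t) (same-mod4 {a} {b} {c} a1 e)
        by (right b c e t) = trans (cong (λ z → proj₁ z % 4) t) (trans (*p%4 b) (trans (same-mod4 {a} {b} {c} a1 e) (sym (*p%4 c))))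

      -- A fixed point would have equal cofactors, making `a` a perfect square.
      cross-free : (∀ s → s * s ≢ a) → ∀ {x} → Π d x → cross x ≢ x
      cross-free ns {h , h₁} π = by (view π)
        where
        by : ∀ {x} → View x → cross x ≢ x
        by (left b c e t) r with trans (sym (cong proj₁ t)) (cong proj₂ r)
        ... | refl = ns b e
        by (right b c e t) r with trans (sym (cong proj₂ t)) (cong proj₁ r)
        ... | refl = ns c e

      module _ (q : ℕ) (q-prime : Prime q) (q≡3 : q % 4 ≡ 3) where
        open Residues q q-prime q≡3

        toggle-Sq : Sq p → ∀ {x} → Π d x → Sq (proj₁ x) → Sq (proj₁ (toggle x))
        toggle-Sq sp {h , h₁} π = by (view π)
          where
          by : ∀ {x} → View x → Sq (proj₁ x) → Sq (proj₁ (toggle x))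
          by (left b c e t) s = subst (λ z → Sq (proj₁ z)) (sym t) (Sq-/ sp (subst Sq (*-comm b p) s))
          by (right b c e t) s = subst (λ z → Sq (proj₁ z)) (sym t) (Sq-* s sp)

        cross-Sq : Unit p → Sq a → ∀ {x} → Π d x → Sq (proj₁ x) → Sq (proj₁ (cross x))
        cross-Sq up sa {h , h₁} π = by (view π)
          where
          arith : ∀ b c p → p * p * (b * c) ≡ b * p * (c * p)
          arith = solve-∀
          by : ∀ {x} → View x → Sq (proj₁ x) → Sq (proj₁ (cross x))
          by (left b c e t) s = subst (λ z → Sq (proj₂ z)) (sym t) (Sq-/ s (subst Sq (trans (cong (p * p *_) (sym e)) (arith b c p)) (Sq-* (Sq-square {p} up) sa)))
          by (right b c e t) s = subst (λ z → Sq (proj₂ z)) (sym t) (Sq-/ s (subst Sq (sym e) sa))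

    -- A product of two numbers that are 1 modulo 4 is again 1, so one factor of a composite `m` is
    -- 3 modulo 4.
    prime-factor≡3 : ∀ m → m % 4 ≡ 3 → ∃[ q ] Prime q × q % 4 ≡ 3 × q ∣ m
    prime-factor≡3 = <-rec (λ m → m % 4 ≡ 3 → ∃[ q ] Prime q × q % 4 ≡ 3 × q ∣ m) step
      where
      step : ∀ m → (∀ {n} → n < m → n % 4 ≡ 3 → ∃[ q ] Prime q × q % 4 ≡ 3 × q ∣ n) → m % 4 ≡ 3 → ∃[ q ] Prime q × q % 4 ≡ 3 × q ∣ m
      step (suc zero) rec ()
      step m@(suc (suc _)) rec m3 with prime? m
      ... | yes pr = m , pr , m3 , ∣-refl
      ... | no ¬pr with ¬prime⇒composite ¬pr
      ... | hasNonTrivialDivisor {c} {{nt}} c<m (divides b e) = by (mod4-odd {b} (proj₁ odds)) (mod4-odd {c} (proj₂ odds))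
        where
        odds = odd-*⁻ b c (trans (cong par (sym e)) (odd-mod4 {m} (inj₂ m3)))
        1<c : 1 < c
        1<c = nonTrivial⇒n>1 c {{nt}}
        b≢0 : b ≢ 0
        b≢0 refl = contradiction e λ ()
        b<m : b < m
        b<m = subst (b <_) (sym e) (m<m*n b c {{≢-nonZero b≢0}} 1<c)
        lift : ∀ {n} → n ∣ m → ∃[ q ] Prime q × q % 4 ≡ 3 × q ∣ n → ∃[ q ] Prime q × q % 4 ≡ 3 × q ∣ m
        lift n∣m (q , pr , q3 , q∣n) = q , pr , q3 , ∣-trans q∣n n∣m
        by : b % 4 ≡ 1 ⊎ b % 4 ≡ 3 → c % 4 ≡ 1 ⊎ c % 4 ≡ 3 → ∃[ q ] Prime q × q % 4 ≡ 3 × q ∣ m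
        by (inj₂ b3) _ = lift (divides c (trans e (*-comm b c))) (rec b<m b3)
        by (inj₁ _) (inj₂ c3) = lift (divides b e) (rec c<m c3)
        by (inj₁ b1) (inj₁ c1) = contradiction (trans (sym m3) (trans (cong (_% 4) e) (trans (%-distribˡ-* b c 4) (cong₂ (λ x y → x * y % 4) b1 c1)))) λ ()

    -- The exponent is recorded through its parity, because `q²` is 1 modulo 8 for odd `q`.
    split-power : ∀ q → Prime q → ∀ m → 0 < m → ∃[ k ] ∃[ a ] ¬ q ∣ a × (m ≡ (q * q) ^ k * a ⊎ m ≡ q * ((q * q) ^ k * a))
    split-power q pr = <-rec (λ m → 0 < m → ∃[ k ] ∃[ a ] ¬ q ∣ a × (m ≡ (q * q) ^ k * a ⊎ m ≡ q * ((q * q) ^ k * a))) step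
      where
      step : ∀ m → (∀ {n} → n < m → 0 < n → ∃[ k ] ∃[ a ] ¬ q ∣ a × (n ≡ (q * q) ^ k * a ⊎ n ≡ q * ((q * q) ^ k * a))) → 0 < m →
        ∃[ k ] ∃[ a ] ¬ q ∣ a × (m ≡ (q * q) ^ k * a ⊎ m ≡ q * ((q * q) ^ k * a))
      step m rec m0 with q ∣? m
      ... | no n = 0 , m , n , inj₁ (sym (*-identityˡ m))
      ... | yes (divides zero refl) = contradiction m0 (n≮n 0)
      ... | yes (divides c@(suc _) refl) with rec {c} (m<m*n c q (nonTrivial⇒n>1 q {{prime⇒nonTrivial pr}})) (s≤s z≤n)
      ...   | k , a , n , inj₁ e = k , a , n , inj₂ (trans (cong (_* q) e) (*-comm _ q))
      ...   | k , a , n , inj₂ e = suc k , a , n , inj₁ (trans (cong (_* q) e) (arith q ((q * q) ^ k) a))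
        where
        arith : ∀ q x a → q * (x * a) * q ≡ q * q * x * a
        arith = solve-∀

    ≡1-^ : ∀ n .{{_ : NonZero n}} x k → Modular._≋_ n x 1 → Modular._≋_ n (x ^ k) 1
    ≡1-^ n x zero    h = Modular.≋-refl n
    ≡1-^ n x (suc k) h = Modular._*≋_ n h (≡1-^ n x k h)

    q²≡1-mod8 : ∀ {q} → Odd q → q * q M8.≋ 1
    q²≡1-mod8 {q} o = M8.mod (trans (sym (_≡₈_.%≡ (res q *₈ res q))) (toWitness {a? = FinP.all? λ x → odd? (toℕ x) →-dec ((toℕ x * toℕ x) % 8 ≟ 1)} _ (residue q) (trans (par-residue q) o)))

    q²≡1-mod4 : ∀ {q} → Odd q → q * q M4.≋ 1
    q²≡1-mod4 {q} o = M4.mod (trans (%8%4 (q * q)) (cong (_% 4) (M8.%≡ (q²≡1-mod8 {q} o))))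

    OddPower : ℕ → Set
    OddPower m = ∃[ q ] ∃[ k ] ∃[ a ] Prime q × q % 4 ≡ 3 × ¬ q ∣ a × m ≡ q * ((q * q) ^ k * a)

    prime∤prime : ∀ {p q} → Prime p → Prime q → p ≢ q → ¬ p ∣ q
    prime∤prime pp pq ne h with prime⇒irreducible pq h
    ... | inj₁ refl = contradiction (nonTrivial⇒n>1 1 {{prime⇒nonTrivial pp}}) (n≮n 1)
    ... | inj₂ e    = ne e

    -- A prime occurring to an even power can be removed without changing the residue modulo 4; the
    -- search continues in the smaller cofactor.
    odd-power : ∀ m → m % 4 ≡ 3 → OddPower m
    odd-power = <-rec (λ m → m % 4 ≡ 3 → OddPower m) step
      where
      step : ∀ m → (∀ {n} → n < m → n % 4 ≡ 3 → OddPower n) → m % 4 ≡ 3 → OddPower m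
      step m rec m3 = go (prime-factor≡3 m m3)
        where
        m0 : 0 < m
        m0 = n≢0⇒n>0 λ { refl → contradiction m3 λ () }
        go : ∃[ q ] Prime q × q % 4 ≡ 3 × q ∣ m → OddPower m
        go (q , pr , q3 , q∣m) = by (split-power q pr m m0)
          where
          oq = odd-mod4 {q} (inj₂ q3)
          by : ∃[ k ] ∃[ a ] ¬ q ∣ a × (m ≡ (q * q) ^ k * a ⊎ m ≡ q * ((q * q) ^ k * a)) → OddPower m
          by (k , a , n , inj₂ e) = q , k , a , pr , q3 , n , e
          by (k , a , n , inj₁ e) = by₂ (rec {a} a<m a3)
            where
            a3 : a % 4 ≡ 3
            a3 = trans (M4.%≡ (M4.≋-trans (M4.≡⇒≋ (sym (*-identityˡ a))) (M4.≋-trans (M4.≋-sym (≡1-^ 4 (q * q) k (q²≡1-mod4 {q} oq)) M4.*≋ M4.≋-refl {a}) (M4.≡⇒≋ (sym e))))) m3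
            a<m : a < m
            a<m = ≤∧≢⇒< (∣⇒≤ {{>-nonZero m0}} (divides ((q * q) ^ k) e)) λ { refl → n q∣m }
            by₂ : OddPower a → OddPower m
            by₂ (q′ , k′ , a′ , pr′ , q′3 , n′ , e′) = q′ , k′ , (q * q) ^ k * a′ , pr′ , q′3 , n″ , trans e (trans (cong ((q * q) ^ k *_) e′) (arith ((q * q) ^ k) q′ ((q′ * q′) ^ k′) a′))
              where
              arith : ∀ x q y a → x * (q * (y * a)) ≡ q * (y * (x * a))
              arith = solve-∀
              q′≢q : q′ ≢ q
              q′≢q refl = n (subst (q ∣_) (sym e′) (m∣m*n _))
              unit-^ : ∀ k → ¬ q′ ∣ (q * q) ^ k
              unit-^ zero    h = contradiction (∣⇒≤ h) (<⇒≱ (nonTrivial⇒n>1 q′ {{prime⇒nonTrivial pr′}}))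
              unit-^ (suc k) h with euclidsLemma (q * q) ((q * q) ^ k) pr′ h
              ... | inj₂ x = unit-^ k x
              ... | inj₁ x with euclidsLemma q q pr′ x
              ...   | inj₁ y = prime∤prime pr′ pr q′≢q y
              ...   | inj₂ y = prime∤prime pr′ pr q′≢q y
              n″ : ¬ q′ ∣ (q * q) ^ k * a′
              n″ h with euclidsLemma ((q * q) ^ k) a′ pr′ h
              ... | inj₁ x = unit-^ k x
              ... | inj₂ x = n′ x

    square? : ∀ a → Dec (∃[ s ] s * s ≡ a)
    square? a with anyUpTo? (λ s → s * s ≟ a) (suc a)
    ... | yes (s , _ , e) = yes (s , e)
    ... | no n = no λ { (s , refl) → n (s , s≤s (square≥ s) , refl) }
      where
      square≥ : ∀ s → s ≤ s * s
      square≥ zero    = z≤n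
      square≥ (suc s) = m≤m*n (suc s) (suc s)

    power-closed : ∀ {q d} (f : ℕ → ℕ) → f 0 ≡ d → (∀ k → f (suc k) ≡ q * q * f k) → ∀ k → f k ≡ (q * q) ^ k * d
    power-closed {d = d} f e₀ e zero = trans e₀ (sym (*-identityˡ d))
    power-closed {q} {d} f e₀ e (suc k) = trans (e k) (trans (cong (q * q *_) (power-closed {q} f e₀ e k)) (sym (*-assoc (q * q) ((q * q) ^ k) d)))

    square-^ : ∀ q k → (q * q) ^ k ≡ q ^ k * q ^ k
    square-^ q zero    = refl
    square-^ q (suc k) = trans (cong (q * q *_) (square-^ q k)) (arith q (q ^ k))
      where
      arith : ∀ q x → q * q * (x * x) ≡ q * x * (q * x)
      arith = solve-∀

    -- Here `q = p` and `d = m`. From `p ≡ 3` modulo 8 follows `m ≡ 5`, so `m` is not a perfect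
    -- square, while it is a square modulo `p`. The final index 0 stands for the first power of `p`.
    residue-result : ∀ p m (p-prime : Prime p) → p % 4 ≡ 3 → p % 8 ≢ 7 → ¬ p ∣ m → (∃[ x ] Modular._≋_ p {{prime⇒nonZero p-prime}} (x * x) m) → p * m % 8 ≡ 7 → Result (p * m)
    residue-result p m p-prime p3 p≢7 p∤m (x , e) pm7 = Swap.R-all p p-prime p3 m (trans (%8%4 m) (cong (_% 4) m5)) p∤m (λ s r → square≢5 s (trans (cong (_% 8) r) m5)) pm7
      (Residues.mk-Sq p p-prime p3 x p∤m e) 0
      where
      m5 : m % 8 ≡ 5
      m5 = product≡7 {p} {m} pm7 p3 p≢7

    module Case₁ (p m : ℕ) (p-prime : Prime p) (p≡1 : p % 4 ≡ 1) (p∤m : ¬ p ∣ m) (x : ℕ) (x²≋m : Modular._≋_ p {{prime⇒nonZero p-prime}} (x * x) m) (pm≡7 : p * m % 8 ≡ 7)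
      (q k a : ℕ) (q-prime : Prime q) (q≡3 : q % 4 ≡ 3) (q∤a : ¬ q ∣ a) (m≡ : m ≡ q * ((q * q) ^ k * a)) where

      d X : ℕ
      d = p * a
      X = (q * q) ^ k

      p∤a : ¬ p ∣ a
      p∤a h = p∤m (subst (p ∣_) (sym m≡) (∣-trans h (∣-trans (n∣m*n X) (n∣m*n q))))

      p≢q : p ≢ q
      p≢q refl with trans (sym p≡1) q≡3
      ... | ()

      q∤p : ¬ q ∣ p
      q∤p = prime∤prime q-prime p-prime λ e → p≢q (sym e)

      q∤d : ¬ q ∣ d
      q∤d h with euclidsLemma p a q-prime h
      ... | inj₁ z = q∤p z
      ... | inj₂ z = q∤a z

      oq : Odd q
      oq = odd-mod4 {q} (inj₂ q≡3)

      m≡3 : m % 4 ≡ 3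
      m≡3 = trans (sym (trans (%-distribˡ-* p m 4) (trans (cong (λ z → z * (m % 4) % 4) p≡1) (trans (cong (_% 4) (*-identityˡ (m % 4))) (m%n%n≡m%n m 4)))))
        (trans (%8%4 (p * m)) (cong (_% 4) pm≡7))

      a≡1 : a % 4 ≡ 1
      a≡1 = by (mod4-odd {a} oa)
        where
        m%4 : m % 4 ≡ (q % 4 * (a % 4)) % 4
        m%4 = trans (M4.%≡ (M4.≋-trans (M4.≡⇒≋ m≡) (M4.≋-refl {q} M4.*≋ M4.≋-trans (≡1-^ 4 (q * q) k (q²≡1-mod4 {q} oq) M4.*≋ M4.≋-refl {a}) (M4.≡⇒≋ (*-identityˡ a))))) (%-distribˡ-* q a 4)
        oa : Odd a
        oa = proj₂ (odd-*⁻ X a (proj₂ (odd-*⁻ q (X * a) (trans (cong par (sym m≡)) (odd-mod4 {m} (inj₂ m≡3))))))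
        by : a % 4 ≡ 1 ⊎ a % 4 ≡ 3 → a % 4 ≡ 1
        by (inj₁ e) = e
        by (inj₂ e) = contradiction (trans (sym m≡3) (trans m%4 (cong₂ (λ u v → u * v % 4) q≡3 e))) λ ()

      d≡1 : d % 4 ≡ 1
      d≡1 = trans (%-distribˡ-* p a 4) (cong₂ (λ u v → u * v % 4) p≡1 a≡1)

      -- The prime `p` divides `d = pa` exactly once.
      d-nonsquare : ∀ s → s * s ≢ d
      d-nonsquare s e = by (euclidsLemma s s p-prime (subst (p ∣_) (sym e) (m∣m*n a)))
        where
        arith : ∀ p c → c * p * (c * p) ≡ p * (c * c * p)
        arith = solve-∀
        root : p ∣ s → ⊥
        root (divides c refl) = p∤a (subst (p ∣_) (*-cancelˡ-≡ (c * c * p) a p {{prime⇒nonZero p-prime}} (trans (sym (arith p c)) e)) (n∣m*n (c * c)))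
        by : p ∣ s ⊎ p ∣ s → ⊥
        by (inj₁ h) = root h
        by (inj₂ h) = root h

      move : p * (q * (X * a)) ≡ X * (q * d)
      move = arith p q X a
        where
        arith : ∀ p q x a → p * (q * (x * a)) ≡ x * (q * (p * a))
        arith = solve-∀

      qd≡7 : q * d % 8 ≡ 7
      qd≡7 = trans (sym (M8.%≡ (M8.≋-trans (M8.≡⇒≋ (trans (cong (p *_) m≡) move)) (M8.≋-trans (≡1-^ 8 (q * q) k (q²≡1-mod8 {q} oq) M8.*≋ M8.≋-refl {q * d}) (M8.≡⇒≋ (*-identityˡ (q * d))))))) pm≡7

      D≡pm : q * (X * d) ≡ p * m
      D≡pm = trans (arith q X d) (sym (trans (cong (p *_) m≡) move))
        where
        arith : ∀ q x d → q * (x * d) ≡ x * (q * d)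
        arith = solve-∀

      open Residues q q-prime q≡3 using (Sq; sq?; Unit; nonSq-*; Sq-/)
      open Toggle p a d p-prime p≡1 p∤a refl

      -- If a were a square then so would be q modulo p, hence p modulo q.
      a-nonsquare : ¬ Sq p → ∀ s → s * s ≢ a
      a-nonsquare np s e = np (Reciprocity.reciprocity p q p-prime q-prime p≡1 q≡3 (x * PM.inv t)
          (PM.≋-trans (PM.≡⇒≋ (arith x (PM.inv t))) (PM.≋-trans ((PM.≋-trans x²≋m (PM.≡⇒≋ m≡qt²)) PM.*≋ PM.≋-refl {PM.inv t * PM.inv t})
            (PM.≋-trans (PM.≡⇒≋ (arith₂ q t (PM.inv t))) (PM.≋-trans (PM.≋-refl {q} PM.*≋ (PM.inv-* ut PM.*≋ PM.inv-* ut)) (PM.≡⇒≋ (*-identityʳ q)))))))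
        where
        module PM = PrimeModular p p-prime
        t = q ^ k * s
        arith : ∀ x i → x * i * (x * i) ≡ x * x * (i * i)
        arith = solve-∀
        arith₂ : ∀ q t i → q * (t * t) * (i * i) ≡ q * (i * t * (i * t))
        arith₂ = solve-∀
        arith₃ : ∀ x s → x * x * (s * s) ≡ x * s * (x * s)
        arith₃ = solve-∀
        m≡qt² : m ≡ q * (t * t)
        m≡qt² = trans m≡ (cong (q *_) (trans (cong₂ _*_ (square-^ q k) (sym e)) (arith₃ (q ^ k) s)))
        ut : ¬ p ∣ t
        ut h = p∤m (subst (p ∣_) (sym m≡qt²) (∣-trans h (∣-trans (m∣m*n t) (n∣m*n q))))

      module With (σ : Pair → Pair) (σ-Π : ∀ {x} → Π d x → Π d (σ x)) (σ-σ : ∀ {x} → Π d x → σ (σ x) ≡ x) (σ-free : ∀ {x} → Π d x → σ x ≢ x)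
        (σ-Sq : ∀ {x} → Π d x → Sq (proj₁ x) → Sq (proj₁ (σ x))) (σ-mod4 : ∀ {x} → Π d x → proj₂ (σ x) % 4 ≡ proj₂ x % 4) where
        open PrimePower q q-prime q≡3 d d≡1 q∤d d-nonsquare qd≡7 σ σ-Π σ-σ σ-free σ-Sq σ-mod4 using (P; R-all)
        result : Result (p * m)
        result = subst Result (trans (cong (q *_) (power-closed {q} P refl (λ _ → refl) k)) D≡pm) (R-all k)

      result : Result (p * m)
      result = by (sq? d) (sq? p) (sq? a)
        where
        up : Unit p
        up = q∤p
        by : Dec (Sq d) → Dec (Sq p) → Dec (Sq a) → Result (p * m)
        by (yes sd) _ _ = subst Result (trans (cong (q *_) (power-closed {q} S.P refl (λ _ → refl) k)) D≡pm) (S.R-all k)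
          where
          module S = Swap q q-prime q≡3 d d≡1 q∤d d-nonsquare qd≡7 sd
        by (no _) (yes sp) _ = With.result toggle toggle-Π toggle-toggle toggle-free (toggle-Sq q q-prime q≡3 sp) toggle-mod4
        by (no _) (no np) (yes sa) = With.result cross (λ π → swΠ (toggle-Π π)) cross-cross (cross-free (a-nonsquare np)) (cross-Sq q q-prime q≡3 up sa) (cross-mod4 a≡1)
        -- If neither `p` nor `a` is a square modulo `q`, their product `d` is one.
        by (no nd) (no np) (no na) = contradiction (nonSq-* up q∤a np na) nd

    core : ∀ p m (p-prime : Prime p) → p % 8 ≢ 7 → ¬ p ∣ m → (∃[ x ] Modular._≋_ p {{prime⇒nonZero p-prime}} (x * x) m) → p * m % 8 ≡ 7 → Result (p * m)
    core p m p-prime p≢7 p∤m (x , e) pm≡7 = by (mod4-odd {p} (proj₁ (odd-*⁻ p m (odd-mod8 {p * m} pm≡7))))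
      where
      by : p % 4 ≡ 1 ⊎ p % 4 ≡ 3 → Result (p * m)
      by (inj₂ p3) = residue-result p m p-prime p3 p≢7 p∤m (x , e) pm≡7
      by (inj₁ p1) = from (odd-power m m≡3)
        where
        m≡3 : m % 4 ≡ 3
        m≡3 = trans (sym (trans (%-distribˡ-* p m 4) (trans (cong (λ z → z * (m % 4) % 4) p1) (trans (cong (_% 4) (*-identityˡ (m % 4))) (m%n%n≡m%n m 4)))))
          (trans (%8%4 (p * m)) (cong (_% 4) pm≡7))
        from : OddPower m → Result (p * m)
        from (q , k , a , q-prime , q3 , q∤a , m≡) = Case₁.result p m p-prime p1 p∤m x e pm≡7 q k a q-prime q3 q∤a m≡

-- From the Legendre symbol to D = pm and the conclusion.

open Enumeration
open Arithmetic
open Quadruples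
open QuadraticResidues
open Coefficients using (4∣NAℕ)
open Pairing using (Result; core)
open import Data.Bool using (true; false; T; _xor_)
import Data.Bool.Properties as 𝔹P
open import Data.Bool.ListAction using (any)
open import Data.Nat as ℕ using (ℕ; zero; suc; _*_; _+_; _≡ᵇ_; NonZero)
import Data.Nat.Properties as ℕP
import Data.Nat.DivMod as ℕM
import Data.Nat.Divisibility as ℕD
open import Data.Nat.Primality
open import Data.Integer as ℤ using (ℤ; +_; -[1+_])
import Data.Integer.Properties as ℤP
open import Data.Integer.DivMod using (_%ℕ_; _/ℕ_; n%ℕd<d; a≡a%ℕn+[a/ℕn]*n)
open import Data.Integer.Divisibility using (_∣_)
import Data.Integer.Divisibility.Signed as ℤD
open import Data.Integer.Tactic.RingSolver using (solve-∀)
import Data.Nat.Tactic.RingSolver as ℕR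
open import Data.List using (upTo)
open import Data.List.Relation.Unary.Any using (satisfied)
open import Data.List.Relation.Unary.Any.Properties using (any⁻)
open import Data.Product using (_×_; _,_; proj₁; proj₂; ∃-syntax)
open import Data.Empty using (⊥-elim)
open import Relation.Nullary using (¬_; contradiction)
open import Relation.Binary.PropositionalEquality

legendre-1 : (k : ℤ) (p : ℕ) → .{{_ : NonZero p}} → legendre k p ≡ + 1 → k %ℕ p ≢ 0 × ∃[ x ] (x * x) ℕ.% p ≡ k %ℕ p
legendre-1 k p e with k %ℕ p
legendre-1 k p () | zero
legendre-1 k p e | suc r with any (λ x → (x * x) ℕ.% p ≡ᵇ suc r) (upTo p) in eq
... | true  = (λ ()) , (let (x , t) = satisfied (any⁻ (λ x → (x * x) ℕ.% p ≡ᵇ suc r) (upTo p) (subst T (sym eq) _)) in x , ℕP.≡ᵇ⇒≡ _ (suc r) t)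
legendre-1 k p () | suc r | false

4∣2h+2g : ∀ h g → par h ≡ par g → 4 ℕD.∣ 2 * h + 2 * g
4∣2h+2g h g e = from (half {h + g} (trans (par-+ h g) (trans (cong (_xor par g) e) (𝔹P.xor-same (par g)))))
  where
  arith : ∀ j → 2 * (2 * j) ≡ j * 4
  arith = ℕR.solve-∀
  from : ∃[ j ] h + g ≡ 2 * j → 4 ℕD.∣ 2 * h + 2 * g
  from (j , s) = ℕD.divides j (trans (sym (ℕP.*-distribˡ-+ 2 h g)) (trans (cong (2 *_) s) (arith j)))

-- With C₁ = `2h` the sum C₁ + 2C₂ is `2 (h + C₂)`, and `h` and C₂ have the same parity.
from-result : ∀ N D → suc D ≡ 8 * N → Result D → 4 ℕD.∣ NAℕ N
from-result N D D+1 (h , e , p) = 4∣NAℕ N (subst (4 ℕD.∣_) (sym (cong₂ (λ a b → a + 2 * b) (trans (CoefficientCounts.c₁≡ N D D+1) e) (CoefficientCounts.c₂≡ N D D+1)))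
  (4∣2h+2g h (# (LiouvilleMaps.G0 D (CoefficientCounts.D≡7 N D D+1))) (trans p (sym (LiouvilleMaps.♯G0 D (CoefficientCounts.D≡7 N D D+1))))))

positive-quotient : ∀ p z D → + suc D ≡ + p ℤ.* z → ∃[ m ] z ≡ + m × suc D ≡ p * m
positive-quotient p (+ m)      D e = m , refl , ℤP.+-injective (trans e (sym (ℤP.pos-* p m)))
positive-quotient zero    -[1+ n ] D e = contradiction (trans e (ℤP.*-zeroˡ -[1+ n ])) λ ()
positive-quotient (suc p) -[1+ n ] D ()

-- As `m` is non-negative, a negative `t` would contradict `r < p`.
residue-of : ∀ p .{{_ : NonZero p}} m r t → r ℕ.< p → + m ≡ + r ℤ.+ t ℤ.* + p → m ℕ.% p ≡ r
residue-of p m r (+ t) lt e = trans (cong (ℕ._% p) (ℤP.+-injective (trans e (cong (λ z → + r ℤ.+ z) (sym (ℤP.pos-* t p)))))) (trans (ℕM.[m+kn]%n≡m%n r t p) (ℕM.m<n⇒m%n≡m lt))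
residue-of p m r -[1+ t ] lt e = ⊥-elim (ℕP.<⇒≱ lt (ℕP.≤-trans (ℕP.≤-trans (ℕP.m≤m+n p (t * p)) (ℕP.m≤n+m _ m)) (ℕP.≤-reflexive (ℤP.+-injective eq))))
  where
  arith : ∀ r t p → r ℤ.+ (ℤ.- t) ℤ.* p ℤ.+ t ℤ.* p ≡ r
  arith = solve-∀
  eq : + (m + suc t * p) ≡ + r
  eq = trans (cong₂ ℤ._+_ e (ℤP.pos-* (suc t) p)) (arith (+ r) (+ suc t) (+ p))

theorem3p3 : (p : ℕ) → .{{_ : NonZero p}} → Prime p → p ≢ 2 → p ℕ.% 8 ≢ 7 →
    (δp : ℤ) → (+ (p * p)) ∣ ((+ 8) ℤ.* δp ℤ.- (+ 1)) →
    (k n : ℤ) → legendre k p ≡ + 1 →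
    4 ℕD.∣ NA ((+ (p * p)) ℤ.* n ℤ.+ ((+ p) ℤ.* k ℤ.+ (+ 1)) ℤ.* δp)
theorem3p3 p p-prime p≢2 p≢7 δ δ-div k n leg = by ((+ (p * p)) ℤ.* n ℤ.+ ((+ p) ℤ.* k ℤ.+ (+ 1)) ℤ.* δ) refl (ℤD.∣ᵤ⇒∣ δ-div)
  where
  r = k %ℕ p
  by : ∀ z → (+ (p * p)) ℤ.* n ℤ.+ ((+ p) ℤ.* k ℤ.+ (+ 1)) ℤ.* δ ≡ z → (+ (p * p)) ℤD.∣ ((+ 8) ℤ.* δ ℤ.- (+ 1)) → 4 ℕD.∣ NA z
  by -[1+ _ ]    _ _ = 4 ℕD.∣0
  by (+ zero)    _ _ = 4 ℕD.∣0
  by (+ (suc N)) e (ℤD.divides c h) = finish (positive-quotient p (k ℤ.+ + p ℤ.* w) (6 + 8 * N) D≡)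
    where
    -- Chosen so that `8N − 1 = p (k + pw)` for the index `N` in question: `8p²n` and the multiple
    -- `cp²` of `8δ − 1` both go into `w`, so the cofactor is `k` modulo `p`.
    w = + 8 ℤ.* n ℤ.+ (+ p ℤ.* k ℤ.+ + 1) ℤ.* c
    D+1 : suc (7 + 8 * N) ≡ 8 * suc N
    D+1 = arith₀ N
      where
      arith₀ : ∀ N → suc (7 + 8 * N) ≡ 8 * suc N
      arith₀ = ℕR.solve-∀
    arith : ∀ p k n δ c → δ ℤ.* + 8 ℤ.- + 1 ≡ c ℤ.* (p ℤ.* p) →
      + 8 ℤ.* (p ℤ.* p ℤ.* n ℤ.+ (p ℤ.* k ℤ.+ + 1) ℤ.* δ) ℤ.- + 1 ≡ p ℤ.* (k ℤ.+ p ℤ.* (+ 8 ℤ.* n ℤ.+ (p ℤ.* k ℤ.+ + 1) ℤ.* c))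
    arith p k n δ c e = trans (lhs p k n δ) (trans (cong (λ z → + 8 ℤ.* (p ℤ.* p ℤ.* n) ℤ.+ (p ℤ.* k ℤ.+ + 1) ℤ.* z ℤ.+ p ℤ.* k) e) (rhs p k n c))
      where
      lhs : ∀ p k n δ → + 8 ℤ.* (p ℤ.* p ℤ.* n ℤ.+ (p ℤ.* k ℤ.+ + 1) ℤ.* δ) ℤ.- + 1
        ≡ + 8 ℤ.* (p ℤ.* p ℤ.* n) ℤ.+ (p ℤ.* k ℤ.+ + 1) ℤ.* (δ ℤ.* + 8 ℤ.- + 1) ℤ.+ p ℤ.* k
      lhs = solve-∀
      rhs : ∀ p k n c → + 8 ℤ.* (p ℤ.* p ℤ.* n) ℤ.+ (p ℤ.* k ℤ.+ + 1) ℤ.* (c ℤ.* (p ℤ.* p)) ℤ.+ p ℤ.* k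
        ≡ p ℤ.* (k ℤ.+ p ℤ.* (+ 8 ℤ.* n ℤ.+ (p ℤ.* k ℤ.+ + 1) ℤ.* c))
      rhs = solve-∀
    pp : + (p * p) ≡ + p ℤ.* + p
    pp = ℤP.pos-* p p
    D≡ : + (7 + 8 * N) ≡ + p ℤ.* (k ℤ.+ + p ℤ.* w)
    D≡ = trans (cong (λ z → z ℤ.- + 1) (trans (cong +_ D+1) (ℤP.pos-* 8 (suc N))))
      (trans (cong (λ z → + 8 ℤ.* z ℤ.- + 1) (sym (trans (cong (λ z → z ℤ.* n ℤ.+ (+ p ℤ.* k ℤ.+ + 1) ℤ.* δ) (sym pp)) e)))
        (arith (+ p) k n δ c (trans (cong (ℤ._- + 1) (ℤP.*-comm δ (+ 8))) (trans h (cong (c ℤ.*_) pp)))))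
    finish : ∃[ m ] k ℤ.+ + p ℤ.* w ≡ + m × 7 + 8 * N ≡ p * m → 4 ℕD.∣ NAℕ (suc N)
    finish (m , em , eD) = from-result (suc N) (7 + 8 * N) D+1 (subst Result (sym eD)
      (core p m p-prime p≢7 p∤m (proj₁ (proj₂ l) , Modular.mod (trans (proj₂ (proj₂ l)) (sym m%p))) (trans (cong (ℕ._% 8) (sym eD)) (CoefficientCounts.D≡7 (suc N) (7 + 8 * N) D+1))))
      where
      l = legendre-1 k p leg
      arith₂ : ∀ r t p w → r ℤ.+ t ℤ.* p ℤ.+ p ℤ.* w ≡ r ℤ.+ (t ℤ.+ w) ℤ.* p
      arith₂ = solve-∀
      m%p : m ℕ.% p ≡ r
      m%p = residue-of p m r (k /ℕ p ℤ.+ w) (n%ℕd<d k p) (trans (sym em) (trans (cong (ℤ._+ + p ℤ.* w) (a≡a%ℕn+[a/ℕn]*n k p)) (arith₂ (+ r) (k /ℕ p) (+ p) w)))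
      p∤m : ¬ p ℕD.∣ m
      p∤m d = proj₁ l (trans (sym m%p) (ℕD.n∣m⇒m%n≡0 m p d))
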